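{- Let $E$ be the set of primes $p$ for which $X^*(p)$ is not a single $\Gamma$-orbit (equivalently, for which $\mathcal{M}(\mathbb{Z}/p\mathbb{Z})$ does not consist of exactly the two $\Gamma$-orbits $\{(0,0,0)\}$ and $X^*(p)$). Then for every $\varepsilon>0$, the number of primes $p\le T$ with $p\in E$ is at most $T^{\varepsilon}$ for all sufficiently large $T$.
   Context: The Markoff surface is $\mathcal{M}: x_1^2+x_2^2+x_3^2-3x_1x_2x_3=0$. For a prime $p$, $X^*(p)=\mathcal{M}(\mathbb{Z}/p\mathbb{Z})\setminus\{(0,0,0)\}$. $\Gamma$ is the group of affine morphisms of $\mathbb{A}^3$ generated by the coordinate permutations and the Vieta involutions $R_1,R_2,R_3$, where $R_3(x_1,x_2,x_3)=(x_1,x_2,3x_1x_2-x_3)$ and $R_1,R_2$ are defined analogously (replacing the first, resp. second, coordinate $x_i$ by $3x_jx_k-x_i$ where $\{i,j,k\}=\{1,2,3\}$). $\Gamma$ acts by permutations on $\mathcal{M}(\mathbb{Z}/p\mathbb{Z})$, fixing $(0,0,0)$. -}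

module Defs where

open import Data.Nat using (ℕ; zero; suc; _+_; _*_; _∸_; _^_; _≤_; _<_; NonZero)
open import Data.Nat.DivMod using (_mod_)
open import Data.Nat.Primality using (Prime)
open import Data.Fin using (Fin; toℕ)
open import Data.Product using (_×_; _,_)
open import Data.Empty using (⊥)
open import Relation.Nullary using (¬_)
open import Relation.Binary.PropositionalEquality using (_≡_)
open import Relation.Binary.Construct.Closure.ReflexiveTransitive using (Star)
open import Relation.Binary.Construct.Closure.Symmetric using (SymClosure)

-- Points of the affine 3-space over Z/pZ, residues represented by Fin p.
Point : (p : ℕ) → Set
Point p = Fin p × Fin p × Fin p

OnMarkoff : (p : ℕ) .{{_ : NonZero p}} → Point p → Set
OnMarkoff p (x₁ , x₂ , x₃) =
  ((toℕ x₁ * toℕ x₁ + toℕ x₂ * toℕ x₂ + toℕ x₃ * toℕ x₃) mod p)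
    ≡ ((3 * toℕ x₁ * toℕ x₂ * toℕ x₃) mod p)

origin : (p : ℕ) .{{_ : NonZero p}} → Point p
origin p = (0 mod p , 0 mod p , 0 mod p)

InXstar : (p : ℕ) .{{_ : NonZero p}} → Point p → Set
InXstar p x = OnMarkoff p x × ¬ (x ≡ origin p)

-- 3 a b - c  in Z/pZ  (computed as 3ab + (p - c) mod p, with c < p)
vieta : (p : ℕ) .{{_ : NonZero p}} → Fin p → Fin p → Fin p → Fin p
vieta p a b c = (3 * toℕ a * toℕ b + (p ∸ toℕ c)) mod p

-- One application of a generator of Γ: the transpositions of coordinates
-- (which generate all coordinate permutations) and the Vieta involutions.
data Step (p : ℕ) .{{_ : NonZero p}} : Point p → Point p → Set where
  swap₁₂ : ∀ a b c → Step p (a , b , c) (b , a , c)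
  swap₁₃ : ∀ a b c → Step p (a , b , c) (c , b , a)
  swap₂₃ : ∀ a b c → Step p (a , b , c) (a , c , b)
  R₁     : ∀ a b c → Step p (a , b , c) (vieta p b c a , b , c)
  R₂     : ∀ a b c → Step p (a , b , c) (a , vieta p a c b , c)
  R₃     : ∀ a b c → Step p (a , b , c) (a , b , vieta p a b c)

SameOrbit : (p : ℕ) .{{_ : NonZero p}} → Point p → Point p → Set
SameOrbit p = Star (SymClosure (Step p))

SingleOrbit : (p : ℕ) .{{_ : NonZero p}} → Set
SingleOrbit p = ∀ x y → InXstar p x → InXstar p y → SameOrbit p x y

E : ℕ → Set
E zero = ⊥
E (suc n) = Prime (suc n) × ¬ SingleOrbit (suc n)

-- Scale the surface to a² + b² + c² = abc and write a = ξ + 1/ξ with ξ in 𝔽_{p²}. The rotation that fixes a moves the second coordinate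
-- through b_j = α ξʲ + β ξ⁻ʲ, so what matters is the order of the ξ attached to a coordinate. Let L be a small power of p.
-- If the three coordinates of a point have orders below L⁹, then the Markoff polynomial vanishes at a character of a small group, and
-- Siegel's lemma in the integral group ring gives a nonzero integer, depending only on the three orders, that p divides: there are few such p.
-- For all other p, every point has a coordinate of order at least L⁹ up to symmetry. By Stepanov's method, few points of a curve
-- α x + β / x = y + 1 / y have both coordinates in given small subgroups, so rotations raise the order up to p / L⁵. From there
-- inclusion-exclusion over the primes dividing p ± 1, again with counts from Stepanov's method, yields many coordinates of maximal order.
-- The whole conic of such a coordinate lies in one orbit, and a second moment count shows that two large sets of coordinates are
-- always joined by a point of the surface. Hence there is a single orbit.

{-# OPTIONS --safe #-}
module Submission where

import Algebra.Properties.CommutativeSemiring.Exp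
import Algebra.Properties.Ring
import Algebra.Properties.Semiring.Exp
import Algebra.Properties.Semiring.Mult
import Algebra.Properties.Semiring.Mult.TCOptimised
import Algebra.Properties.Semiring.Sum
import Algebra.Solver.Ring
import Data.List.Relation.Unary.All as All
import Data.List.Relation.Unary.AllPairs as AllPairs
import Data.List.Relation.Unary.AllPairs.Properties as AllPairs
import Data.List.Relation.Unary.All.Properties as All
import Data.List.Relation.Unary.Any as Any
import Data.List.Membership.DecPropositional
import Data.List.Relation.Unary.Unique.DecPropositional.Properties as DecUnique
import Data.Fin as Fin
import Data.Fin.Properties as Fin
import Data.List as List
import Data.List.Properties as List
import Data.List.Relation.Unary.Unique.Propositional.Properties as Unique
import Data.Nat as N
import Data.Nat.Properties as N
import Data.Integer as ℤ
import Data.Integer.Tactic.RingSolver as ℤ-Solver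
import Data.Integer.Properties as ℤ

-- The curves α x + β / x = y + 1 / y are handled through r = x y and s = y / x: then s is a Möbius
-- function of r, and auxiliary polynomials in the single variable r suffice. The price is that x
-- and y are known only up to a common sign, because x² = r / s and y² = r s; hence the even orders,
-- the changes of sign of b and the factors 2 in all counts. For orders below L⁹ the decisive fact
-- is a positivity at complex characters; it is proved over ℤ, with the inner product of integral
-- functions on a finite box. For ε = a / b let C = 57 + 56 b, and let L be the integral part of the
-- C-th root of p, or of T when exceptions are counted. The Stepanov parameter of the ascent is L²,
-- the loss in the order L⁵, the precision of the final counts L⁸. The ascent can start at order L⁹,
-- and the largest estimate needs 26 L^55 < p, whence 57. The L^27 triples of orders give integers
-- below 2 ^ (12 L^27), so at most 12 L^54 primes divide one of them; with the small primes this
-- stays below L^56.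

-- Integer coefficients for ring solving; fields.

module Alg where
 open import Level using (0ℓ)
 open import Algebra.Bundles using (CommutativeRing)
 open import Algebra.Structures using (IsCommutativeRing)
 open import Data.Nat using (ℕ; zero; suc)
 open import Data.Integer using (ℤ; +_; -[1+_]; _⊖_)
 open import Data.Product using (Σ; _,_; _×_) renaming (proj₁ to fst; proj₂ to snd)
 open import Data.Sum using (_⊎_; [_,_]′) renaming (inj₁ to inl; inj₂ to inr)
 open import Data.Empty using (⊥-elim)
 open import Data.Maybe using (just; nothing)
 open import Relation.Nullary using (yes; no)
 open import Relation.Binary.Definitions using (DecidableEquality; WeaklyDecidable)
 open import Relation.Binary.PropositionalEquality as ≡ using (_≡_; _≢_)
 open import Algebra.Solver.Ring.AlmostCommutativeRing using (fromCommutativeRing; _-Raw-AlmostCommutative⟶_; Induced-equivalence)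

 -- Coefficients are compared in ℤ, so the solver serves polynomials as well as fields, and numerals
 -- such as 4 and 16 are coefficients instead of atoms.
 module IntSolver {c ℓ} (R : CommutativeRing c ℓ) where
  open CommutativeRing R
  open Algebra.Properties.Ring ring
  open Algebra.Properties.Semiring.Mult semiring using () renaming (_×_ to _⋆_)
  open Algebra.Properties.Semiring.Mult.TCOptimised semiring using (×-homo-+; ×1-homo-*; 1+×; ×ᵤ≈×) renaming (_×_ to _⋆ₒ_)
  open import Relation.Binary.Reasoning.Setoid setoid
  cast : ℕ -> Carrier
  cast n = n ⋆ 1#
  -- Reduces to 1# on the numeral 1, unlike cast.
  num : ℕ -> Carrier
  num n = n ⋆ₒ 1#
  cast≈num : ∀ n -> cast n ≈ num n
  cast≈num n = ×ᵤ≈× n 1#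
  castℤ : ℤ -> Carrier
  castℤ (+ n) = num n
  castℤ -[1+ n ] = - num (suc n)
  castℤ-⊖ : ∀ m n -> castℤ (m ⊖ n) ≈ num m - num n
  castℤ-⊖ m zero = sym (trans (+-congˡ -0#≈0#) (+-identityʳ _))
  castℤ-⊖ zero (suc n) = sym (+-identityˡ _)
  castℤ-⊖ (suc m) (suc n) = begin
   castℤ (suc m ⊖ suc n) ≡⟨ ≡.cong castℤ (ℤ.[1+m]⊖[1+n]≡m⊖n m n) ⟩
   castℤ (m ⊖ n) ≈⟨ castℤ-⊖ m n ⟩
   num m - num n ≈⟨ +-congʳ (+-identityˡ (num m)) ⟨
   0# + num m - num n ≈⟨ +-congʳ (+-congʳ (-‿inverseʳ 1#)) ⟨
   1# - 1# + num m - num n ≈⟨ +-congʳ (trans (+-assoc _ _ _) (trans (+-congˡ (+-comm _ _)) (sym (+-assoc _ _ _)))) ⟩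
   1# + num m - 1# - num n ≈⟨ +-congʳ (+-congʳ (1+× m 1#)) ⟨
   num (suc m) - 1# - num n ≈⟨ +-assoc _ _ _ ⟩
   num (suc m) + (- 1# - num n) ≈⟨ +-congˡ (-‿+-comm 1# (num n)) ⟩
   num (suc m) - (1# + num n) ≈⟨ +-congˡ (-‿cong (1+× n 1#)) ⟨
   num (suc m) - num (suc n) ∎
  castℤ-neg : ∀ i -> castℤ (ℤ.- i) ≈ - castℤ i
  castℤ-neg (+ zero) = sym -0#≈0#
  castℤ-neg (+ suc n) = refl
  castℤ-neg -[1+ n ] = sym (-‿involutive _)
  castℤ-+ : ∀ i j -> castℤ (i ℤ.+ j) ≈ castℤ i + castℤ j
  castℤ-+ (+ m) (+ n) = ×-homo-+ 1# m n
  castℤ-+ (+ m) -[1+ n ] = castℤ-⊖ m (suc n)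
  castℤ-+ -[1+ m ] (+ n) = trans (castℤ-⊖ n (suc m)) (+-comm _ _)
  castℤ-+ -[1+ m ] -[1+ n ] = begin
   - num (suc (suc (m N.+ n))) ≡⟨ ≡.cong (\ k -> - num (suc k)) (N.+-suc m n) ⟨
   - num (suc m N.+ suc n) ≈⟨ -‿cong (×-homo-+ 1# (suc m) (suc n)) ⟩
   - (num (suc m) + num (suc n)) ≈⟨ -‿+-comm _ _ ⟨
   - num (suc m) - num (suc n) ∎
  castℤ-pos* : ∀ m j -> castℤ (+ m ℤ.* j) ≈ num m * castℤ j
  castℤ-pos* m (+ n) = trans (reflexive (≡.cong castℤ (≡.sym (ℤ.pos-* m n)))) (×1-homo-* m n)
  castℤ-pos* m -[1+ n ] = begin
   castℤ (+ m ℤ.* -[1+ n ]) ≡⟨ ≡.cong castℤ (ℤ.neg-distribʳ-* (+ m) (+ suc n)) ⟨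
   castℤ (ℤ.- (+ m ℤ.* + suc n)) ≈⟨ castℤ-neg (+ m ℤ.* + suc n) ⟩
   - castℤ (+ m ℤ.* + suc n) ≈⟨ -‿cong (castℤ-pos* m (+ suc n)) ⟩
   - (num m * num (suc n)) ≈⟨ -‿distribʳ-* _ _ ⟩
   num m * - num (suc n) ∎
  castℤ-* : ∀ i j -> castℤ (i ℤ.* j) ≈ castℤ i * castℤ j
  castℤ-* (+ m) j = castℤ-pos* m j
  castℤ-* -[1+ m ] j = begin
   castℤ (-[1+ m ] ℤ.* j) ≡⟨ ≡.cong castℤ (ℤ.neg-distribˡ-* (+ suc m) j) ⟨
   castℤ (ℤ.- (+ suc m ℤ.* j)) ≈⟨ castℤ-neg (+ suc m ℤ.* j) ⟩
   - castℤ (+ suc m ℤ.* j) ≈⟨ -‿cong (castℤ-pos* (suc m) j) ⟩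
   - (num (suc m) * castℤ j) ≈⟨ -‿distribˡ-* _ _ ⟩
   - num (suc m) * castℤ j ∎
  morphism : ℤ.+-*-rawRing -Raw-AlmostCommutative⟶ fromCommutativeRing R
  morphism = record
   { ⟦_⟧ = castℤ ; +-homo = castℤ-+ ; *-homo = castℤ-* ; -‿homo = castℤ-neg
   ; 0-homo = refl ; 1-homo = refl }
  coeff≟ : WeaklyDecidable (Induced-equivalence morphism)
  coeff≟ i j with i ℤ.≟ j
  ... | yes ≡.refl = just refl
  ... | no _ = nothing
  open Algebra.Solver.Ring ℤ.+-*-rawRing (fromCommutativeRing R) morphism coeff≟ public
   using (solve; _:=_; con; _:+_; _:*_; _:-_; :-_; _:^_; Polynomial)
  lit : ∀ {n} -> ℕ -> Polynomial n
  lit k = con (+ k)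

 record Field : Set1 where
  infixl 6 _+_
  infixl 7 _*_
  infix 8 -_
  infix 4 _≟_
  field
   Carrier : Set
   _+_ _*_ : Carrier -> Carrier -> Carrier
   -_ : Carrier -> Carrier
   0# 1# : Carrier
   isCommutativeRing : IsCommutativeRing _≡_ _+_ _*_ -_ 0# 1#
   _≟_ : DecidableEquality Carrier
   inverse : ∀ x -> x ≢ 0# -> Σ Carrier \ y -> x * y ≡ 1#
   1≢0 : 1# ≢ 0#
  commutativeRing : CommutativeRing 0ℓ 0ℓ
  commutativeRing = record { isCommutativeRing = isCommutativeRing }

 module FieldProps (K : Field) where
  open Field K public hiding (isCommutativeRing)
  open CommutativeRing commutativeRing public
   using (+-assoc; +-comm; +-identityˡ; +-identityʳ; *-assoc; *-comm; *-identityˡ; *-identityʳ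
      ; distribˡ; distribʳ; +-congˡ; +-congʳ; *-congˡ; *-congʳ; zeroˡ; zeroʳ; -‿inverseˡ; -‿inverseʳ; _-_; ring; semiring; commutativeSemiring)
  open Algebra.Properties.Ring ring public using (-0#≈0#; -‿involutive; -‿distribˡ-*; -‿distribʳ-*)
  open Algebra.Properties.Semiring.Exp semiring public using (_^_; ^-homo-*; ^-assocʳ)
  open Algebra.Properties.CommutativeSemiring.Exp commutativeSemiring public using (^-distrib-*)
  open Algebra.Properties.Semiring.Mult semiring using (×-homo-+)
  open IntSolver commutativeRing public
  open ≡
  cast-+ : ∀ m n -> cast (m N.+ n) ≡ cast m + cast n
  cast-+ m n = ×-homo-+ 1# m n
  no-zero-divisors : ∀ {x y} -> x * y ≡ 0# -> x ≡ 0# ⊎ y ≡ 0#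
  no-zero-divisors {x} {y} xy≡0 with x ≟ 0#
  ... | yes x≡0 = inl x≡0
  ... | no x≢0 with z , xz ← inverse x x≢0 = inr (begin
   y ≡⟨ *-identityˡ y ⟨
   1# * y ≡⟨ cong (_* y) xz ⟨
   x * z * y ≡⟨ solve 3 (\ x z y -> x :* z :* y := z :* (x :* y)) refl x z y ⟩
   z * (x * y) ≡⟨ cong (z *_) xy≡0 ⟩
   z * 0# ≡⟨ zeroʳ z ⟩
   0# ∎)
   where open ≡-Reasoning
  *-≢0 : ∀ {x y} -> x ≢ 0# -> y ≢ 0# -> x * y ≢ 0#
  *-≢0 x≢0 y≢0 xy = [ x≢0 , y≢0 ]′ (no-zero-divisors xy)
  ^-≢0 : ∀ {x} n -> x ≢ 0# -> x ^ n ≢ 0#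
  ^-≢0 zero x≢0 = 1≢0
  ^-≢0 (suc n) x≢0 = *-≢0 x≢0 (^-≢0 n x≢0)
  x-y≡0⇒x≡y : ∀ {x y} -> x - y ≡ 0# -> x ≡ y
  x-y≡0⇒x≡y {x} {y} eq = begin
   x ≡⟨ solve 2 (\ x y -> x := x :- y :+ y) refl x y ⟩
   x - y + y ≡⟨ cong (_+ y) eq ⟩
   0# + y ≡⟨ +-identityˡ y ⟩
   y ∎
   where open ≡-Reasoning
  x≡y⇒x-y≡0 : ∀ {x y} -> x ≡ y -> x - y ≡ 0#
  x≡y⇒x-y≡0 {x} refl = -‿inverseʳ x
  *-cancelˡ : ∀ {z x y} -> z ≢ 0# -> z * x ≡ z * y -> x ≡ y
  *-cancelˡ {z} {x} {y} z≢0 eq =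
   [ (\ z≡0 -> ⊥-elim (z≢0 z≡0)) , x-y≡0⇒x≡y ]′
    (no-zero-divisors (trans (solve 3 (\ z x y -> z :* (x :- y) := z :* x :- z :* y) refl z x y) (x≡y⇒x-y≡0 eq)))
  *-cancelʳ : ∀ {z x y} -> z ≢ 0# -> x * z ≡ y * z -> x ≡ y
  *-cancelʳ z≢0 eq = *-cancelˡ z≢0 (trans (*-comm _ _) (trans eq (*-comm _ _)))
  infix 9 _⁻¹
  -- Total, with the default 0 ⁻¹ = 0.
  _⁻¹ : Carrier -> Carrier
  x ⁻¹ with x ≟ 0#
  ... | yes _ = 0#
  ... | no x≢0 = fst (inverse x x≢0)
  *-inverseʳ : ∀ {x} -> x ≢ 0# -> x * x ⁻¹ ≡ 1#
  *-inverseʳ {x} x≢0 with x ≟ 0#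
  ... | yes x≡0 = ⊥-elim (x≢0 x≡0)
  ... | no x≢0' = snd (inverse x x≢0')
  ⁻¹-≢0 : ∀ {x} -> x ≢ 0# -> x ⁻¹ ≢ 0#
  ⁻¹-≢0 {x} x≢0 eq = 1≢0 (trans (sym (*-inverseʳ x≢0)) (trans (cong (x *_) eq) (zeroʳ x)))
  neg-≢0 : ∀ {x} -> x ≢ 0# -> - x ≢ 0#
  neg-≢0 {x} x≢0 eq = x≢0 (trans (sym (-‿involutive x)) (trans (cong -_ eq) -0#≈0#))
  ^-1# : ∀ n -> 1# ^ n ≡ 1#
  ^-1# zero = refl
  ^-1# (suc n) = trans (*-identityˡ _) (^-1# n)
  ^-*-≡1 : ∀ {x} n k -> x ^ n ≡ 1# -> x ^ (n N.* k) ≡ 1#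
  ^-*-≡1 {x} n k eq = trans (sym (^-assocʳ x n k)) (trans (cong (_^ k) eq) (^-1# k))
  sqrt-unique : ∀ {x y} -> x * x ≡ y * y -> x ≡ y ⊎ x ≡ - y
  sqrt-unique {x} {y} eq with no-zero-divisors
   (trans (solve 2 (\ x y -> (x :- y) :* (x :- (:- y)) := x :* x :- y :* y) refl x y) (x≡y⇒x-y≡0 eq))
  ... | inl e = inl (x-y≡0⇒x≡y e)
  ... | inr e = inr (x-y≡0⇒x≡y e)

open import Data.Nat using (ℕ; zero; suc; z≤n; s≤s; _≤_; _<_; _∸_)
open import Data.Nat using () renaming (_*_ to infixl 7 _·_)
open import Data.Nat.Properties using (*-cancelʳ-≤; *-cancelˡ-<; *-cancelˡ-≡; *-cancelˡ-≤; *-mono-≤; *-monoʳ-≤; *-monoˡ-<; *-monoˡ-≤; *-suc; +-cancelʳ-≡; +-cancelˡ-<; +-cancelˡ-≡; +-cancelˡ-≤; +-mono-≤; +-monoʳ-<; +-monoʳ-≤; +-monoˡ-<; +-monoˡ-≤; +-suc; 1+n≰n; <-asym; <-cmp; <-irrefl; <-trans; <-≤-trans; <⇒≢; <⇒≤; <⇒≤pred; <⇒≱; ^-*-assoc; ^-monoˡ-<; m+[n∸m]≡n; m+n∸m≡n; m+n∸n≡m; m<m+n; m<n+m; m<n⇒0<n∸m; m^n>0; m∸n+n≡m; m∸n≤m; m≤m+n; m≤n*m; m≤n+m; m≤n+m∸n; m≤n+o⇒m∸n≤o; m≤n⇒m<n∨m≡n; m≤n⇒m≤1+n; m⊓n≤m;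 n<1+n; n≢0⇒n>0; n≤1+n; suc-injective; ∸-+-assoc; ∸-monoʳ-<; ∸-monoˡ-≤; ≤-<-connex; ≤-<-trans; ≤-antisym; ≤-pred; ≤-refl; ≤-total; ≤-trans; ≤∧≢⇒<; ≮⇒≥; ≰⇒>; ⊔-lub) renaming (≤-reflexive to ≤-eq; module ≤-Reasoning to ≤R)
open import Data.Nat.Tactic.RingSolver using (solve-∀)
open import Data.List using (List; []; _∷_; map; length; filter)
open import Data.List.Membership.Propositional using (_∈_)
open import Data.List.Membership.Propositional.Properties using (∈-filter⁻)
open import Data.List.Relation.Unary.All using (All; []; _∷_)
open import Data.List.Relation.Unary.Any using (Any; here; there)
open import Data.List.Relation.Unary.AllPairs using ([]; _∷_)
open import Data.List.Relation.Unary.Unique.Propositional using (Unique)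
open import Data.Product using (Σ; _,_; _×_) renaming (proj₁ to fst; proj₂ to snd)
open import Data.Sum using (_⊎_; [_,_]′) renaming (inj₁ to inl; inj₂ to inr)
open import Data.Empty using (⊥; ⊥-elim)
open import Function using (_∘_)
open import Relation.Nullary using (¬_; yes; no; Dec)
open import Relation.Nullary.Decidable using (¬?; _×-dec_)
open import Relation.Binary.PropositionalEquality hiding (J) renaming (cong₂ to cong2; module ≡-Reasoning to ≡R)
open Alg

-- Counting in lists by splitting and covering.

module Count where
 open import Data.Nat using (_+_; _*_)
 open import Data.Nat.Properties
 open import Data.Nat.ListAction using (sum)
 open import Data.List using (cartesianProduct)
 open import Relation.Unary using (Decidable)

 module _ {A : Set} where
  filter-split : ∀ {P : A -> Set} (P? : Decidable P) xs -> length (filter P? xs) + length (filter (\ x -> ¬? (P? x)) xs) ≡ length xs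
  filter-split P? [] = refl
  filter-split P? (x ∷ xs) with P? x
  ... | yes _ = cong suc (filter-split P? xs)
  ... | no _ = trans (+-suc _ _) (cong suc (filter-split P? xs))
  filter-mono : ∀ {P Q : A -> Set} (P? : Decidable P) (Q? : Decidable Q) xs -> (∀ x -> x ∈ xs -> P x -> Q x) -> length (filter P? xs) ≤ length (filter Q? xs)
  filter-mono P? Q? [] imp = z≤n
  filter-mono P? Q? (x ∷ xs) imp with P? x | Q? x
  ... | yes _ | yes _ = s≤s (filter-mono P? Q? xs (\ y y∈ -> imp y (there y∈)))
  ... | yes p | no ¬q = ⊥-elim (¬q (imp x (here refl) p))
  ... | no _ | yes _ = m≤n⇒m≤1+n (filter-mono P? Q? xs (\ y y∈ -> imp y (there y∈)))
  ... | no _ | no _ = filter-mono P? Q? xs (\ y y∈ -> imp y (there y∈))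
  filter-cong : ∀ {P Q : A -> Set} (P? : Decidable P) (Q? : Decidable Q) xs -> (∀ x -> x ∈ xs -> P x -> Q x) -> (∀ x -> x ∈ xs -> Q x -> P x) -> length (filter P? xs) ≡ length (filter Q? xs)
  filter-cong P? Q? xs to from = ≤-antisym (filter-mono P? Q? xs to) (filter-mono Q? P? xs from)
  filter-filter : ∀ {P Q : A -> Set} (P? : Decidable P) (Q? : Decidable Q) xs -> length (filter P? (filter Q? xs)) ≤ length (filter P? xs)
  filter-filter P? Q? [] = z≤n
  filter-filter P? Q? (x ∷ xs) with Q? x
  filter-filter P? Q? (x ∷ xs) | yes _ with P? x
  ... | yes _ = s≤s (filter-filter P? Q? xs)
  ... | no _ = filter-filter P? Q? xs
  filter-filter P? Q? (x ∷ xs) | no _ with P? x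
  ... | yes _ = m≤n⇒m≤1+n (filter-filter P? Q? xs)
  ... | no _ = filter-filter P? Q? xs
  module _ {B : Set} {R : B -> A -> Set} (R? : ∀ b a -> Dec (R b a)) where
   -- The elements related to `b` are removed before the tail of `bs` is treated. The parts may
   -- overlap, since filtering a shorter list only lowers the later counts.
   cover-count : ∀ xs (bs : List B) -> (∀ x -> x ∈ xs -> Any (\ b -> R b x) bs) -> length xs ≤ sum (map (\ b -> length (filter (R? b) xs)) bs)
   cover-count [] [] cov = z≤n
   cover-count (x ∷ xs) [] cov with cov x (here refl)
   ... | ()
   cover-count xs (b ∷ bs) cov = ≤-trans (≤-eq (sym (filter-split (R? b) xs)))
    (+-monoʳ-≤ _ (≤-trans (cover-count rest bs cov') (sum-mono bs)))
    where
    rest = filter (\ x -> ¬? (R? b x)) xs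
    cov' : ∀ x -> x ∈ rest -> Any (\ b -> R b x) bs
    cov' x x∈ with ∈-filter⁻ (\ x -> ¬? (R? b x)) {xs = xs} x∈
    ... | x∈xs , ¬r with cov x x∈xs
    ...   | here r = ⊥-elim (¬r r)
    ...   | there a = a
    sum-mono : ∀ bs -> sum (map (\ b' -> length (filter (R? b') rest)) bs) ≤ sum (map (\ b' -> length (filter (R? b') xs)) bs)
    sum-mono [] = z≤n
    sum-mono (b' ∷ bs) = +-mono-≤ (filter-filter (R? b') (\ x -> ¬? (R? b x)) xs) (sum-mono bs)
   -- `D` is a denominator: each part has at most U / D elements, and multiplying by `D` keeps the
   -- estimate in ℕ.
   sum-bound : ∀ xs (bs : List B) D U -> (∀ b -> b ∈ bs -> length (filter (R? b) xs) * D ≤ U) -> sum (map (\ b -> length (filter (R? b) xs)) bs) * D ≤ length bs * U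
   sum-bound xs [] D U h = z≤n
   sum-bound xs (b ∷ bs) D U h = ≤-trans (≤-eq (*-distribʳ-+ D (length (filter (R? b) xs)) _))
    (+-mono-≤ (h b (here refl)) (sum-bound xs bs D U (\ b' b'∈ -> h b' (there b'∈))))
   -- With `R b x` of the form f x ≡ b this bounds the domain of a map whose fibres have at most `U`
   -- elements.
   fiber-bound : ∀ xs (bs : List B) U -> (∀ x -> x ∈ xs -> Any (\ b -> R b x) bs) -> (∀ b -> b ∈ bs -> length (filter (R? b) xs) ≤ U) -> length xs ≤ length bs * U
   fiber-bound xs bs U cov h = ≤-trans (cover-count xs bs cov) (≤-trans (≤-eq (sym (*-identityʳ _)))
    (sum-bound xs bs 1 U (\ b b∈ -> ≤-trans (≤-eq (*-identityʳ _)) (h b b∈))))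
  unique-⊆ : (∀ (x y : A) -> Dec (x ≡ y)) -> ∀ xs ys -> Unique xs -> (∀ x -> x ∈ xs -> x ∈ ys) -> length xs ≤ length ys
  unique-⊆ _≟_ xs ys u sub = ≤-trans (fiber-bound (\ y x -> x ≟ y) xs ys 1 sub (\ y _ -> single y _ (Unique.filter⁺ (_≟ y) u) (\ x∈ -> snd (∈-filter⁻ (_≟ y) {xs = xs} x∈))))
   (≤-eq (*-identityʳ _))
   where
   single : ∀ n zs -> Unique zs -> (∀ {x} -> x ∈ zs -> x ≡ n) -> length zs ≤ 1
   single n [] _ _ = z≤n
   single n (_ ∷ []) _ _ = s≤s z≤n
   single n (x ∷ y ∷ _) ((ne ∷ _) ∷ _) eq = ⊥-elim (ne (trans (eq (here refl)) (sym (eq (there (here refl))))))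

 length-product : ∀ {A B : Set} (xs : List A) (ys : List B) -> length (cartesianProduct xs ys) ≡ length xs * length ys
 length-product [] ys = refl
 length-product (x ∷ xs) ys = trans (List.length-++ (map (x ,_) ys)) (cong2 _+_ (List.length-map _ ys) (length-product xs ys))

-- Polynomials in one variable: ring structure, derivations, degrees, multiple zeros.

module Poly (K : Field) where
 open import Level using (0ℓ)
 open import Algebra.Bundles using (CommutativeRing)

 open FieldProps K

 Poly : Set
 Poly = List Carrier

 coeff : Poly -> ℕ -> Carrier
 coeff [] _ = 0#
 coeff (a ∷ f) zero = a
 coeff (a ∷ f) (suc n) = coeff f n

 infix 4 _≈_
 -- Coefficient lists may end in zeros, so equality of lists is too fine.
 record _≈_ (f g : Poly) : Set where
  constructor mk
  field at : ∀ n -> coeff f n ≡ coeff g n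
 open _≈_ public

 ≈-refl : ∀ {f} -> f ≈ f
 ≈-refl = mk \ n -> refl

 ≈-sym : ∀ {f g} -> f ≈ g -> g ≈ f
 ≈-sym e = mk \ n -> sym (at e n)

 ≈-trans : ∀ {f g h} -> f ≈ g -> g ≈ h -> f ≈ h
 ≈-trans e e' = mk \ n -> trans (at e n) (at e' n)

 infixl 6 _⊕_
 infixl 7 _**_
 eval : Poly -> Carrier -> Carrier
 eval [] r = 0#
 eval (a ∷ f) r = a + r * eval f r

 const : Carrier -> Poly
 const c = c ∷ []

 opaque
  _⊕_ : Poly -> Poly -> Poly
  [] ⊕ g = g
  (a ∷ f) ⊕ [] = a ∷ f
  (a ∷ f) ⊕ (b ∷ g) = a + b ∷ f ⊕ g
  scale : Carrier -> Poly -> Poly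
  scale c = map (c *_)
  ⊝_ : Poly -> Poly
  ⊝_ = map (\ a -> - a)
  _**_ : Poly -> Poly -> Poly
  [] ** g = []
  (a ∷ f) ** g = scale a g ⊕ (0# ∷ f ** g)
  coeff-⊕ : ∀ f g n -> coeff (f ⊕ g) n ≡ coeff f n + coeff g n
  coeff-⊕ [] g n = sym (+-identityˡ _)
  coeff-⊕ (a ∷ f) [] n = sym (+-identityʳ _)
  coeff-⊕ (a ∷ f) (b ∷ g) zero = refl
  coeff-⊕ (a ∷ f) (b ∷ g) (suc n) = coeff-⊕ f g n
  coeff-scale : ∀ c f n -> coeff (scale c f) n ≡ c * coeff f n
  coeff-scale c [] n = sym (zeroʳ c)
  coeff-scale c (a ∷ f) zero = refl
  coeff-scale c (a ∷ f) (suc n) = coeff-scale c f n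
  coeff-⊝ : ∀ f n -> coeff (⊝ f) n ≡ - coeff f n
  coeff-⊝ [] n = sym -0#≈0#
  coeff-⊝ (a ∷ f) zero = refl
  coeff-⊝ (a ∷ f) (suc n) = coeff-⊝ f n
  coeff-∷** : ∀ a f g n -> coeff ((a ∷ f) ** g) n ≡ a * coeff g n + coeff (0# ∷ f ** g) n
  coeff-∷** a f g n = trans (coeff-⊕ (scale a g) _ n) (+-congʳ (coeff-scale a g n))
  ∷-cong : ∀ {a b f g} -> a ≡ b -> f ≈ g -> (a ∷ f) ≈ (b ∷ g)
  ∷-cong a≡b f≈g = mk \ { zero -> a≡b ; (suc n) -> at f≈g n }
  ⊕-cong : ∀ {f f' g g'} -> f ≈ f' -> g ≈ g' -> f ⊕ g ≈ f' ⊕ g'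
  ⊕-cong {f} {f'} {g} {g'} e e' = mk \ n ->
   trans (coeff-⊕ f g n) (trans (cong2 _+_ (at e n) (at e' n)) (sym (coeff-⊕ f' g' n)))
  scale-cong : ∀ c {f g} -> f ≈ g -> scale c f ≈ scale c g
  scale-cong c {f} {g} e = mk \ n -> trans (coeff-scale c f n) (trans (cong (c *_) (at e n)) (sym (coeff-scale c g n)))
  ⊝-cong : ∀ {f g} -> f ≈ g -> ⊝ f ≈ ⊝ g
  ⊝-cong {f} {g} e = mk \ n -> trans (coeff-⊝ f n) (trans (cong (\ a -> - a) (at e n)) (sym (coeff-⊝ g n)))
  ⊕-assoc : ∀ f g h -> (f ⊕ g) ⊕ h ≈ f ⊕ (g ⊕ h)
  ⊕-assoc f g h = mk \ n -> trans (coeff-⊕ (f ⊕ g) h n) (trans (+-congʳ (coeff-⊕ f g n))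
   (trans (+-assoc _ _ _) (sym (trans (coeff-⊕ f (g ⊕ h) n) (+-congˡ (coeff-⊕ g h n))))))
  ⊕-comm : ∀ f g -> f ⊕ g ≈ g ⊕ f
  ⊕-comm f g = mk \ n -> trans (coeff-⊕ f g n) (trans (+-comm _ _) (sym (coeff-⊕ g f n)))
  ⊕-identityʳ : ∀ f -> f ⊕ [] ≈ f
  ⊕-identityʳ f = mk \ n -> trans (coeff-⊕ f [] n) (+-identityʳ _)
  ⊕-inverseʳ : ∀ f -> f ⊕ ⊝ f ≈ []
  ⊕-inverseʳ f = mk \ n -> trans (coeff-⊕ f (⊝ f) n) (trans (+-congˡ (coeff-⊝ f n)) (-‿inverseʳ _))
  0∷-⊕ : ∀ f g -> (0# ∷ f ⊕ g) ≈ (0# ∷ f) ⊕ (0# ∷ g)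
  0∷-⊕ f g = ∷-cong (sym (+-identityʳ 0#)) ≈-refl
  **-distribʳ : ∀ h f g -> (f ⊕ g) ** h ≈ f ** h ⊕ g ** h
  **-distribʳ h [] g = ≈-refl
  **-distribʳ h (a ∷ f) [] = ≈-sym (⊕-identityʳ _)
  **-distribʳ h (a ∷ f) (b ∷ g) = mk \ n -> begin
   coeff ((a + b ∷ f ⊕ g) ** h) n ≡⟨ coeff-∷** (a + b) (f ⊕ g) h n ⟩
   (a + b) * coeff h n + coeff (0# ∷ (f ⊕ g) ** h) n ≡⟨ +-congˡ (trans (at (∷-cong refl (**-distribʳ h f g)) n) (trans (at (0∷-⊕ (f ** h) (g ** h)) n) (coeff-⊕ (0# ∷ f ** h) (0# ∷ g ** h) n))) ⟩
   (a + b) * coeff h n + (coeff (0# ∷ f ** h) n + coeff (0# ∷ g ** h) n)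
    ≡⟨ solve 5 (\ a b h s t -> (a :+ b) :* h :+ (s :+ t) := (a :* h :+ s) :+ (b :* h :+ t)) refl a b _ _ _ ⟩
   (a * coeff h n + coeff (0# ∷ f ** h) n) + (b * coeff h n + coeff (0# ∷ g ** h) n)
    ≡⟨ cong2 _+_ (coeff-∷** a f h n) (coeff-∷** b g h n) ⟨
   coeff ((a ∷ f) ** h) n + coeff ((b ∷ g) ** h) n ≡⟨ coeff-⊕ ((a ∷ f) ** h) _ n ⟨
   coeff ((a ∷ f) ** h ⊕ (b ∷ g) ** h) n ∎
   where open ≡R
  scale-** : ∀ c f g -> scale c f ** g ≈ scale c (f ** g)
  scale-** c [] g = ≈-refl
  scale-** c (a ∷ f) g = mk \ n -> trans (coeff-∷** (c * a) (scale c f) g n)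
   (trans (+-congˡ (trans (at (∷-cong (sym (zeroʳ c)) (scale-** c f g)) n) (coeff-scale c (0# ∷ f ** g) n)))
   (trans (solve 4 (\ c a x y -> c :* a :* x :+ c :* y := c :* (a :* x :+ y)) refl c a _ _)
   (sym (trans (coeff-scale c ((a ∷ f) ** g) n) (cong (c *_) (coeff-∷** a f g n))))))
  shift-** : ∀ f g -> (0# ∷ f) ** g ≈ (0# ∷ f ** g)
  shift-** f g = mk \ n -> trans (coeff-∷** 0# f g n) (trans (+-congʳ (zeroˡ _)) (+-identityˡ _))
  **-assoc : ∀ f g h -> (f ** g) ** h ≈ f ** (g ** h)
  **-assoc [] g h = ≈-refl
  **-assoc (a ∷ f) g h = ≈-trans (**-distribʳ h (scale a g) (0# ∷ f ** g))
   (⊕-cong (scale-** a g h) (≈-trans (shift-** (f ** g) h) (∷-cong refl (**-assoc f g h))))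
  **-zeroʳ : ∀ f -> f ** [] ≈ []
  **-zeroʳ [] = ≈-refl
  **-zeroʳ (a ∷ f) = mk \ { zero -> refl ; (suc n) -> at (**-zeroʳ f) n }
  **-∷ : ∀ g a f -> g ** (a ∷ f) ≈ scale a g ⊕ (0# ∷ g ** f)
  **-∷ [] a f = mk \ { zero -> refl ; (suc n) -> refl }
  **-∷ (b ∷ g) a f = mk \
   { zero -> trans (+-identityʳ _) (trans (*-comm b a) (sym (+-identityʳ _)))
   ; (suc n) -> begin
     coeff (scale b f ⊕ g ** (a ∷ f)) n ≡⟨ coeff-⊕ (scale b f) _ n ⟩
     coeff (scale b f) n + coeff (g ** (a ∷ f)) n ≡⟨ +-congˡ (trans (at (**-∷ g a f) n) (coeff-⊕ (scale a g) _ n)) ⟩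
     coeff (scale b f) n + (coeff (scale a g) n + coeff (0# ∷ g ** f) n)
      ≡⟨ solve 3 (\ x y z -> x :+ (y :+ z) := y :+ (x :+ z)) refl _ _ _ ⟩
     coeff (scale a g) n + (coeff (scale b f) n + coeff (0# ∷ g ** f) n)
      ≡⟨ +-congˡ (coeff-⊕ (scale b f) _ n) ⟨
     coeff (scale a g) n + coeff (scale b f ⊕ (0# ∷ g ** f)) n ≡⟨ coeff-⊕ (scale a g) _ n ⟨
     coeff (scale a g ⊕ (b ∷ g) ** f) n ∎ }
   where open ≡R
  **-comm : ∀ f g -> f ** g ≈ g ** f
  **-comm [] g = ≈-sym (**-zeroʳ g)
  **-comm (a ∷ f) g = ≈-trans (⊕-cong ≈-refl (∷-cong refl (**-comm f g))) (≈-sym (**-∷ g a f))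
  **-congʳ : ∀ f {g g'} -> g ≈ g' -> f ** g ≈ f ** g'
  **-congʳ [] e = ≈-refl
  **-congʳ (a ∷ f) e = ⊕-cong (scale-cong a e) (∷-cong refl (**-congʳ f e))
  **-cong : ∀ {f f' g g'} -> f ≈ f' -> g ≈ g' -> f ** g ≈ f' ** g'
  **-cong {f} {f'} {g} {g'} e e' = ≈-trans (**-congʳ f e') (≈-trans (**-comm f g') (≈-trans (**-congʳ g' e) (**-comm g' f')))
  const-** : ∀ c f -> const c ** f ≈ scale c f
  const-** c f = mk \ n -> trans (coeff-⊕ (scale c f) (0# ∷ []) n) (trans (+-congˡ (z n)) (+-identityʳ _))
   where
   z : ∀ n -> coeff (0# ∷ []) n ≡ 0#
   z zero = refl
   z (suc n) = refl
  **-identityˡ : ∀ f -> const 1# ** f ≈ f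
  **-identityˡ f = ≈-trans (const-** 1# f) (mk \ n -> trans (coeff-scale 1# f n) (*-identityˡ _))
  eval-⊕ : ∀ f g r -> eval (f ⊕ g) r ≡ eval f r + eval g r
  eval-⊕ [] g r = sym (+-identityˡ _)
  eval-⊕ (a ∷ f) [] r = sym (+-identityʳ _)
  eval-⊕ (a ∷ f) (b ∷ g) r = trans (cong (\ t -> a + b + r * t) (eval-⊕ f g r))
   (solve 5 (\ a b r s t -> a :+ b :+ r :* (s :+ t) := a :+ r :* s :+ (b :+ r :* t)) refl a b r _ _)
  eval-scale : ∀ c f r -> eval (scale c f) r ≡ c * eval f r
  eval-scale c [] r = sym (zeroʳ c)
  eval-scale c (a ∷ f) r = trans (cong (\ t -> c * a + r * t) (eval-scale c f r))
   (solve 4 (\ c a r t -> c :* a :+ r :* (c :* t) := c :* (a :+ r :* t)) refl c a r _)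
  eval-** : ∀ f g r -> eval (f ** g) r ≡ eval f r * eval g r
  eval-** [] g r = sym (zeroˡ _)
  eval-** (a ∷ f) g r = trans (eval-⊕ (scale a g) _ r) (trans (cong2 (\ s t -> s + (0# + r * t)) (eval-scale a g r) (eval-** f g r))
   (solve 4 (\ a r s t -> a :* t :+ (lit 0 :+ r :* (s :* t)) := (a :+ r :* s) :* t) refl a r _ _))
  D : Poly -> Poly
  D [] = []
  D (a ∷ f) = f ⊕ (0# ∷ D f)
  coeff-D : ∀ f n -> coeff (D f) n ≡ cast (suc n) * coeff f (suc n)
  coeff-D [] n = sym (zeroʳ _)
  coeff-D (a ∷ f) zero = trans (coeff-⊕ f _ 0) (solve 1 (\ x -> x :+ lit 0 := (lit 1 :+ lit 0) :* x) refl _)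
  coeff-D (a ∷ f) (suc n) = trans (coeff-⊕ f _ (suc n)) (trans (+-congˡ (coeff-D f n))
   (solve 2 (\ x c -> x :+ c :* x := (lit 1 :+ c) :* x) refl _ _))
  D-∷ : ∀ a f -> D (a ∷ f) ≈ f ⊕ (0# ∷ D f)
  D-∷ a f = ≈-refl
  **-∷ˡ : ∀ a f g -> (a ∷ f) ** g ≈ scale a g ⊕ (0# ∷ f ** g)
  **-∷ˡ a f g = ≈-refl
  D-[] : D [] ≈ []
  D-[] = ≈-refl
  **-zeroˡ : ∀ g -> [] ** g ≈ []
  **-zeroˡ g = ≈-refl
  ⊕-identityˡ : ∀ g -> [] ⊕ g ≈ g
  ⊕-identityˡ g = ≈-refl

 polyRing : CommutativeRing 0ℓ 0ℓ
 polyRing = record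
  { Carrier = Poly ; _≈_ = _≈_ ; _+_ = _⊕_ ; _*_ = _**_ ; -_ = ⊝_ ; 0# = [] ; 1# = const 1#
  ; isCommutativeRing = record
   { isRing = record
    { +-isAbelianGroup = record
     { isGroup = record
      { isMonoid = record
       { isSemigroup = record
        { isMagma = record
         { isEquivalence = record { refl = ≈-refl ; sym = ≈-sym ; trans = ≈-trans }
         ; ∙-cong = ⊕-cong }
        ; assoc = ⊕-assoc }
       ; identity = ⊕-identityˡ , ⊕-identityʳ }
      ; inverse = (\ f -> ≈-trans (⊕-comm (⊝ f) f) (⊕-inverseʳ f)) , ⊕-inverseʳ
      ; ⁻¹-cong = ⊝-cong }
     ; comm = ⊕-comm }
    ; *-cong = **-cong
    ; *-assoc = **-assoc
    ; *-identity = **-identityˡ , (\ f -> ≈-trans (**-comm f (const 1#)) (**-identityˡ f))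
    ; distrib = (\ f g h -> ≈-trans (**-comm f (g ⊕ h)) (≈-trans (**-distribʳ f g h) (⊕-cong (**-comm g f) (**-comm h f)))) , **-distribʳ }
   ; *-comm = **-comm } }

 module R = CommutativeRing polyRing
 module PS = IntSolver polyRing
 open Algebra.Properties.Semiring.Exp R.semiring public
  using () renaming (_^_ to _^^_; ^-homo-* to ^^-homo-*; ^-congˡ to ^^-congˡ)
 open import Relation.Binary.Reasoning.Setoid R.setoid as ≈R using ()

 eval-≈0 : ∀ {f} r -> f ≈ [] -> eval f r ≡ 0#
 eval-≈0 {[]} r e = refl
 eval-≈0 {a ∷ f} r e = trans (cong2 (\ s t -> s + r * t) (at e 0) (eval-≈0 {f} r (mk (at e ∘ suc)))) (trans (+-identityˡ _) (zeroʳ r))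

 eval-cong : ∀ {f g} r -> f ≈ g -> eval f r ≡ eval g r
 eval-cong {[]} {g} r e = sym (eval-≈0 r (≈-sym e))
 eval-cong {a ∷ f} {[]} r e = eval-≈0 r e
 eval-cong {a ∷ f} {b ∷ g} r e = cong2 (\ s t -> s + r * t) (at e 0) (eval-cong {f} {g} r (mk (at e ∘ suc)))

 eval-const : ∀ c r -> eval (const c) r ≡ c
 eval-const c r = trans (cong (c +_) (zeroʳ r)) (+-identityʳ c)

 eval-^^ : ∀ f n r -> eval (f ^^ n) r ≡ eval f r ^ n
 eval-^^ f zero r = eval-const 1# r
 eval-^^ f (suc n) r = trans (eval-** f (f ^^ n) r) (*-congˡ (eval-^^ f n r))

 D-cong : ∀ {f g} -> f ≈ g -> D f ≈ D g
 D-cong {f} {g} e = mk \ n -> trans (coeff-D f n) (trans (*-congˡ (at e (suc n))) (sym (coeff-D g n)))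

 D-⊕ : ∀ f g -> D (f ⊕ g) ≈ D f ⊕ D g
 D-⊕ f g = mk \ n -> trans (coeff-D (f ⊕ g) n) (trans (*-congˡ (coeff-⊕ f g (suc n))) (trans (distribˡ _ _ _)
  (sym (trans (coeff-⊕ (D f) (D g) n) (cong2 _+_ (coeff-D f n) (coeff-D g n))))))

 D-scale : ∀ c f -> D (scale c f) ≈ scale c (D f)
 D-scale c f = mk \ n -> trans (coeff-D (scale c f) n) (trans (*-congˡ (coeff-scale c f (suc n)))
  (trans (solve 3 (\ k c x -> k :* (c :* x) := c :* (k :* x)) refl _ c _)
  (sym (trans (coeff-scale c (D f) n) (cong (c *_) (coeff-D f n))))))

 D-** : ∀ f g -> D (f ** g) ≈ D f ** g ⊕ f ** D g
 D-** [] g = begin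
  D ([] ** g) ≈⟨ D-cong (**-zeroˡ g) ⟩
  D [] ≈⟨ D-[] ⟩
  [] ≈⟨ ≈-trans (⊕-cong (≈-trans (**-cong D-[] ≈-refl) (**-zeroˡ g)) (**-zeroˡ (D g))) (⊕-identityˡ []) ⟨
  D [] ** g ⊕ [] ** D g ∎
  where open ≈R
 D-** (a ∷ f) g = begin
  D ((a ∷ f) ** g) ≈⟨ D-cong (**-∷ˡ a f g) ⟩
  D (scale a g ⊕ (0# ∷ f ** g)) ≈⟨ D-⊕ (scale a g) _ ⟩
  D (scale a g) ⊕ D (0# ∷ f ** g)
   ≈⟨ ⊕-cong (D-scale a g) (≈-trans (D-∷ 0# (f ** g)) (⊕-cong ≈-refl (≈-trans (∷-cong refl (D-** f g)) (0∷-⊕ (D f ** g) (f ** D g))))) ⟩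
  scale a (D g) ⊕ (f ** g ⊕ ((0# ∷ D f ** g) ⊕ (0# ∷ f ** D g)))
   ≈⟨ PS.solve 4 (\ x y z w -> x PS.:+ (y PS.:+ (z PS.:+ w)) PS.:= (y PS.:+ z) PS.:+ (x PS.:+ w)) ≈-refl (scale a (D g)) (f ** g) (0# ∷ D f ** g) (0# ∷ f ** D g) ⟩
  (f ** g ⊕ (0# ∷ D f ** g)) ⊕ (scale a (D g) ⊕ (0# ∷ f ** D g))
   ≈⟨ ⊕-cong (≈-trans (**-distribʳ g f (0# ∷ D f)) (⊕-cong ≈-refl (shift-** (D f) g))) (**-∷ˡ a f (D g)) ⟨
  (f ⊕ (0# ∷ D f)) ** g ⊕ (a ∷ f) ** D g ≈⟨ ⊕-cong (**-cong (D-∷ a f) ≈-refl) ≈-refl ⟨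
  D (a ∷ f) ** g ⊕ (a ∷ f) ** D g ∎
  where open ≈R

 const0 : const 0# ≈ []
 const0 = mk \ { zero -> refl ; (suc m) -> refl }

 const-+ : ∀ a b -> const (a + b) ≈ const a ⊕ const b
 const-+ a b = mk \ { zero -> sym (coeff-⊕ (const a) (const b) 0)
  ; (suc m) -> sym (trans (coeff-⊕ (const a) (const b) (suc m)) (+-identityʳ 0#)) }

 D-const : ∀ c -> D (const c) ≈ []
 D-const c = mk \ n -> trans (coeff-D (const c) n) (zeroʳ _)

 -- The derivation q d/dX, not d/dX itself: for q = X u v it multiplies X ^ m u ^ n v ^ k by a
 -- polynomial of degree at most 2, so no denominators arise.
 module Derivation (q : Poly) where
  ∂ : Poly -> Poly
  ∂ f = q ** D f
  ∂-cong : ∀ {f g} -> f ≈ g -> ∂ f ≈ ∂ g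
  ∂-cong e = **-congʳ q (D-cong e)
  ∂-⊕ : ∀ f g -> ∂ (f ⊕ g) ≈ ∂ f ⊕ ∂ g
  ∂-⊕ f g = ≈-trans (**-congʳ q (D-⊕ f g)) (fst R.distrib q (D f) (D g))
  ∂-** : ∀ f g -> ∂ (f ** g) ≈ ∂ f ** g ⊕ f ** ∂ g
  ∂-** f g = ≈-trans (**-congʳ q (D-** f g))
   (PS.solve 5 (\ q f g f' g' -> q PS.:* (f' PS.:* g PS.:+ f PS.:* g') PS.:= q PS.:* f' PS.:* g PS.:+ f PS.:* (q PS.:* g')) ≈-refl q f g (D f) (D g))
  -- A logarithmic derivative of f gives one of every power of f.
  ∂-^^ : ∀ {f l} n -> ∂ f ≈ l ** f -> ∂ (f ^^ n) ≈ const (cast n) ** l ** f ^^ n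
  ∂-^^ {f} {l} zero e = begin
   q ** D (const 1#) ≈⟨ **-congʳ q (D-const 1#) ⟩
   q ** [] ≈⟨ **-zeroʳ q ⟩
   [] ≈⟨ PS.solve 2 (\ l w -> PS.lit 0 PS.:* l PS.:* w PS.:= PS.lit 0) ≈-refl l (const 1#) ⟨
   [] ** l ** const 1# ≈⟨ **-cong (**-cong const0 ≈-refl) ≈-refl ⟨
   const 0# ** l ** const 1# ∎
   where open ≈R
  ∂-^^ {f} {l} (suc n) e = begin
   ∂ (f ** f ^^ n) ≈⟨ ∂-** f (f ^^ n) ⟩
   ∂ f ** f ^^ n ⊕ f ** ∂ (f ^^ n) ≈⟨ ⊕-cong (**-cong e ≈-refl) (**-congʳ f (∂-^^ {f} {l} n e)) ⟩
   l ** f ** f ^^ n ⊕ f ** (const (cast n) ** l ** f ^^ n)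
    ≈⟨ PS.solve 4 (\ l f w c -> l PS.:* f PS.:* w PS.:+ f PS.:* (c PS.:* l PS.:* w) PS.:= (PS.lit 1 PS.:+ c) PS.:* l PS.:* (f PS.:* w)) ≈-refl l f (f ^^ n) (const (cast n)) ⟩
   (const 1# ⊕ const (cast n)) ** l ** (f ** f ^^ n) ≈⟨ **-cong (**-cong (const-+ 1# (cast n)) ≈-refl) ≈-refl ⟨
   const (cast (suc n)) ** l ** (f ** f ^^ n) ∎
   where open ≈R
  iter : ℕ -> Poly -> Poly
  iter zero f = f
  iter (suc k) f = iter k (∂ f)
  iter-cong : ∀ k {f g} -> f ≈ g -> iter k f ≈ iter k g
  iter-cong zero e = e
  iter-cong (suc k) e = iter-cong k (∂-cong e)

 -- A strict bound: the zero polynomial is the case n = 0, and `n` counts the available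
 -- coefficients.
 record Deg< (n : ℕ) (f : Poly) : Set where
  constructor deg
  field top : ∀ i -> n ≤ i -> coeff f i ≡ 0#
 open Deg< public

 Deg<-cong : ∀ {n f g} -> f ≈ g -> Deg< n f -> Deg< n g
 Deg<-cong e d = deg \ i n≤i -> trans (sym (at e i)) (top d i n≤i)

 Deg<-mono : ∀ {m n f} -> m ≤ n -> Deg< m f -> Deg< n f
 Deg<-mono m≤n d = deg \ i n≤i -> top d i (≤-trans m≤n n≤i)

 Deg<-⊕ : ∀ {n f g} -> Deg< n f -> Deg< n g -> Deg< n (f ⊕ g)
 Deg<-⊕ {n} {f} {g} d e = deg \ i n≤i -> trans (coeff-⊕ f g i) (trans (cong2 _+_ (top d i n≤i) (top e i n≤i)) (+-identityʳ 0#))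

 Deg<0⇒≈0 : ∀ {f} -> Deg< 0 f -> f ≈ []
 Deg<0⇒≈0 d = mk \ n -> top d n z≤n

 Deg<-** : ∀ {m n f g} -> Deg< m f -> Deg< (suc n) g -> Deg< (m N.+ n) (f ** g)
 Deg<-** {m} {n} {f} {g} d e = deg (go m f d)
  where
  go : ∀ m f -> Deg< m f -> ∀ i -> m N.+ n ≤ i -> coeff (f ** g) i ≡ 0#
  go zero f d i le = at (≈-trans (**-cong {f} {[]} {g} (Deg<0⇒≈0 d) ≈-refl) (**-zeroˡ g)) i
  go (suc m) [] d i le = at (**-zeroˡ g) i
  go (suc m) (a ∷ f) d (suc i) (s≤s le) = trans (coeff-∷** a f g (suc i))
   (trans (cong2 _+_ (trans (cong (a *_) (top e (suc i) (s≤s (≤-trans (m≤n+m n m) le)))) (zeroʳ a))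
            (go m f (deg \ j le' -> top d (suc j) (s≤s le')) i le)) (+-identityʳ 0#))

 Deg<-^^ : ∀ {k f} n -> Deg< (suc k) f -> Deg< (suc (n · k)) (f ^^ n)
 Deg<-^^ zero d = deg \ { (suc i) le -> refl }
 Deg<-^^ (suc n) d = Deg<-** d (Deg<-^^ n d)

 Deg<-D : ∀ {n f} -> Deg< (suc n) f -> Deg< n (D f)
 Deg<-D {n} {f} d = deg \ i le -> trans (coeff-D f i) (trans (*-congˡ (top d (suc i) (s≤s le))) (zeroʳ _))

 Deg<-linear : ∀ {a b} -> Deg< 2 (a ∷ b ∷ [])
 Deg<-linear = deg \ { (suc (suc i)) le -> refl ; (suc zero) (s≤s ()) }

 Deg<-const : ∀ {c} -> Deg< 1 (const c)
 Deg<-const = deg \ { (suc i) le -> refl }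

 lin : Carrier -> Poly
 lin r = - r ∷ 1# ∷ []

 eval-lin : ∀ r x -> eval (lin r) x ≡ x - r
 eval-lin r x = solve 2 (\ r x -> (:- r) :+ x :* (lit 1 :+ x :* lit 0) := x :- r) refl r x
 divLin : Carrier -> Poly -> Poly
 divLin r [] = []
 divLin r (a ∷ f) = eval f r ∷ divLin r f

 coeff-lin** : ∀ r h i -> coeff (lin r ** h) (suc i) ≡ coeff h i - r * coeff h (suc i)
 coeff-lin** r h i = trans (coeff-∷** (- r) (1# ∷ []) h (suc i)) (trans (+-congˡ (at (**-identityˡ h) i))
  (solve 3 (\ r x y -> (:- r) :* y :+ x := x :- r :* y) refl r _ _))

 coeff-lin**0 : ∀ r h -> coeff (lin r ** h) 0 ≡ - (r * coeff h 0)
 coeff-lin**0 r h = trans (coeff-∷** (- r) (1# ∷ []) h 0)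
  (solve 2 (\ r x -> (:- r) :* x :+ lit 0 := :- (r :* x)) refl r _)

 divLin-correct : ∀ r f -> f ≈ lin r ** divLin r f ⊕ const (eval f r)
 divLin-correct r [] = ≈-sym (≈-trans (⊕-cong (**-zeroʳ (lin r)) const0) (⊕-identityˡ []))
 divLin-correct r (a ∷ f) = mk \
  { zero -> sym (trans (coeff-⊕ (lin r ** (e ∷ h)) (const (a + r * e)) 0) (trans (+-congʳ (coeff-lin**0 r (e ∷ h)))
    (solve 3 (\ r e a -> (:- (r :* e)) :+ (a :+ r :* e) := a) refl r e a)))
  ; (suc n) -> sym (trans (coeff-⊕ (lin r ** (e ∷ h)) (const (a + r * e)) (suc n))
    (trans (+-identityʳ _) (trans (coeff-lin** r (e ∷ h) n) (step n)))) }
  where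
  e = eval f r
  h = divLin r f
  step : ∀ n -> coeff (e ∷ h) n - r * coeff h n ≡ coeff f n
  step zero = sym (trans (at (divLin-correct r f) 0) (trans (coeff-⊕ (lin r ** h) (const e) 0)
    (trans (+-congʳ (coeff-lin**0 r h)) (+-comm _ _))))
  step (suc n) = sym (trans (at (divLin-correct r f) (suc n)) (trans (coeff-⊕ (lin r ** h) (const e) (suc n))
    (trans (+-identityʳ _) (coeff-lin** r h n))))

 root⇒lin∣ : ∀ r f -> eval f r ≡ 0# -> f ≈ lin r ** divLin r f
 root⇒lin∣ r f e = ≈-trans (divLin-correct r f)
  (≈-trans (⊕-cong ≈-refl (mk {const (eval f r)} {[]} \ { zero -> e ; (suc n) -> refl })) (⊕-identityʳ _))

 coeff-length : ∀ f i -> length f ≤ i -> coeff f i ≡ 0#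
 coeff-length [] i le = refl
 coeff-length (a ∷ f) (suc i) (s≤s le) = coeff-length f i le

 -- Where the product has no coefficient i + 1, coefficient i of `h` is r times coefficient i + 1.
 -- The recursion descends from beyond the length of `h`, where all coefficients vanish.
 Deg<-lin**⁻ : ∀ {n} r h -> Deg< n (lin r ** h) -> Deg< (n ∸ 1) h
 Deg<-lin**⁻ {n} r h d = deg \ i le -> go (length h) i le (m≤n+m _ i)
  where
  go : ∀ k i -> n ∸ 1 ≤ i -> length h ≤ i N.+ k -> coeff h i ≡ 0#
  go zero i le l = coeff-length h i (subst (length h ≤_) (N.+-identityʳ i) l)
  go (suc k) i le l = trans (x-y≡0⇒x≡y (trans (sym (coeff-lin** r h i)) (top d (suc i) (≤-trans (m≤n+m∸n n 1) (s≤s le)))))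
   (trans (cong (r *_) (go k (suc i) (m≤n⇒m≤1+n le) (subst (length h ≤_) (+-suc i k) l))) (zeroʳ r))

 lin-cancel0 : ∀ r {f} -> lin r ** f ≈ [] -> f ≈ []
 lin-cancel0 r {f} e = Deg<0⇒≈0 (Deg<-lin**⁻ {0} r f (deg \ i _ -> at e i))

 lin-cancel : ∀ r {f g} -> lin r ** f ≈ lin r ** g -> f ≈ g
 lin-cancel r {f} {g} e = mk \ n -> x-y≡0⇒x≡y (trans (sym (trans (coeff-⊕ f (⊝ g) n) (+-congˡ (coeff-⊝ g n)))) (at z n))
  where
  z : f ⊕ ⊝ g ≈ []
  z = lin-cancel0 r (≈-trans (PS.solve 3 (\ l f g -> l PS.:* (f PS.:- g) PS.:= l PS.:* f PS.:- l PS.:* g) ≈-refl (lin r) f g)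
   (≈-trans (⊕-cong e ≈-refl) (⊕-inverseʳ _)))

 Deg<-lin^**⁻ : ∀ {n} M r h -> Deg< n (lin r ^^ M ** h) -> Deg< (n ∸ M) h
 Deg<-lin^**⁻ zero r h d = Deg<-cong (**-identityˡ h) d
 Deg<-lin^**⁻ {n} (suc M) r h d = subst (\ t -> Deg< t h) (trans (∸-+-assoc n 1 M) refl)
  (Deg<-lin^**⁻ M r h (Deg<-lin**⁻ r (lin r ^^ M ** h) (Deg<-cong (**-assoc (lin r) (lin r ^^ M) h) d)))

 ZeroOrder : Poly -> ℕ -> Carrier -> Set
 ZeroOrder f M r = Σ Poly \ h -> f ≈ lin r ^^ M ** h

 private
  factor-root : ∀ {r r'} M M' h g -> r ≢ r' -> lin r ^^ M ** h ≈ lin r' ^^ suc M' ** g -> eval h r' ≡ 0#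
  factor-root {r} {r'} M M' h g ne e with no-zero-divisors {eval (lin r ^^ M) r'} {eval h r'}
   (trans (sym (eval-** (lin r ^^ M) h r')) (trans (eval-cong r' e)
    (trans (eval-** (lin r' ^^ suc M') g r') (trans (*-congʳ (trans (eval-** (lin r') (lin r' ^^ M') r')
     (trans (*-congʳ (trans (eval-lin r' r') (-‿inverseʳ r'))) (zeroˡ _)))) (zeroˡ _)))))
  ... | inr z = z
  ... | inl z = ⊥-elim (^-≢0 M (\ w -> ne (sym (x-y≡0⇒x≡y (trans (sym (eval-lin r r')) w)))) (trans (sym (eval-^^ (lin r) M r')) z))
  -- A power of `lin r` does not vanish at r' ≠ r, so `h` does, and one factor `lin r'` is cancelled
  -- on both sides.
  coprime : ∀ {r r'} M M' h g -> r ≢ r' -> lin r ^^ M ** h ≈ lin r' ^^ M' ** g -> ZeroOrder h M' r'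
  coprime M zero h g ne e = h , ≈-sym (**-identityˡ h)
  coprime {r} {r'} M (suc M') h g ne e =
   let h∣ = root⇒lin∣ r' h (factor-root M M' h g ne e)
       k , e' = coprime M M' (divLin r' h) g ne (lin-cancel r' (cancelled h∣))
   in k , ≈-trans h∣ (≈-trans (**-congʳ (lin r') e') (≈-sym (**-assoc (lin r') (lin r' ^^ M') k)))
   where
   cancelled : h ≈ lin r' ** divLin r' h -> lin r' ** (lin r ^^ M ** divLin r' h) ≈ lin r' ** (lin r' ^^ M' ** g)
   cancelled h∣ = begin
    lin r' ** (lin r ^^ M ** divLin r' h)
     ≈⟨ PS.solve 3 (\ a b c -> a PS.:* (b PS.:* c) PS.:= b PS.:* (a PS.:* c)) ≈-refl (lin r') (lin r ^^ M) (divLin r' h) ⟩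
    lin r ^^ M ** (lin r' ** divLin r' h) ≈⟨ **-congʳ (lin r ^^ M) h∣ ⟨
    lin r ^^ M ** h ≈⟨ e ⟩
    lin r' ** lin r' ^^ M' ** g ≈⟨ **-assoc (lin r') (lin r' ^^ M') g ⟩
    lin r' ** (lin r' ^^ M' ** g) ∎
    where open ≈R

 -- Dividing out one zero of order `M` lowers the degree bound by `M`, and by `coprime` the other
 -- zeros keep their order in the cofactor.
 zero-count : ∀ {n} M f rs -> Unique rs -> All (ZeroOrder f M) rs -> Deg< n f -> n ≤ length rs · M -> f ≈ []
 zero-count {n} M f [] _ _ d z≤n = Deg<0⇒≈0 d
 zero-count {n} M f (r ∷ rs) (r∉ ∷ u) ((h , e) ∷ zs) d le = ≈-trans e (≈-trans (**-congʳ (lin r ^^ M) h≈0) (**-zeroʳ _))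
  where
  h≈0 : h ≈ []
  h≈0 = zero-count {n ∸ M} M h rs u
   (All.zipWith (\ { (ne , g , e') -> coprime M M h g ne (≈-trans (≈-sym e) e') }) (r∉ , zs))
   (Deg<-lin^**⁻ M r h (Deg<-cong e d))
   (≤-trans (∸-monoˡ-≤ M le) (≤-eq (m+n∸m≡n M _)))

 root-count : ∀ {n} f rs -> Unique rs -> All (\ r -> eval f r ≡ 0#) rs -> Deg< n f -> n ≤ length rs -> f ≈ []
 root-count f rs u zs d le = zero-count 1 f rs u
  (All.map (\ {r} z -> divLin r f , ≈-trans (root⇒lin∣ r f z) (**-cong (≈-sym (≈-trans (**-comm (lin r) (const 1#)) (**-identityˡ (lin r)))) ≈-refl)) zs)
  d (≤-trans le (≤-eq (sym (N.*-identityʳ _))))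

-- Tools for Stepanov's method: linear systems, orders of vanishing, sparse polynomials.

module Stepanov (K : Field) where
 open import Data.Fin using (Fin; zero; suc; punchIn)
 open import Data.List using (_++_)
 open import Data.List.Relation.Unary.AllPairs using (AllPairs)
 open import Data.Vec.Functional using (insertAt)
 open import Data.Vec.Functional.Properties using (insertAt-lookup; insertAt-punchIn)

 open FieldProps K
 open Poly K
 open Algebra.Properties.Semiring.Sum semiring using (sum; sum-remove; *-distribˡ-sum; sum-cong-≗; ∑-distrib-+)
 open Algebra.Properties.Semiring.Sum R.semiring
  using () renaming (sum to ΣP; sum-remove to ΣP-remove; *-distribˡ-sum to **-distribˡ-ΣP; sum-cong-≋ to ΣP-cong; ∑-distrib-+ to ΣP-⊕)
 open import Relation.Binary.Reasoning.Setoid R.setoid as ≈R using ()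

 -- Gaussian elimination, one equation at a time. A nonzero coefficient of the first equation is the
 -- pivot, and `t` is the value of its variable that solves this equation; without a pivot the
 -- equation is void.
 homogeneous : ∀ {m n} -> m < n -> (L : Fin m -> Fin n -> Carrier) ->
  Σ (Fin n -> Carrier) \ x -> (Σ (Fin n) \ i -> x i ≢ 0#) × (∀ k -> sum (\ j -> L k j * x j) ≡ 0#)
 homogeneous {zero} {suc n} _ L = (\ _ -> 1#) , (zero , 1≢0) , \ ()
 homogeneous {suc m} {suc n} (s≤s m<n) L with Fin.any? (\ j -> ¬? (L zero j ≟ 0#))
 ... | yes (j , c≢0) = x , nz , sol
  where
  c⁻¹ = L zero j ⁻¹
  L' : Fin m -> Fin n -> Carrier
  L' k i = L (suc k) (punchIn j i) - L (suc k) j * (c⁻¹ * L zero (punchIn j i))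
  IH = homogeneous m<n L'
  x' = fst IH
  S = sum (\ i -> L zero (punchIn j i) * x' i)
  t = - (c⁻¹ * S)
  x = insertAt x' j t
  nz : Σ (Fin (suc n)) \ i -> x i ≢ 0#
  nz = let i , ne = fst (snd IH) in punchIn j i , \ e -> ne (trans (sym (insertAt-punchIn x' j t i)) e)
  split : ∀ k -> sum (\ i -> L k i * x i) ≡ L k j * t + sum (\ i -> L k (punchIn j i) * x' i)
  split k = trans (sum-remove {i = j} (\ i -> L k i * x i)) (cong2 _+_ (cong (L k j *_) (insertAt-lookup x' j t))
   (sum-cong-≗ (\ i -> cong (L k (punchIn j i) *_) (insertAt-punchIn x' j t i))))
  sol : ∀ k -> sum (\ i -> L k i * x i) ≡ 0#
  sol zero = trans (split zero) (trans (solve 3 (\ c d s -> c :* (:- (d :* s)) :+ s := s :- c :* d :* s) refl (L zero j) c⁻¹ S)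
   (x≡y⇒x-y≡0 (sym (trans (*-congʳ (*-inverseʳ c≢0)) (*-identityˡ S)))))
  sol (suc k) = begin
   sum (\ i -> L (suc k) i * x i) ≡⟨ split (suc k) ⟩
   a * t + S2 ≡⟨ solve 4 (\ a d s s2 -> a :* (:- (d :* s)) :+ s2 := s2 :+ (:- (a :* d)) :* s) refl a c⁻¹ S S2 ⟩
   S2 + (- (a * c⁻¹)) * S ≡⟨ +-congˡ (*-distribˡ-sum _ (\ i -> L zero (punchIn j i) * x' i)) ⟩
   S2 + sum (\ i -> (- (a * c⁻¹)) * (L zero (punchIn j i) * x' i)) ≡⟨ ∑-distrib-+ (\ i -> L (suc k) (punchIn j i) * x' i) _ ⟨
   sum (\ i -> L (suc k) (punchIn j i) * x' i + (- (a * c⁻¹)) * (L zero (punchIn j i) * x' i))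
    ≡⟨ sum-cong-≗ (\ i -> solve 5 (\ l a d l0 x -> l :* x :+ (:- (a :* d)) :* (l0 :* x) := (l :- a :* (d :* l0)) :* x) refl (L (suc k) (punchIn j i)) a c⁻¹ (L zero (punchIn j i)) (x' i)) ⟩
   sum (\ i -> L' k i * x' i) ≡⟨ snd (snd IH) k ⟩
   0# ∎
   where
   open ≡R
   a = L (suc k) j
   S2 = sum (\ i -> L (suc k) (punchIn j i) * x' i)
 ... | no none = x , fst (snd IH) , sol
  where
  IH = homogeneous {m} {suc n} (m≤n⇒m≤1+n m<n) (L ∘ suc)
  x = fst IH
  sum-0 : ∀ {k} (f : Fin k -> Carrier) -> (∀ i -> f i ≡ 0#) -> sum f ≡ 0#
  sum-0 {zero} f z = refl
  sum-0 {suc k} f z = trans (cong2 _+_ (z zero) (sum-0 (f ∘ suc) (z ∘ suc))) (+-identityʳ 0#)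
  sol : ∀ k -> sum (\ i -> L k i * x i) ≡ 0#
  sol (suc k) = snd (snd IH) k
  sol zero = sum-0 (\ i -> L zero i * x i) \ i -> trans (*-congʳ (z i)) (zeroˡ _)
   where
   z : ∀ i -> L zero i ≡ 0#
   z i with L zero i ≟ 0#
   ... | yes e = e
   ... | no ne = ⊥-elim (none (i , ne))

 record Linear {n} (φ : (Fin n -> Carrier) -> Carrier) : Set where
  field
   ext : ∀ {x y} -> (∀ i -> x i ≡ y i) -> φ x ≡ φ y
   add : ∀ x y -> φ (\ i -> x i + y i) ≡ φ x + φ y
   hom : ∀ c x -> φ (\ i -> c * x i) ≡ c * φ x
 open Linear

 basis : ∀ {n} -> Fin n -> Fin n -> Carrier
 basis zero zero = 1#
 basis zero (suc i) = 0#
 basis (suc j) zero = 0#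
 basis (suc j) (suc i) = basis j i

 cons : ∀ {n} -> Carrier -> (Fin n -> Carrier) -> Fin (suc n) -> Carrier
 cons a x zero = a
 cons a x (suc i) = x i

 expand : ∀ {n} φ -> Linear {n} φ -> ∀ x -> φ x ≡ sum (\ j -> φ (basis j) * x j)
 expand {zero} φ l x = trans (ext l {y = \ i -> 0# * x i} (\ ())) (trans (hom l 0# x) (zeroˡ _))
 expand {suc n} φ l x = begin
  φ x ≡⟨ ext l {x} {\ i -> x zero * basis zero i + cons 0# (x ∘ suc) i} (\ { zero -> sym (trans (+-identityʳ _) (*-identityʳ _)) ; (suc i) -> sym (trans (+-congʳ (zeroʳ _)) (+-identityˡ _)) }) ⟩
  φ (\ i -> x zero * basis zero i + cons 0# (x ∘ suc) i) ≡⟨ add l _ _ ⟩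
  φ (\ i -> x zero * basis zero i) + φ (cons 0# (x ∘ suc)) ≡⟨ cong2 _+_ (trans (hom l (x zero) (basis zero)) (*-comm _ _)) (expand (φ ∘ cons 0#) l' (x ∘ suc)) ⟩
  φ (basis zero) * x zero + sum (\ j -> φ (cons 0# (basis j)) * x (suc j))
   ≡⟨ +-congˡ (sum-cong-≗ (\ j -> *-congʳ {x (suc j)} (ext l {cons 0# (basis j)} {basis (suc j)} (\ { zero -> refl ; (suc i) -> refl })))) ⟩
  φ (basis zero) * x zero + sum (\ j -> φ (basis (suc j)) * x (suc j)) ∎
  where
  open ≡R
  l' : Linear (φ ∘ cons 0#)
  l' .ext e = ext l (\ { zero -> refl ; (suc i) -> e i })
  l' .add y z = trans (ext l (\ { zero -> sym (+-identityʳ 0#) ; (suc i) -> refl })) (add l _ _)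
  l' .hom c y = trans (ext l (\ { zero -> sym (zeroʳ c) ; (suc i) -> refl })) (hom l c _)

 -- The conditions enter as linear functionals, because they will be coefficients of iterated
 -- derivatives, for which no explicit matrix is at hand.
 kernel : ∀ {m n} -> m < n -> (φ : Fin m -> (Fin n -> Carrier) -> Carrier) -> (∀ k -> Linear (φ k)) ->
  Σ (Fin n -> Carrier) \ x -> (Σ (Fin n) \ i -> x i ≢ 0#) × (∀ k -> φ k x ≡ 0#)
 kernel m<n φ lin with x , nz , sol ← homogeneous m<n (\ k j -> φ k (basis j)) =
  x , nz , \ k -> trans (expand (φ k) (lin k) x) (sol k)

 X : Poly
 X = 0# ∷ 1# ∷ []

 eval-X : ∀ r -> eval X r ≡ r
 eval-X r = solve 1 (\ r -> lit 0 :+ r :* (lit 1 :+ r :* lit 0) := r) refl r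

 D-linear : ∀ a b -> D (a ∷ b ∷ []) ≈ const b
 D-linear a b = mk \
  { zero -> trans (coeff-D (a ∷ b ∷ []) 0) (trans (*-congʳ (+-identityʳ 1#)) (*-identityˡ b))
  ; (suc n) -> trans (coeff-D (a ∷ b ∷ []) (suc n)) (zeroʳ _) }

 const-* : ∀ a b -> const (a * b) ≈ const a ** const b
 const-* a b = ≈-sym (≈-trans (const-** a (const b)) (mk \ n -> trans (coeff-scale a (const b) n) (lem n)))
  where
  lem : ∀ n -> a * coeff (const b) n ≡ coeff (const (a * b)) n
  lem zero = refl
  lem (suc n) = zeroʳ a

 module Multiplicity (q : Poly) (r : Carrier) (q≢0 : eval q r ≢ 0#) where
  open Derivation q
  private
   ∂lin : ∂ (lin r) ≈ q
   ∂lin = ≈-trans (**-congʳ q (D-linear (- r) 1#)) (≈-trans (**-comm q _) (**-identityˡ q))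
   ∂lin^ : ∀ n -> ∂ (lin r ^^ suc n) ≈ const (cast (suc n)) ** q ** lin r ^^ n
   ∂lin^ zero = begin
    ∂ (lin r ** const 1#) ≈⟨ ∂-cong (≈-trans (**-comm (lin r) _) (**-identityˡ _)) ⟩
    ∂ (lin r) ≈⟨ ∂lin ⟩
    q ≈⟨ PS.solve 1 (\ q -> q PS.:= PS.lit 1 PS.:* q PS.:* PS.lit 1) ≈-refl q ⟩
    const 1# ** q ** const 1# ≈⟨ **-cong (**-cong (∷-cong (sym (+-identityʳ 1#)) ≈-refl) ≈-refl) ≈-refl ⟩
    const (cast 1) ** q ** const 1# ∎
    where open ≈R
   ∂lin^ (suc n) = begin
    ∂ (lin r ** lin r ^^ suc n) ≈⟨ ∂-** (lin r) (lin r ^^ suc n) ⟩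
    ∂ (lin r) ** lin r ^^ suc n ⊕ lin r ** ∂ (lin r ^^ suc n) ≈⟨ ⊕-cong (**-cong ∂lin ≈-refl) (**-congʳ (lin r) (∂lin^ n)) ⟩
    q ** (lin r ** lin r ^^ n) ⊕ lin r ** (const (cast (suc n)) ** q ** lin r ^^ n)
     ≈⟨ PS.solve 4 (\ q l w c -> q PS.:* (l PS.:* w) PS.:+ l PS.:* (c PS.:* q PS.:* w) PS.:= (PS.lit 1 PS.:+ c) PS.:* q PS.:* (l PS.:* w)) ≈-refl q (lin r) (lin r ^^ n) (const (cast (suc n))) ⟩
    (const 1# ⊕ const (cast (suc n))) ** q ** (lin r ** lin r ^^ n) ≈⟨ **-cong (**-cong (const-+ 1# (cast (suc n))) ≈-refl) ≈-refl ⟨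
    const (cast (suc (suc n))) ** q ** lin r ^^ suc n ∎
    where open ≈R
   -- Each application of `∂` lowers the order of vanishing at `r` by exactly one: the new cofactor
   -- has the value j q(r) h(r), which is nonzero as long as j is nonzero in `K`.
   nonvanishing : ∀ j h -> (∀ i -> i < j -> cast (suc i) ≢ 0#) -> eval h r ≢ 0# -> eval (iter j (lin r ^^ j ** h)) r ≢ 0#
   nonvanishing zero h ch h≢0 e = h≢0 (trans (sym (eval-cong r (**-identityˡ h))) e)
   nonvanishing (suc j) h ch h≢0 e = nonvanishing j h' (\ i i<j -> ch i (m≤n⇒m≤1+n i<j)) h'≢0 (trans (sym (eval-cong r (iter-cong j step))) e)
    where
    h' = const (cast (suc j)) ** q ** h ⊕ lin r ** ∂ h
    step : ∂ (lin r ^^ suc j ** h) ≈ lin r ^^ j ** h'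
    step = begin
     ∂ (lin r ^^ suc j ** h) ≈⟨ ∂-** (lin r ^^ suc j) h ⟩
     ∂ (lin r ^^ suc j) ** h ⊕ lin r ** lin r ^^ j ** ∂ h ≈⟨ ⊕-cong (**-cong (∂lin^ j) ≈-refl) ≈-refl ⟩
     const (cast (suc j)) ** q ** lin r ^^ j ** h ⊕ lin r ** lin r ^^ j ** ∂ h
      ≈⟨ PS.solve 6 (\ c q w h l d -> c PS.:* q PS.:* w PS.:* h PS.:+ l PS.:* w PS.:* d PS.:= w PS.:* (c PS.:* q PS.:* h PS.:+ l PS.:* d)) ≈-refl
         (const (cast (suc j))) q (lin r ^^ j) h (lin r) (∂ h) ⟩
     lin r ^^ j ** h' ∎
     where open ≈R
    h'≢0 : eval h' r ≢ 0#
    h'≢0 z = *-≢0 (*-≢0 (ch j ≤-refl) q≢0) h≢0 (trans (sym ev) z)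
     where
     ev : eval h' r ≡ cast (suc j) * eval q r * eval h r
     ev = trans (eval-⊕ (const (cast (suc j)) ** q ** h) (lin r ** ∂ h) r) (trans (cong2 _+_
      (trans (eval-** (const (cast (suc j)) ** q) h r) (*-congʳ (trans (eval-** (const (cast (suc j))) q r) (*-congʳ (eval-const _ r)))))
      (trans (eval-** (lin r) (∂ h) r) (trans (*-congʳ (trans (eval-lin r r) (-‿inverseʳ r))) (zeroˡ _)))) (+-identityʳ _))
  vanishing⇒ZeroOrder : ∀ M f -> (∀ i -> i < M -> cast (suc i) ≢ 0#) -> (∀ k -> k < M -> eval (iter k f) r ≡ 0#) -> ZeroOrder f M r
  vanishing⇒ZeroOrder zero f ch v = f , ≈-sym (**-identityˡ f)
  vanishing⇒ZeroOrder (suc M) f ch v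
   with h , e ← vanishing⇒ZeroOrder M f (\ i i<M -> ch i (m≤n⇒m≤1+n i<M)) (\ k k<M -> v k (m≤n⇒m≤1+n k<M))
   with eval h r ≟ 0#
  ... | yes z = divLin r h , ≈-trans e (≈-trans (**-congʳ (lin r ^^ M) (root⇒lin∣ r h z))
     (PS.solve 3 (\ w l h -> w PS.:* (l PS.:* h) PS.:= l PS.:* w PS.:* h) ≈-refl (lin r ^^ M) (lin r) (divLin r h)))
  ... | no nz = ⊥-elim (nonvanishing M h (\ i i<M -> ch i (m≤n⇒m≤1+n i<M)) nz
     (trans (sym (eval-cong r (iter-cong M e))) (v M ≤-refl)))

 Term : Set
 Term = Carrier × ℕ

 sparse : List Term -> Poly
 sparse [] = []
 sparse ((c , e) ∷ ts) = const c ** X ^^ e ⊕ sparse ts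

 sparse-++ : ∀ ts us -> sparse (ts ++ us) ≈ sparse ts ⊕ sparse us
 sparse-++ [] us = ≈-sym (⊕-identityˡ _)
 sparse-++ ((c , e) ∷ ts) us = ≈-trans (⊕-cong ≈-refl (sparse-++ ts us)) (≈-sym (⊕-assoc _ _ _))

 monomials : Poly -> ℕ -> List Term
 monomials [] m = []
 monomials (c ∷ f) m = (c , m) ∷ monomials f (suc m)

 sparse-monomials : ∀ f m -> sparse (monomials f m) ≈ f ** X ^^ m
 sparse-monomials [] m = ≈-sym (**-zeroˡ _)
 sparse-monomials (c ∷ f) m = begin
  const c ** X ^^ m ⊕ sparse (monomials f (suc m)) ≈⟨ ⊕-cong ≈-refl (sparse-monomials f (suc m)) ⟩
  const c ** X ^^ m ⊕ f ** (X ** X ^^ m) ≈⟨ PS.solve 4 (\ c w f x -> c PS.:* w PS.:+ f PS.:* (x PS.:* w) PS.:= (c PS.:+ x PS.:* f) PS.:* w) ≈-refl (const c) (X ^^ m) f X ⟩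
  (const c ⊕ X ** f) ** X ^^ m ≈⟨ **-cong split ≈-refl ⟨
  (c ∷ f) ** X ^^ m ∎
  where
  open ≈R
  Xf : X ** f ≈ (0# ∷ f)
  Xf = ≈-trans (shift-** (const 1#) f) (∷-cong refl (**-identityˡ f))
  split : (c ∷ f) ≈ const c ⊕ X ** f
  split = mk \ { zero -> sym (trans (coeff-⊕ (const c) (X ** f) 0) (trans (+-congˡ (at Xf 0)) (+-identityʳ c)))
   ; (suc n) -> sym (trans (coeff-⊕ (const c) (X ** f) (suc n)) (trans (+-congˡ (at Xf (suc n))) (+-identityˡ _))) }

 module Sparse (u : Poly) (z : Carrier) (u-root : eval u z ≡ 0#) (z≢0 : z ≢ 0#) where
  open Derivation X
  Distinct : Term -> Term -> Set
  Distinct (_ , e) (_ , e') = cast e ≢ cast e'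
  private
   -- The effect of X d/dX - e0 on the coefficients. It kills the term of exponent e0 and costs one
   -- factor of `u`, which drives the induction on the number of terms.
   twist : ℕ -> List Term -> List Term
   twist e0 = map (\ { (c , e) -> c * (cast e - cast e0) , e })
   θX^ : ∀ c e -> ∂ (const c ** X ^^ e) ≈ const (cast e) ** (const c ** X ^^ e)
   θX^ c e = begin
    ∂ (const c ** X ^^ e) ≈⟨ ∂-** (const c) (X ^^ e) ⟩
    X ** D (const c) ** X ^^ e ⊕ const c ** ∂ (X ^^ e) ≈⟨ ⊕-cong (**-cong (≈-trans (**-congʳ X (D-const c)) (**-zeroʳ X)) ≈-refl)
      (**-congʳ (const c) (∂-^^ {X} {const 1#} e (≈-trans (**-congʳ X (D-linear 0# 1#)) (**-comm X _)))) ⟩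
    [] ** X ^^ e ⊕ const c ** (const (cast e) ** const 1# ** X ^^ e)
     ≈⟨ PS.solve 3 (\ w c k -> PS.lit 0 PS.:* w PS.:+ c PS.:* (k PS.:* PS.lit 1 PS.:* w) PS.:= k PS.:* (c PS.:* w)) ≈-refl (X ^^ e) (const c) (const (cast e)) ⟩
    const (cast e) ** (const c ** X ^^ e) ∎
    where open ≈R
   const-sub : ∀ a b -> const (a - b) ≈ const a ⊕ ⊝ const b
   const-sub a b = mk \ { zero -> sym (trans (coeff-⊕ (const a) (⊝ const b) 0) (+-congˡ (coeff-⊝ (const b) 0)))
    ; (suc n) -> sym (trans (coeff-⊕ (const a) (⊝ const b) (suc n)) (trans (+-congˡ (coeff-⊝ (const b) (suc n))) (-‿inverseʳ 0#))) }
   θ-sparse : ∀ e0 ts -> ∂ (sparse ts) ⊕ ⊝ (const (cast e0) ** sparse ts) ≈ sparse (twist e0 ts)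
   θ-sparse e0 [] = ≈-trans (⊕-cong (≈-trans (**-congʳ X D-[]) (**-zeroʳ X)) ≈-refl)
    (PS.solve 1 (\ c -> PS.lit 0 PS.:- c PS.:* PS.lit 0 PS.:= PS.lit 0) ≈-refl (const (cast e0)))
   θ-sparse e0 ((c , e) ∷ ts) = begin
    ∂ (M ⊕ sparse ts) ⊕ ⊝ (k0 ** (M ⊕ sparse ts)) ≈⟨ ⊕-cong (≈-trans (∂-⊕ M (sparse ts)) (⊕-cong (θX^ c e) ≈-refl)) ≈-refl ⟩
    const (cast e) ** M ⊕ ∂ (sparse ts) ⊕ ⊝ (k0 ** (M ⊕ sparse ts))
     ≈⟨ PS.solve 6 (\ k c w d k0 s -> k PS.:* (c PS.:* w) PS.:+ d PS.:- k0 PS.:* (c PS.:* w PS.:+ s) PS.:= c PS.:* (k PS.:- k0) PS.:* w PS.:+ (d PS.:- k0 PS.:* s)) ≈-refl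
        (const (cast e)) (const c) (X ^^ e) (∂ (sparse ts)) k0 (sparse ts) ⟩
    const c ** (const (cast e) ⊕ ⊝ k0) ** X ^^ e ⊕ (∂ (sparse ts) ⊕ ⊝ (k0 ** sparse ts))
     ≈⟨ ⊕-cong (**-cong (≈-trans (**-congʳ (const c) (≈-sym (const-sub (cast e) (cast e0)))) (≈-sym (const-* c _))) ≈-refl) (θ-sparse e0 ts) ⟩
    sparse (twist e0 ((c , e) ∷ ts)) ∎
    where
    open ≈R
    k0 = const (cast e0)
    M = const c ** X ^^ e
   θ-u^ : ∀ n h -> Σ Poly \ w -> ∂ (u ^^ suc n ** h) ≈ u ^^ n ** w
   θ-u^ zero h = ∂ (u ^^ 1 ** h) , ≈-sym (**-identityˡ _)
   θ-u^ (suc n) h with w , e ← θ-u^ n h = ∂ u ** h ⊕ w , (begin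
    ∂ (u ** u ^^ suc n ** h) ≈⟨ ∂-cong (**-assoc u (u ^^ suc n) h) ⟩
    ∂ (u ** (u ^^ suc n ** h)) ≈⟨ ∂-** u (u ^^ suc n ** h) ⟩
    ∂ u ** (u ^^ suc n ** h) ⊕ u ** ∂ (u ^^ suc n ** h) ≈⟨ ⊕-cong ≈-refl (**-congʳ u e) ⟩
    ∂ u ** (u ^^ suc n ** h) ⊕ u ** (u ^^ n ** w)
     ≈⟨ PS.solve 5 (\ d u h w v -> d PS.:* (u PS.:* v PS.:* h) PS.:+ u PS.:* (v PS.:* w) PS.:= u PS.:* v PS.:* (d PS.:* h PS.:+ w)) ≈-refl (∂ u) u h w (u ^^ n) ⟩
    u ^^ suc n ** (∂ u ** h ⊕ w) ∎)
    where open ≈R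
  -- A polynomial with T terms whose exponents are distinct in K cannot vanish to order T away from 0.
  descartes : ∀ n ts h -> length ts ≡ n -> AllPairs Distinct ts -> sparse ts ≈ u ^^ n ** h -> All (\ t -> fst t ≡ 0#) ts
  descartes n [] h l ds e = []
  descartes (suc n) ((c , e0) ∷ ts) h l (d ∷ ds) e = c≡0 ∷ rest
   where
   w = θ-u^ n h
   f = const c ** X ^^ e0 ⊕ sparse ts
   twisted : sparse (twist e0 ts) ≈ u ^^ n ** (fst w ⊕ ⊝ (const (cast e0) ** u ** h))
   twisted = begin
    sparse (twist e0 ts) ≈⟨ PS.solve 2 (\ w s -> s PS.:= PS.lit 0 PS.:* w PS.:+ s) ≈-refl (X ^^ e0) (sparse (twist e0 ts)) ⟩
    [] ** X ^^ e0 ⊕ sparse (twist e0 ts) ≈⟨ ⊕-cong (**-cong (≈-trans (∷-cong (trans (*-congˡ (-‿inverseʳ (cast e0))) (zeroʳ c)) ≈-refl) const0) ≈-refl) ≈-refl ⟨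
    sparse (twist e0 ((c , e0) ∷ ts)) ≈⟨ θ-sparse e0 ((c , e0) ∷ ts) ⟨
    ∂ f ⊕ ⊝ (const (cast e0) ** f) ≈⟨ ⊕-cong (≈-trans (∂-cong e) (snd w)) (⊝-cong (**-congʳ _ e)) ⟩
    u ^^ n ** fst w ⊕ ⊝ (const (cast e0) ** (u ** u ^^ n ** h))
     ≈⟨ PS.solve 5 (\ v w k u h -> v PS.:* w PS.:- k PS.:* (u PS.:* v PS.:* h) PS.:= v PS.:* (w PS.:- k PS.:* u PS.:* h)) ≈-refl (u ^^ n) (fst w) (const (cast e0)) u h ⟩
    u ^^ n ** (fst w ⊕ ⊝ (const (cast e0) ** u ** h)) ∎
    where open ≈R
   rest : All (\ t -> fst t ≡ 0#) ts
   rest = All.zipWith (\ { {c' , e'} (ne , ce) -> cancel {c'} {e'} ne ce })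
    (d , All.map⁻ (descartes n (twist e0 ts) _ (trans (List.length-map _ ts) (suc-injective l)) (AllPairs.map⁺ ds) twisted))
    where
    cancel : ∀ {c' e'} -> cast e0 ≢ cast e' -> c' * (cast e' - cast e0) ≡ 0# -> c' ≡ 0#
    cancel ne ce = [ (\ z -> z) , (\ z -> ⊥-elim (ne (sym (x-y≡0⇒x≡y z)))) ]′ (no-zero-divisors ce)
   sparse0 : ∀ us -> All (\ t -> fst t ≡ 0#) us -> sparse us ≈ []
   sparse0 [] [] = ≈-refl
   sparse0 ((c' , e') ∷ us) (z ∷ zs) = ≈-trans (⊕-cong (**-cong (≈-trans (∷-cong z ≈-refl) const0) ≈-refl) (sparse0 us zs))
    (PS.solve 1 (\ w -> PS.lit 0 PS.:* w PS.:+ PS.lit 0 PS.:= PS.lit 0) ≈-refl (X ^^ e'))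
   -- All other coefficients vanish, so a single monomial is a multiple of `u`; it is evaluated at
   -- the root `z`.
   c*z^e0≡0 : c * z ^ e0 ≡ 0#
   c*z^e0≡0 = begin
     c * z ^ e0 ≡⟨ cong2 _*_ (eval-const c z) (trans (eval-^^ X e0 z) (cong (_^ e0) (eval-X z))) ⟨
     eval (const c) z * eval (X ^^ e0) z ≡⟨ eval-** (const c) (X ^^ e0) z ⟨
     eval (const c ** X ^^ e0) z ≡⟨ eval-cong z (≈-trans (⊕-cong ≈-refl (sparse0 ts rest)) (⊕-identityʳ _)) ⟨
     eval f z ≡⟨ eval-cong z e ⟩
     eval (u ** u ^^ n ** h) z ≡⟨ trans (eval-** (u ** u ^^ n) h z) (*-congʳ (trans (eval-** u (u ^^ n) z) (*-congʳ u-root))) ⟩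
     0# * eval (u ^^ n) z * eval h z ≡⟨ trans (*-congʳ (zeroˡ _)) (zeroˡ _) ⟩
     0# ∎
    where open ≡R
   c≡0 : c ≡ 0#
   c≡0 = [ (\ e' -> e') , (\ e' -> ⊥-elim (^-≢0 e0 z≢0 e')) ]′ (no-zero-divisors c*z^e0≡0)

-- The Stepanov bound for products of powers of X and two linear factors.

module Bound (K : Field) where
 open import Data.Fin using (Fin; zero; suc; toℕ; punchIn; combine; remQuot; fromℕ<)
 open import Data.List using (take; concat; tabulate)
 open import Data.List.Relation.Unary.AllPairs using (AllPairs)

 open FieldProps K
 open Poly K
 open Stepanov K
 open Linear
 open Algebra.Properties.Semiring.Sum R.semiring
  using () renaming (sum to ΣP; sum-remove to ΣP-remove; *-distribˡ-sum to **-distribˡ-ΣP; sum-cong-≋ to ΣP-cong; ∑-distrib-+ to ΣP-⊕)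
 open import Relation.Binary.Reasoning.Setoid R.setoid as ≈R using ()

 exponent-split : ∀ N {o W Nn} -> o ≤ W -> N N.+ W ≤ Nn -> Nn ∸ (N N.+ o) ≡ (Nn ∸ (N N.+ W)) N.+ (W ∸ o)
 exponent-split N {o} {W} {Nn} o≤W NW≤ = begin
  Nn ∸ (N N.+ o) ≡⟨ cong (_∸ (N N.+ o)) (m∸n+n≡m NW≤) ⟨
  k N.+ (N N.+ W) ∸ (N N.+ o) ≡⟨ cong (\ t -> k N.+ (N N.+ t) ∸ (N N.+ o)) (m∸n+n≡m o≤W) ⟨
  k N.+ (N N.+ (W ∸ o N.+ o)) ∸ (N N.+ o) ≡⟨ cong (_∸ (N N.+ o)) (calc k N (W ∸ o) o) ⟩
  k N.+ (W ∸ o) N.+ (N N.+ o) ∸ (N N.+ o) ≡⟨ m+n∸n≡m _ (N N.+ o) ⟩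
  k N.+ (W ∸ o) ∎
  where
  open ≡R
  k = Nn ∸ (N N.+ W)
  calc : ∀ k N d o -> k N.+ (N N.+ (d N.+ o)) ≡ k N.+ d N.+ (N N.+ o)
  calc = solve-∀

 scale-cancel : ∀ {c f} -> c ≢ 0# -> const c ** f ≈ [] -> f ≈ []
 scale-cancel {c} {f} c≢0 e = mk \ n ->
  [ (\ z -> ⊥-elim (c≢0 z)) , (\ z -> z) ]′ (no-zero-divisors (trans (sym (coeff-scale c f n)) (trans (sym (at (const-** c f) n)) (at e n))))

 linear≈ : ∀ a b z -> eval (a ∷ b ∷ []) z ≡ 0# -> (a ∷ b ∷ []) ≈ const b ** lin z
 linear≈ a b z e = ≈-sym (≈-trans (const-** b (lin z)) (mk \ n -> trans (coeff-scale b (lin z) n) (lem n)))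
  where
  lem : ∀ n -> b * coeff (lin z) n ≡ coeff (a ∷ b ∷ []) n
  lem zero = trans (solve 3 (\ a b z -> b :* (:- z) := a :- (a :+ z :* (b :+ z :* lit 0))) refl a b z)
   (trans (+-congˡ (trans (cong (\ t -> - t) e) -0#≈0#)) (+-identityʳ a))
  lem (suc zero) = *-identityʳ b
  lem (suc (suc n)) = zeroʳ b

 linear-cancel : ∀ {a b} z -> b ≢ 0# -> eval (a ∷ b ∷ []) z ≡ 0# -> ∀ {f} -> (a ∷ b ∷ []) ** f ≈ [] -> f ≈ []
 linear-cancel {a} {b} z b≢0 e {f} h = lin-cancel0 z (scale-cancel b≢0 (≈-trans (≈-trans (≈-sym (**-assoc (const b) (lin z) f)) (**-cong (≈-sym (linear≈ a b z e)) ≈-refl)) h))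

 power-cancel : ∀ {g} -> (∀ {f} -> g ** f ≈ [] -> f ≈ []) -> ∀ n {f} -> g ^^ n ** f ≈ [] -> f ≈ []
 power-cancel c zero {f} e = ≈-trans (≈-sym (**-identityˡ f)) e
 power-cancel {g} c (suc n) {f} e = power-cancel c n (c (≈-trans (≈-sym (**-assoc g (g ^^ n) f)) e))

 ≈-⊝ : ∀ {f g} -> f ⊕ ⊝ g ≈ [] -> f ≈ g
 ≈-⊝ {f} {g} e = begin
  f ≈⟨ PS.solve 2 (\ f g -> f PS.:= f PS.:- g PS.:+ g) ≈-refl f g ⟩
  f ⊕ ⊝ g ⊕ g ≈⟨ ⊕-cong e ≈-refl ⟩
  [] ⊕ g ≈⟨ ⊕-identityˡ g ⟩
  g ∎
  where open ≈R

 cancel≈ : ∀ {g} -> (∀ {f} -> g ** f ≈ [] -> f ≈ []) -> ∀ {f h} -> g ** f ≈ g ** h -> f ≈ h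
 cancel≈ {g} c {f} {h} e = ≈-⊝ (c (≈-trans (PS.solve 3 (\ g f h -> g PS.:* (f PS.:- h) PS.:= g PS.:* f PS.:- g PS.:* h) ≈-refl g f h)
  (≈-trans (⊕-cong e ≈-refl) (⊕-inverseʳ _))))

 divisible-sum : ∀ {n} g (t : Fin n -> Poly) -> (∀ i -> Σ Poly \ h -> t i ≈ g ** h) -> Σ Poly \ h -> ΣP t ≈ g ** h
 divisible-sum {zero} g t d = [] , ≈-sym (**-zeroʳ g)
 divisible-sum {suc n} g t d =
  let h , e = d zero
      h' , e' = divisible-sum g (t ∘ suc) (d ∘ suc)
  in h ⊕ h' , ≈-trans (⊕-cong e e') (≈-sym (fst R.distrib g h h'))

 isolate-sum : ∀ {n} (t : Fin n -> Poly) b g -> (∀ b' -> b' ≢ b -> Σ Poly \ h -> t b' ≈ g ** h) -> Σ Poly \ h -> ΣP t ≈ t b ⊕ g ** h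
 isolate-sum {suc n} t b g d =
  let h , e = divisible-sum g (t ∘ punchIn b) (\ i -> d (punchIn b i) (Fin.punchInᵢ≢i b i))
  in h , ≈-trans (ΣP-remove {i = b} t) (⊕-cong ≈-refl e)

 sparse-concat : ∀ {C} (f : Fin C -> List Term) -> sparse (concat (tabulate f)) ≈ ΣP (\ a -> sparse (f a))
 sparse-concat {zero} f = ≈-refl
 sparse-concat {suc C} f = ≈-trans (sparse-++ (f zero) (concat (tabulate (f ∘ suc)))) (⊕-cong ≈-refl (sparse-concat (f ∘ suc)))

 monomials-exponents : ∀ f m -> All (\ t -> Σ ℕ \ i -> i < length f × snd t ≡ m N.+ i) (monomials f m)
 monomials-exponents [] m = []
 monomials-exponents (c ∷ f) m = (0 , s≤s z≤n , sym (N.+-identityʳ m)) ∷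
  All.map (\ { (i , i< , e) -> suc i , s≤s i< , trans e (sym (+-suc m i)) }) (monomials-exponents f (suc m))

 monomials-zero : ∀ f m -> All (\ t -> fst t ≡ 0#) (monomials f m) -> f ≈ []
 monomials-zero [] m z = ≈-refl
 monomials-zero (c ∷ f) m (z ∷ zs) = mk \ { zero -> z ; (suc n) -> at (monomials-zero f (suc m) zs) n }

 monomials-length : ∀ f m -> length (monomials f m) ≡ length f
 monomials-length [] m = refl
 monomials-length (c ∷ f) m = cong suc (monomials-length f (suc m))

 take≈ : ∀ n f -> Deg< n f -> take n f ≈ f
 take≈ zero f d = ≈-sym (Deg<0⇒≈0 d)
 take≈ (suc n) [] d = ≈-refl
 take≈ (suc n) (c ∷ f) d = ∷-cong refl (take≈ n f (deg \ i le -> top d (suc i) (s≤s le)))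

 vecPoly : ∀ {n} -> (Fin n -> Carrier) -> Poly
 vecPoly {zero} x = []
 vecPoly {suc n} x = x zero ∷ vecPoly (x ∘ suc)

 coeff-vecPoly : ∀ {n} (x : Fin n -> Carrier) i -> coeff (vecPoly x) (toℕ i) ≡ x i
 coeff-vecPoly x zero = refl
 coeff-vecPoly x (suc i) = coeff-vecPoly (x ∘ suc) i

 Deg<-vecPoly : ∀ {n} (x : Fin n -> Carrier) -> Deg< n (vecPoly x)
 Deg<-vecPoly {zero} x = deg \ i le -> refl
 Deg<-vecPoly {suc n} x = deg \ { (suc i) (s≤s le) -> top (Deg<-vecPoly (x ∘ suc)) i le }

 vecPoly-cong : ∀ {n} {x y : Fin n -> Carrier} -> (∀ i -> x i ≡ y i) -> vecPoly x ≈ vecPoly y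
 vecPoly-cong {zero} e = ≈-refl
 vecPoly-cong {suc n} e = ∷-cong (e zero) (vecPoly-cong (e ∘ suc))

 vecPoly-+ : ∀ {n} (x y : Fin n -> Carrier) -> vecPoly (\ i -> x i + y i) ≈ vecPoly x ⊕ vecPoly y
 vecPoly-+ {zero} x y = ≈-sym (⊕-identityˡ [])
 vecPoly-+ {suc n} x y = mk \
  { zero -> sym (coeff-⊕ (vecPoly x) (vecPoly y) 0)
  ; (suc k) -> trans (at (vecPoly-+ (x ∘ suc) (y ∘ suc)) k) (trans (coeff-⊕ (vecPoly (x ∘ suc)) (vecPoly (y ∘ suc)) k) (sym (coeff-⊕ (vecPoly x) (vecPoly y) (suc k)))) }

 vecPoly-* : ∀ {n} c (x : Fin n -> Carrier) -> vecPoly (\ i -> c * x i) ≈ const c ** vecPoly x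
 vecPoly-* c x = ≈-sym (≈-trans (const-** c (vecPoly x)) (go x))
  where
  go : ∀ {n} (x : Fin n -> Carrier) -> scale c (vecPoly x) ≈ vecPoly (\ i -> c * x i)
  go {zero} x = mk \ n -> trans (coeff-scale c [] n) (zeroʳ c)
  go {suc n} x = mk \ { zero -> coeff-scale c (vecPoly x) 0
   ; (suc k) -> trans (coeff-scale c (vecPoly x) (suc k)) (trans (sym (coeff-scale c (vecPoly (x ∘ suc)) k)) (at (go (x ∘ suc)) k)) }

 eval-ΣP : ∀ {n} (t : Fin n -> Poly) r (g : Carrier) (s : Fin n -> Poly) -> (∀ i -> eval (t i) r ≡ g * eval (s i) r) -> eval (ΣP t) r ≡ g * eval (ΣP s) r
 eval-ΣP {zero} t r g s e = sym (zeroʳ g)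
 eval-ΣP {suc n} t r g s e = trans (eval-⊕ (t zero) (ΣP (t ∘ suc)) r) (trans (cong2 _+_ (e zero) (eval-ΣP (t ∘ suc) r g (s ∘ suc) (e ∘ suc)))
  (trans (sym (distribˡ g _ _)) (cong (g *_) (sym (eval-⊕ (s zero) (ΣP (s ∘ suc)) r)))))

 Deg<-ΣP : ∀ {k n} (t : Fin n -> Poly) -> (∀ i -> Deg< k (t i)) -> Deg< k (ΣP t)
 Deg<-ΣP {k} {zero} t d = deg \ i le -> refl
 Deg<-ΣP {k} {suc n} t d = Deg<-⊕ {k} {t zero} {ΣP (t ∘ suc)} (d zero) (Deg<-ΣP (t ∘ suc) (d ∘ suc))

 ΣP-zero : ∀ {n} (t : Fin n -> Poly) -> (∀ i -> t i ≈ []) -> ΣP t ≈ []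
 ΣP-zero {zero} t z = ≈-refl
 ΣP-zero {suc n} t z = ≈-trans (⊕-cong (z zero) (ΣP-zero (t ∘ suc) (z ∘ suc))) (⊕-identityˡ [])

 ∂-ΣP : ∀ {n} q (t : Fin n -> Poly) -> Derivation.∂ q (ΣP t) ≈ ΣP (\ i -> Derivation.∂ q (t i))
 ∂-ΣP {zero} q t = ≈-trans (**-congʳ q D-[]) (**-zeroʳ q)
 ∂-ΣP {suc n} q t = ≈-trans (Derivation.∂-⊕ q (t zero) (ΣP (t ∘ suc))) (⊕-cong ≈-refl (∂-ΣP q (t ∘ suc)))

 -- The last two hypotheses say that neither `X` nor `v` vanishes at the root `z` of `u`, so that
 -- divisibility by powers of `u` is not disturbed by powers of `X` and `v`.
 module Frame (u0 u1 v0 v1 z z' : Carrier) (u1≢0 : u1 ≢ 0#) (v1≢0 : v1 ≢ 0#)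
  (u-root : eval (u0 ∷ u1 ∷ []) z ≡ 0#) (v-root : eval (v0 ∷ v1 ∷ []) z' ≡ 0#)
  (z≢0 : z ≢ 0#) (vz≢0 : eval (v0 ∷ v1 ∷ []) z ≢ 0#) where
  u v : Poly
  u = u0 ∷ u1 ∷ []
  v = v0 ∷ v1 ∷ []
  u-cancel : ∀ {f} -> u ** f ≈ [] -> f ≈ []
  u-cancel = linear-cancel z u1≢0 u-root
  v-cancel : ∀ {f} -> v ** f ≈ [] -> f ≈ []
  v-cancel = linear-cancel z' v1≢0 v-root
  u∣ : ∀ f -> eval f z ≡ 0# -> Σ Poly \ h -> f ≈ u ** h
  u∣ f e = const (u1 ⁻¹) ** divLin z f , (begin
   f ≈⟨ root⇒lin∣ z f e ⟩
   lin z ** q ≈⟨ PS.solve 2 (\ l q -> l PS.:* q PS.:= PS.lit 1 PS.:* l PS.:* q) ≈-refl (lin z) q ⟩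
   const 1# ** lin z ** q ≈⟨ **-cong (**-cong (≈-trans (≈-sym (const-* u1 (u1 ⁻¹))) (∷-cong (*-inverseʳ u1≢0) ≈-refl)) ≈-refl) ≈-refl ⟨
   const u1 ** const (u1 ⁻¹) ** lin z ** q ≈⟨ PS.solve 4 (\ a b l q -> a PS.:* b PS.:* l PS.:* q PS.:= a PS.:* l PS.:* (b PS.:* q)) ≈-refl (const u1) (const (u1 ⁻¹)) (lin z) q ⟩
   const u1 ** lin z ** (const (u1 ⁻¹) ** q) ≈⟨ **-cong (linear≈ u0 u1 z u-root) ≈-refl ⟨
   u ** (const (u1 ⁻¹) ** q) ∎)
   where
   open ≈R
   q = divLin z f
  coprime-u : ∀ T f g h -> eval f z ≢ 0# -> f ** g ≈ u ^^ T ** h -> Σ Poly \ h' -> g ≈ u ^^ T ** h'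
  coprime-u zero f g h f≢0 e = g , ≈-sym (**-identityˡ g)
  coprime-u (suc T) f g h f≢0 e = step (u∣ g g≡0)
   where
   fg≡0 : eval f z * eval g z ≡ 0#
   fg≡0 = trans (sym (eval-** f g z)) (trans (eval-cong z e) (trans (eval-** (u ** u ^^ T) h z)
    (trans (*-congʳ (trans (eval-** u (u ^^ T) z) (trans (*-congʳ u-root) (zeroˡ _)))) (zeroˡ _))))
   g≡0 : eval g z ≡ 0#
   g≡0 = [ (\ w -> ⊥-elim (f≢0 w)) , (\ w -> w) ]′ (no-zero-divisors fg≡0)
   step : (Σ Poly \ k -> g ≈ u ** k) -> Σ Poly \ h' -> g ≈ u ^^ suc T ** h'
   step (k , g≈) = let h' , e' = coprime-u T f k h f≢0 (cancel≈ u-cancel cancelled)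
           in h' , ≈-trans g≈ (≈-trans (**-congʳ u e') (≈-sym (**-assoc u (u ^^ T) h')))
    where
    cancelled : u ** (f ** k) ≈ u ** (u ^^ T ** h)
    cancelled = ≈-trans (PS.solve 3 (\ u f k -> u PS.:* (f PS.:* k) PS.:= f PS.:* (u PS.:* k)) ≈-refl u f k)
     (≈-trans (**-congʳ f (≈-sym g≈)) (≈-trans e (**-assoc u (u ^^ T) h)))
  -- The u-exponents of row `b` are N b plus offsets of at most `W`, and the N b are at least `G`
  -- apart. Inside a row the exponents of `X` fill `C` blocks of length B + W that stay disjoint in
  -- the field (`dist`), and their number fits into the gap (`terms≤`). Under these conditions the
  -- weights are linearly independent over polynomials of degree below `B`. The powers of `v` make
  -- all weights homogeneous of degree `Nn` in `u` and `v`.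
  module Family (Rn C B W G Nn : ℕ) (m o : Fin Rn -> Fin C -> ℕ) (N : Fin Rn -> ℕ)
   (o≤W : ∀ b a -> o b a ≤ W) (N≤ : ∀ b -> N b N.+ W ≤ Nn)
   (gap : ∀ b b' -> b ≢ b' -> N b N.+ G ≤ N b' ⊎ N b' N.+ G ≤ N b)
   (dist : ∀ b a a' i i' -> i < B N.+ W -> i' < B N.+ W -> cast (m b a N.+ i) ≡ cast (m b a' N.+ i') -> a ≡ a' × i ≡ i')
   (terms≤ : C · (B N.+ W) ≤ G) (0<G : 0 < G) where
   n : Fin Rn -> Fin C -> ℕ
   n b a = N b N.+ o b a
   n≤Nn : ∀ b a -> n b a ≤ Nn
   n≤Nn b a = ≤-trans (+-monoʳ-≤ (N b) (o≤W b a)) (N≤ b)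
   weight : Fin Rn -> Fin C -> Poly
   weight b a = X ^^ m b a ** u ^^ n b a ** v ^^ (Nn ∸ n b a)
   combination : (Fin Rn -> Fin C -> Poly) -> Poly
   combination A = ΣP (\ b -> ΣP (\ a -> A b a ** weight b a))
   module _ (A : Fin Rn -> Fin C -> Poly) (A-deg : ∀ b a -> Deg< B (A b a)) (A-zero : combination A ≈ []) where
    private
     row : Fin Rn -> Poly
     row b = ΣP (\ a -> A b a ** weight b a)
     -- The part of a coefficient that is left when u ^ N b and the power of `v` common to the row
     -- are taken out; it has at most B + W coefficients, so `core b` is sparse.
     Ã : Fin Rn -> Fin C -> Poly
     Ã b a = A b a ** (u ^^ o b a ** v ^^ (W ∸ o b a))
     Ã-deg : ∀ b a -> Deg< (B N.+ W) (Ã b a)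
     Ã-deg b a = Deg<-** {B} {W} {A b a} (A-deg b a)
      (Deg<-mono {suc (o b a · 1) N.+ (W ∸ o b a) · 1}
       (≤-eq (cong suc (trans (cong2 N._+_ (N.*-identityʳ (o b a)) (N.*-identityʳ (W ∸ o b a))) (m+[n∸m]≡n (o≤W b a)))))
       (Deg<-** {suc (o b a · 1)} {(W ∸ o b a) · 1} {u ^^ o b a} (Deg<-^^ {1} {u} (o b a) Deg<-linear) (Deg<-^^ {1} {v} (W ∸ o b a) Deg<-linear)))
     ts : Fin Rn -> List Term
     ts b = concat (tabulate (\ a -> monomials (take (B N.+ W) (Ã b a)) (m b a)))
     core : Fin Rn -> Poly
     core b = ΣP (\ a -> Ã b a ** X ^^ m b a)
     ts-sparse : ∀ b -> sparse (ts b) ≈ core b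
     ts-sparse b = ≈-trans (sparse-concat (\ a -> monomials (take (B N.+ W) (Ã b a)) (m b a)))
      (ΣP-cong (\ a -> ≈-trans (sparse-monomials (take (B N.+ W) (Ã b a)) (m b a)) (**-cong (take≈ _ (Ã b a) (Ã-deg b a)) ≈-refl)))
     take-length : ∀ b a -> length (take (B N.+ W) (Ã b a)) ≤ B N.+ W
     take-length b a = ≤-trans (≤-eq (List.length-take (B N.+ W) (Ã b a))) (m⊓n≤m _ _)
     concat-length : ∀ {C k} (f : Fin C -> List Term) -> (∀ a -> length (f a) ≤ k) -> length (concat (tabulate f)) ≤ C · k
     concat-length {zero} f l = z≤n
     concat-length {suc C} f l = ≤-trans (≤-eq (List.length-++ (f zero)))
      (+-mono-≤ (l zero) (concat-length (f ∘ suc) (l ∘ suc)))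
     ts-length : ∀ b -> length (ts b) ≤ G
     ts-length b = ≤-trans (concat-length _ (\ a -> ≤-trans (≤-eq (monomials-length (take (B N.+ W) (Ã b a)) (m b a))) (take-length b a))) terms≤
     open Sparse u z u-root z≢0
     monomials-distinct : ∀ f e -> (∀ i i' -> i < length f -> i' < length f -> cast (e N.+ i) ≡ cast (e N.+ i') -> i ≡ i') -> AllPairs Distinct (monomials f e)
     monomials-distinct [] e inj = []
     monomials-distinct (c ∷ f) e inj =
      All.map (\ { {c' , e'} (i , i< , refl) eq -> 0≢suc (inj 0 (suc i) (s≤s z≤n) (s≤s i<)
            (trans (cong cast (N.+-identityʳ e)) (trans eq (cong cast (sym (+-suc e i)))))) }) (monomials-exponents f (suc e))
      ∷ monomials-distinct f (suc e) (\ i i' i< i'< eq -> suc-injective (inj (suc i) (suc i') (s≤s i<) (s≤s i'<)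
            (trans (cong cast (+-suc e i)) (trans eq (cong cast (sym (+-suc e i')))))))
      where
      0≢suc : ∀ {k} -> 0 ≢ suc k
      0≢suc ()
     ts-distinct : ∀ b -> AllPairs Distinct (ts b)
     ts-distinct b = AllPairs.concat⁺
      (All.tabulate⁺ (\ a -> monomials-distinct _ (m b a) (\ i i' i< i'< eq ->
       snd (dist b a a i i' (<-≤-trans i< (take-length b a)) (<-≤-trans i'< (take-length b a)) eq))))
      (AllPairs.tabulate⁺ (\ {a} {a'} a≢a' -> All.map (\ { {c , e} (i , i< , refl) -> All.map (\ { {c' , e'} (i' , i'< , refl) eq ->
       a≢a' (fst (dist b a a' i i' (<-≤-trans i< (take-length b a)) (<-≤-trans i'< (take-length b a')) eq)) }) (monomials-exponents _ (m b a')) }) (monomials-exponents _ (m b a))))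
     row-core : ∀ b -> row b ≈ u ^^ N b ** (v ^^ (Nn ∸ (N b N.+ W)) ** core b)
     row-core b = begin
      row b ≈⟨ ΣP-cong term ⟩
      ΣP (\ a -> u ^^ N b ** v ^^ k ** (Ã b a ** X ^^ m b a)) ≈⟨ **-distribˡ-ΣP (u ^^ N b ** v ^^ k) (\ a -> Ã b a ** X ^^ m b a) ⟨
      u ^^ N b ** v ^^ k ** core b ≈⟨ **-assoc (u ^^ N b) (v ^^ k) (core b) ⟩
      u ^^ N b ** (v ^^ k ** core b) ∎
      where
      open ≈R
      k = Nn ∸ (N b N.+ W)
      exponent : ∀ a -> Nn ∸ n b a ≡ k N.+ (W ∸ o b a)
      exponent a = exponent-split (N b) (o≤W b a) (N≤ b)
      term : ∀ a -> A b a ** weight b a ≈ u ^^ N b ** v ^^ k ** (Ã b a ** X ^^ m b a)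
      term a = begin
       A b a ** (X ^^ m b a ** u ^^ n b a ** v ^^ (Nn ∸ n b a))
        ≈⟨ **-congʳ (A b a) (**-cong (**-congʳ (X ^^ m b a) (^^-homo-* u (N b) (o b a))) (≈-trans (≈-reflexive (cong (v ^^_) (exponent a))) (^^-homo-* v k (W ∸ o b a)))) ⟩
       A b a ** (X ^^ m b a ** (u ^^ N b ** u ^^ o b a) ** (v ^^ k ** v ^^ (W ∸ o b a)))
        ≈⟨ PS.solve 6 (\ A x u w v y -> A PS.:* (x PS.:* (u PS.:* w) PS.:* (v PS.:* y)) PS.:= u PS.:* v PS.:* (A PS.:* (w PS.:* y) PS.:* x)) ≈-refl
           (A b a) (X ^^ m b a) (u ^^ N b) (u ^^ o b a) (v ^^ k) (v ^^ (W ∸ o b a)) ⟩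
       u ^^ N b ** v ^^ k ** (Ã b a ** X ^^ m b a) ∎
       where
       ≈-reflexive : ∀ {f g} -> f ≡ g -> f ≈ g
       ≈-reflexive refl = ≈-refl
     A≈0⇒row≈0 : ∀ b -> (∀ a -> A b a ≈ []) -> row b ≈ []
     A≈0⇒row≈0 b z = ΣP-zero _ (\ a -> ≈-trans (**-cong (z a) ≈-refl) (**-zeroˡ _))
     high-row : ∀ k b -> k ≤ N b -> Σ Poly \ h -> row b ≈ u ^^ k ** h
     high-row k b le = u ^^ (N b ∸ k) ** r , ≈-trans (row-core b) (≈-trans (**-cong split ≈-refl) (**-assoc (u ^^ k) (u ^^ (N b ∸ k)) r))
      where
      r = v ^^ (Nn ∸ (N b N.+ W)) ** core b
      split : u ^^ N b ≈ u ^^ k ** u ^^ (N b ∸ k)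
      split = subst (\ t -> u ^^ t ≈ u ^^ k ** u ^^ (N b ∸ k)) (m+[n∸m]≡n le) (^^-homo-* u k (N b ∸ k))
     eval-v^ : ∀ k -> eval (v ^^ k) z ≢ 0#
     eval-v^ k e = ^-≢0 k vz≢0 (trans (sym (eval-^^ v k z)) e)
     -- Cancelling u ^ N b and the power of `v` leaves a `core` with at most `G` terms that is
     -- divisible by u ^ G; by `descartes` all its coefficients vanish.
     row-zero : ∀ b h -> row b ≈ u ^^ (N b N.+ G) ** h -> ∀ a -> A b a ≈ []
     row-zero b h e = finish (coprime-u G (v ^^ k) (core b) h (eval-v^ k) (cancel≈ (power-cancel u-cancel (N b)) cancelled))
      where
      k = Nn ∸ (N b N.+ W)
      cancelled : u ^^ N b ** (v ^^ k ** core b) ≈ u ^^ N b ** (u ^^ G ** h)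
      cancelled = ≈-trans (≈-sym (row-core b)) (≈-trans e (≈-trans (**-cong (^^-homo-* u (N b) G) ≈-refl) (**-assoc (u ^^ N b) (u ^^ G) h)))
      finish : (Σ Poly \ h' -> core b ≈ u ^^ G ** h') -> ∀ a -> A b a ≈ []
      finish (h' , e') a = power-cancel v-cancel (W ∸ o b a) (power-cancel u-cancel (o b a)
       (≈-trans (PS.solve 3 (\ u v A -> u PS.:* (v PS.:* A) PS.:= A PS.:* (u PS.:* v)) ≈-refl (u ^^ o b a) (v ^^ (W ∸ o b a)) (A b a))
        (≈-trans (≈-sym (take≈ _ (Ã b a) (Ã-deg b a))) (monomials-zero _ (m b a) (All.tabulate⁻ (All.concat⁻ zs) a)))))
       where
       L = length (ts b)
       G-split : u ^^ G ≈ u ^^ L ** u ^^ (G ∸ L)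
       G-split = subst (\ t -> u ^^ t ≈ u ^^ L ** u ^^ (G ∸ L)) (m+[n∸m]≡n (ts-length b)) (^^-homo-* u L (G ∸ L))
       zs : All (\ t -> fst t ≡ 0#) (ts b)
       zs = descartes L (ts b) (u ^^ (G ∸ L) ** h') refl (ts-distinct b)
        (≈-trans (ts-sparse b) (≈-trans e' (≈-trans (**-cong G-split ≈-refl) (**-assoc (u ^^ L) (u ^^ (G ∸ L)) h'))))
     -- The row with the smallest power of u is isolated modulo u^(N b + G).
     below : ∀ k b -> N b < k -> ∀ a -> A b a ≈ []
     below (suc k) b (s≤s Nb≤k) = row-zero b (⊝ fst rest) isolated
      where
      others : ∀ b' -> b' ≢ b -> Σ Poly \ h -> row b' ≈ u ^^ (N b N.+ G) ** h
      others b' ne = [ (\ le -> [] , ≈-trans (A≈0⇒row≈0 b' (below k b' (<-≤-trans (lower le) Nb≤k))) (≈-sym (**-zeroʳ _)))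
              , (\ le -> high-row (N b N.+ G) b' le) ]′ (gap b' b ne)
       where
       lower : N b' N.+ G ≤ N b -> N b' < N b
       lower le = <-≤-trans (≤-trans (≤-eq (sym (N.+-comm (N b') 1))) (+-monoʳ-≤ (N b') 0<G)) le
      rest = isolate-sum row b (u ^^ (N b N.+ G)) others
      isolated : row b ≈ u ^^ (N b N.+ G) ** ⊝ fst rest
      isolated = begin
       row b ≈⟨ PS.solve 3 (\ r g h -> r PS.:= (r PS.:+ g PS.:* h) PS.:+ g PS.:* (PS.:- h)) ≈-refl (row b) g (fst rest) ⟩
       (row b ⊕ g ** fst rest) ⊕ g ** ⊝ fst rest ≈⟨ ⊕-cong (≈-trans (≈-sym (snd rest)) A-zero) ≈-refl ⟩
       [] ⊕ g ** ⊝ fst rest ≈⟨ ⊕-identityˡ _ ⟩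
       g ** ⊝ fst rest ∎
       where
       open ≈R
       g = u ^^ (N b N.+ G)
    independent : ∀ b a -> A b a ≈ []
    independent b = below (suc (N b)) b ≤-refl
   -- At a target all weights agree, up to one common factor ω, with polynomials `ρ` of degree at
   -- most `J`. Vanishing to order `M` at all targets then follows from the vanishing of `M`
   -- polynomials of degree below B + 2 M + J, and `enough` compares these conditions with the Rn C
   -- B unknown coefficients.
   module _ (M J Mm : ℕ) (ρ : Fin Rn -> Fin C -> Poly) (ρ-deg : ∀ b a -> Deg< (suc J) (ρ b a)) (m≤Mm : ∀ b a -> m b a ≤ Mm)
    (char : ∀ i -> i < M -> cast (suc i) ≢ 0#) (enough : M · (B N.+ 2 · M N.+ J) < Rn · C · B) where
    Target : Carrier -> Set
    Target r = r ≢ 0# × eval u r ≢ 0# × eval v r ≢ 0# × Σ Carrier \ ω -> ∀ b a ->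
     r ^ m b a * eval u r ^ n b a * eval v r ^ (Nn ∸ n b a) ≡ ω * eval (ρ b a) r
    private
     q = X ** u ** v
     open Derivation q
     ∂lin : ∀ a b -> ∂ (a ∷ b ∷ []) ≈ q ** const b
     ∂lin a b = **-congʳ q (D-linear a b)
     Λ : Fin Rn -> Fin C -> Poly
     Λ b a = const (cast (m b a)) ** (u ** v) ⊕ const (cast (n b a)) ** (X ** v ** const u1) ⊕ const (cast (Nn ∸ n b a)) ** (X ** u ** const v1)
     ∂weight : ∀ b a -> ∂ (weight b a) ≈ Λ b a ** weight b a
     ∂weight b a = begin
      ∂ (x ** y ** w) ≈⟨ ∂-** (x ** y) w ⟩
      ∂ (x ** y) ** w ⊕ x ** y ** ∂ w ≈⟨ ⊕-cong (**-cong (∂-** x y) ≈-refl) ≈-refl ⟩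
      (∂ x ** y ⊕ x ** ∂ y) ** w ⊕ x ** y ** ∂ w ≈⟨ ⊕-cong (**-cong (⊕-cong (**-cong ∂x ≈-refl) (**-congʳ x ∂y)) ≈-refl) (**-congʳ (x ** y) ∂w) ⟩
      (lx ** x ** y ⊕ x ** (ly ** y)) ** w ⊕ x ** y ** (lw ** w)
       ≈⟨ PS.solve 6 (\ x y w lx ly lw -> (lx PS.:* x PS.:* y PS.:+ x PS.:* (ly PS.:* y)) PS.:* w PS.:+ x PS.:* y PS.:* (lw PS.:* w)
          PS.:= (lx PS.:+ ly PS.:+ lw) PS.:* (x PS.:* y PS.:* w)) ≈-refl x y w lx ly lw ⟩
      Λ b a ** weight b a ∎
      where
      open ≈R
      x = X ^^ m b a
      y = u ^^ n b a
      w = v ^^ (Nn ∸ n b a)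
      lx = const (cast (m b a)) ** (u ** v)
      ly = const (cast (n b a)) ** (X ** v ** const u1)
      lw = const (cast (Nn ∸ n b a)) ** (X ** u ** const v1)
      ∂x = ∂-^^ {X} {u ** v} (m b a) (≈-trans (∂lin 0# 1#) (PS.solve 3 (\ x u v -> x PS.:* u PS.:* v PS.:* PS.lit 1 PS.:= u PS.:* v PS.:* x) ≈-refl X u v))
      ∂y = ∂-^^ {u} {X ** v ** const u1} (n b a) (≈-trans (∂lin u0 u1) (PS.solve 4 (\ x u v c -> x PS.:* u PS.:* v PS.:* c PS.:= x PS.:* v PS.:* c PS.:* u) ≈-refl X u v (const u1)))
      ∂w = ∂-^^ {v} {X ** u ** const v1} (Nn ∸ n b a) (≈-trans (∂lin v0 v1) (PS.solve 4 (\ x u v c -> x PS.:* u PS.:* v PS.:* c PS.:= x PS.:* u PS.:* c PS.:* v) ≈-refl X u v (const v1)))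
     -- Since `∂` multiplies a weight by `Λ`, it acts on the coefficients alone and raises their
     -- degree by at most 2.
     step : Fin Rn -> Fin C -> Poly -> Poly
     step b a f = ∂ f ⊕ Λ b a ** f
     steps : ℕ -> Fin Rn -> Fin C -> Poly -> Poly
     steps zero b a f = f
     steps (suc k) b a f = steps k b a (step b a f)
     ∂-term : ∀ b a f -> ∂ (f ** weight b a) ≈ step b a f ** weight b a
     ∂-term b a f = ≈-trans (∂-** f (weight b a)) (≈-trans (⊕-cong ≈-refl (**-congʳ f (∂weight b a)))
      (PS.solve 4 (\ d w f l -> d PS.:* w PS.:+ f PS.:* (l PS.:* w) PS.:= (d PS.:+ l PS.:* f) PS.:* w) ≈-refl (∂ f) (weight b a) f (Λ b a)))
     iter-combination : ∀ k A -> iter k (combination A) ≈ combination (\ b a -> steps k b a (A b a))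
     iter-combination zero A = ≈-refl
     iter-combination (suc k) A = ≈-trans (iter-cong k (≈-trans (∂-ΣP q (\ b -> ΣP (\ a -> A b a ** weight b a)))
       (ΣP-cong (\ b -> ≈-trans (∂-ΣP q (\ a -> A b a ** weight b a)) (ΣP-cong (\ a -> ∂-term b a (A b a)))))))
      (iter-combination k (\ b a -> step b a (A b a)))
     step-cong : ∀ b a {f g} -> f ≈ g -> step b a f ≈ step b a g
     step-cong b a e = ⊕-cong (∂-cong e) (**-congʳ (Λ b a) e)
     steps-cong : ∀ k b a {f g} -> f ≈ g -> steps k b a f ≈ steps k b a g
     steps-cong zero b a e = e
     steps-cong (suc k) b a e = steps-cong k b a (step-cong b a e)
     steps-⊕ : ∀ k b a f g -> steps k b a (f ⊕ g) ≈ steps k b a f ⊕ steps k b a g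
     steps-⊕ zero b a f g = ≈-refl
     steps-⊕ (suc k) b a f g = ≈-trans (steps-cong k b a (≈-trans (⊕-cong (∂-⊕ f g) ≈-refl)
      (PS.solve 5 (\ d e l f g -> d PS.:+ e PS.:+ l PS.:* (f PS.:+ g) PS.:= (d PS.:+ l PS.:* f) PS.:+ (e PS.:+ l PS.:* g)) ≈-refl (∂ f) (∂ g) (Λ b a) f g)))
      (steps-⊕ k b a (step b a f) (step b a g))
     steps-const : ∀ k b a c f -> steps k b a (const c ** f) ≈ const c ** steps k b a f
     steps-const zero b a c f = ≈-refl
     steps-const (suc k) b a c f = ≈-trans (steps-cong k b a (≈-trans (⊕-cong (≈-trans (∂-** (const c) f)
       (⊕-cong (**-cong (≈-trans (**-congʳ q (D-const c)) (**-zeroʳ q)) ≈-refl) ≈-refl)) ≈-refl)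
      (PS.solve 4 (\ c d l f -> PS.lit 0 PS.:* f PS.:+ c PS.:* d PS.:+ l PS.:* (c PS.:* f) PS.:= c PS.:* (d PS.:+ l PS.:* f)) ≈-refl (const c) (∂ f) (Λ b a) f)))
      (steps-const k b a c (step b a f))
     Λ-deg : ∀ b a -> Deg< 3 (Λ b a)
     Λ-deg b a = Deg<-⊕ {3} {const (cast (m b a)) ** (u ** v) ⊕ const (cast (n b a)) ** (X ** v ** const u1)}
      (Deg<-⊕ {3} {const (cast (m b a)) ** (u ** v)} (Deg<-** {1} {2} {const (cast (m b a))} Deg<-const (Deg<-** {2} {1} {u} {v} Deg<-linear Deg<-linear))
       (Deg<-** {1} {2} {const (cast (n b a))} Deg<-const (Deg<-** {3} {0} {X ** v} {const u1} (Deg<-** {2} {1} {X} {v} Deg<-linear Deg<-linear) Deg<-const)))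
      (Deg<-** {1} {2} {const (cast (Nn ∸ n b a))} Deg<-const (Deg<-** {3} {0} {X ** u} {const v1} (Deg<-** {2} {1} {X} {u} Deg<-linear Deg<-linear) Deg<-const))
     q-deg : Deg< 4 q
     q-deg = Deg<-** {3} {1} {X ** u} {v} (Deg<-** {2} {1} {X} {u} Deg<-linear Deg<-linear) Deg<-linear
     step-deg : ∀ k b a f -> Deg< k f -> Deg< (k N.+ 2) (step b a f)
     step-deg k b a f d = Deg<-⊕ {k N.+ 2} {∂ f} {Λ b a ** f} (∂-deg k d) (Deg<-cong (**-comm f (Λ b a)) (Deg<-** {k} {2} {f} d (Λ-deg b a)))
      where
      ∂-deg : ∀ k -> Deg< k f -> Deg< (k N.+ 2) (∂ f)
      ∂-deg zero d = deg \ i le -> at (≈-trans (**-congʳ q (≈-trans (D-cong (Deg<0⇒≈0 d)) D-[])) (**-zeroʳ q)) i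
      ∂-deg (suc k) d = Deg<-mono {k N.+ 3} (≤-eq (+-suc k 2)) (Deg<-cong (**-comm (D f) q) (Deg<-** {k} {3} {D f} {q} (Deg<-D {k} {f} d) q-deg))
     steps-deg : ∀ j k b a f -> Deg< k f -> Deg< (k N.+ 2 · j) (steps j b a f)
     steps-deg zero k b a f d = Deg<-mono (m≤m+n k _) d
     steps-deg (suc j) k b a f d = Deg<-mono (≤-eq (calc k j)) (steps-deg j (k N.+ 2) b a (step b a f) (step-deg k b a f d))
      where
      calc : ∀ k j -> k N.+ 2 N.+ 2 · j ≡ k N.+ 2 · suc j
      calc = solve-∀
     unknowns = Rn · C · B
     bound = B N.+ 2 · M N.+ J
     coeffs : (Fin unknowns -> Carrier) -> Fin Rn -> Fin C -> Poly
     coeffs x b a = vecPoly (\ i -> x (combine (combine b a) i))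
     -- The k-th derivative with every weight replaced by its reduced value. Requiring this
     -- polynomial to be zero is independent of the individual targets and settles all of them at
     -- once.
     condition : ℕ -> (Fin unknowns -> Carrier) -> Poly
     condition k x = ΣP (\ b -> ΣP (\ a -> steps k b a (coeffs x b a) ** ρ b a))
     condition-deg : ∀ k x -> k < M -> Deg< bound (condition k x)
     condition-deg k x k<M = Deg<-ΣP _ (\ b -> Deg<-ΣP _ (\ a -> Deg<-mono
      (+-monoˡ-≤ J (+-monoʳ-≤ B (*-monoʳ-≤ 2 (<⇒≤ k<M))))
      (Deg<-** {B N.+ 2 · k} {J} {steps k b a (coeffs x b a)} (steps-deg k B b a _ (Deg<-vecPoly (\ i -> x (combine (combine b a) i)))) (ρ-deg b a))))
     φ : Fin (M · bound) -> (Fin unknowns -> Carrier) -> Carrier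
     φ e x = coeff (condition (toℕ (fst (remQuot {M} bound e))) x) (toℕ (snd (remQuot {M} bound e)))
     condition-cong : ∀ k {x y} -> (∀ i -> x i ≡ y i) -> condition k x ≈ condition k y
     condition-cong k e = ΣP-cong (\ b -> ΣP-cong (\ a -> **-cong (steps-cong k b a (vecPoly-cong (\ i -> e _))) ≈-refl))
     condition-+ : ∀ k x y -> condition k (\ i -> x i + y i) ≈ condition k x ⊕ condition k y
     condition-+ k x y = ≈-trans (ΣP-cong (\ b -> ≈-trans (ΣP-cong (\ a -> ≈-trans
       (**-cong (≈-trans (steps-cong k b a (vecPoly-+ (\ i -> x (combine (combine b a) i)) (\ i -> y (combine (combine b a) i)))) (steps-⊕ k b a _ _)) ≈-refl)
       (**-distribʳ (ρ b a) (steps k b a (coeffs x b a)) (steps k b a (coeffs y b a)))))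
      (ΣP-⊕ (\ a -> steps k b a (coeffs x b a) ** ρ b a) (\ a -> steps k b a (coeffs y b a) ** ρ b a))))
      (ΣP-⊕ (\ b -> ΣP (\ a -> steps k b a (coeffs x b a) ** ρ b a)) (\ b -> ΣP (\ a -> steps k b a (coeffs y b a) ** ρ b a)))
     condition-* : ∀ k c x -> condition k (\ i -> c * x i) ≈ const c ** condition k x
     condition-* k c x = ≈-trans (ΣP-cong (\ b -> ≈-trans (ΣP-cong (\ a -> ≈-trans
       (**-cong (≈-trans (steps-cong k b a (vecPoly-* c (\ i -> x (combine (combine b a) i)))) (steps-const k b a c _)) ≈-refl)
       (**-assoc (const c) (steps k b a (coeffs x b a)) (ρ b a))))
      (≈-sym (**-distribˡ-ΣP (const c) (\ a -> steps k b a (coeffs x b a) ** ρ b a)))))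
      (≈-sym (**-distribˡ-ΣP (const c) (\ b -> ΣP (\ a -> steps k b a (coeffs x b a) ** ρ b a))))
     φ-linear : ∀ e -> Linear (φ e)
     φ-linear e .ext h = at (condition-cong (toℕ (fst (remQuot {M} bound e))) h) _
     φ-linear e .add x y = trans (at (condition-+ k x y) i) (coeff-⊕ (condition k x) (condition k y) i)
      where
      k = toℕ (fst (remQuot {M} bound e))
      i = toℕ (snd (remQuot {M} bound e))
     φ-linear e .hom c x = trans (at (≈-trans (condition-* k c x) (const-** c _)) i) (coeff-scale c (condition k x) i)
      where
      k = toℕ (fst (remQuot {M} bound e))
      i = toℕ (snd (remQuot {M} bound e))
     solution = kernel enough φ φ-linear
     x = fst solution
     A = coeffs x
     F = combination A
     condition-zero : ∀ k -> k < M -> condition k x ≈ []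
     condition-zero k k<M = mk coeff0
      where
      coeff0 : ∀ i -> coeff (condition k x) i ≡ 0#
      coeff0 i with i N.<? bound
      ... | no i≮ = top (condition-deg k x k<M) i (≮⇒≥ i≮)
      ... | yes i< = trans (sym (cong2 (\ s t -> coeff (condition s x) t)
         (trans (cong (toℕ ∘ fst) rq) (Fin.toℕ-fromℕ< k<M)) (trans (cong (toℕ ∘ snd) rq) (Fin.toℕ-fromℕ< i<))))
         (snd (snd solution) (combine (fromℕ< k<M) (fromℕ< i<)))
       where
       rq = Fin.remQuot-combine {M} {bound} (fromℕ< k<M) (fromℕ< i<)
     F-deg : Deg< (B N.+ (Mm N.+ Nn)) F
     F-deg = Deg<-ΣP _ (\ b -> Deg<-ΣP _ (\ a -> Deg<-** {B} {Mm N.+ Nn} {A b a} (Deg<-vecPoly (\ i -> x (combine (combine b a) i))) (weight-deg b a)))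
      where
      weight-deg : ∀ b a -> Deg< (suc (Mm N.+ Nn)) (weight b a)
      weight-deg b a = Deg<-mono (s≤s (≤-trans (≤-eq sizes) (+-monoˡ-≤ Nn (m≤Mm b a))))
       (Deg<-** {suc (m b a · 1 N.+ n b a · 1)} {(Nn ∸ n b a) · 1} {X ^^ m b a ** u ^^ n b a}
        (Deg<-** {suc (m b a · 1)} {n b a · 1} {X ^^ m b a} (Deg<-^^ {1} {X} (m b a) Deg<-linear) (Deg<-^^ {1} {u} (n b a) Deg<-linear))
        (Deg<-^^ {1} {v} (Nn ∸ n b a) Deg<-linear))
       where
       sizes : m b a · 1 N.+ n b a · 1 N.+ (Nn ∸ n b a) · 1 ≡ m b a N.+ Nn
       sizes = trans (cong2 N._+_ (cong2 N._+_ (N.*-identityʳ (m b a)) (N.*-identityʳ (n b a))) (N.*-identityʳ (Nn ∸ n b a)))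
        (trans (N.+-assoc (m b a) _ _) (cong (m b a N.+_) (m+[n∸m]≡n (n≤Nn b a))))
     F≉0 : ¬ (F ≈ [])
     F≉0 e = snd nz (trans (sym (cong x index)) (trans (sym (coeff-vecPoly (\ i -> x (combine (combine b a) i)) (snd ri)))
      (at (independent A (\ b a -> Deg<-vecPoly (\ i -> x (combine (combine b a) i))) e b a) (toℕ (snd ri)))))
      where
      nz = fst (snd solution)
      ri = remQuot {Rn · C} B (fst nz)
      rba = remQuot {Rn} C (fst ri)
      b = fst rba
      a = snd rba
      index : combine (combine b a) (snd ri) ≡ fst nz
      index = trans (cong (\ t -> combine t (snd ri)) (Fin.combine-remQuot {Rn} C (fst ri))) (Fin.combine-remQuot {Rn · C} B (fst nz))
     eval-weight : ∀ b a r -> eval (weight b a) r ≡ r ^ m b a * eval u r ^ n b a * eval v r ^ (Nn ∸ n b a)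
     eval-weight b a r = trans (eval-** (X ^^ m b a ** u ^^ n b a) (v ^^ (Nn ∸ n b a)) r) (cong2 _*_
      (trans (eval-** (X ^^ m b a) (u ^^ n b a) r) (cong2 _*_ (trans (eval-^^ X (m b a) r) (cong (_^ m b a) (eval-X r))) (eval-^^ u (n b a) r)))
      (eval-^^ v (Nn ∸ n b a) r))
     target-order : ∀ r -> Target r -> ZeroOrder F M r
     target-order r (r≢0 , u≢0 , v≢0 , ω , W≡) = Multiplicity.vanishing⇒ZeroOrder q r q≢0 M F char vanish
      where
      q≢0 : eval q r ≢ 0#
      q≢0 e = *-≢0 (*-≢0 r≢0 u≢0) v≢0 (trans (sym (trans (eval-** (X ** u) v r) (cong (_* eval v r) (trans (eval-** X u r) (cong (_* eval u r) (eval-X r)))))) e)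
      vanish : ∀ k -> k < M -> eval (iter k F) r ≡ 0#
      vanish k k<M = trans (eval-cong r (iter-combination k A)) (trans (eval-ΣP (\ b -> ΣP (\ a -> steps k b a (A b a) ** weight b a)) r ω (\ b -> ΣP (\ a -> steps k b a (A b a) ** ρ b a)) (\ b ->
        eval-ΣP (\ a -> steps k b a (A b a) ** weight b a) r ω (\ a -> steps k b a (A b a) ** ρ b a) (\ a -> begin
         eval (steps k b a (A b a) ** weight b a) r ≡⟨ eval-** (steps k b a (A b a)) (weight b a) r ⟩
         eval (steps k b a (A b a)) r * eval (weight b a) r ≡⟨ cong (eval (steps k b a (A b a)) r *_) (trans (eval-weight b a r) (W≡ b a)) ⟩
         eval (steps k b a (A b a)) r * (ω * eval (ρ b a) r) ≡⟨ solve 3 (\ s w t -> s :* (w :* t) := w :* (s :* t)) refl _ ω _ ⟩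
         ω * (eval (steps k b a (A b a)) r * eval (ρ b a) r) ≡⟨ cong (ω *_) (eval-** (steps k b a (A b a)) (ρ b a) r) ⟨
         ω * eval (steps k b a (A b a) ** ρ b a) r ∎)))
       (trans (cong (ω *_) (eval-≈0 r (condition-zero k k<M))) (zeroʳ ω)))
       where open ≡R
    -- `F` is nonzero by independence and vanishes to order `M` at every target, so its degree
    -- bounds their number.
    stepanov-bound : ∀ rs -> Unique rs -> All Target rs -> length rs · M < B N.+ (Mm N.+ Nn)
    stepanov-bound rs uniq targets = ≰⇒> \ le -> F≉0 (zero-count M F rs uniq (All.map (\ {r} -> target-order r) targets) F-deg le)

-- Inclusion-exclusion over primes with an error term.

module Sieve where
 open import Data.Nat using (_+_; _*_; _^_)
 open import Data.Nat.Properties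
 open import Data.Nat.Divisibility using (_∣_; divides; ∣-trans; n∣m*n; m∣m*n)
 open import Data.Nat.Primality using (Prime; prime⇒nonZero; prime⇒nonTrivial; productOfPrimes≢0)
 open import Data.Nat.ListAction using (product)

 open Count

 -- P w x stands for "the order of x divides w"; the estimate compares the number of such x with a multiple of w.
 module InclusionExclusion {X : Set} (xs : List X) (P : ℕ -> X -> Set) (P? : ∀ w x -> Dec (P w x)) (n c J Err : ℕ)
  (intersect : ∀ q R w x -> Prime q -> R * (q * w) ≡ n -> ¬ (q ∣ R) -> P (q * w) x -> P (R * w) x -> P w x)
  (multiple : ∀ k w x -> P w x -> P (k * w) x)
  (estimate : ∀ R w -> R * w ≡ n -> 2 ∣ w -> c * length (filter (P? w) xs) ≤ J * w + Err × J * w ≤ c * length (filter (P? w) xs) + Err) where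
  Avoids : List ℕ -> X -> Set
  Avoids qs x = All (\ q -> ∀ w -> q * w ≡ n -> ¬ P w x) qs
  private
   avoids? : ∀ qs x -> All Prime qs -> Dec (Avoids qs x)
   avoids? [] x [] = yes []
   avoids? (q ∷ qs) x (pq ∷ ps) with avoids? qs x ps
   ... | no ¬a = no \ { (_ ∷ a) -> ¬a a }
   ... | yes a with n N.≟ q * (n N./ q)
    where instance _ = prime⇒nonZero pq
   ...   | no ne = yes ((\ w e _ -> ne (exact w e)) ∷ a)
    where
    instance _ = prime⇒nonZero pq
    open import Data.Nat.DivMod using (m*n/n≡m)
    exact : ∀ w -> q * w ≡ n -> n ≡ q * (n N./ q)
    exact w refl = cong (q *_) (sym (trans (cong (N._/ q) (*-comm q w)) (m*n/n≡m w q)))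
   ...   | yes e with P? (n N./ q) x
    where instance _ = prime⇒nonZero pq
   ...     | yes px = no \ { (f ∷ _) -> f _ (sym e) px }
   ...     | no ¬px = yes ((\ w e' pw -> ¬px (subst (\ t -> P t x) (*-cancelˡ-≡ w _ q {{prime⇒nonZero pq}} (trans e' e)) pw)) ∷ a)
   A? : ∀ qs -> All Prime qs -> ∀ w x -> Dec (P w x × Avoids qs x)
   A? qs ps w x = P? w x ×-dec avoids? qs x ps
  count : ∀ qs -> All Prime qs -> ℕ -> ℕ
  count qs ps w = length (filter (A? qs ps w) xs)
  survivors : ∀ qs -> All Prime qs -> ℕ -> List X
  survivors qs ps w = filter (A? qs ps w) xs
  survivor-sound : ∀ qs ps w x -> x ∈ survivors qs ps w -> x ∈ xs × P w x × Avoids qs x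
  survivor-sound qs ps w x x∈ = ∈-filter⁻ (A? qs ps w) {xs = xs} x∈
   where open import Data.List.Membership.Propositional.Properties using (∈-filter⁻)
  private
   -- Among the x with P (q w), split by P (n / q), where n / q = R w. As q does not divide R, both
   -- conditions together mean P w; the remaining x are those that avoid q.
   recursion : ∀ q qs pq ps R w -> R * (q * w) ≡ n -> ¬ (q ∣ R) -> count (q ∷ qs) (pq ∷ ps) (q * w) + count qs ps w ≡ count qs ps (q * w)
   recursion q qs pq ps R w e q∤R = trans (+-comm (count (q ∷ qs) (pq ∷ ps) (q * w)) _) (trans (cong2 _+_ into out) (filter-split split? ys))
    where
    ys = filter (A? qs ps (q * w)) xs
    qRw : q * (R * w) ≡ n
    qRw = trans (calc q R w) e
     where
     calc : ∀ q R w -> q * (R * w) ≡ R * (q * w)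
     calc = solve-∀
    split? : ∀ x -> Dec (P (R * w) x)
    split? x = P? (R * w) x
    open import Data.List.Membership.Propositional.Properties using (∈-filter⁻)
    filter-∘ : ∀ {Q S T : X -> Set} (Q? : ∀ x -> Dec (Q x)) (S? : ∀ x -> Dec (S x)) (T? : ∀ x -> Dec (T x)) zs ->
     (∀ x -> T x -> S x × Q x) -> (∀ x -> S x -> Q x -> T x) -> length (filter T? zs) ≡ length (filter Q? (filter S? zs))
    filter-∘ Q? S? T? [] to from = refl
    filter-∘ Q? S? T? (z ∷ zs) to from with S? z
    filter-∘ Q? S? T? (z ∷ zs) to from | yes s with Q? z | T? z
    ... | yes _ | yes _ = cong suc (filter-∘ Q? S? T? zs to from)
    ... | no ¬q | no _ = filter-∘ Q? S? T? zs to from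
    ... | yes q | no ¬t = ⊥-elim (¬t (from z s q))
    ... | no ¬q | yes t = ⊥-elim (¬q (snd (to z t)))
    filter-∘ Q? S? T? (z ∷ zs) to from | no ¬s with T? z
    ... | yes t = ⊥-elim (¬s (fst (to z t)))
    ... | no _ = filter-∘ Q? S? T? zs to from
    into : count qs ps w ≡ length (filter split? ys)
    into = filter-∘ split? (A? qs ps (q * w)) (A? qs ps w) xs
     (\ x -> \ { (pw , av) -> (multiple q w x pw , av) , multiple R w x pw })
     (\ x -> \ { (pqw , av) pRw -> intersect q R w x pq e q∤R pqw pRw , av })
    out : count (q ∷ qs) (pq ∷ ps) (q * w) ≡ length (filter (\ x -> ¬? (split? x)) ys)
    out = filter-∘ (\ x -> ¬? (split? x)) (A? qs ps (q * w)) (A? (q ∷ qs) (pq ∷ ps) (q * w)) xs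
     (\ x -> \ { (pqw , f ∷ av) -> (pqw , av) , f (R * w) qRw })
     (\ x -> \ { (pqw , av) ¬pRw -> pqw , (\ w' e' pw' -> ¬pRw (subst (\ t -> P t x) (*-cancelˡ-≡ w' (R * w) q {{prime⇒nonZero pq}} (trans e' (sym qRw))) pw')) ∷ av })
  totient : List ℕ -> ℕ
  totient qs = product (map (\ q -> q ∸ 1) qs)
  -- μ is the exact count w ∏ (1 - 1/q) in the model case.
  sieve : ∀ qs (ps : All Prime qs) -> Unique qs -> ∀ R w -> R * w ≡ n -> 2 * product qs ∣ w -> All (\ q -> ¬ (q ∣ R)) qs ->
   Σ ℕ \ μ -> μ * product qs ≡ w * totient qs × c * count qs ps w ≤ J * μ + 2 ^ length qs * Err × J * μ ≤ c * count qs ps w + 2 ^ length qs * Err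
  sieve [] [] u R w e 2∣w nd = w , refl ,
   subst (\ t -> c * t ≤ J * w + 1 * Err) (sym count≡) (≤-trans (fst est) (≤-eq (cong (J * w +_) (sym (*-identityˡ Err))))) ,
   subst (\ t -> J * w ≤ c * t + 1 * Err) (sym count≡) (≤-trans (snd est) (≤-eq (cong (c * length (filter (P? w) xs) +_) (sym (*-identityˡ Err)))))
   where
   est = estimate R w e (∣-trans (m∣m*n 1) 2∣w)
   count≡ : count [] [] w ≡ length (filter (P? w) xs)
   count≡ = filter-cong (A? [] [] w) (P? w) xs (\ x _ -> fst) (\ x _ p -> p , [])
  -- Used at `w` and at `w' = w / q`, so the error doubles with each prime. The 2 in the
  -- divisibility hypothesis keeps every modulus that is reached even, as `estimate` demands.
  sieve (q ∷ qs) (pq ∷ ps) (nq ∷ u) R w e (divides k w≡) (q∤R ∷ nd) = combine (sieve qs ps u R w e ∣w nd) (sieve qs ps u (R * q) w' e″ ∣w' nd')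
   where
   Π = product qs
   w' = k * (2 * Π)
   w≡qw' : w ≡ q * w'
   w≡qw' = trans w≡ (calc k q Π)
    where
    calc : ∀ k q Π -> k * (2 * (q * Π)) ≡ q * (k * (2 * Π))
    calc = solve-∀
   ∣w' : 2 * Π ∣ w'
   ∣w' = n∣m*n k
   ∣w : 2 * Π ∣ w
   ∣w = ∣-trans ∣w' (divides q w≡qw')
   e' : R * (q * w') ≡ n
   e' = trans (cong (R *_) (sym w≡qw')) e
   e″ : R * q * w' ≡ n
   e″ = trans (*-assoc R q w') e'
   open import Data.Nat.Primality using (euclidsLemma)
   nd' : All (\ q' -> ¬ (q' ∣ R * q)) qs
   nd' = All.zipWith (\ { {q'} ((ne , q'∤R) , pq') d -> case ne q'∤R pq' d }) (All.zip (nq , nd) , ps)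
    where
    open import Data.Nat.Primality using (prime⇒irreducible)
    prime-∣ : ∀ {q q'} -> Prime q -> Prime q' -> q' ∣ q -> q ≡ q'
    prime-∣ {q} {q'} pq pq' d with prime⇒irreducible pq d
    ... | inl refl = ⊥-elim (<-irrefl refl (N.nonTrivial⇒n>1 1 {{prime⇒nonTrivial pq'}}))
    ... | inr eq = sym eq
    case : ∀ {q'} -> q ≢ q' -> ¬ (q' ∣ R) -> Prime q' -> ¬ (q' ∣ R * q)
    case {q'} ne q'∤R pq' d = [ q'∤R , (\ d' -> ne (prime-∣ pq pq' d')) ]′ (euclidsLemma R q pq' d)
   E = 2 ^ length qs * Err
   rec : count (q ∷ qs) (pq ∷ ps) w + count qs ps w' ≡ count qs ps w
   rec = subst (\ t -> count (q ∷ qs) (pq ∷ ps) t + count qs ps w' ≡ count qs ps t) (sym w≡qw') (recursion q qs pq ps R w' e' q∤R)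
   combine : (Σ ℕ \ μ -> μ * Π ≡ w * totient qs × c * count qs ps w ≤ J * μ + E × J * μ ≤ c * count qs ps w + E) ->
    (Σ ℕ \ μ -> μ * Π ≡ w' * totient qs × c * count qs ps w' ≤ J * μ + E × J * μ ≤ c * count qs ps w' + E) ->
    Σ ℕ \ μ -> μ * (q * Π) ≡ w * ((q ∸ 1) * totient qs) × c * count (q ∷ qs) (pq ∷ ps) w ≤ J * μ + 2 * 2 ^ length qs * Err × J * μ ≤ c * count (q ∷ qs) (pq ∷ ps) w + 2 * 2 ^ length qs * Err
   combine (μ1 , m1 , u1 , l1) (μ2 , m2 , u2 , l2) = μ , exact , upper , lower
    where
    Φ = totient qs
    a = count (q ∷ qs) (pq ∷ ps) w
    a1 = count qs ps w
    a2 = count qs ps w'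
    instance
     q≢0 = prime⇒nonZero pq
     Π≢0 : N.NonZero Π
     Π≢0 = productOfPrimes≢0 ps
    μ1≡qμ2 : μ1 ≡ q * μ2
    μ1≡qμ2 = *-cancelʳ-≡ μ1 (q * μ2) Π (trans m1 (trans (cong (_* Φ) w≡qw') (trans (*-assoc q w' Φ) (trans (cong (q *_) (sym m2)) (sym (*-assoc q μ2 Π))))))
    μ = (q ∸ 1) * μ2
    q≡ : suc (q ∸ 1) ≡ q
    q≡ = m+[n∸m]≡n (N.>-nonZero⁻¹ q)
    μ+μ2 : μ + μ2 ≡ μ1
    μ+μ2 = trans (+-comm μ μ2) (trans (cong (_* μ2) q≡) (sym μ1≡qμ2))
    exact : μ * (q * Π) ≡ w * ((q ∸ 1) * Φ)
    exact = trans (calc1 (q ∸ 1) μ2 q Π) (trans (cong (\ t -> (q ∸ 1) * q * t) m2) (trans (calc2 (q ∸ 1) q w' Φ) (cong (_* ((q ∸ 1) * Φ)) (sym w≡qw'))))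
     where
     calc1 : ∀ r m q Π -> r * m * (q * Π) ≡ r * q * (m * Π)
     calc1 = solve-∀
     calc2 : ∀ r q w Φ -> r * q * (w * Φ) ≡ q * w * (r * Φ)
     calc2 = solve-∀
    double : ∀ x -> x + E + E ≡ x + 2 * 2 ^ length qs * Err
    double x = calc x (2 ^ length qs) Err
     where
     calc : ∀ x t e -> x + t * e + t * e ≡ x + 2 * t * e
     calc = solve-∀
    upper : c * a ≤ J * μ + 2 * 2 ^ length qs * Err
    upper = +-cancelʳ-≤ (c * a2) (c * a) (J * μ + 2 * 2 ^ length qs * Err) (begin
     c * a + c * a2 ≡⟨ *-distribˡ-+ c a a2 ⟨
     c * (a + a2) ≡⟨ cong (c *_) rec ⟩
     c * a1 ≤⟨ u1 ⟩
     J * μ1 + E ≡⟨ cong (\ t -> J * t + E) μ+μ2 ⟨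
     J * (μ + μ2) + E ≡⟨ calc J μ μ2 E ⟩
     J * μ + E + J * μ2 ≤⟨ +-monoʳ-≤ (J * μ + E) l2 ⟩
     J * μ + E + (c * a2 + E) ≡⟨ calc' (J * μ) E (c * a2) ⟩
     J * μ + E + E + c * a2 ≡⟨ cong (_+ c * a2) (double (J * μ)) ⟩
     J * μ + 2 * 2 ^ length qs * Err + c * a2 ∎)
     where
     open ≤R
     calc : ∀ J m n E -> J * (m + n) + E ≡ J * m + E + J * n
     calc = solve-∀
     calc' : ∀ x E y -> x + E + (y + E) ≡ x + E + E + y
     calc' = solve-∀
    lower : J * μ ≤ c * a + 2 * 2 ^ length qs * Err
    lower = +-cancelʳ-≤ (J * μ2) (J * μ) (c * a + 2 * 2 ^ length qs * Err) (begin
     J * μ + J * μ2 ≡⟨ *-distribˡ-+ J μ μ2 ⟨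
     J * (μ + μ2) ≡⟨ cong (J *_) μ+μ2 ⟩
     J * μ1 ≤⟨ l1 ⟩
     c * a1 + E ≡⟨ cong (\ t -> c * t + E) rec ⟨
     c * (a + a2) + E ≡⟨ calc c a a2 E ⟩
     c * a + E + c * a2 ≤⟨ +-monoʳ-≤ (c * a + E) u2 ⟩
     c * a + E + (J * μ2 + E) ≡⟨ calc' (c * a) E (J * μ2) ⟩
     c * a + E + E + J * μ2 ≡⟨ cong (_+ J * μ2) (double (c * a)) ⟩
     c * a + 2 * 2 ^ length qs * Err + J * μ2 ∎)
     where
     open ≤R
     calc : ∀ J m n E -> J * (m + n) + E ≡ J * m + E + J * n
     calc = solve-∀
     calc' : ∀ x E y -> x + E + (y + E) ≡ x + E + E + y
     calc' = solve-∀
  -- The crude estimate 1 - 1/q ≥ 1/2 for each prime; the loss is harmless because the number of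
  -- primes will be tiny.
  totient-bound : ∀ qs -> All Prime qs -> product qs ≤ 2 ^ length qs * totient qs
  totient-bound [] [] = ≤-refl
  totient-bound (q ∷ qs) (pq ∷ ps) = ≤-trans (*-mono-≤ q≤ (totient-bound qs ps)) (≤-eq (calc (q ∸ 1) (2 ^ length qs) (totient qs)))
   where
   1<q : 1 < q
   1<q = N.nonTrivial⇒n>1 q {{prime⇒nonTrivial pq}}
   q≤ : q ≤ 2 * (q ∸ 1)
   q≤ = ≤-trans (≤-eq (sym (m+[n∸m]≡n (<⇒≤ 1<q)))) (≤-trans (+-monoˡ-≤ (q ∸ 1) (m<n⇒0<n∸m 1<q)) (≤-eq (cong (q ∸ 1 +_) (sym (+-identityʳ (q ∸ 1))))))
   calc : ∀ r t f -> 2 * r * (t * f) ≡ 2 * t * (r * f)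
   calc = solve-∀
  sieve-lower : ∀ qs (ps : All Prime qs) -> Unique qs -> 2 * product qs ∣ n -> J * n ≤ 2 ^ length qs * (c * count qs ps n + 2 ^ length qs * Err)
  sieve-lower qs ps u d = *-cancelʳ-≤ (J * n) _ (product qs) (begin
   J * n * product qs ≤⟨ *-monoʳ-≤ (J * n) (totient-bound qs ps) ⟩
   J * n * (2 ^ length qs * totient qs) ≡⟨ calc1 J n (2 ^ length qs) (totient qs) ⟩
   2 ^ length qs * (J * (n * totient qs)) ≡⟨ cong (\ t -> 2 ^ length qs * (J * t)) (fst (snd s)) ⟨
   2 ^ length qs * (J * (fst s * product qs)) ≡⟨ calc2 (2 ^ length qs) J (fst s) (product qs) ⟩
   2 ^ length qs * (J * fst s) * product qs ≤⟨ *-monoˡ-≤ (product qs) (*-monoʳ-≤ (2 ^ length qs) (snd (snd (snd s)))) ⟩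
   2 ^ length qs * (c * count qs ps n + 2 ^ length qs * Err) * product qs ∎)
   where
   open ≤R
   open import Data.Nat.Primality using (productOfPrimes≢0)
   open import Data.Nat.Divisibility using (∣1⇒≡1)
   instance _ = productOfPrimes≢0 ps
   s = sieve qs ps u 1 n (*-identityˡ n) d (All.map (\ {q} pq q∣1 -> <-irrefl (sym (∣1⇒≡1 q∣1)) (N.nonTrivial⇒n>1 q {{prime⇒nonTrivial pq}})) ps)
   calc1 : ∀ J n t f -> J * n * (t * f) ≡ t * (J * (n * f))
   calc1 = solve-∀
   calc2 : ∀ t J m π -> t * (J * (m * π)) ≡ t * (J * m) * π
   calc2 = solve-∀

-- The field with p elements.

module Fp where
 open import Data.Nat using (NonZero; _%_)
 open import Data.Nat.DivMod using (_mod_; m%n<n; m<n⇒m%n≡m; %-distribˡ-+; %-distribˡ-*; n%n≡0)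
 open import Data.Nat.Divisibility using (_∣_; ∣⇒≤; m%n≡0⇒n∣m; n∣m⇒m%n≡0)
 open import Data.Nat.Primality using (Prime; prime⇒nonZero; euclidsLemma; prime⇒nonTrivial)
 open import Data.Fin using (Fin; zero; suc; toℕ; punchOut)
 open import Function.Definitions using (Injective)
 open import Algebra.Structures using (IsCommutativeRing)

 injective⇒surjective : ∀ {n} (f : Fin n -> Fin n) -> Injective _≡_ _≡_ f -> ∀ y -> Σ (Fin n) \ x -> f x ≡ y
 injective⇒surjective {suc n} f inj y with Fin.any? (\ x -> f x Fin.≟ y)
 ... | yes w = w
 ... | no none = ⊥-elim (1+n≰n (Fin.injective⇒≤ {f = \ x -> punchOut (ne x)} \ {x} {x'} e -> inj (Fin.punchOut-injective (ne x) (ne x') e)))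
  where
  ne : ∀ x -> y ≢ f x
  ne x e = none (x , sym e)

 module Mod (p : ℕ) .{{_ : NonZero p}} where
  π : ℕ -> Fin p
  π m = m mod p
  toℕ-π : ∀ m -> toℕ (π m) ≡ m % p
  toℕ-π m = Fin.toℕ-fromℕ< (m%n<n m p)
  π-cong : ∀ {m n} -> m % p ≡ n % p -> π m ≡ π n
  π-cong {m} {n} e = Fin.toℕ-injective (trans (toℕ-π m) (trans e (sym (toℕ-π n))))
  π⁻¹ : ∀ {m n} -> π m ≡ π n -> m % p ≡ n % p
  π⁻¹ {m} {n} e = trans (sym (toℕ-π m)) (trans (cong toℕ e) (toℕ-π n))
  π-toℕ : ∀ a -> π (toℕ a) ≡ a
  π-toℕ a = Fin.toℕ-injective (trans (toℕ-π (toℕ a)) (m<n⇒m%n≡m (Fin.toℕ<n a)))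
  infixl 6 _+ₚ_
  infixl 7 _*ₚ_
  _+ₚ_ _*ₚ_ : Fin p -> Fin p -> Fin p
  a +ₚ b = π (toℕ a N.+ toℕ b)
  a *ₚ b = π (toℕ a · toℕ b)
  -ₚ_ : Fin p -> Fin p
  -ₚ a = π (p ∸ toℕ a)
  π-+ : ∀ m n -> π (m N.+ n) ≡ π m +ₚ π n
  π-+ m n = π-cong (trans (%-distribˡ-+ m n p) (cong2 (\ s t -> (s N.+ t) % p) (sym (toℕ-π m)) (sym (toℕ-π n))))
  π-* : ∀ m n -> π (m · n) ≡ π m *ₚ π n
  π-* m n = π-cong (trans (%-distribˡ-* m n p) (cong2 (\ s t -> (s · t) % p) (sym (toℕ-π m)) (sym (toℕ-π n))))
  private
   π-+ʳ : ∀ m b -> π (m N.+ toℕ b) ≡ π m +ₚ b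
   π-+ʳ m b = trans (π-+ m (toℕ b)) (cong (π m +ₚ_) (π-toℕ b))
   π-+ˡ : ∀ a n -> π (toℕ a N.+ n) ≡ a +ₚ π n
   π-+ˡ a n = trans (π-+ (toℕ a) n) (cong (_+ₚ π n) (π-toℕ a))
   π-*ʳ : ∀ m b -> π (m · toℕ b) ≡ π m *ₚ b
   π-*ʳ m b = trans (π-* m (toℕ b)) (cong (π m *ₚ_) (π-toℕ b))
   π-*ˡ : ∀ a n -> π (toℕ a · n) ≡ a *ₚ π n
   π-*ˡ a n = trans (π-* (toℕ a) n) (cong (_*ₚ π n) (π-toℕ a))
  +ₚ-assoc : ∀ a b c -> (a +ₚ b) +ₚ c ≡ a +ₚ (b +ₚ c)
  +ₚ-assoc a b c = trans (sym (π-+ʳ (toℕ a N.+ toℕ b) c)) (trans (cong π (N.+-assoc (toℕ a) _ _)) (π-+ˡ a _))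
  +ₚ-comm : ∀ a b -> a +ₚ b ≡ b +ₚ a
  +ₚ-comm a b = cong π (N.+-comm (toℕ a) (toℕ b))
  *ₚ-assoc : ∀ a b c -> (a *ₚ b) *ₚ c ≡ a *ₚ (b *ₚ c)
  *ₚ-assoc a b c = trans (sym (π-*ʳ (toℕ a · toℕ b) c)) (trans (cong π (N.*-assoc (toℕ a) _ _)) (π-*ˡ a _))
  *ₚ-comm : ∀ a b -> a *ₚ b ≡ b *ₚ a
  *ₚ-comm a b = cong π (N.*-comm (toℕ a) (toℕ b))
  +ₚ-identityˡ : ∀ a -> π 0 +ₚ a ≡ a
  +ₚ-identityˡ a = trans (sym (π-+ʳ 0 a)) (π-toℕ a)
  *ₚ-identityˡ : ∀ a -> π 1 *ₚ a ≡ a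
  *ₚ-identityˡ a = trans (sym (π-*ʳ 1 a)) (trans (cong π (N.*-identityˡ (toℕ a))) (π-toℕ a))
  *ₚ-distribˡ : ∀ a b c -> a *ₚ (b +ₚ c) ≡ a *ₚ b +ₚ a *ₚ c
  *ₚ-distribˡ a b c = trans (sym (π-*ˡ a _)) (trans (cong π (N.*-distribˡ-+ (toℕ a) _ _)) (π-+ _ _))
  π-p : π p ≡ π 0
  π-p = π-cong (trans (n%n≡0 p) (sym (m<n⇒m%n≡m (N.>-nonZero⁻¹ p))))
  -ₚ-inverseʳ : ∀ a -> a +ₚ -ₚ a ≡ π 0
  -ₚ-inverseʳ a = trans (sym (π-+ˡ a _)) (trans (cong π (m+[n∸m]≡n (<⇒≤ (Fin.toℕ<n a)))) π-p)
  isCommutativeRingₚ : IsCommutativeRing _≡_ _+ₚ_ _*ₚ_ -ₚ_ (π 0) (π 1)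
  isCommutativeRingₚ = record
   { isRing = record
    { +-isAbelianGroup = record
     { isGroup = record
      { isMonoid = record
       { isSemigroup = record
        { isMagma = record { isEquivalence = isEquivalence ; ∙-cong = cong2 _+ₚ_ }
        ; assoc = +ₚ-assoc }
       ; identity = +ₚ-identityˡ , (\ a -> trans (+ₚ-comm a _) (+ₚ-identityˡ a)) }
      ; inverse = (\ a -> trans (+ₚ-comm _ a) (-ₚ-inverseʳ a)) , -ₚ-inverseʳ
      ; ⁻¹-cong = cong -ₚ_ }
     ; comm = +ₚ-comm }
    ; *-cong = cong2 _*ₚ_
    ; *-assoc = *ₚ-assoc
    ; *-identity = *ₚ-identityˡ , (\ a -> trans (*ₚ-comm a _) (*ₚ-identityˡ a))
    ; distrib = *ₚ-distribˡ , (\ a b c -> trans (*ₚ-comm (b +ₚ c) a) (trans (*ₚ-distribˡ a b c) (cong2 _+ₚ_ (*ₚ-comm a b) (*ₚ-comm a c)))) }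
   ; *-comm = *ₚ-comm }
  π≡0⇒∣ : ∀ {m} -> π m ≡ π 0 -> p ∣ m
  π≡0⇒∣ {m} e = m%n≡0⇒n∣m m p (trans (π⁻¹ e) (m<n⇒m%n≡m (N.>-nonZero⁻¹ p)))

 module PrimeField (p : ℕ) (p-prime : Prime p) where
  instance
   p≢0 : NonZero p
   p≢0 = prime⇒nonZero p-prime
  open Mod p public
  1<p : 1 < p
  1<p = N.nonTrivial⇒n>1 p {{prime⇒nonTrivial p-prime}}
  ∣toℕ⇒≡0 : ∀ a -> p ∣ toℕ a -> a ≡ π 0
  ∣toℕ⇒≡0 a p∣a = trans (sym (π-toℕ a)) (π-cong (trans (n∣m⇒m%n≡0 (toℕ a) p p∣a) (sym (m<n⇒m%n≡m (N.>-nonZero⁻¹ p)))))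
  noZeroDivisorsₚ : ∀ a b -> a *ₚ b ≡ π 0 -> a ≡ π 0 ⊎ b ≡ π 0
  noZeroDivisorsₚ a b e with euclidsLemma (toℕ a) (toℕ b) p-prime (π≡0⇒∣ e)
  ... | inl d = inl (∣toℕ⇒≡0 a d)
  ... | inr d = inr (∣toℕ⇒≡0 b d)
  private
   cancelₚ : ∀ a -> a ≢ π 0 -> ∀ {b c} -> a *ₚ b ≡ a *ₚ c -> b ≡ c
   cancelₚ a a≢0 {b} {c} e with noZeroDivisorsₚ a (b +ₚ -ₚ c) (trans (*ₚ-distribˡ a b (-ₚ c)) (trans (cong (_+ₚ a *ₚ -ₚ c) e) (trans (sym (*ₚ-distribˡ a c (-ₚ c))) (trans (cong (a *ₚ_) (-ₚ-inverseʳ c)) zero*))))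
    where
    zero* : a *ₚ π 0 ≡ π 0
    zero* = trans (cong (\ t -> π (toℕ a · t)) (trans (toℕ-π 0) (m<n⇒m%n≡m (N.>-nonZero⁻¹ p)))) (cong π (N.*-zeroʳ (toℕ a)))
   ... | inl z = ⊥-elim (a≢0 z)
   ... | inr z = trans (sym (trans (+ₚ-comm b _) (+ₚ-identityˡ b))) (trans (cong (b +ₚ_) (sym (trans (+ₚ-comm (-ₚ c) c) (-ₚ-inverseʳ c)))) (trans (sym (+ₚ-assoc b _ c)) (trans (cong (_+ₚ c) z) (+ₚ-identityˡ c))))
  𝔽 : Field
  𝔽 = record
   { Carrier = Fin p ; _+_ = _+ₚ_ ; _*_ = _*ₚ_ ; -_ = -ₚ_ ; 0# = π 0 ; 1# = π 1
   ; isCommutativeRing = isCommutativeRingₚ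
   ; _≟_ = Fin._≟_
   ; inverse = \ a a≢0 -> injective⇒surjective (a *ₚ_) (cancelₚ a a≢0) (π 1)
   ; 1≢0 = \ e -> <⇒≱ 1<p (∣⇒≤ (π≡0⇒∣ e)) }
  open FieldProps 𝔽
  cast≡π : ∀ n -> cast n ≡ π n
  cast≡π zero = refl
  cast≡π (suc n) = trans (cong (π 1 +ₚ_) (cast≡π n)) (sym (π-+ 1 n))
  cast≡0⇒∣ : ∀ n -> cast n ≡ 0# -> p ∣ n
  cast≡0⇒∣ n e = π≡0⇒∣ (trans (sym (cast≡π n)) e)
  cast-p : cast p ≡ 0#
  cast-p = trans (cast≡π p) π-p
  cast-toℕ : ∀ a -> cast (toℕ a) ≡ a
  cast-toℕ a = trans (cast≡π (toℕ a)) (π-toℕ a)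
  module Odd (2<p : 2 < p) where
   2≢0 : 1# + 1# ≢ 0#
   2≢0 e = <⇒≱ 2<p (∣⇒≤ (cast≡0⇒∣ 2 (trans (cong (1# +_) (+-identityʳ 1#)) e)))
   x≡-x⇒x≡0 : ∀ {x} -> x ≡ - x -> x ≡ 0#
   x≡-x⇒x≡0 {x} e = [ (\ z -> ⊥-elim (2≢0 z)) , (\ z -> z) ]′ (no-zero-divisors {1# + 1#} {x}
    (trans (distribʳ x 1# 1#) (trans (cong2 _+_ (*-identityˡ x) (trans (*-identityˡ x) e)) (-‿inverseʳ x))))
   private
    Square : Carrier -> Set
    Square t = Σ Carrier \ w -> w * w ≡ t
    square? : ∀ t -> Dec (Square t)
    square? t = Fin.any? (\ w -> w * w ≟ t)
   -- A choice `g` of square roots would be injective, hence surjective; the elements with roots 1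
   -- and -1 would both be 1, so 1 = -1.
   ¬all-squares : ¬ (∀ t -> Square t)
   ¬all-squares all = 1≢0 (x≡-x⇒x≡0 (trans (sym g1) (trans (cong g (trans (sym t≡1) t'≡1)) g'1)))
    where
    g : Carrier -> Carrier
    g t = fst (all t)
    g² : ∀ t -> g t * g t ≡ t
    g² t = snd (all t)
    surj = injective⇒surjective g (\ {s} {t} e -> trans (sym (g² s)) (trans (cong2 _*_ e e) (g² t)))
    t = fst (surj 1#)
    t' = fst (surj (- 1#))
    g1 : g t ≡ 1#
    g1 = snd (surj 1#)
    g'1 : g t' ≡ - 1#
    g'1 = snd (surj (- 1#))
    t≡1 : 1# ≡ t
    t≡1 = trans (sym (*-identityˡ 1#)) (trans (cong2 _*_ (sym g1) (sym g1)) (g² t))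
    t'≡1 : 1# ≡ t'
    t'≡1 = trans (sym (*-identityˡ 1#)) (trans (solve 1 (\ o -> o :* o := (:- o) :* (:- o)) refl 1#) (trans (cong2 _*_ (sym g'1) (sym g'1)) (g² t')))
   nonsquare : Σ Carrier \ d -> ∀ w -> w * w ≢ d
   nonsquare =
    let d , nd = Fin.¬∀⟶∃¬ p Square square? ¬all-squares
    in d , \ w e -> nd (w , e)
   module _ (d : Carrier) (d-nonsquare : ∀ w -> w * w ≢ d) where
    private
     Pos : Carrier -> Set
     Pos w = toℕ w < toℕ (- w)
     pos? : ∀ w -> Dec (Pos w)
     pos? w = toℕ w N.<? toℕ (- w)
     val : ∀ w -> Dec (Pos w) -> Carrier
     val w (yes _) = w * w
     val w (no _) = d * (w * w)
     -- One of w and -w goes to w², the other one to d w². This is injective because `d` is not a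
     -- square, hence onto, so every element is a square or `d` times a square.
     f : Carrier -> Carrier
     f w = val w (pos? w)
     mixed : ∀ {w w'} -> Pos w -> ¬ (w * w ≡ d * (w' * w'))
     mixed {w} {w'} pw e with w' ≟ 0#
     ... | yes w'≡0 = pos⇒≢0 pw ([ (\ z -> z) , (\ z -> z) ]′ (no-zero-divisors (trans e (trans (cong (\ t -> d * (t * t)) w'≡0) (trans (*-congˡ {d} (zeroʳ 0#)) (zeroʳ d))))))
      where
      pos⇒≢0 : ∀ {w} -> Pos w -> w ≢ 0#
      pos⇒≢0 pw refl = <-irrefl (cong toℕ (sym -0#≈0#)) pw
     ... | no w'≢0 = d-nonsquare (w * w' ⁻¹) (begin
      w * w' ⁻¹ * (w * w' ⁻¹) ≡⟨ solve 2 (\ w i -> w :* i :* (w :* i) := w :* w :* (i :* i)) refl w (w' ⁻¹) ⟩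
      w * w * (w' ⁻¹ * w' ⁻¹) ≡⟨ cong (_* (w' ⁻¹ * w' ⁻¹)) e ⟩
      d * (w' * w') * (w' ⁻¹ * w' ⁻¹) ≡⟨ solve 3 (\ d w i -> d :* (w :* w) :* (i :* i) := d :* ((w :* i) :* (w :* i))) refl d w' (w' ⁻¹) ⟩
      d * (w' * w' ⁻¹ * (w' * w' ⁻¹)) ≡⟨ cong (\ t -> d * (t * t)) (*-inverseʳ w'≢0) ⟩
      d * (1# * 1#) ≡⟨ trans (*-congˡ {d} (*-identityˡ 1#)) (*-identityʳ d) ⟩
      d ∎)
      where open ≡R
     d≢0 : d ≢ 0#
     d≢0 e = d-nonsquare 0# (trans (zeroʳ 0#) (sym e))
     val-injective : ∀ w w' dw dw' -> val w dw ≡ val w' dw' -> w ≡ w'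
     val-injective w w' (yes pw) (no _) e = ⊥-elim (mixed {w} {w'} pw e)
     val-injective w w' (no _) (yes pw) e = ⊥-elim (mixed {w'} {w} pw (sym e))
     val-injective w w' (yes pw) (yes pw') e = [ (\ z -> z) , opposite ]′ (sqrt-unique e)
      where
      opposite : w ≡ - w' -> w ≡ w'
      opposite z = ⊥-elim (<-asym pw (subst₂ (\ s t -> toℕ s < toℕ t) (trans (sym (-‿involutive w')) (cong -ₚ_ (sym z))) (sym z) pw'))
     val-injective w w' (no ¬pw) (no ¬pw') e = [ (\ z -> z) , opposite ]′ (sqrt-unique (*-cancelˡ d≢0 e))
      where
      opposite : w ≡ - w' -> w ≡ w'
      opposite z = Fin.toℕ-injective (≤-antisym
       (subst (\ t -> toℕ t N.≤ toℕ w') (sym z) (≮⇒≥ ¬pw'))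
       (subst (\ t -> toℕ t N.≤ toℕ w) (trans (cong -ₚ_ z) (-‿involutive w')) (≮⇒≥ ¬pw)))
     val-class : ∀ {t} w dw -> val w dw ≡ t -> t ≡ w * w ⊎ t ≡ d * (w * w)
     val-class w (yes _) e = inl (sym e)
     val-class w (no _) e = inr (sym e)
    square-class : ∀ t -> Σ Carrier \ w -> t ≡ w * w ⊎ t ≡ d * (w * w)
    square-class t =
     let w , e = injective⇒surjective f (\ {w} {w'} -> val-injective w w' (pos? w) (pos? w')) t
     in w , val-class w (pos? w) e

-- The quadratic extension and its conjugation.

module Quad (F : Field) (d : Field.Carrier F) (d-nonsquare : ∀ w -> Field._*_ F w w ≢ d) where
 open import Data.Product.Properties using (≡-dec)
 open import Algebra.Structures using (IsCommutativeRing)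

 private module F = FieldProps F
 open F using (_⁻¹; solve; _:=_; _:+_; _:*_; _:-_; :-_; con; lit)

 Pair : Set
 Pair = F.Carrier × F.Carrier

 infixl 6 _+₂_
 infixl 7 _*₂_
 _+₂_ _*₂_ : Pair -> Pair -> Pair
 (a , b) +₂ (a' , b') = a F.+ a' , b F.+ b'
 (a , b) *₂ (a' , b') = a F.* a' F.+ d F.* (b F.* b') , a F.* b' F.+ b F.* a'

 -₂_ σ : Pair -> Pair
 -₂ (a , b) = F.- a , F.- b
 σ (a , b) = a , F.- b

 ι : F.Carrier -> Pair
 ι a = a , F.0#

 √d : Pair
 √d = F.0# , F.1#

 0₂ 1₂ : Pair
 0₂ = ι F.0#
 1₂ = ι F.1#

 norm : Pair -> F.Carrier
 norm (a , b) = a F.* a F.- d F.* (b F.* b)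

 isCommutativeRing2 : IsCommutativeRing _≡_ _+₂_ _*₂_ -₂_ 0₂ 1₂
 isCommutativeRing2 = record
  { isRing = record
   { +-isAbelianGroup = record
    { isGroup = record
     { isMonoid = record
      { isSemigroup = record
       { isMagma = record { isEquivalence = isEquivalence ; ∙-cong = cong2 _+₂_ }
       ; assoc = \ { (a , b) (a' , b') (a″ , b″) -> cong2 _,_ (F.+-assoc a a' a″) (F.+-assoc b b' b″) } }
      ; identity = (\ { (a , b) -> cong2 _,_ (F.+-identityˡ a) (F.+-identityˡ b) }) , (\ { (a , b) -> cong2 _,_ (F.+-identityʳ a) (F.+-identityʳ b) }) }
     ; inverse = (\ { (a , b) -> cong2 _,_ (F.-‿inverseˡ a) (F.-‿inverseˡ b) }) , (\ { (a , b) -> cong2 _,_ (F.-‿inverseʳ a) (F.-‿inverseʳ b) })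
     ; ⁻¹-cong = cong -₂_ }
    ; comm = \ { (a , b) (a' , b') -> cong2 _,_ (F.+-comm a a') (F.+-comm b b') } }
   ; *-cong = cong2 _*₂_
   ; *-assoc = \ { (a , b) (a' , b') (a″ , b″) -> cong2 _,_
     (solve 7 (\ d a b a' b' a″ b″ -> (a :* a' :+ d :* (b :* b')) :* a″ :+ d :* ((a :* b' :+ b :* a') :* b″)
      := a :* (a' :* a″ :+ d :* (b' :* b″)) :+ d :* (b :* (a' :* b″ :+ b' :* a″))) refl d a b a' b' a″ b″)
     (solve 7 (\ d a b a' b' a″ b″ -> (a :* a' :+ d :* (b :* b')) :* b″ :+ (a :* b' :+ b :* a') :* a″
      := a :* (a' :* b″ :+ b' :* a″) :+ b :* (a' :* a″ :+ d :* (b' :* b″))) refl d a b a' b' a″ b″) }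
   ; *-identity = identityˡ , (\ x -> trans (comm x 1₂) (identityˡ x))
   ; distrib = distribˡ , (\ x y z -> trans (comm (y +₂ z) x) (trans (distribˡ x y z) (cong2 _+₂_ (comm x y) (comm x z)))) }
  ; *-comm = comm }
  where
  comm : ∀ x y -> x *₂ y ≡ y *₂ x
  comm (a , b) (a' , b') = cong2 _,_ (solve 5 (\ d a b a' b' -> a :* a' :+ d :* (b :* b') := a' :* a :+ d :* (b' :* b)) refl d a b a' b')
   (solve 4 (\ a b a' b' -> a :* b' :+ b :* a' := a' :* b :+ b' :* a) refl a b a' b')
  identityˡ : ∀ x -> 1₂ *₂ x ≡ x
  identityˡ (a , b) = cong2 _,_ (solve 3 (\ d a b -> lit 1 :* a :+ d :* (lit 0 :* b) := a) refl d a b)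
   (solve 2 (\ a b -> lit 1 :* b :+ lit 0 :* a := b) refl a b)
  distribˡ : ∀ x y z -> x *₂ (y +₂ z) ≡ x *₂ y +₂ x *₂ z
  distribˡ (a , b) (a' , b') (a″ , b″) = cong2 _,_
   (solve 7 (\ d a b a' b' a″ b″ -> a :* (a' :+ a″) :+ d :* (b :* (b' :+ b″)) := a :* a' :+ d :* (b :* b') :+ (a :* a″ :+ d :* (b :* b″))) refl d a b a' b' a″ b″)
   (solve 6 (\ a b a' b' a″ b″ -> a :* (b' :+ b″) :+ b :* (a' :+ a″) := a :* b' :+ b :* a' :+ (a :* b″ :+ b :* a″)) refl a b a' b' a″ b″)

 -- Norm zero with b ≠ 0 would make `d` the square of a / b.
 norm≢0 : ∀ x -> x ≢ 0₂ -> norm x ≢ F.0#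
 norm≢0 (a , b) x≢0 e with b F.≟ F.0#
 ... | yes b≡0 = x≢0 (cong2 _,_ a≡0 b≡0)
  where
  a≡0 : a ≡ F.0#
  a≡0 = [ (\ z -> z) , (\ z -> z) ]′ (F.no-zero-divisors (trans (F.x-y≡0⇒x≡y e) (trans (cong (\ t -> d F.* (t F.* t)) b≡0) (trans (F.*-congˡ (F.zeroʳ _)) (F.zeroʳ d)))))
 ... | no b≢0 = d-nonsquare (a F.* b ⁻¹) (begin
  a F.* i F.* (a F.* i) ≡⟨ solve 2 (\ a i -> a :* i :* (a :* i) := a :* a :* (i :* i)) refl a i ⟩
  a F.* a F.* (i F.* i) ≡⟨ cong (F._* (i F.* i)) (F.x-y≡0⇒x≡y e) ⟩
  d F.* (b F.* b) F.* (i F.* i) ≡⟨ solve 3 (\ d b i -> d :* (b :* b) :* (i :* i) := d :* ((b :* i) :* (b :* i))) refl d b i ⟩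
  d F.* (b F.* i F.* (b F.* i)) ≡⟨ cong (\ t -> d F.* (t F.* t)) (F.*-inverseʳ b≢0) ⟩
  d F.* (F.1# F.* F.1#) ≡⟨ trans (F.*-congˡ (F.*-identityˡ _)) (F.*-identityʳ d) ⟩
  d ∎)
  where
  open ≡R
  i = b ⁻¹

 *σ : ∀ x -> x *₂ σ x ≡ ι (norm x)
 *σ (a , b) = cong2 _,_ (solve 3 (\ d a b -> a :* a :+ d :* (b :* (:- b)) := a :* a :- d :* (b :* b)) refl d a b)
  (solve 2 (\ a b -> a :* (:- b) :+ b :* a := lit 0) refl a b)

 ι-* : ∀ a b -> ι (a F.* b) ≡ ι a *₂ ι b
 ι-* a b = cong2 _,_ (solve 3 (\ d a b -> a :* b := a :* b :+ d :* (lit 0 :* lit 0)) refl d a b)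
  (solve 2 (\ a b -> lit 0 := a :* lit 0 :+ lit 0 :* b) refl a b)

 ι-+ : ∀ a b -> ι (a F.+ b) ≡ ι a +₂ ι b
 ι-+ a b = cong2 _,_ refl (sym (F.+-identityʳ _))

 ι-neg : ∀ a -> ι (F.- a) ≡ -₂ ι a
 ι-neg a = cong2 _,_ refl (sym F.-0#≈0#)

 ι-injective : ∀ {a b} -> ι a ≡ ι b -> a ≡ b
 ι-injective e = cong fst e

 𝕂 : Field
 𝕂 = record
  { Carrier = Pair ; _+_ = _+₂_ ; _*_ = _*₂_ ; -_ = -₂_ ; 0# = 0₂ ; 1# = 1₂
  ; isCommutativeRing = isCommutativeRing2
  ; _≟_ = ≡-dec F._≟_ F._≟_
  ; inverse = inverse2
  ; 1≢0 = \ e -> F.1≢0 (ι-injective e) }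
  where
  open IsCommutativeRing isCommutativeRing2 using (*-assoc)
  inverse2 : ∀ x -> x ≢ 0₂ -> Σ Pair \ y -> x *₂ y ≡ 1₂
  inverse2 x x≢0 = σ x *₂ ι (norm x ⁻¹) , (begin
   x *₂ (σ x *₂ ι (norm x ⁻¹)) ≡⟨ *-assoc x (σ x) _ ⟨
   x *₂ σ x *₂ ι (norm x ⁻¹) ≡⟨ cong (_*₂ ι (norm x ⁻¹)) (*σ x) ⟩
   ι (norm x) *₂ ι (norm x ⁻¹) ≡⟨ ι-* _ _ ⟨
   ι (norm x F.* norm x ⁻¹) ≡⟨ cong ι (F.*-inverseʳ (norm≢0 x x≢0)) ⟩
   1₂ ∎)
   where open ≡R

 σ-+ : ∀ x y -> σ (x +₂ y) ≡ σ x +₂ σ y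
 σ-+ (a , b) (a' , b') = cong2 _,_ refl (solve 2 (\ b b' -> :- (b :+ b') := (:- b) :+ (:- b')) refl b b')

 σ-* : ∀ x y -> σ (x *₂ y) ≡ σ x *₂ σ y
 σ-* (a , b) (a' , b') = cong2 _,_ (solve 5 (\ d a b a' b' -> a :* a' :+ d :* (b :* b') := a :* a' :+ d :* ((:- b) :* (:- b'))) refl d a b a' b')
  (solve 4 (\ a b a' b' -> :- (a :* b' :+ b :* a') := a :* (:- b') :+ (:- b) :* a') refl a b a' b')

 σ-neg : ∀ x -> σ (-₂ x) ≡ -₂ σ x
 σ-neg x = refl

 σ-ι : ∀ a -> σ (ι a) ≡ ι a
 σ-ι a = cong2 _,_ refl F.-0#≈0#

 σ-fixed : (∀ {x} -> x ≡ F.- x -> x ≡ F.0#) -> ∀ x -> σ x ≡ x -> x ≡ ι (fst x)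
 σ-fixed odd (a , b) e = cong (a ,_) (odd (sym (cong snd e)))

 √d² : √d *₂ √d ≡ ι d
 √d² = cong2 _,_ (solve 1 (\ d -> lit 0 :* lit 0 :+ d :* (lit 1 :* lit 1) := d) refl d)
  (solve 1 (\ d -> lit 0 :* lit 1 :+ lit 1 :* lit 0 := lit 0) refl d)

 σ-√d : σ √d ≡ -₂ √d
 σ-√d = cong2 _,_ (sym F.-0#≈0#) refl

-- Roots of unity, orders, and the two tori.

module Torus where
 open import Data.Nat using (_%_; _/_)
 open import Data.Nat.DivMod using (m≡m%n+[m/n]*n; m%n<n)
 open import Data.Nat.Divisibility using (_∣_; m%n≡0⇒n∣m; ∣⇒≤)
 open import Data.Nat.Primality using (Prime)
 open import Data.List using (foldr; applyUpTo)
 open import Data.List.Membership.Propositional.Properties using (∈-map⁺; ∈-map⁻; ∈-applyUpTo⁻; ∈-filter⁺)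
 open import Data.List.Membership.Propositional.Properties.WithK using (unique∧set⇒bag)
 open import Data.List.Relation.Binary.BagAndSetEquality using (∼bag⇒↭)
 open import Data.List.Relation.Binary.Permutation.Propositional using (_↭_; refl; prep; swap) renaming (trans to ↭-trans)
 open import Function using (mk⇔)

 module Roots (K : Field) where
  open FieldProps K
  open Poly K using (Poly; eval; const; _⊕_; _^^_; _≈_; at; Deg<; deg; root-count; eval-⊕; eval-^^; eval-const; eval-≈0; Deg<-⊕; Deg<-^^; Deg<-linear; Deg<-mono; Deg<-const)
  open Stepanov K using (X; eval-X)
  open Data.List.Membership.DecPropositional _≟_ using (_∈?_)
  unity-bound : ∀ n c rs -> 0 < n -> c ≢ 0# -> Unique rs -> All (\ r -> r ^ n ≡ c) rs -> length rs ≤ n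
  unity-bound (suc n) c rs _ c≢0 u zs = ≮⇒≥ \ lt -> c≢0 (begin
   c ≡⟨ solve 1 (\ c -> c := :- (lit 0 :+ :- c)) refl c ⟩
   - (0# + - c) ≡⟨ cong (\ t -> - (t + - c)) (zeroˡ (0# ^ n)) ⟨
   - (0# ^ suc n + - c) ≡⟨ cong (\ t -> - t) (eval-f 0#) ⟨
   - eval f 0# ≡⟨ cong (\ t -> - t) (eval-≈0 0# (f≈0 lt)) ⟩
   - 0# ≡⟨ -0#≈0# ⟩
   0# ∎)
   where
   open ≡R
   f = X ^^ suc n ⊕ const (- c)
   eval-f : ∀ r -> eval f r ≡ r ^ suc n + - c
   eval-f r = trans (eval-⊕ (X ^^ suc n) (const (- c)) r) (cong2 _+_ (trans (eval-^^ X (suc n) r) (cong (_^ suc n) (eval-X r))) (eval-const (- c) r))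
   f≈0 : suc n < length rs -> f ≈ []
   f≈0 lt = root-count f rs u (All.map (\ {r} z -> trans (eval-f r) (x≡y⇒x-y≡0 z)) zs)
    (Deg<-⊕ (Deg<-mono (s≤s (≤-eq (N.*-identityʳ (suc n)))) (Deg<-^^ (suc n) Deg<-linear)) (Deg<-mono (s≤s z≤n) Deg<-const)) lt
  quadratic-bound : ∀ a b c rs -> a ≢ 0# -> Unique rs -> All (\ x -> c + x * (b + x * (a + x * 0#)) ≡ 0#) rs -> length rs ≤ 2
  quadratic-bound a b c rs a≢0 u zs = ≮⇒≥ \ lt -> a≢0 (at (root-count (c ∷ b ∷ a ∷ []) rs u zs
   (deg \ { (suc (suc (suc i))) le -> refl ; (suc zero) (s≤s ()) ; (suc (suc zero)) (s≤s (s≤s ())) }) lt) 2)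
  unity-complete : ∀ n rs -> 0 < n -> Unique rs -> All (\ r -> r ^ n ≡ 1#) rs -> n ≤ length rs -> ∀ z -> z ^ n ≡ 1# -> z ∈ rs
  unity-complete n rs 0<n u zs le z e with z ∈? rs
  ... | yes z∈ = z∈
  ... | no z∉ = ⊥-elim (<⇒≱ (s≤s le) (unity-bound n 1# (z ∷ rs) 0<n 1≢0
   (All.¬Any⇒All¬ rs z∉ ∷ u) (e ∷ zs)))
  private
   product : List Carrier -> Carrier
   product = foldr _*_ 1#
   product-↭ : ∀ {xs ys} -> xs ↭ ys -> product xs ≡ product ys
   product-↭ refl = refl
   product-↭ (prep x e) = cong (x *_) (product-↭ e)
   product-↭ (swap x y e) = trans (cong (\ t -> x * (y * t)) (product-↭ e)) (solve 3 (\ x y t -> x :* (y :* t) := y :* (x :* t)) refl x y _)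
   product-↭ (↭-trans e e') = trans (product-↭ e) (product-↭ e')
   product-map : ∀ x ys -> product (map (x *_) ys) ≡ x ^ length ys * product ys
   product-map x [] = sym (*-identityˡ 1#)
   product-map x (y ∷ ys) = trans (cong (x * y *_) (product-map x ys)) (solve 4 (\ x y w s -> x :* y :* (w :* s) := x :* w :* (y :* s)) refl x y _ _)
   product≢0 : ∀ ys -> All (_≢ 0#) ys -> product ys ≢ 0#
   product≢0 [] [] = 1≢0
   product≢0 (y ∷ ys) (nz ∷ nzs) = *-≢0 nz (product≢0 ys nzs)
  -- Multiplication by `x` permutes `ys`; the products of the list before and after are compared.
  lagrange : ∀ x ys -> Unique ys -> All (_≢ 0#) ys -> x ≢ 0# -> (∀ y -> y ∈ ys -> x * y ∈ ys) -> (∀ y -> y ∈ ys -> x ⁻¹ * y ∈ ys) -> x ^ length ys ≡ 1#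
  lagrange x ys u nz x≢0 closed closed⁻ = *-cancelʳ (product≢0 ys nz)
   (trans (sym (product-map x ys)) (trans (product-↭ perm) (sym (*-identityˡ _))))
   where
   to : ∀ {y} -> y ∈ map (x *_) ys -> y ∈ ys
   to y∈ with z , z∈ , e ← ∈-map⁻ (x *_) y∈ = subst (_∈ ys) (sym e) (closed z z∈)
   from : ∀ {y} -> y ∈ ys -> y ∈ map (x *_) ys
   from {y} y∈ = subst (_∈ map (x *_) ys) (trans (sym (*-assoc x (x ⁻¹) y)) (trans (*-congʳ (*-inverseʳ x≢0)) (*-identityˡ y)))
    (∈-map⁺ (x *_) (closed⁻ y y∈))
   perm : map (x *_) ys ↭ ys
   perm = ∼bag⇒↭ (unique∧set⇒bag (Unique.map⁺ (*-cancelˡ x≢0) u) u (mk⇔ to from))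
  record Order (x : Carrier) (ℓ : ℕ) : Set where
   field
    positive : 0 < ℓ
    kills : x ^ ℓ ≡ 1#
    least : ∀ k -> 0 < k -> k < ℓ -> x ^ k ≢ 1#
  open Order public
  order : ∀ x n -> 0 < n -> x ^ n ≡ 1# -> Σ ℕ (Order x)
  order x n 0<n e = go 0 n refl (\ k 0<k k≤0 -> ⊥-elim (<⇒≱ 0<k k≤0))
   where
   go : ∀ k d -> k N.+ d ≡ n -> (∀ j -> 0 < j -> j ≤ k -> x ^ j ≢ 1#) -> Σ ℕ (Order x)
   go k zero k≡n none = ⊥-elim (none n 0<n (≤-eq (trans (sym k≡n) (N.+-identityʳ k))) e)
   go k (suc d) k+d≡n none with x ^ suc k ≟ 1#
   ... | yes e1 = suc k , record { positive = s≤s z≤n ; kills = e1 ; least = \ j 0<j j<sk -> none j 0<j (<⇒≤pred j<sk) }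
   ... | no ne = go (suc k) d (trans (sym (+-suc k d)) k+d≡n) none'
    where
    none' : ∀ j -> 0 < j -> j ≤ suc k -> x ^ j ≢ 1#
    none' j 0<j j≤ with m≤n⇒m<n∨m≡n j≤
    ... | inl (s≤s j≤k) = none j 0<j j≤k
    ... | inr refl = ne
  order-∣ : ∀ {x ℓ} n -> Order x ℓ -> x ^ n ≡ 1# -> ℓ ∣ n
  order-∣ {x} {zero} n o e = ⊥-elim (<-irrefl refl (positive o))
  order-∣ {x} {suc ℓ} n o e = m%n≡0⇒n∣m n (suc ℓ) (rem≡0 (n % suc ℓ) refl)
   where
   e' : x ^ (n % suc ℓ) ≡ 1#
   e' = begin
    x ^ (n % suc ℓ) ≡⟨ *-identityʳ _ ⟨
    x ^ (n % suc ℓ) * 1# ≡⟨ cong (x ^ (n % suc ℓ) *_) (^-*-≡1 (suc ℓ) (n / suc ℓ) (kills o)) ⟨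
    x ^ (n % suc ℓ) * x ^ (suc ℓ · (n / suc ℓ)) ≡⟨ ^-homo-* x (n % suc ℓ) _ ⟨
    x ^ (n % suc ℓ N.+ suc ℓ · (n / suc ℓ)) ≡⟨ cong (x ^_) (trans (cong (n % suc ℓ N.+_) (N.*-comm (suc ℓ) _)) (sym (m≡m%n+[m/n]*n n (suc ℓ)))) ⟩
    x ^ n ≡⟨ e ⟩
    1# ∎
    where open ≡R
   rem≡0 : ∀ r -> r ≡ n % suc ℓ -> r ≡ 0
   rem≡0 zero _ = refl
   rem≡0 (suc r) eq = ⊥-elim (least o (suc r) (s≤s z≤n) (≤-trans (≤-eq (cong suc eq)) (m%n<n n (suc ℓ))) (trans (cong (x ^_) eq) e'))
  powers : Carrier -> ℕ -> List Carrier
  powers x ℓ = applyUpTo (x ^_) ℓ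
  order⇒≢0 : ∀ {x ℓ} -> Order x ℓ -> x ≢ 0#
  order⇒≢0 {x} {zero} o = ⊥-elim (<-irrefl refl (positive o))
  order⇒≢0 {x} {suc ℓ} o x≡0 = 1≢0 (trans (sym (kills o)) (trans (cong (_^ suc ℓ) x≡0) (zeroˡ _)))
  powers-distinct : ∀ {x ℓ} -> Order x ℓ -> ∀ {i j} -> i < j -> j < ℓ -> x ^ i ≢ x ^ j
  powers-distinct {x} {ℓ} o {i} {j} i<j j<ℓ e = least o (j ∸ i) (m<n⇒0<n∸m i<j) (≤-<-trans (m∸n≤m j i) j<ℓ)
   (*-cancelˡ (^-≢0 i (order⇒≢0 o)) (begin
    x ^ i * x ^ (j ∸ i) ≡⟨ ^-homo-* x i (j ∸ i) ⟨
    x ^ (i N.+ (j ∸ i)) ≡⟨ cong (x ^_) (m+[n∸m]≡n (<⇒≤ i<j)) ⟩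
    x ^ j ≡⟨ e ⟨
    x ^ i ≡⟨ *-identityʳ _ ⟨
    x ^ i * 1# ∎))
   where open ≡R
  powers-unique : ∀ {x ℓ} -> Order x ℓ -> Unique (powers x ℓ)
  powers-unique {x} {ℓ} o = Unique.applyUpTo⁺₁ (x ^_) ℓ (\ i<j j<ℓ -> powers-distinct o i<j j<ℓ)
  powers-kill : ∀ {x} ℓ i -> x ^ ℓ ≡ 1# -> (x ^ i) ^ ℓ ≡ 1#
  powers-kill {x} ℓ i e = trans (^-assocʳ x i ℓ) (trans (cong (x ^_) (N.*-comm i ℓ)) (^-*-≡1 ℓ i e))
  powers-complete : ∀ {x ℓ} -> Order x ℓ -> ∀ z -> z ^ ℓ ≡ 1# -> Σ ℕ \ j -> j < ℓ × z ≡ x ^ j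
  powers-complete {x} {ℓ} o z e = ∈-applyUpTo⁻ (x ^_) (unity-complete ℓ (powers x ℓ) (positive o) (powers-unique o)
   (All.applyUpTo⁺₂ (x ^_) ℓ (\ i -> powers-kill ℓ i (kills o)))
   (≤-eq (sym (List.length-applyUpTo (x ^_) ℓ))) z e)

 -- The interface to the prime field `F` inside its quadratic extension `K`. Only `F` is enumerated.
 -- The root chosen by `sqrt` depends only on the element of `F`, and `σ` fixes or negates it; this
 -- decides in which torus a parameter lies.
 record Setting : Set1 where
  field
   p : ℕ
   p-prime : Prime p
   2<p : 2 < p
   F K : Field
  module F = FieldProps F
  module K = FieldProps K
  field
   elements : List F.Carrier
   elements-unique : Unique elements
   elements-complete : ∀ a -> a ∈ elements
   elements-length : length elements ≡ p
   char-F : ∀ n -> F.cast n ≡ F.0# -> p ∣ n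
   cast-onto : ∀ a -> Σ ℕ \ n -> F.cast n ≡ a
   cast-p : F.cast p ≡ F.0#
   ι : F.Carrier -> K.Carrier
   ι-injective : ∀ {a b} -> ι a ≡ ι b -> a ≡ b
   ι-+ : ∀ a b -> ι (a F.+ b) ≡ ι a K.+ ι b
   ι-* : ∀ a b -> ι (a F.* b) ≡ ι a K.* ι b
   ι-neg : ∀ a -> ι (F.- a) ≡ K.- ι a
   ι-0 : ι F.0# ≡ K.0#
   ι-1 : ι F.1# ≡ K.1#
   σ : K.Carrier -> K.Carrier
   σ-+ : ∀ x y -> σ (x K.+ y) ≡ σ x K.+ σ y
   σ-* : ∀ x y -> σ (x K.* y) ≡ σ x K.* σ y
   σ-neg : ∀ x -> σ (K.- x) ≡ K.- σ x
   σ-ι : ∀ a -> σ (ι a) ≡ ι a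
   σ-fixed : ∀ x -> σ x ≡ x -> Σ F.Carrier \ a -> x ≡ ι a
   √d : K.Carrier
   √d≢0 : √d ≢ K.0#
   σ-√d : σ √d ≡ K.- √d
   sqrt : F.Carrier -> K.Carrier
   sqrt² : ∀ t -> sqrt t K.* sqrt t ≡ ι t
   sqrt-σ : ∀ t -> σ (sqrt t) ≡ sqrt t ⊎ σ (sqrt t) ≡ K.- sqrt t

 module Tori (S : Setting) where
  open Setting S public
  open K
  open Roots K public
  cast-ι : ∀ n -> cast n ≡ ι (F.cast n)
  cast-ι zero = sym ι-0
  cast-ι (suc n) = trans (cong2 _+_ (sym ι-1) (cast-ι n)) (sym (ι-+ F.1# (F.cast n)))
  char : ∀ n -> cast n ≡ 0# -> p ∣ n
  char n e = char-F n (ι-injective (trans (sym (cast-ι n)) (trans e (sym ι-0))))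
  cast≢0 : ∀ n -> 0 < n -> n < p -> cast n ≢ 0#
  cast≢0 (suc n) _ n<p e = <⇒≱ n<p (∣⇒≤ (char (suc n) e))
  2≢0 : num 2 ≢ 0#
  2≢0 e = cast≢0 2 (s≤s z≤n) 2<p (trans (cast≈num 2) e)
  ½ : Carrier
  ½ = num 2 ⁻¹
  2½ : num 2 * ½ ≡ 1#
  2½ = *-inverseʳ 2≢0
  x≡-x⇒x≡0 : ∀ {x} -> x ≡ - x -> x ≡ 0#
  x≡-x⇒x≡0 {x} e = [ (\ z -> ⊥-elim (2≢0 z)) , (\ z -> z) ]′ (no-zero-divisors {num 2} {x}
   (trans (solve 1 (\ x -> lit 2 :* x := x :+ x) refl x) (trans (cong (x +_) e) (-‿inverseʳ x))))
  -- `split` stands for the multiplicative group of `F`, `inert` for the elements of norm 1 in `K`;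
  -- their orders are p - 1 and p + 1.
  data Type : Set where
   split inert : Type
  size : Type -> ℕ
  size split = p ∸ 1
  size inert = suc p
  InTorus : Type -> Carrier -> Set
  InTorus split x = x ≢ 0# × σ x ≡ x
  InTorus inert x = x * σ x ≡ 1#
  σ-0 : σ 0# ≡ 0#
  σ-0 = trans (cong σ (sym ι-0)) (trans (σ-ι F.0#) ι-0)
  σ-1 : σ 1# ≡ 1#
  σ-1 = trans (cong σ (sym ι-1)) (trans (σ-ι F.1#) ι-1)
  σ-⁻¹ : ∀ {x} -> x ≢ 0# -> σ x * σ (x ⁻¹) ≡ 1#
  σ-⁻¹ {x} x≢0 = trans (sym (σ-* x (x ⁻¹))) (trans (cong σ (*-inverseʳ x≢0)) σ-1)
  *≡1⇒≢0 : ∀ {x y} -> x * y ≡ 1# -> x ≢ 0#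
  *≡1⇒≢0 {x} {y} e z = 1≢0 (trans (sym e) (trans (cong (_* y) z) (zeroˡ y)))
  *≡1⇒⁻¹ : ∀ {x y} -> x * y ≡ 1# -> x ⁻¹ ≡ y
  *≡1⇒⁻¹ {x} {y} e = *-cancelˡ (*≡1⇒≢0 e) (trans (*-inverseʳ (*≡1⇒≢0 e)) (sym e))
  InTorus⇒≢0 : ∀ t {x} -> InTorus t x -> x ≢ 0#
  InTorus⇒≢0 split = fst
  InTorus⇒≢0 inert e = *≡1⇒≢0 e
  InTorus-* : ∀ t {x y} -> InTorus t x -> InTorus t y -> InTorus t (x * y)
  InTorus-* split {x} {y} (x≢0 , ex) (y≢0 , ey) = *-≢0 x≢0 y≢0 , trans (σ-* x y) (cong2 _*_ ex ey)
  InTorus-* inert {x} {y} ex ey = begin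
   x * y * σ (x * y) ≡⟨ cong (x * y *_) (σ-* x y) ⟩
   x * y * (σ x * σ y) ≡⟨ solve 4 (\ x y s t -> x :* y :* (s :* t) := (x :* s) :* (y :* t)) refl x y (σ x) (σ y) ⟩
   x * σ x * (y * σ y) ≡⟨ cong2 _*_ ex ey ⟩
   1# * 1# ≡⟨ *-identityˡ 1# ⟩
   1# ∎
   where open ≡R
  InTorus-⁻¹ : ∀ t {x} -> InTorus t x -> InTorus t (x ⁻¹)
  InTorus-⁻¹ split {x} (x≢0 , ex) = ⁻¹-≢0 x≢0 , *-cancelˡ x≢0 (trans (cong (_* σ (x ⁻¹)) (sym ex)) (trans (σ-⁻¹ x≢0) (sym (*-inverseʳ x≢0))))
  InTorus-⁻¹ inert {x} ex = begin
   x ⁻¹ * σ (x ⁻¹) ≡⟨ *-identityˡ _ ⟨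
   1# * (x ⁻¹ * σ (x ⁻¹)) ≡⟨ cong (_* (x ⁻¹ * σ (x ⁻¹))) ex ⟨
   x * σ x * (x ⁻¹ * σ (x ⁻¹)) ≡⟨ solve 4 (\ x s i t -> x :* s :* (i :* t) := (x :* i) :* (s :* t)) refl x (σ x) (x ⁻¹) (σ (x ⁻¹)) ⟩
   x * x ⁻¹ * (σ x * σ (x ⁻¹)) ≡⟨ cong2 _*_ (*-inverseʳ (*≡1⇒≢0 ex)) (σ-⁻¹ (*≡1⇒≢0 ex)) ⟩
   1# * 1# ≡⟨ *-identityˡ 1# ⟩
   1# ∎
   where open ≡R
  InTorus-neg : ∀ t {x} -> InTorus t x -> InTorus t (- x)
  InTorus-neg split (x≢0 , ex) = neg-≢0 x≢0 , trans (σ-neg _) (cong (\ t -> - t) ex)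
  InTorus-neg inert {x} ex = trans (cong (- x *_) (σ-neg x)) (trans (solve 2 (\ x s -> (:- x) :* (:- s) := x :* s) refl x (σ x)) ex)
  private
   nonzero? : ∀ a -> Dec (a ≢ F.0#)
   nonzero? a = ¬? (a F.≟ F.0#)
   nonzero : List F.Carrier -> List F.Carrier
   nonzero = filter nonzero?
   filter-nonzero : ∀ xs -> All (\ a -> F.0# ≢ a) xs -> length (nonzero xs) ≡ length xs
   filter-nonzero xs nz = cong length (List.filter-all nonzero? (All.map (\ ne -> ne ∘ sym) nz))
   nonzero-length : ∀ xs -> Unique xs -> F.0# ∈ xs -> suc (length (nonzero xs)) ≡ length xs
   nonzero-length (x ∷ xs) (nx ∷ u) (here z) = cong suc (trans (cong length (List.filter-reject nonzero? {x} {xs} (\ ne -> ne (sym z))))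
    (filter-nonzero xs (All.map (\ ne -> subst (_≢ _) (sym z) ne) nx)))
   nonzero-length (x ∷ xs) (nx ∷ u) (there z∈) = trans (cong (suc ∘ length) (List.filter-accept nonzero? {x} {xs} (\ z -> All.lookup nx z∈ z)))
    (cong suc (nonzero-length xs u z∈))
   -- A bijection from `F` onto the elements of norm 1 other than 1, which shows that the inert
   -- torus has p + 1 elements.
   cayley : F.Carrier -> Carrier
   cayley t = (ι t + √d) * (ι t - √d) ⁻¹
   t-√d≢0 : ∀ t -> ι t - √d ≢ 0#
   t-√d≢0 t e = √d≢0 (x≡-x⇒x≡0 (trans (sym (x-y≡0⇒x≡y e)) (trans (sym (σ-ι t)) (trans (cong σ (x-y≡0⇒x≡y e)) σ-√d))))
   cayley-* : ∀ t -> cayley t * (ι t - √d) ≡ ι t + √d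
   cayley-* t = trans (*-assoc _ _ _) (trans (*-congˡ (trans (*-comm _ _) (*-inverseʳ (t-√d≢0 t)))) (*-identityʳ _))
   σ[t+√d] : ∀ t -> σ (ι t + √d) ≡ ι t - √d
   σ[t+√d] t = trans (σ-+ _ _) (cong2 _+_ (σ-ι t) σ-√d)
   σ[t-√d] : ∀ t -> σ (ι t - √d) ≡ ι t + √d
   σ[t-√d] t = trans (σ-+ _ _) (cong2 _+_ (σ-ι t) (trans (σ-neg √d) (trans (cong (\ x -> - x) σ-√d) (-‿involutive √d))))
   cayley-norm : ∀ t -> cayley t * σ (cayley t) ≡ 1#
   cayley-norm t = *-cancelʳ (*-≢0 (t-√d≢0 t) t+≢0) (begin
    c * σ c * (m * q) ≡⟨ solve 4 (\ c s m q -> c :* s :* (m :* q) := (c :* m) :* (s :* q)) refl c (σ c) m q ⟩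
    c * m * (σ c * q) ≡⟨ cong2 _*_ (cayley-* t) (trans (cong (σ c *_) (sym (σ[t-√d] t))) (trans (sym (σ-* c m)) (trans (cong σ (cayley-* t)) (σ[t+√d] t)))) ⟩
    q * m ≡⟨ solve 2 (\ q m -> q :* m := lit 1 :* (m :* q)) refl q m ⟩
    1# * (m * q) ∎)
    where
    open ≡R
    c = cayley t
    m = ι t - √d
    q = ι t + √d
    t+≢0 : q ≢ 0#
    t+≢0 e = t-√d≢0 t (trans (sym (σ[t+√d] t)) (trans (cong σ e) σ-0))
   cayley-injective : ∀ {s t} -> cayley s ≡ cayley t -> s ≡ t
   cayley-injective {s} {t} e = ι-injective (x-y≡0⇒x≡y (*-cancelˡ 2√d≢0 (trans diff (sym (zeroʳ _)))))
    where
    2√d≢0 : num 2 * √d ≢ 0#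
    2√d≢0 = *-≢0 2≢0 √d≢0
    cross : (ι s + √d) * (ι t - √d) ≡ (ι t + √d) * (ι s - √d)
    cross = begin
     (ι s + √d) * (ι t - √d) ≡⟨ cong (_* (ι t - √d)) (cayley-* s) ⟨
     cayley s * (ι s - √d) * (ι t - √d) ≡⟨ cong (\ c -> c * (ι s - √d) * (ι t - √d)) e ⟩
     cayley t * (ι s - √d) * (ι t - √d) ≡⟨ solve 3 (\ c a b -> c :* a :* b := (c :* b) :* a) refl (cayley t) _ _ ⟩
     cayley t * (ι t - √d) * (ι s - √d) ≡⟨ cong (_* (ι s - √d)) (cayley-* t) ⟩
     (ι t + √d) * (ι s - √d) ∎
     where open ≡R
    diff : num 2 * √d * (ι s - ι t) ≡ 0#
    diff = trans (solve 3 (\ w s t -> lit 2 :* w :* (s :- t) := (t :+ w) :* (s :- w) :- (s :+ w) :* (t :- w)) refl √d (ι s) (ι t)) (x≡y⇒x-y≡0 (sym cross))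
   cayley≢1 : ∀ t -> 1# ≢ cayley t
   cayley≢1 t e = *-≢0 2≢0 √d≢0 (trans (solve 2 (\ w t -> lit 2 :* w := (t :+ w) :- lit 1 :* (t :- w)) refl √d (ι t))
    (x≡y⇒x-y≡0 (sym (trans (cong (_* (ι t - √d)) e) (cayley-* t)))))
   cayley-onto : ∀ x -> x * σ x ≡ 1# -> x ≢ 1# -> Σ F.Carrier \ t -> x ≡ cayley t
   cayley-onto x ex x≢1 = let t , et = σ-fixed τ fixed in t , *-cancelʳ (t-√d≢0 t) (trans (solution t et) (sym (cayley-* t)))
    where
    x-1≢0 : x - 1# ≢ 0#
    x-1≢0 e = x≢1 (x-y≡0⇒x≡y e)
    i = (x - 1#) ⁻¹
    ii : (x - 1#) * i ≡ 1#
    ii = *-inverseʳ x-1≢0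
    -- The equation x = `cayley` t solved for t.
    τ = √d * (x + 1#) * i
    τ-eq : τ * (x - 1#) ≡ √d * (x + 1#)
    τ-eq = trans (*-assoc _ _ _) (trans (*-congˡ (trans (*-comm _ _) ii)) (*-identityʳ _))
    στ-eq : σ τ * (σ x - 1#) ≡ - √d * (σ x + 1#)
    στ-eq = trans (cong (σ τ *_) (sym (trans (σ-+ x (- 1#)) (cong (σ x +_) (trans (σ-neg 1#) (cong (\ t -> - t) σ-1))))))
     (trans (sym (σ-* τ (x - 1#))) (trans (cong σ τ-eq) (trans (σ-* √d (x + 1#)) (cong2 _*_ σ-√d (trans (σ-+ x 1#) (cong (σ x +_) σ-1))))))
    fixed : σ τ ≡ τ
    fixed = *-cancelʳ x-1≢0 (x-y≡0⇒x≡y (begin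
     σ τ * (x - 1#) - τ * (x - 1#) ≡⟨ cong (\ t -> σ τ * (x - 1#) - t) τ-eq ⟩
     σ τ * (x - 1#) - √d * (x + 1#)
      ≡⟨ solve 4 (\ τ x w s -> τ :* (x :- lit 1) :- w :* (x :+ lit 1)
         := :- (x :* (τ :* (s :- lit 1) :- (:- w) :* (s :+ lit 1))) :+ (τ :+ w) :* (x :* s :- lit 1)) refl (σ τ) x √d (σ x) ⟩
     - (x * (σ τ * (σ x - 1#) - (- √d) * (σ x + 1#))) + (σ τ + √d) * (x * σ x - 1#)
      ≡⟨ cong2 (\ s t -> - (x * s) + (σ τ + √d) * t) (x≡y⇒x-y≡0 στ-eq) (x≡y⇒x-y≡0 ex) ⟩
     - (x * 0#) + (σ τ + √d) * 0# ≡⟨ solve 2 (\ x y -> (:- (x :* lit 0)) :+ y :* lit 0 := lit 0) refl x (σ τ + √d) ⟩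
     0# ∎))
     where open ≡R
    solution : ∀ t -> τ ≡ ι t -> x * (ι t - √d) ≡ ι t + √d
    solution t et = trans (cong (\ s -> x * (s - √d)) (sym et)) (trans (x-y≡0⇒x≡y (trans
     (solve 3 (\ x τ w -> x :* (τ :- w) :- (τ :+ w) := τ :* (x :- lit 1) :- w :* (x :+ lit 1)) refl x τ √d) (x≡y⇒x-y≡0 τ-eq))) (cong (_+ √d) et))
  torus : Type -> List Carrier
  torus split = map ι (nonzero elements)
  torus inert = 1# ∷ map cayley elements
  torus-length : ∀ t -> length (torus t) ≡ size t
  torus-length split = trans (List.length-map ι (nonzero elements))
   (cong (_∸ 1) (trans (nonzero-length elements elements-unique (elements-complete F.0#)) elements-length))
  torus-length inert = cong suc (trans (List.length-map cayley elements) elements-length)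
  torus-unique : ∀ t -> Unique (torus t)
  torus-unique split = Unique.map⁺ ι-injective (Unique.filter⁺ nonzero? elements-unique)
  torus-unique inert = All.map⁺ (All.universal cayley≢1 elements) ∷ Unique.map⁺ cayley-injective elements-unique
  torus-sound : ∀ t -> All (InTorus t) (torus t)
  torus-sound split = All.map⁺ (All.map (\ {a} ne -> (\ e -> ne (ι-injective (trans e (sym ι-0)))) , σ-ι a) (All.all-filter nonzero? elements))
  torus-sound inert = trans (*-identityˡ _) σ-1 ∷ All.map⁺ (All.universal cayley-norm elements)
  torus-complete : ∀ t x -> InTorus t x -> x ∈ torus t
  torus-complete split x (x≢0 , ex) =
   let a , x≡ιa = σ-fixed x ex
   in subst (_∈ torus split) (sym x≡ιa) (∈-map⁺ ι (∈-filter⁺ nonzero? (elements-complete a) (\ a≡0 -> x≢0 (trans x≡ιa (trans (cong ι a≡0) ι-0)))))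
  torus-complete inert x ex = found (x ≟ 1#)
   where
   found : Dec (x ≡ 1#) -> x ∈ torus inert
   found (yes x≡1) = here x≡1
   found (no x≢1) = let t , e = cayley-onto x ex x≢1 in there (subst (_∈ map cayley elements) (sym e) (∈-map⁺ cayley (elements-complete t)))
  InTorus-size : ∀ t {x} -> InTorus t x -> x ^ size t ≡ 1#
  InTorus-size t {x} ix = subst (\ n -> x ^ n ≡ 1#) (torus-length t) (lagrange x (torus t) (torus-unique t)
   (All.map (InTorus⇒≢0 t) (torus-sound t)) (InTorus⇒≢0 t ix)
   (\ y y∈ -> torus-complete t _ (InTorus-* t ix (All.lookup (torus-sound t) y∈)))
   (\ y y∈ -> torus-complete t _ (InTorus-* t (InTorus-⁻¹ t ix) (All.lookup (torus-sound t) y∈))))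

open Torus using (Setting; module Tori)

-- Points of a curve with both coordinates in given subgroups.

module Middle (K : Field) (p : ℕ) (cast≢0 : ∀ n -> 0 < n -> n < p -> FieldProps.cast K n ≢ Field.0# K) where
 open import Data.Fin using (Fin; zero; suc; toℕ; remQuot; combine)
 open import Data.Sum using (swap)
 open import Relation.Binary.Definitions using (tri<; tri≈; tri>)

 open FieldProps K
 open Poly K using (Poly; const; eval; eval-const; Deg<-const)
 open Bound K using (module Frame)

 private
  cast-< : ∀ {i j} -> i < j -> j < p -> cast i ≢ cast j
  cast-< {i} {j} i<j j<p e = cast≢0 (j ∸ i) (m<n⇒0<n∸m i<j) (≤-<-trans (m∸n≤m j i) j<p) (begin
   cast (j ∸ i) ≡⟨ solve 2 (\ x y -> y := x :+ y :- x) refl (cast i) (cast (j ∸ i)) ⟩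
   cast i + cast (j ∸ i) - cast i ≡⟨ cong (\ t -> t - cast i) (trans (sym (cast-+ i (j ∸ i))) (cong cast (m+[n∸m]≡n (<⇒≤ i<j)))) ⟩
   cast j - cast i ≡⟨ x≡y⇒x-y≡0 (sym e) ⟩
   0# ∎)
   where open ≡R

 cast-injective : ∀ i j -> i < p -> j < p -> cast i ≡ cast j -> i ≡ j
 cast-injective i j i<p j<p e with <-cmp i j
 ... | tri≈ _ i≡j _ = i≡j
 ... | tri< i<j _ _ = ⊥-elim (cast-< i<j j<p e)
 ... | tri> _ _ j<i = ⊥-elim (cast-< j<i i<p (sym e))

 -- α β ≠ 1 says that the Möbius map r ↦ (α r - 1) / (r - β) is nondegenerate.
 module Curve (α β : Carrier) (α≢0 : α ≢ 0#) (β≢0 : β ≢ 0#) (αβ≢1 : α * β ≢ 1#) where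
  record OnCurve (x y : Carrier) : Set where
   constructor onCurve
   field
    x≢0 : x ≢ 0#
    y≢0 : y ≢ 0#
    equation : α * x + β * x ⁻¹ ≡ y + y ⁻¹
  open OnCurve public
  -- With r = x y and s = y / x the curve becomes the graph of a Möbius map: s (r - β) = α r - 1.
  möbius : ∀ {x y} -> OnCurve x y -> y * x ⁻¹ * (x * y - β) ≡ α * (x * y) - 1#
  möbius {x} {y} c = x-y≡0⇒x≡y (begin
   y * x̄ * (x * y - β) - (α * (x * y) - 1#)
    ≡⟨ solve 6 (\ x y x̄ ȳ α β -> y :* x̄ :* (x :* y :- β) :- (α :* (x :* y) :- lit 1)
       := y :* ((y :+ ȳ) :- (α :* x :+ β :* x̄)) :+ y :* y :* (x :* x̄ :- lit 1) :+ (lit 1 :- y :* ȳ)) refl x y x̄ ȳ α β ⟩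
   y * ((y + ȳ) - (α * x + β * x̄)) + y * y * (x * x̄ - 1#) + (1# - y * ȳ)
    ≡⟨ cong2 _+_ (cong2 _+_ (cong (y *_) (x≡y⇒x-y≡0 (sym (equation c)))) (cong (y * y *_) (x≡y⇒x-y≡0 (*-inverseʳ (x≢0 c))))) (x≡y⇒x-y≡0 (sym (*-inverseʳ (y≢0 c)))) ⟩
   y * 0# + y * y * 0# + 0# ≡⟨ solve 1 (\ y -> y :* lit 0 :+ y :* y :* lit 0 :+ lit 0 := lit 0) refl y ⟩
   0# ∎)
   where
   open ≡R
   x̄ = x ⁻¹
   ȳ = y ⁻¹
  eval1 : ∀ a b r -> eval (a ∷ b ∷ []) r ≡ a + b * r
  eval1 a b r = solve 3 (\ a b r -> a :+ r :* (b :+ r :* lit 0) := a :+ b :* r) refl a b r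
  v≢0 : ∀ {x y} -> OnCurve x y -> x * y - β ≢ 0#
  v≢0 {x} {y} c e = αβ≢1 (begin
   α * β ≡⟨ cong (α *_) (x-y≡0⇒x≡y e) ⟨
   α * (x * y) ≡⟨ x-y≡0⇒x≡y (trans (sym (möbius c)) (trans (cong (y * x ⁻¹ *_) e) (zeroʳ _))) ⟩
   1# ∎)
   where open ≡R
  s≢0 : ∀ {x y} -> OnCurve x y -> y * x ⁻¹ ≢ 0#
  s≢0 c = *-≢0 (y≢0 c) (⁻¹-≢0 (x≢0 c))
  -- At r = x y the weight equals r ^ m s ^ n v ^ Nn, that is, x ^ (m - n) y ^ (m + n) v ^ Nn. Hence
  -- all weights with m - n ≡ -e modulo ℓ and m + n ≡ f modulo d take the same value.
  monomial : ∀ {x y} ℓ d m n Nn {e f k1 k2 k3} -> OnCurve x y -> x ^ ℓ ≡ 1# -> y ^ d ≡ 1# -> n ≤ Nn ->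
   m N.+ e N.+ ℓ · k2 ≡ n N.+ ℓ · k1 -> m N.+ n ≡ f N.+ d · k3 ->
   (x * y) ^ m * (α * (x * y) - 1#) ^ n * (x * y - β) ^ (Nn ∸ n) ≡ (x ⁻¹) ^ e * y ^ f * (x * y - β) ^ Nn
  monomial {x} {y} ℓ d m n Nn {e} {f} {k1} {k2} {k3} c xℓ yd n≤ xe ye = begin
   (x * y) ^ m * (α * (x * y) - 1#) ^ n * v ^ (Nn ∸ n) ≡⟨ cong (\ t -> (x * y) ^ m * t ^ n * v ^ (Nn ∸ n)) (möbius c) ⟨
   (x * y) ^ m * (y * x̄ * v) ^ n * v ^ (Nn ∸ n) ≡⟨ cong (\ t -> t * v ^ (Nn ∸ n)) (cong2 _*_ (^-distrib-* x y m) (trans (^-distrib-* (y * x̄) v n) (cong (_* v ^ n) (^-distrib-* y x̄ n)))) ⟩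
   x ^ m * y ^ m * (y ^ n * x̄ ^ n * v ^ n) * v ^ (Nn ∸ n)
    ≡⟨ solve 6 (\ a b c d e f -> a :* b :* (c :* d :* e) :* f := (a :* d) :* (b :* c) :* (e :* f)) refl (x ^ m) (y ^ m) (y ^ n) (x̄ ^ n) (v ^ n) (v ^ (Nn ∸ n)) ⟩
   x ^ m * x̄ ^ n * (y ^ m * y ^ n) * (v ^ n * v ^ (Nn ∸ n))
    ≡⟨ cong2 _*_ (cong2 _*_ x-part y-part) (trans (sym (^-homo-* v n (Nn ∸ n))) (cong (v ^_) (m+[n∸m]≡n n≤))) ⟩
   x̄ ^ e * y ^ f * v ^ Nn ∎
   where
   open ≡R
   x̄ = x ⁻¹
   v = x * y - β
   xx̄ : ∀ k -> x ^ k * x̄ ^ k ≡ 1#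
   xx̄ k = trans (sym (^-distrib-* x x̄ k)) (trans (cong (_^ k) (*-inverseʳ (x≢0 c))) (^-1# k))
   killed : ∀ {g} n ℓ k -> g ^ ℓ ≡ 1# -> g ^ (n N.+ ℓ · k) ≡ g ^ n
   killed {g} n ℓ k e = trans (^-homo-* g n (ℓ · k)) (trans (cong (g ^ n *_) (^-*-≡1 ℓ k e)) (*-identityʳ _))
   x-part : x ^ m * x̄ ^ n ≡ x̄ ^ e
   x-part = begin
    x ^ m * x̄ ^ n ≡⟨ *-identityʳ _ ⟨
    x ^ m * x̄ ^ n * 1# ≡⟨ cong (x ^ m * x̄ ^ n *_) (xx̄ e) ⟨
    x ^ m * x̄ ^ n * (x ^ e * x̄ ^ e) ≡⟨ solve 4 (\ a b c d -> a :* b :* (c :* d) := (a :* c) :* b :* d) refl (x ^ m) (x̄ ^ n) (x ^ e) (x̄ ^ e) ⟩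
    x ^ m * x ^ e * x̄ ^ n * x̄ ^ e ≡⟨ cong (\ t -> t * x̄ ^ n * x̄ ^ e) (trans (sym (^-homo-* x m e)) (trans (sym (killed (m N.+ e) ℓ k2 xℓ)) (trans (cong (x ^_) xe) (killed n ℓ k1 xℓ)))) ⟩
    x ^ n * x̄ ^ n * x̄ ^ e ≡⟨ cong (_* x̄ ^ e) (xx̄ n) ⟩
    1# * x̄ ^ e ≡⟨ *-identityˡ _ ⟩
    x̄ ^ e ∎
   y-part : y ^ m * y ^ n ≡ y ^ f
   y-part = trans (sym (^-homo-* y m n)) (trans (cong (y ^_) ye) (killed f d k3 yd))
  private
   u-root : eval (- 1# ∷ α ∷ []) (α ⁻¹) ≡ 0#
   u-root = trans (eval1 (- 1#) α (α ⁻¹)) (trans (cong (- 1# +_) (*-inverseʳ α≢0)) (-‿inverseˡ 1#))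
   v-root : eval (- β ∷ 1# ∷ []) β ≡ 0#
   v-root = trans (eval1 (- β) 1# β) (trans (cong (- β +_) (*-identityˡ β)) (-‿inverseˡ β))
   vz≢0 : eval (- β ∷ 1# ∷ []) (α ⁻¹) ≢ 0#
   vz≢0 e = αβ≢1 (begin
    α * β ≡⟨ cong (α *_) (x-y≡0⇒x≡y (trans (solve 2 (\ a b -> a :- b := (:- b) :+ lit 1 :* a) refl (α ⁻¹) β) (trans (sym (eval1 (- β) 1# (α ⁻¹))) e))) ⟨
    α * α ⁻¹ ≡⟨ *-inverseʳ α≢0 ⟩
    1# ∎)
    where open ≡R
  module Fr = Frame (- 1#) α (- β) 1# (α ⁻¹) β α≢0 1≢0 u-root v-root (⁻¹-≢0 α≢0) vz≢0
  eval-u : ∀ r -> eval Fr.u r ≡ α * r - 1#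
  eval-u r = trans (eval1 (- 1#) α r) (+-comm _ _)
  eval-v : ∀ r -> eval Fr.v r ≡ r - β
  eval-v r = trans (eval1 (- β) 1# r) (trans (cong (- β +_) (*-identityˡ r)) (+-comm _ _))
  weight-value : ∀ r m n k -> r ^ m * eval Fr.u r ^ n * eval Fr.v r ^ k ≡ r ^ m * (α * r - 1#) ^ n * (r - β) ^ k
  weight-value r m n k = cong2 (\ s t -> r ^ m * s ^ n * t ^ k) (eval-u r) (eval-v r)
  -- Pairs (m, n) are needed with m - n constant modulo ℓ, m + n constant modulo d, and the values n
  -- well apart. They come from the multiples ℓ i and d j with i, j < 2 Λ, and two constructions are
  -- required according to whether some of these multiples nearly coincide.
  module Subgroups (ℓ d Λ : ℕ) (0<Λ : 0 < Λ) (d≤ℓ : d ≤ ℓ) (Λ²≤d : Λ · Λ ≤ d)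
   (6Λ⁴≤ℓ : 6 · (Λ · Λ · (Λ · Λ)) ≤ ℓ) (13Λ²ℓ<p : 13 · (Λ · Λ · ℓ) < p) where
   Pair : Carrier × Carrier -> Set
   Pair (x , y) = OnCurve x y × x ^ ℓ ≡ 1# × y ^ d ≡ 1#
   private
    J0 = 2 · Λ
    B1 = Λ · Λ
    -- The distance of d j and ℓ i is less than Λ².
    Close : ℕ -> ℕ -> Set
    Close i j = d · j < ℓ · i N.+ B1 × ℓ · i < d · j N.+ B1
    close? : ∀ i j -> Dec (Close i j)
    close? i j = (d · j N.<? ℓ · i N.+ B1) ×-dec (ℓ · i N.<? d · j N.+ B1)
    B1≤ℓ : B1 ≤ ℓ
    B1≤ℓ = ≤-trans Λ²≤d d≤ℓ
    1≤B₁ : 1 ≤ B1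
    1≤B₁ = *-mono-≤ 0<Λ 0<Λ
    Λ≤Λ² : Λ ≤ Λ · Λ
    Λ≤Λ² = ≤-trans (≤-eq (sym (N.*-identityʳ Λ))) (*-monoʳ-≤ Λ 0<Λ)
    Λ³ = Λ · Λ · Λ
    Λ³≤Λ⁴ : Λ³ ≤ Λ · Λ · (Λ · Λ)
    Λ³≤Λ⁴ = *-monoʳ-≤ (Λ · Λ) Λ≤Λ²
    Λ³≤ℓ : 6 · Λ³ ≤ ℓ
    Λ³≤ℓ = ≤-trans (*-monoʳ-≤ 6 Λ³≤Λ⁴) 6Λ⁴≤ℓ
    ℓ≤Λ²ℓ : ℓ ≤ Λ · Λ · ℓ
    ℓ≤Λ²ℓ = ≤-trans (≤-eq (sym (N.*-identityˡ ℓ))) (*-monoˡ-≤ ℓ 1≤B₁)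
    ℓ<p : ℓ < p
    ℓ<p = ≤-<-trans (≤-trans ℓ≤Λ²ℓ (m≤n*m (Λ · Λ · ℓ) 13)) 13Λ²ℓ<p
    Λ³<p : Λ³ < p
    Λ³<p = ≤-<-trans (≤-trans (m≤n*m Λ³ 6) Λ³≤ℓ) ℓ<p
    B1≤Λ³ : B1 ≤ Λ³
    B1≤Λ³ = ≤-trans (≤-eq (sym (N.*-identityʳ B1))) (*-monoʳ-≤ B1 0<Λ)
    char : ∀ M -> M ≤ Λ³ -> ∀ i -> i < M -> cast (suc i) ≢ 0#
    char M M≤ i i<M = cast≢0 (suc i) (s≤s z≤n) (≤-<-trans (≤-trans i<M M≤) Λ³<p)
    target : ∀ {x y} -> OnCurve x y -> x * y ≢ 0# × eval Fr.u (x * y) ≢ 0# × eval Fr.v (x * y) ≢ 0#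
    target {x} {y} c = *-≢0 (x≢0 c) (y≢0 c)
     , (\ e -> *-≢0 (s≢0 c) (v≢0 c) (trans (möbius c) (trans (sym (eval-u (x * y))) e)))
     , (\ e -> v≢0 c (trans (sym (eval-v (x * y))) e))
    rs : List (Carrier × Carrier) -> List Carrier
    rs = map (\ { (x , y) -> x * y })
   -- One row for each pair (i, j), with m = ℓ i + d j and n = d j + ℓ (2 Λ - i). Without a
   -- resonance the values n are Λ² apart. With B = M = Λ² there are 4 Λ⁴ unknowns against 3 Λ⁴
   -- conditions.
   module Far (far : ∀ i j -> 0 < i -> i < J0 -> 0 < j -> j < J0 -> ¬ Close i j) where
    private
     I J : Fin (J0 · J0) -> ℕ
     I e = toℕ (fst (remQuot {J0} J0 e))
     J e = toℕ (snd (remQuot {J0} J0 e))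
     I< : ∀ e -> I e < J0
     I< e = Fin.toℕ<n (fst (remQuot {J0} J0 e))
     J< : ∀ e -> J e < J0
     J< e = Fin.toℕ<n (snd (remQuot {J0} J0 e))
     IJ-injective : ∀ e e' -> I e ≡ I e' -> J e ≡ J e' -> e ≡ e'
     IJ-injective e e' i j = trans (sym (Fin.combine-remQuot {J0} J0 e)) (trans (cong2 combine (Fin.toℕ-injective i) (Fin.toℕ-injective j)) (Fin.combine-remQuot {J0} J0 e'))
     N : Fin (J0 · J0) -> ℕ
     N e = d · J e N.+ ℓ · (J0 ∸ I e)
     m : Fin (J0 · J0) -> Fin 1 -> ℕ
     m e _ = ℓ · I e N.+ d · J e
     Gap : Fin (J0 · J0) -> Fin (J0 · J0) -> Set
     Gap e e' = N e N.+ B1 ≤ N e' ⊎ N e' N.+ B1 ≤ N e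
     d-step : ∀ {j j'} -> j < j' -> d · j N.+ B1 ≤ d · j'
     d-step {j} {j'} lt = ≤-trans (+-monoʳ-≤ (d · j) Λ²≤d) (≤-trans (≤-eq (trans (N.+-comm (d · j) d) (sym (*-suc d j)))) (*-monoʳ-≤ d lt))
     same-I : ∀ e e' -> I e ≡ I e' -> J e < J e' -> N e N.+ B1 ≤ N e'
     same-I e e' i j = ≤-trans (≤-eq (calc (d · J e) (ℓ · (J0 ∸ I e)) B1)) (+-mono-≤ (d-step j) (≤-eq (cong (\ t -> ℓ · (J0 ∸ t)) i)))
      where
      calc : ∀ a b c -> a N.+ b N.+ c ≡ a N.+ c N.+ b
      calc = solve-∀
     ∸-split : ∀ {i i'} -> i < i' -> i' ≤ J0 -> J0 ∸ i ≡ (i' ∸ i) N.+ (J0 ∸ i')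
     ∸-split {i} {i'} lt le = +-cancelˡ-≡ i (J0 ∸ i) ((i' ∸ i) N.+ (J0 ∸ i')) (trans (m+[n∸m]≡n (≤-trans (<⇒≤ lt) le))
      (sym (trans (sym (N.+-assoc i _ _)) (trans (cong (N._+ (J0 ∸ i')) (m+[n∸m]≡n (<⇒≤ lt))) (m+[n∸m]≡n le)))))
     gap< : ∀ e e' -> I e < I e' -> Gap e e'
     gap< e e' i<i' = [ above , below ]′ (≤-<-connex (J e') (J e))
      where
      i0 = I e' ∸ I e
      rest = ℓ · (J0 ∸ I e')
      Ne : N e ≡ d · J e N.+ (ℓ · i0 N.+ rest)
      Ne = cong (d · J e N.+_) (trans (cong (ℓ ·_) (∸-split i<i' (<⇒≤ (I< e')))) (N.*-distribˡ-+ ℓ i0 _))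
      0<i₀ : 0 < i0
      0<i₀ = m<n⇒0<n∸m i<i'
      i0<J0 : i0 < J0
      i0<J0 = ≤-<-trans (m∸n≤m (I e') (I e)) (I< e')
      ℓ≤ℓi0 : ℓ ≤ ℓ · i0
      ℓ≤ℓi0 = ≤-trans (≤-eq (sym (N.*-identityʳ ℓ))) (*-monoʳ-≤ ℓ 0<i₀)
      above : J e' ≤ J e -> Gap e e'
      above le = inr (begin
       d · J e' N.+ rest N.+ B1 ≤⟨ +-mono-≤ (+-monoˡ-≤ rest (*-monoʳ-≤ d le)) (≤-trans B1≤ℓ ℓ≤ℓi0) ⟩
       d · J e N.+ rest N.+ ℓ · i0 ≡⟨ calc (d · J e) rest (ℓ · i0) ⟩
       d · J e N.+ (ℓ · i0 N.+ rest) ≡⟨ Ne ⟨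
       N e ∎)
       where
       open ≤R
       calc : ∀ a b c -> a N.+ b N.+ c ≡ a N.+ (c N.+ b)
       calc = solve-∀
      below : J e < J e' -> Gap e e'
      below lt with ≤-<-connex (ℓ · i0 N.+ B1) (d · j0) | ≤-<-connex (d · j0 N.+ B1) (ℓ · i0)
       where j0 = J e' ∸ J e
      ... | inl le | _ = inl (begin
       N e N.+ B1 ≡⟨ cong (N._+ B1) Ne ⟩
       d · J e N.+ (ℓ · i0 N.+ rest) N.+ B1 ≡⟨ calc (d · J e) (ℓ · i0) rest B1 ⟩
       d · J e N.+ (ℓ · i0 N.+ B1) N.+ rest ≤⟨ +-monoˡ-≤ rest (+-monoʳ-≤ (d · J e) le) ⟩
       d · J e N.+ d · (J e' ∸ J e) N.+ rest ≡⟨ cong (N._+ rest) (trans (sym (N.*-distribˡ-+ d (J e) _)) (cong (d ·_) (m+[n∸m]≡n (<⇒≤ lt)))) ⟩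
       N e' ∎)
       where
       open ≤R
       calc : ∀ a b c e -> a N.+ (b N.+ c) N.+ e ≡ a N.+ (b N.+ e) N.+ c
       calc = solve-∀
      ... | inr _ | inl le = inr (begin
       d · J e' N.+ rest N.+ B1 ≡⟨ cong (\ t -> t N.+ rest N.+ B1) (trans (cong (d ·_) (sym (m+[n∸m]≡n (<⇒≤ lt)))) (N.*-distribˡ-+ d (J e) _)) ⟩
       d · J e N.+ d · (J e' ∸ J e) N.+ rest N.+ B1 ≡⟨ calc (d · J e) (d · (J e' ∸ J e)) rest B1 ⟩
       d · J e N.+ (d · (J e' ∸ J e) N.+ B1 N.+ rest) ≤⟨ +-monoʳ-≤ (d · J e) (+-monoˡ-≤ rest le) ⟩
       d · J e N.+ (ℓ · i0 N.+ rest) ≡⟨ Ne ⟨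
       N e ∎)
       where
       open ≤R
       calc : ∀ a b c e -> a N.+ b N.+ c N.+ e ≡ a N.+ (b N.+ e N.+ c)
       calc = solve-∀
      ... | inr lt1 | inr lt2 = ⊥-elim (far i0 (J e' ∸ J e) 0<i₀ i0<J0 (m<n⇒0<n∸m lt) (≤-<-trans (m∸n≤m (J e') (J e)) (J< e')) (lt1 , lt2))
     gap : ∀ e e' -> e ≢ e' -> Gap e e'
     gap e e' ne with <-cmp (I e) (I e')
     ... | tri< lt _ _ = gap< e e' lt
     ... | tri> _ _ gt = swap (gap< e' e gt)
     ... | tri≈ _ i _ with <-cmp (J e) (J e')
     ...   | tri< lt _ _ = inl (same-I e e' i lt)
     ...   | tri> _ _ gt = inr (same-I e' e (sym i) gt)
     ...   | tri≈ _ j _ = ⊥-elim (ne (IJ-injective e e' i j))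
     Nn = 2 · (J0 · ℓ)
     N≤ : ∀ e -> N e N.+ 0 ≤ Nn
     N≤ e = begin
      d · J e N.+ ℓ · (J0 ∸ I e) N.+ 0 ≤⟨ +-monoˡ-≤ 0 (+-mono-≤ (*-mono-≤ d≤ℓ (<⇒≤ (J< e))) (*-monoʳ-≤ ℓ (m∸n≤m J0 (I e)))) ⟩
      ℓ · J0 N.+ ℓ · J0 N.+ 0 ≡⟨ calc ℓ J0 ⟩
      Nn ∎
      where
      open ≤R
      calc : ∀ l j -> l · j N.+ l · j N.+ 0 ≡ 2 · (j · l)
      calc = solve-∀
     m≤ : ∀ e a -> m e a ≤ Nn
     m≤ e a = ≤-trans (+-mono-≤ (*-monoʳ-≤ ℓ (<⇒≤ (I< e))) (*-mono-≤ d≤ℓ (<⇒≤ (J< e)))) (≤-eq (calc ℓ J0))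
      where
      calc : ∀ l j -> l · j N.+ l · j ≡ 2 · (j · l)
      calc = solve-∀
     dist : ∀ e a a' i i' -> i < B1 N.+ 0 -> i' < B1 N.+ 0 -> cast (m e a N.+ i) ≡ cast (m e a' N.+ i') -> a ≡ a' × i ≡ i'
     dist e zero zero i i' i< i'< eq = refl , cast-injective i i' (small i<) (small i'<)
      (x-y≡0⇒x≡y (trans (solve 3 (\ m x y -> x :- y := (m :+ x) :- (m :+ y)) refl (cast (m e zero)) (cast i) (cast i'))
       (x≡y⇒x-y≡0 (trans (sym (cast-+ (m e zero) i)) (trans eq (cast-+ (m e zero) i'))))))
      where
      small : ∀ {i} -> i < B1 N.+ 0 -> i < p
      small i< = <-≤-trans i< (≤-trans (≤-eq (N.+-identityʳ B1)) (≤-trans B1≤Λ³ (<⇒≤ Λ³<p)))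
     module Fam = Fr.Family (J0 · J0) 1 B1 0 B1 Nn m (\ _ _ -> 0) N (\ _ _ -> z≤n) N≤ gap dist
      (≤-eq (trans (N.*-identityˡ (B1 N.+ 0)) (N.+-identityʳ B1))) 1≤B₁
     enough : B1 · (B1 N.+ 2 · B1 N.+ 0) < J0 · J0 · 1 · B1
     enough = <-≤-trans (m<m+n _ {B1 · B1} (*-mono-≤ 1≤B₁ 1≤B₁)) (≤-eq (calc Λ))
      where
      calc : ∀ L -> (L · L) · ((L · L) N.+ 2 · (L · L) N.+ 0) N.+ (L · L) · (L · L) ≡ (2 · L) · (2 · L) · 1 · (L · L)
      calc = solve-∀
     one : Fin (J0 · J0) -> Fin 1 -> Poly
     one _ _ = const 1#
     is-target : ∀ {x y} -> Pair (x , y) -> Fam.Target B1 0 Nn one (\ _ _ -> Deg<-const) m≤ (char B1 B1≤Λ³) enough (x * y)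
     is-target {x} {y} (c , xℓ , yd) = let a , b , e = target c in a , b , e , ω , \ e a -> begin
      r ^ m e a * eval Fr.u r ^ (N e N.+ 0) * eval Fr.v r ^ (Nn ∸ (N e N.+ 0)) ≡⟨ weight-value r (m e a) (N e N.+ 0) (Nn ∸ (N e N.+ 0)) ⟩
      r ^ m e a * (α * r - 1#) ^ (N e N.+ 0) * (r - β) ^ (Nn ∸ (N e N.+ 0)) ≡⟨ monomial ℓ d (m e a) (N e N.+ 0) Nn c xℓ yd (N≤ e)
        (x-exponent (ℓ) (d) (I e) (J e) (J0 ∸ I e)) (y-exponent e) ⟩
      ω ≡⟨ *-identityʳ ω ⟨
      ω * 1# ≡⟨ cong (ω *_) (eval-const 1# r) ⟨
      ω * eval (const 1#) r ∎
      where
      open ≡R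
      r = x * y
      ω = (x ⁻¹) ^ 0 * y ^ (ℓ · J0) * (r - β) ^ Nn
      x-exponent : ∀ l d i j k -> l · i N.+ d · j N.+ 0 N.+ l · k ≡ d · j N.+ l · k N.+ 0 N.+ l · i
      x-exponent = solve-∀
      y-exponent : ∀ e -> ℓ · I e N.+ d · J e N.+ (d · J e N.+ ℓ · (J0 ∸ I e) N.+ 0) ≡ ℓ · J0 N.+ d · (2 · J e)
      y-exponent e = trans (calc ℓ d (I e) (J e) (J0 ∸ I e)) (cong (\ t -> ℓ · t N.+ d · (2 · J e)) (m+[n∸m]≡n (<⇒≤ (I< e))))
       where
       calc : ∀ l d i j k -> l · i N.+ d · j N.+ (d · j N.+ l · k N.+ 0) ≡ l · (i N.+ k) N.+ d · (2 · j)
       calc = solve-∀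
    bound : ∀ ps -> Unique (rs ps) -> All Pair ps -> length ps · Λ ≤ 18 · ℓ
    bound ps u c = *-cancelʳ-≤ (length ps · Λ) (18 · ℓ) Λ {{N.>-nonZero 0<Λ}} (begin
     length ps · Λ · Λ ≡⟨ N.*-assoc (length ps) Λ Λ ⟩
     length ps · B1 ≡⟨ cong (_· B1) (List.length-map _ ps) ⟨
     length (rs ps) · B1 <⟨ Fam.stepanov-bound B1 0 Nn one (\ _ _ -> Deg<-const) m≤ (char B1 B1≤Λ³) enough (rs ps) u (All.map⁺ (All.map (\ {q} -> is-target) c)) ⟩
     B1 N.+ (Nn N.+ Nn) ≤⟨ +-monoˡ-≤ (Nn N.+ Nn) (*-monoʳ-≤ Λ (≤-trans Λ≤Λ² B1≤ℓ)) ⟩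
     Λ · ℓ N.+ (Nn N.+ Nn) ≡⟨ calc Λ ℓ ⟩
     9 · ℓ · Λ ≤⟨ *-monoˡ-≤ Λ (*-monoˡ-≤ ℓ (m≤m+n 9 9)) ⟩
     18 · ℓ · Λ ∎)
     where
     open ≤R
     calc : ∀ L l -> L · l N.+ (2 · (2 · L · l) N.+ 2 · (2 · L · l)) ≡ 9 · l · L
     calc = solve-∀
   -- A resonance makes m = a (ℓ i0 + d j0) admissible with a small u-exponent `o a`; `key` yields
   -- both congruences. These are the columns, and the multiples of ℓ give the rows. The exponents
   -- of `X` stay below p because 13 Λ² ℓ < p. With B = M = Λ³ there are 8 Λ⁶ unknowns against 3 Λ⁶
   -- conditions.
   module Near (i0 j0 e0 : ℕ) (0<i₀ : 0 < i0) (i0< : i0 < J0) (j0< : j0 < J0)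
    (o : ℕ -> ℕ) (o≤ : ∀ a -> a < J0 -> o a ≤ J0 · B1) (key : ∀ a -> a < J0 -> a · (ℓ · i0) N.+ o a ≡ a · (d · j0) N.+ e0) where
    private
     Rn = J0 · J0
     W = J0 · B1
     Nn = Rn · ℓ N.+ W
     m0 = ℓ · i0 N.+ d · j0
     Λ²ℓ = Λ · Λ · ℓ
     Mm = 12 · Λ²ℓ
     N : Fin Rn -> ℕ
     N b = (Rn ∸ toℕ b) · ℓ
     m o' : Fin Rn -> Fin J0 -> ℕ
     m b a = toℕ a · m0 N.+ toℕ b · ℓ
     o' b a = o (toℕ a)
     o'≤ : ∀ b a -> o' b a ≤ W
     o'≤ b a = o≤ (toℕ a) (Fin.toℕ<n a)
     N≤ : ∀ b -> N b N.+ W ≤ Nn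
     N≤ b = +-monoˡ-≤ W (*-monoˡ-≤ ℓ (m∸n≤m Rn (toℕ b)))
     gap< : ∀ b b' -> toℕ b < toℕ b' -> N b' N.+ ℓ ≤ N b
     gap< b b' lt = ≤-trans (≤-eq (N.+-comm (N b') ℓ)) (*-monoˡ-≤ ℓ (∸-monoʳ-< lt (<⇒≤ (Fin.toℕ<n b'))))
     gap : ∀ b b' -> b ≢ b' -> N b N.+ ℓ ≤ N b' ⊎ N b' N.+ ℓ ≤ N b
     gap b b' ne with <-cmp (toℕ b) (toℕ b')
     ... | tri< lt _ _ = inr (gap< b b' lt)
     ... | tri≈ _ eq _ = ⊥-elim (ne (Fin.toℕ-injective eq))
     ... | tri> _ _ gt = inl (gap< b' b gt)
     ℓ≤m0 : ℓ ≤ m0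
     ℓ≤m0 = ≤-trans (≤-trans (≤-eq (sym (N.*-identityʳ ℓ))) (*-monoʳ-≤ ℓ 0<i₀)) (m≤m+n _ _)
     m0≤ : m0 ≤ 4 · (Λ · ℓ)
     m0≤ = ≤-trans (+-mono-≤ (*-monoʳ-≤ ℓ (<⇒≤ i0<)) (*-mono-≤ d≤ℓ (<⇒≤ j0<))) (≤-eq (calc ℓ Λ))
      where
      calc : ∀ l L -> l · (2 · L) N.+ l · (2 · L) ≡ 4 · (L · l)
      calc = solve-∀
     m≤ : ∀ b a -> m b a ≤ Mm
     m≤ b a = ≤-trans (+-mono-≤ (*-mono-≤ (<⇒≤ (Fin.toℕ<n a)) m0≤) (*-monoˡ-≤ ℓ (<⇒≤ (Fin.toℕ<n b)))) (≤-eq (calc ℓ Λ))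
      where
      calc : ∀ l L -> (2 · L) · (4 · (L · l)) N.+ (2 · L) · (2 · L) · l ≡ 12 · (L · L · l)
      calc = solve-∀
     BW : Λ³ N.+ W ≡ 3 · Λ³
     BW = calc Λ
      where
      calc : ∀ L -> L · L · L N.+ 2 · L · (L · L) ≡ 3 · (L · L · L)
      calc = solve-∀
     BW≤ℓ : Λ³ N.+ W ≤ ℓ
     BW≤ℓ = ≤-trans (≤-eq BW) (≤-trans (*-monoˡ-≤ Λ³ (m≤m+n 3 3)) Λ³≤ℓ)
     exponent<p : ∀ b a i -> i < Λ³ N.+ W -> m b a N.+ i < p
     exponent<p b a i i< = ≤-<-trans (+-mono-≤ (m≤ b a) (≤-trans (<⇒≤ i<) (≤-trans BW≤ℓ ℓ≤Λ²ℓ)))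
      (≤-<-trans (≤-eq (N.+-comm Mm Λ²ℓ)) 13Λ²ℓ<p)
     quotient-< : ∀ {a a' i i'} -> a < a' -> i < m0 -> a · m0 N.+ i ≢ a' · m0 N.+ i'
     quotient-< {a} {a'} {i} {i'} lt i< eq = <-irrefl eq (<-≤-trans (+-monoʳ-< (a · m0) i<)
      (≤-trans (≤-eq (N.+-comm (a · m0) m0)) (≤-trans (*-monoˡ-≤ m0 lt) (m≤m+n _ i'))))
     dist : ∀ b a a' i i' -> i < Λ³ N.+ W -> i' < Λ³ N.+ W -> cast (m b a N.+ i) ≡ cast (m b a' N.+ i') -> a ≡ a' × i ≡ i'
     dist b a a' i i' i< i'< eq = divided (+-cancelʳ-≡ (toℕ b · ℓ) _ _ (trans (calc (toℕ a · m0) i (toℕ b · ℓ))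
       (trans (cast-injective _ _ (exponent<p b a i i<) (exponent<p b a' i' i'<) eq) (sym (calc (toℕ a' · m0) i' (toℕ b · ℓ))))))
      where
      calc : ∀ x i y -> x N.+ i N.+ y ≡ x N.+ y N.+ i
      calc = solve-∀
      <m₀ : ∀ {i} -> i < Λ³ N.+ W -> i < m0
      <m₀ i< = <-≤-trans i< (≤-trans BW≤ℓ ℓ≤m0)
      divided : toℕ a · m0 N.+ i ≡ toℕ a' · m0 N.+ i' -> a ≡ a' × i ≡ i'
      divided e with <-cmp (toℕ a) (toℕ a')
      ... | tri< lt _ _ = ⊥-elim (quotient-< lt (<m₀ i<) e)
      ... | tri> _ _ gt = ⊥-elim (quotient-< gt (<m₀ i'<) (sym e))
      ... | tri≈ _ a≡a' _ = Fin.toℕ-injective a≡a' , +-cancelˡ-≡ (toℕ a · m0) i i' (trans e (cong (\ t -> t · m0 N.+ i') (sym a≡a')))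
     terms≤ : J0 · (Λ³ N.+ W) ≤ ℓ
     terms≤ = ≤-trans (≤-eq (trans (cong (J0 ·_) BW) (calc Λ))) 6Λ⁴≤ℓ
      where
      calc : ∀ L -> 2 · L · (3 · (L · L · L)) ≡ 6 · (L · L · (L · L))
      calc = solve-∀
     1≤Λ³ : 1 ≤ Λ³
     1≤Λ³ = *-mono-≤ 1≤B₁ 0<Λ
     module Fam = Fr.Family Rn J0 Λ³ W ℓ Nn m o' N o'≤ N≤ gap dist terms≤ (≤-trans 1≤B₁ B1≤ℓ)
     enough : Λ³ · (Λ³ N.+ 2 · Λ³ N.+ 0) < Rn · J0 · Λ³
     enough = <-≤-trans (m<m+n _ {5 · (Λ³ · Λ³)} (≤-trans (*-mono-≤ 1≤Λ³ 1≤Λ³) (m≤n*m (Λ³ · Λ³) 5))) (≤-eq (calc Λ))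
      where
      calc : ∀ L -> (L · L · L) · ((L · L · L) N.+ 2 · (L · L · L) N.+ 0) N.+ 5 · ((L · L · L) · (L · L · L))
           ≡ (2 · L) · (2 · L) · (2 · L) · (L · L · L)
      calc = solve-∀
     one : Fin Rn -> Fin J0 -> Poly
     one _ _ = const 1#
     is-target : ∀ {x y} -> Pair (x , y) -> Fam.Target Λ³ 0 Mm one (\ _ _ -> Deg<-const) m≤ (char Λ³ ≤-refl) enough (x * y)
     is-target {x} {y} (c , xℓ , yd) = let a , b , e = target c in a , b , e , ω , \ b a -> begin
      r ^ m b a * eval Fr.u r ^ (N b N.+ o' b a) * eval Fr.v r ^ (Nn ∸ (N b N.+ o' b a)) ≡⟨ weight-value r (m b a) (N b N.+ o' b a) (Nn ∸ (N b N.+ o' b a)) ⟩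
      r ^ m b a * (α * r - 1#) ^ (N b N.+ o' b a) * (r - β) ^ (Nn ∸ (N b N.+ o' b a)) ≡⟨ monomial ℓ d (m b a) (N b N.+ o' b a) Nn c xℓ yd (Fam.n≤Nn b a)
        (x-exponent b a) (y-exponent b a) ⟩
      ω ≡⟨ *-identityʳ ω ⟨
      ω * 1# ≡⟨ cong (ω *_) (eval-const 1# r) ⟨
      ω * eval (const 1#) r ∎
      where
      open ≡R
      r = x * y
      ω = (x ⁻¹) ^ e0 * y ^ (e0 N.+ Rn · ℓ) * (r - β) ^ Nn
      x-exponent : ∀ b a -> m b a N.+ e0 N.+ ℓ · (Rn ∸ toℕ b) ≡ N b N.+ o' b a N.+ ℓ · (2 · (toℕ a · i0) N.+ toℕ b)
      x-exponent b a = trans (calc1 (toℕ a) (ℓ · i0) (d · j0) (toℕ b · ℓ) e0 (ℓ · (Rn ∸ toℕ b)))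
       (trans (cong (\ t -> toℕ a · (ℓ · i0) N.+ toℕ b · ℓ N.+ t N.+ ℓ · (Rn ∸ toℕ b)) (sym (key (toℕ a) (Fin.toℕ<n a))))
        (calc2 (toℕ a) ℓ i0 (toℕ b) (o (toℕ a)) (Rn ∸ toℕ b)))
       where
       calc1 : ∀ a u w b e z -> a · (u N.+ w) N.+ b N.+ e N.+ z ≡ a · u N.+ b N.+ (a · w N.+ e) N.+ z
       calc1 = solve-∀
       calc2 : ∀ a l i b o z -> a · (l · i) N.+ b · l N.+ (a · (l · i) N.+ o) N.+ l · z ≡ z · l N.+ o N.+ l · (2 · (a · i) N.+ b)
       calc2 = solve-∀
      y-exponent : ∀ b a -> m b a N.+ (N b N.+ o' b a) ≡ e0 N.+ Rn · ℓ N.+ d · (2 · (toℕ a · j0))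
      y-exponent b a = trans (calc1 (toℕ a) (ℓ · i0) (d · j0) (toℕ b) ℓ (Rn ∸ toℕ b) (o (toℕ a)))
       (trans (cong2 (\ t s -> t N.+ toℕ a · (d · j0) N.+ s · ℓ) (key (toℕ a) (Fin.toℕ<n a)) (m+[n∸m]≡n (<⇒≤ (Fin.toℕ<n b))))
        (calc2 (toℕ a) d j0 e0 (Rn · ℓ)))
       where
       calc1 : ∀ a u w b l z o -> a · (u N.+ w) N.+ b · l N.+ (z · l N.+ o) ≡ a · u N.+ o N.+ a · w N.+ (b N.+ z) · l
       calc1 = solve-∀
       calc2 : ∀ a d j e z -> a · (d · j) N.+ e N.+ a · (d · j) N.+ z ≡ e N.+ z N.+ d · (2 · (a · j))
       calc2 = solve-∀
    bound : ∀ ps -> Unique (rs ps) -> All Pair ps -> length ps · Λ ≤ 18 · ℓ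
    bound ps u c = *-cancelʳ-≤ (length ps · Λ) (18 · ℓ) B1 {{N.>-nonZero 1≤B₁}} (begin
     length ps · Λ · B1 ≡⟨ calc1 (length ps) Λ ⟩
     length ps · Λ³ ≡⟨ cong (_· Λ³) (List.length-map _ ps) ⟨
     length (rs ps) · Λ³ <⟨ Fam.stepanov-bound Λ³ 0 Mm one (\ _ _ -> Deg<-const) m≤ (char Λ³ ≤-refl) enough (rs ps) u (All.map⁺ (All.map (\ {q} -> is-target) c)) ⟩
     Λ³ N.+ (Mm N.+ Nn) ≡⟨ calc2 Λ ℓ ⟩
     3 · Λ³ N.+ 16 · Λ²ℓ ≤⟨ +-monoˡ-≤ (16 · Λ²ℓ) (≤-trans (*-monoˡ-≤ Λ³ (m≤m+n 3 3)) (≤-trans Λ³≤ℓ ℓ≤Λ²ℓ)) ⟩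
     Λ²ℓ N.+ 16 · Λ²ℓ ≤⟨ m≤n+m (17 · Λ²ℓ) Λ²ℓ ⟩
     18 · Λ²ℓ ≡⟨ calc3 Λ ℓ ⟩
     18 · ℓ · B1 ∎)
     where
     open ≤R
     calc1 : ∀ n L -> n · L · (L · L) ≡ n · (L · L · L)
     calc1 = solve-∀
     calc2 : ∀ L l -> (L · L · L) N.+ (12 · (L · L · l) N.+ (2 · L · (2 · L) · l N.+ 2 · L · (L · L))) ≡ 3 · (L · L · L) N.+ 16 · (L · L · l)
     calc2 = solve-∀
     calc3 : ∀ L l -> 18 · (L · L · l) ≡ 18 · l · (L · L)
     calc3 = solve-∀
   private
    near-bound : ∀ i0 j0 -> 0 < i0 -> i0 < J0 -> j0 < J0 -> Close i0 j0 -> ∀ ps -> Unique (rs ps) -> All Pair ps -> length ps · Λ ≤ 18 · ℓ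
    near-bound i0 j0 0<i₀ i0< j0< (c1 , c2) = [ ascending , descending ]′ (≤-total (ℓ · i0) (d · j0))
     where
     ascending : ℓ · i0 ≤ d · j0 -> ∀ ps -> Unique (rs ps) -> All Pair ps -> length ps · Λ ≤ 18 · ℓ
     ascending le = Near.bound i0 j0 0 0<i₀ i0< j0< (\ a -> a · δ)
      (\ a a< -> *-mono-≤ (<⇒≤ a<) (m≤n+o⇒m∸n≤o (d · j0) (ℓ · i0) (<⇒≤ c1)))
      (\ a a< -> trans (sym (N.*-distribˡ-+ a _ δ)) (trans (cong (a ·_) (m+[n∸m]≡n le)) (sym (N.+-identityʳ _))))
      where δ = d · j0 ∸ ℓ · i0
     descending : d · j0 ≤ ℓ · i0 -> ∀ ps -> Unique (rs ps) -> All Pair ps -> length ps · Λ ≤ 18 · ℓ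
     -- The offsets must be natural numbers, so the multiples of δ are counted downwards from J0 δ,
     -- which `e0` compensates.
     descending le = Near.bound i0 j0 (J0 · δ) 0<i₀ i0< j0< (\ a -> (J0 ∸ a) · δ)
      (\ a a< -> *-mono-≤ (m∸n≤m J0 a) (m≤n+o⇒m∸n≤o (ℓ · i0) (d · j0) (<⇒≤ c2)))
      (\ a a< -> trans (cong (\ t -> a · t N.+ (J0 ∸ a) · δ) (sym (m+[n∸m]≡n le))) (trans (calc a (d · j0) δ (J0 ∸ a)) (cong (\ t -> a · (d · j0) N.+ t · δ) (m+[n∸m]≡n (<⇒≤ a<)))))
      where
      δ = ℓ · i0 ∸ d · j0
      calc : ∀ a w δ z -> a · (w N.+ δ) N.+ z · δ ≡ a · w N.+ (a N.+ z) · δ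
      calc = solve-∀
    Resonance : Set
    Resonance = Σ (Fin J0) \ i -> Σ (Fin J0) \ j -> 0 < toℕ i × 0 < toℕ j × Close (toℕ i) (toℕ j)
    resonance? : Dec Resonance
    resonance? = Fin.any? \ i -> Fin.any? \ j -> (0 N.<? toℕ i) ×-dec (0 N.<? toℕ j) ×-dec close? (toℕ i) (toℕ j)
   -- Distinctness is required of the products x y, since the auxiliary polynomial is a polynomial
   -- in r.
   subgroup-bound : ∀ ps -> Unique (map (\ { (x , y) -> x * y }) ps) -> All Pair ps -> length ps · Λ ≤ 18 · ℓ
   subgroup-bound with resonance?
   ... | yes (i , j , 0<i , 0<j , c) = near-bound (toℕ i) (toℕ j) 0<i (Fin.toℕ<n i) (Fin.toℕ<n j) c
   ... | no none = Far.bound \ i j 0<i i< 0<j j< c -> none (Fin.fromℕ< i< , Fin.fromℕ< j< ,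
     subst (0 <_) (sym (Fin.toℕ-fromℕ< i<)) 0<i , subst (0 <_) (sym (Fin.toℕ-fromℕ< j<)) 0<j ,
     subst₂ Close (sym (Fin.toℕ-fromℕ< i<)) (sym (Fin.toℕ-fromℕ< j<)) c)

-- Stepanov's method for whole tori, with relations from the p-th power.

module End (K : Field) (p : ℕ) (cast≢0 : ∀ n -> 0 < n -> n < p -> FieldProps.cast K n ≢ Field.0# K) where
 open import Data.Nat using (_/_; _%_; NonZero)
 open import Data.Nat.DivMod using (m≡m%n+[m/n]*n; m%n<n)
 open import Data.Fin using (Fin; zero; suc; toℕ; remQuot; combine)
 open import Relation.Binary.Definitions using (tri<; tri≈; tri>)

 open FieldProps K
 open Poly K using (Poly; const; eval; eval-const; eval-**; eval-^^; _**_; _^^_; Deg<; Deg<-const; Deg<-**; Deg<-^^; Deg<-linear; Deg<-mono)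
 open Stepanov K using (X; eval-X)
 open Bound K using (module Frame)
 open Middle K p cast≢0 using (cast-injective; module Curve)

 module Single (u0 u1 v0 v1 z z' : Carrier) (u1≢0 : u1 ≢ 0#) (v1≢0 : v1 ≢ 0#)
  (u-root : eval (u0 ∷ u1 ∷ []) z ≡ 0#) (v-root : eval (v0 ∷ v1 ∷ []) z' ≡ 0#)
  (z≢0 : z ≢ 0#) (vz≢0 : eval (v0 ∷ v1 ∷ []) z ≢ 0#) where
  open Frame u0 u1 v0 v1 z z' u1≢0 v1≢0 u-root v-root z≢0 vz≢0 public
  -- One column and M + 1 rows for order of vanishing `M`: the unknowns exceed the conditions by B -
  -- M (2 M + J), which `big` makes positive.
  module Rows (M B J Nn Mm : ℕ) (m N : Fin (suc M) -> ℕ) (ρ : Fin (suc M) -> Poly) (ρ-deg : ∀ e -> Deg< (suc J) (ρ e))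
   (N≤ : ∀ e -> N e ≤ Nn) (m≤ : ∀ e -> m e ≤ Mm)
   (gap : ∀ e e' -> e ≢ e' -> N e N.+ B ≤ N e' ⊎ N e' N.+ B ≤ N e) (B<p : B < p)
   (big : M · (2 · M N.+ J) < B) where
   Target : Carrier -> Set
   Target r = r ≢ 0# × eval u r ≢ 0# × eval v r ≢ 0# × Σ Carrier \ ω -> ∀ e ->
    r ^ m e * eval u r ^ N e * eval v r ^ (Nn ∸ N e) ≡ ω * eval (ρ e) r
   private
    dist : ∀ e (a a' : Fin 1) i i' -> i < B N.+ 0 -> i' < B N.+ 0 -> cast (m e N.+ i) ≡ cast (m e N.+ i') -> a ≡ a' × i ≡ i'
    dist e zero zero i i' i< i'< eq = refl , cast-injective i i' (small i<) (small i'<)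
     (x-y≡0⇒x≡y (trans (solve 3 (\ m x y -> x :- y := (m :+ x) :- (m :+ y)) refl (cast (m e)) (cast i) (cast i'))
      (x≡y⇒x-y≡0 (trans (sym (cast-+ (m e) i)) (trans eq (cast-+ (m e) i'))))))
     where
     small : ∀ {i} -> i < B N.+ 0 -> i < p
     small i< = <-trans (<-≤-trans i< (≤-eq (N.+-identityʳ B))) B<p
    module Fam = Family (suc M) 1 B 0 B Nn (\ e _ -> m e) (\ _ _ -> 0) N (\ _ _ -> z≤n)
     (\ e -> ≤-trans (≤-eq (N.+-identityʳ (N e))) (N≤ e)) gap dist
     (≤-eq (trans (N.*-identityˡ (B N.+ 0)) (N.+-identityʳ B))) (≤-<-trans z≤n big)
    enough : M · (B N.+ 2 · M N.+ J) < suc M · 1 · B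
    enough = ≤-<-trans (≤-eq (calc1 M B J)) (<-≤-trans (+-monoʳ-< (M · B) big) (≤-eq (calc2 M B)))
     where
     calc1 : ∀ M B J -> M · (B N.+ 2 · M N.+ J) ≡ M · B N.+ M · (2 · M N.+ J)
     calc1 = solve-∀
     calc2 : ∀ M B -> M · B N.+ B ≡ suc M · 1 · B
     calc2 = solve-∀
    char : ∀ i -> i < M -> cast (suc i) ≢ 0#
    char i i<M = cast≢0 (suc i) (s≤s z≤n) (≤-<-trans i<M (<-trans (≤-<-trans M≤ big) B<p))
     where
     M≤ : M ≤ M · (2 · M N.+ J)
     M≤ = ≤-trans (≤-eq (sym (N.*-identityʳ M))) (*-monoʳ-≤ M (≤-trans (≤-trans (s≤s z≤n) i<M) (≤-trans (m≤n*m M 2) (m≤m+n _ J))))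
    convert : ∀ {r} -> Target r -> Fam.Target M J Mm (\ e _ -> ρ e) (\ e _ -> ρ-deg e) (\ e _ -> m≤ e) char enough r
    convert {r} (a , b , c , ω , W≡) = a , b , c , ω , \ e _ ->
     trans (cong (\ n -> r ^ m e * eval u r ^ n * eval v r ^ (Nn ∸ n)) (N.+-identityʳ (N e))) (W≡ e)
   bound : ∀ rs -> Unique rs -> All Target rs -> length rs · M < B N.+ (Mm N.+ Nn)
   bound rs uq ts = Fam.stepanov-bound M J Mm (\ e _ -> ρ e) (\ e _ -> ρ-deg e) (\ e _ -> m≤ e) char enough rs uq (All.map convert ts)
  -- The situation where x and y lie in tori of different type: the p-th power exchanges r with s,
  -- which is y / x or x / y.
  record MixedTarget (h : ℕ) (c r : Carrier) : Set where
   field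
    s : Carrier
    r≢0 : r ≢ 0#
    u≢0 : eval u r ≢ 0#
    v≢0 : eval v r ≢ 0#
    s*v : s * eval v r ≡ eval u r
    r^p : r ^ p ≡ s
    s^p : s ^ p ≡ r
    r^h : r ^ h ≡ c
  -- Here r ^ m s ^ N = r ^ (m + p N). The rows are chosen so that m + p N = h I + p² T with I < κ
  -- and T < J; since r ^ (p²) = r, the value is c ^ I r ^ T, of degree below `J`. As κ h = p² - 1,
  -- these numbers are at least h apart.
  module MixedRows (κ J h : ℕ) (κh : suc (κ · h) ≡ p · p) (0<κ : 0 < κ) (0<J : 0 < J)
   (B≤ : p · suc (3 · (κ · J · (κ · J))) ≤ h) (B<p : 3 · (κ · J · (κ · J)) < p) (c : Carrier) where
   private
    instance
     p-nonZero : NonZero p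
     p-nonZero = N.>-nonZero (≤-<-trans z≤n B<p)
    B = 3 · (κ · J · (κ · J))
    M = κ · J ∸ 1
    1≤κJ : 1 ≤ κ · J
    1≤κJ = *-mono-≤ 0<κ 0<J
    sucM : suc M ≡ κ · J
    sucM = m+[n∸m]≡n 1≤κJ
    index : Fin (suc M) -> Fin κ × Fin J
    index e = remQuot J (subst Fin sucM e)
    index-injective : ∀ e e' -> index e ≡ index e' -> e ≡ e'
    index-injective e e' eq = subst-injective sucM (trans (sym (Fin.combine-remQuot {κ} J (subst Fin sucM e)))
      (trans (cong (\ q -> combine (fst q) (snd q)) eq) (Fin.combine-remQuot {κ} J (subst Fin sucM e'))))
    I T : Fin (suc M) -> ℕ
    I e = toℕ (fst (index e))
    T e = toℕ (snd (index e))
    m N V : Fin (suc M) -> ℕ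
    m e = (h · I e) % p
    N e = (h · I e) / p N.+ p · T e
    V e = h · I e N.+ p · p · T e
    V≡ : ∀ e -> V e ≡ m e N.+ p · N e
    V≡ e = trans (cong (N._+ p · p · T e) (m≡m%n+[m/n]*n (h · I e) p)) (calc (m e) ((h · I e) / p) p (T e))
     where
     calc : ∀ m q p t -> m N.+ q · p N.+ p · p · t ≡ m N.+ p · (q N.+ p · t)
     calc = solve-∀
    I<κ : ∀ e -> I e < κ
    I<κ e = Fin.toℕ<n (fst (index e))
    hI : ∀ e -> h · I e N.+ h < p · p
    hI e = ≤-trans (s≤s (≤-trans (≤-eq (trans (N.+-comm (h · I e) h) (trans (sym (*-suc h (I e))) (N.*-comm h _)))) (*-monoˡ-≤ h (I<κ e)))) (≤-eq κh)
    V-gap : ∀ e e' -> T e < T e' ⊎ (T e ≡ T e' × I e < I e') -> V e N.+ h ≤ V e'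
    V-gap e e' (inl lt) = begin
     h · I e N.+ p · p · T e N.+ h ≡⟨ calc (h · I e) (p · p · T e) h ⟩
     h · I e N.+ h N.+ p · p · T e ≤⟨ +-monoˡ-≤ _ (<⇒≤ (hI e)) ⟩
     p · p N.+ p · p · T e ≡⟨ *-suc (p · p) (T e) ⟨
     p · p · suc (T e) ≤⟨ *-monoʳ-≤ (p · p) lt ⟩
     p · p · T e' ≤⟨ m≤n+m _ (h · I e') ⟩
     V e' ∎
     where
     open ≤R
     calc : ∀ a b c -> a N.+ b N.+ c ≡ a N.+ c N.+ b
     calc = solve-∀
    V-gap e e' (inr (t , lt)) = begin
     h · I e N.+ p · p · T e N.+ h ≡⟨ calc h (I e) (p · p · T e) ⟩
     h · suc (I e) N.+ p · p · T e ≤⟨ +-mono-≤ (*-monoʳ-≤ h lt) (≤-eq (cong (p · p ·_) t)) ⟩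
     V e' ∎
     where
     open ≤R
     calc : ∀ h i c -> h · i N.+ c N.+ h ≡ h · suc i N.+ c
     calc = solve-∀
    -- Passing from V to its quotient by p loses less than 1; the `suc` in `B≤` pays for it.
    N-gap : ∀ e e' -> V e N.+ h ≤ V e' -> N e N.+ B ≤ N e'
    N-gap e e' le = *-cancelˡ-≤ p (<⇒≤ (+-cancelˡ-< p _ _ (begin-strict
     p N.+ p · (N e N.+ B) ≡⟨ calc p (N e) B ⟩
     p · N e N.+ p · suc B ≤⟨ +-monoʳ-≤ (p · N e) B≤ ⟩
     p · N e N.+ h ≤⟨ +-monoˡ-≤ h (≤-trans (m≤n+m _ (m e)) (≤-eq (sym (V≡ e)))) ⟩
     V e N.+ h ≤⟨ le ⟩
     V e' ≡⟨ V≡ e' ⟩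
     m e' N.+ p · N e' <⟨ +-monoˡ-< (p · N e') (m%n<n (h · I e') p) ⟩
     p N.+ p · N e' ∎)))
     where
     open ≤R
     calc : ∀ p n B -> p N.+ p · (n N.+ B) ≡ p · n N.+ p · suc B
     calc = solve-∀
    gap : ∀ e e' -> e ≢ e' -> N e N.+ B ≤ N e' ⊎ N e' N.+ B ≤ N e
    gap e e' ne with <-cmp (T e) (T e')
    ... | tri< lt _ _ = inl (N-gap e e' (V-gap e e' (inl lt)))
    ... | tri> _ _ gt = inr (N-gap e' e (V-gap e' e (inl gt)))
    ... | tri≈ _ t _ with <-cmp (I e) (I e')
    ...   | tri< lt _ _ = inl (N-gap e e' (V-gap e e' (inr (t , lt))))
    ...   | tri> _ _ gt = inr (N-gap e' e (V-gap e' e (inr (sym t , gt))))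
    ...   | tri≈ _ i _ = ⊥-elim (ne (index-injective e e' (cong2 _,_ (Fin.toℕ-injective i) (Fin.toℕ-injective t))))
    Nn = p · J
    N≤ : ∀ e -> N e ≤ Nn
    N≤ e = *-cancelˡ-≤ p (≤-trans (m≤n+m _ (m e)) (≤-trans (≤-eq (sym (V≡ e)))
     (≤-trans (+-monoˡ-≤ _ (≤-trans (m≤m+n _ h) (<⇒≤ (hI e)))) (≤-trans (≤-eq (sym (*-suc (p · p) (T e))))
      (≤-trans (*-monoʳ-≤ (p · p) (Fin.toℕ<n (snd (index e)))) (≤-eq (N.*-assoc p p J)))))))
    ρ : Fin (suc M) -> Poly
    ρ e = const (c ^ I e) ** X ^^ T e
    ρ-deg : ∀ e -> Deg< (suc J) (ρ e)
    ρ-deg e = Deg<-** {1} {J} Deg<-const (Deg<-mono (s≤s (≤-trans (≤-eq (N.*-identityʳ (T e))) (<⇒≤ (Fin.toℕ<n (snd (index e)))))) (Deg<-^^ {1} (T e) Deg<-linear))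
    big : M · (2 · M N.+ J) < B
    big = begin-strict
     M · (2 · M N.+ J) ≤⟨ *-monoʳ-≤ M (+-mono-≤ (*-monoʳ-≤ 2 (m∸n≤m (κ · J) 1)) (m≤n*m J κ {{N.>-nonZero 0<κ}})) ⟩
     M · (2 · (κ · J) N.+ κ · J) <⟨ *-monoˡ-< _ {{N.>-nonZero (≤-trans 1≤κJ (m≤n+m _ _))}} (≤-eq sucM) ⟩
     κ · J · (2 · (κ · J) N.+ κ · J) ≡⟨ calc (κ · J) ⟩
     B ∎
     where
     open ≤R
     calc : ∀ k -> k · (2 · k N.+ k) ≡ 3 · (k · k)
     calc = solve-∀
    module Rw = Rows M B J Nn p m N ρ ρ-deg N≤ (\ e -> <⇒≤ (m%n<n (h · I e) p)) gap B<p big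
    convert : ∀ {r} -> MixedTarget h c r -> Rw.Target r
    convert {r} t = r≢0 , u≢0 , v≢0 , eval v r ^ Nn , \ e -> begin
     r ^ m e * eval u r ^ N e * eval v r ^ (Nn ∸ N e) ≡⟨ cong (\ w -> r ^ m e * w ^ N e * eval v r ^ (Nn ∸ N e)) s*v ⟨
     r ^ m e * (s * eval v r) ^ N e * eval v r ^ (Nn ∸ N e) ≡⟨ cong (\ w -> r ^ m e * w * eval v r ^ (Nn ∸ N e)) (^-distrib-* s (eval v r) (N e)) ⟩
     r ^ m e * (s ^ N e * eval v r ^ N e) * eval v r ^ (Nn ∸ N e) ≡⟨ solve 4 (\ a b c d -> a :* (b :* c) :* d := (a :* b) :* (c :* d)) refl (r ^ m e) (s ^ N e) (eval v r ^ N e) (eval v r ^ (Nn ∸ N e)) ⟩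
     r ^ m e * s ^ N e * (eval v r ^ N e * eval v r ^ (Nn ∸ N e)) ≡⟨ cong2 _*_ (value e) (trans (sym (^-homo-* (eval v r) (N e) (Nn ∸ N e))) (cong (eval v r ^_) (m+[n∸m]≡n (N≤ e)))) ⟩
     c ^ I e * r ^ T e * eval v r ^ Nn ≡⟨ *-comm _ _ ⟩
     eval v r ^ Nn * (c ^ I e * r ^ T e) ≡⟨ cong (eval v r ^ Nn *_) (trans (eval-** (const (c ^ I e)) (X ^^ T e) r) (cong2 _*_ (eval-const _ r) (trans (eval-^^ X (T e) r) (cong (_^ T e) (eval-X r))))) ⟨
     eval v r ^ Nn * eval (ρ e) r ∎
     where
     open ≡R
     open MixedTarget t
     value : ∀ e -> r ^ m e * s ^ N e ≡ c ^ I e * r ^ T e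
     value e = begin
      r ^ m e * s ^ (Q N.+ p · T e) ≡⟨ cong (r ^ m e *_) (^-homo-* s Q (p · T e)) ⟩
      r ^ m e * (s ^ Q * s ^ (p · T e)) ≡⟨ cong2 (\ a b -> r ^ m e * (a * b)) (trans (cong (_^ Q) (sym r^p)) (^-assocʳ r p Q)) (trans (sym (^-assocʳ s p (T e))) (cong (_^ T e) s^p)) ⟩
      r ^ m e * (r ^ (p · Q) * r ^ T e) ≡⟨ *-assoc _ _ _ ⟨
      r ^ m e * r ^ (p · Q) * r ^ T e ≡⟨ cong (_* r ^ T e) (trans (sym (^-homo-* r (m e) (p · Q))) (cong (r ^_) (trans (cong (m e N.+_) (N.*-comm p Q)) (sym (m≡m%n+[m/n]*n (h · I e) p))))) ⟩
      r ^ (h · I e) * r ^ T e ≡⟨ cong (_* r ^ T e) (trans (sym (^-assocʳ r h (I e))) (cong (_^ I e) r^h)) ⟩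
      c ^ I e * r ^ T e ∎
      where Q = (h · I e) / p
   mixed-bound : ∀ rs -> Unique rs -> All (MixedTarget h c) rs -> length rs · (κ · J ∸ 1) ≤ p · (2 N.+ J)
   mixed-bound rs uq ts = ≤-trans (<⇒≤ (Rw.bound rs uq (All.map convert ts))) (≤-trans (+-monoˡ-≤ _ (<⇒≤ B<p)) (≤-eq (calc p J)))
    where
    calc : ∀ p J -> p N.+ (p N.+ p · J) ≡ p · (2 N.+ J)
    calc = solve-∀
  -- The situation where x and y lie in the same torus: r s = y² is killed by half the order of the
  -- torus, and s ^ p is s or 1 / s.
  record SameTarget (n' : ℕ) {J : ℕ} (τ : Fin J -> Poly) (r : Carrier) : Set where
   field
    s ω : Carrier
    r≢0 : r ≢ 0#
    u≢0 : eval u r ≢ 0#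
    v≢0 : eval v r ≢ 0#
    s*v : s * eval v r ≡ eval u r
    rs^n' : (r * s) ^ n' ≡ 1#
    s^pt : ∀ t -> (s ^ p) ^ toℕ t ≡ ω * eval (τ t) r
  -- With m = n' I and N = n' I + p T the factor (r s) ^ (n' I) is 1, so r ^ m s ^ N = (s ^ p) ^ T.
  -- After clearing one common denominator this has degree at most `J` in r. Two values of I give 2
  -- J rows.
  module SameRows (J n' : ℕ) (0<J : 0 < J) (n'≤p : n' ≤ p) (B≤n' : 3 · (2 · J · (2 · J)) ≤ n')
   (B+n'≤p : n' N.+ 3 · (2 · J · (2 · J)) ≤ p) (τ : Fin J -> Poly) (τ-deg : ∀ t -> Deg< (suc J) (τ t)) where
   private
    κ = 2
    B = 3 · (κ · J · (κ · J))
    M = κ · J ∸ 1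
    1≤κJ : 1 ≤ κ · J
    1≤κJ = *-mono-≤ {1} {2} (s≤s z≤n) 0<J
    sucM : suc M ≡ κ · J
    sucM = m+[n∸m]≡n 1≤κJ
    1≤B : 1 ≤ B
    1≤B = ≤-trans (*-mono-≤ 1≤κJ 1≤κJ) (m≤n*m _ 3)
    B<p : B < p
    B<p = <-≤-trans (m<n+m B {n'} (≤-trans 1≤B B≤n')) B+n'≤p
    index : Fin (suc M) -> Fin κ × Fin J
    index e = remQuot J (subst Fin sucM e)
    index-injective : ∀ e e' -> index e ≡ index e' -> e ≡ e'
    index-injective e e' eq = subst-injective sucM (trans (sym (Fin.combine-remQuot {κ} J (subst Fin sucM e)))
      (trans (cong (\ q -> combine (fst q) (snd q)) eq) (Fin.combine-remQuot {κ} J (subst Fin sucM e'))))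
    I T : Fin (suc M) -> ℕ
    I e = toℕ (fst (index e))
    T e = toℕ (snd (index e))
    I≤1 : ∀ e -> I e ≤ 1
    I≤1 e = <⇒≤pred (Fin.toℕ<n (fst (index e)))
    m N : Fin (suc M) -> ℕ
    m e = n' · I e
    N e = n' · I e N.+ p · T e
    m≤n' : ∀ e -> m e ≤ n'
    m≤n' e = ≤-trans (*-monoʳ-≤ n' (I≤1 e)) (≤-eq (N.*-identityʳ n'))
    N-gap : ∀ e e' -> T e < T e' ⊎ (T e ≡ T e' × I e < I e') -> N e N.+ B ≤ N e'
    N-gap e e' (inl lt) = begin
     n' · I e N.+ p · T e N.+ B ≡⟨ calc (n' · I e) (p · T e) B ⟩
     n' · I e N.+ B N.+ p · T e ≤⟨ +-monoˡ-≤ _ (≤-trans (+-monoˡ-≤ B (m≤n' e)) B+n'≤p) ⟩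
     p N.+ p · T e ≡⟨ *-suc p (T e) ⟨
     p · suc (T e) ≤⟨ *-monoʳ-≤ p lt ⟩
     p · T e' ≤⟨ m≤n+m _ (n' · I e') ⟩
     N e' ∎
     where
     open ≤R
     calc : ∀ a b c -> a N.+ b N.+ c ≡ a N.+ c N.+ b
     calc = solve-∀
    N-gap e e' (inr (t , lt)) = begin
     n' · I e N.+ p · T e N.+ B ≤⟨ +-monoʳ-≤ _ B≤n' ⟩
     n' · I e N.+ p · T e N.+ n' ≡⟨ calc n' (I e) (p · T e) ⟩
     n' · suc (I e) N.+ p · T e ≤⟨ +-mono-≤ (*-monoʳ-≤ n' lt) (≤-eq (cong (p ·_) t)) ⟩
     N e' ∎
     where
     open ≤R
     calc : ∀ h i c -> h · i N.+ c N.+ h ≡ h · suc i N.+ c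
     calc = solve-∀
    gap : ∀ e e' -> e ≢ e' -> N e N.+ B ≤ N e' ⊎ N e' N.+ B ≤ N e
    gap e e' ne with <-cmp (T e) (T e')
    ... | tri< lt _ _ = inl (N-gap e e' (inl lt))
    ... | tri> _ _ gt = inr (N-gap e' e (inl gt))
    ... | tri≈ _ t _ with <-cmp (I e) (I e')
    ...   | tri< lt _ _ = inl (N-gap e e' (inr (t , lt)))
    ...   | tri> _ _ gt = inr (N-gap e' e (inr (sym t , gt)))
    ...   | tri≈ _ i _ = ⊥-elim (ne (index-injective e e' (cong2 _,_ (Fin.toℕ-injective i) (Fin.toℕ-injective t))))
    Nn = p · J
    N≤ : ∀ e -> N e ≤ Nn
    N≤ e = ≤-trans (+-monoˡ-≤ _ (≤-trans (m≤n' e) n'≤p)) (≤-trans (≤-eq (sym (*-suc p (T e)))) (*-monoʳ-≤ p (Fin.toℕ<n (snd (index e)))))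
    ρ : Fin (suc M) -> Poly
    ρ e = τ (snd (index e))
    big : M · (2 · M N.+ J) < B
    big = begin-strict
     M · (2 · M N.+ J) ≤⟨ *-monoʳ-≤ M (+-mono-≤ (*-monoʳ-≤ 2 (m∸n≤m (κ · J) 1)) (m≤n*m J κ)) ⟩
     M · (2 · (κ · J) N.+ κ · J) <⟨ *-monoˡ-< _ {{N.>-nonZero (≤-trans 1≤κJ (m≤n+m (κ · J) (2 · (κ · J))))}} (≤-eq sucM) ⟩
     κ · J · (2 · (κ · J) N.+ κ · J) ≡⟨ calc (κ · J) ⟩
     B ∎
     where
     open ≤R
     calc : ∀ k -> k · (2 · k N.+ k) ≡ 3 · (k · k)
     calc = solve-∀
    module Rw = Rows M B J Nn p m N ρ (\ e -> τ-deg (snd (index e))) N≤ (\ e -> ≤-trans (m≤n' e) n'≤p) gap B<p big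
    convert : ∀ {r} -> SameTarget n' τ r -> Rw.Target r
    convert {r} t = r≢0 , u≢0 , v≢0 , eval v r ^ Nn * ω , \ e -> begin
     r ^ m e * eval u r ^ N e * eval v r ^ (Nn ∸ N e) ≡⟨ cong (\ w -> r ^ m e * w ^ N e * eval v r ^ (Nn ∸ N e)) s*v ⟨
     r ^ m e * (s * eval v r) ^ N e * eval v r ^ (Nn ∸ N e) ≡⟨ cong (\ w -> r ^ m e * w * eval v r ^ (Nn ∸ N e)) (^-distrib-* s (eval v r) (N e)) ⟩
     r ^ m e * (s ^ N e * eval v r ^ N e) * eval v r ^ (Nn ∸ N e) ≡⟨ solve 4 (\ a b c d -> a :* (b :* c) :* d := (a :* b) :* (c :* d)) refl (r ^ m e) (s ^ N e) (eval v r ^ N e) (eval v r ^ (Nn ∸ N e)) ⟩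
     r ^ m e * s ^ N e * (eval v r ^ N e * eval v r ^ (Nn ∸ N e)) ≡⟨ cong2 _*_ (value e) (trans (sym (^-homo-* (eval v r) (N e) (Nn ∸ N e))) (cong (eval v r ^_) (m+[n∸m]≡n (N≤ e)))) ⟩
     ω * eval (ρ e) r * eval v r ^ Nn ≡⟨ solve 3 (\ a b c -> a :* b :* c := c :* a :* b) refl ω (eval (ρ e) r) (eval v r ^ Nn) ⟩
     eval v r ^ Nn * ω * eval (ρ e) r ∎
     where
     open ≡R
     open SameTarget t
     value : ∀ e -> r ^ m e * s ^ N e ≡ ω * eval (ρ e) r
     value e = begin
      r ^ m e * s ^ (m e N.+ p · T e) ≡⟨ cong (r ^ m e *_) (^-homo-* s (m e) (p · T e)) ⟩
      r ^ m e * (s ^ m e * s ^ (p · T e)) ≡⟨ *-assoc _ _ _ ⟨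
      r ^ m e * s ^ m e * s ^ (p · T e) ≡⟨ cong2 _*_ (trans (sym (^-distrib-* r s (m e))) (^-*-≡1 n' (I e) rs^n')) (sym (^-assocʳ s p (T e))) ⟩
      1# * (s ^ p) ^ T e ≡⟨ *-identityˡ _ ⟩
      (s ^ p) ^ T e ≡⟨ s^pt (snd (index e)) ⟩
      ω * eval (ρ e) r ∎
   same-bound : ∀ rs -> Unique rs -> All (SameTarget n' τ) rs -> length rs · (2 · J ∸ 1) ≤ p · (2 N.+ J)
   same-bound rs uq ts = ≤-trans (<⇒≤ (Rw.bound rs uq (All.map convert ts))) (≤-trans (+-monoˡ-≤ _ (<⇒≤ B<p)) (≤-eq (calc p J)))
    where
    calc : ∀ p J -> p N.+ (p N.+ p · J) ≡ p · (2 N.+ J)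
    calc = solve-∀

-- Parameters of coordinates, and the points of a conic.

module Conic (S : Setting) where
 open import Data.Fin using (Fin; toℕ)

 open Tori S
 open K
 open Poly K using (Poly; eval; eval-**; eval-^^; _**_; _^^_; Deg<; Deg<-**; Deg<-^^; Deg<-linear; Deg<-mono)
 open Middle K p cast≢0 using (module Curve)
 open End K p cast≢0 using (module Single)

 ι-num4 : ι (F.num 4) ≡ num 4
 ι-num4 = trans (ι-+ _ _) (cong2 _+_ (trans (ι-+ _ _) (cong2 _+_ (trans (ι-+ _ _) (cong2 _+_ ι-1 ι-1)) ι-1)) ι-1)

 disc : F.Carrier -> F.Carrier
 disc b = b F.* b F.- F.num 4

 w : F.Carrier -> Carrier
 w b = sqrt (disc b)

 w² : ∀ b -> w b * w b ≡ ι b * ι b - num 4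
 w² b = trans (sqrt² (disc b)) (trans (ι-+ _ _) (cong2 _+_ (ι-* b b) (trans (ι-neg _) (cong (\ t -> - t) ι-num4))))

 4½½ : num 4 * (½ * ½) ≡ 1#
 4½½ = trans (solve 1 (\ h -> lit 4 :* (h :* h) := (lit 2 :* h) :* (lit 2 :* h)) refl ½) (trans (cong2 _*_ 2½ 2½) (*-identityˡ 1#))

 σ-num2 : σ (num 2) ≡ num 2
 σ-num2 = trans (σ-+ _ _) (cong2 _+_ σ-1 σ-1)

 σ-½ : σ ½ ≡ ½
 σ-½ = *-cancelˡ 2≢0 (trans (cong (_* σ ½) (sym σ-num2)) (trans (σ-⁻¹ 2≢0) (sym 2½)))

 opaque
  Y Y' : F.Carrier -> Carrier
  Y b = (ι b + w b) * ½
  Y' b = (ι b - w b) * ½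
  YY' : ∀ b -> Y b * Y' b ≡ 1#
  YY' b = begin
   (ι b + w b) * ½ * ((ι b - w b) * ½) ≡⟨ solve 3 (\ b w h -> (b :+ w) :* h :* ((b :- w) :* h) := (b :* b :- w :* w) :* (h :* h)) refl (ι b) (w b) ½ ⟩
   (ι b * ι b - w b * w b) * (½ * ½) ≡⟨ cong (\ t -> (ι b * ι b - t) * (½ * ½)) (w² b) ⟩
   (ι b * ι b - (ι b * ι b - num 4)) * (½ * ½) ≡⟨ solve 2 (\ b h -> (b :* b :- (b :* b :- lit 4)) :* (h :* h) := lit 4 :* (h :* h)) refl (ι b) ½ ⟩
   num 4 * (½ * ½) ≡⟨ 4½½ ⟩
   1# ∎
   where open ≡R
  Y+Y' : ∀ b -> Y b + Y' b ≡ ι b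
  Y+Y' b = trans (solve 3 (\ b w h -> (b :+ w) :* h :+ (b :- w) :* h := b :* (lit 2 :* h)) refl (ι b) (w b) ½) (trans (cong (ι b *_) 2½) (*-identityʳ _))
  Y-Y' : ∀ b -> Y b - Y' b ≡ w b
  Y-Y' b = trans (solve 3 (\ b w h -> (b :+ w) :* h :- (b :- w) :* h := w :* (lit 2 :* h)) refl (ι b) (w b) ½) (trans (cong (w b *_) 2½) (*-identityʳ _))
  -- b and -b have the same discriminant, hence the same chosen square root.
  Y-neg : ∀ b -> Y (F.- b) ≡ - Y' b
  Y-neg b = trans (cong2 (\ s t -> (s + sqrt t) * ½) (ι-neg b) (F.solve 1 (\ b -> (F.:- b) F.:* (F.:- b) F.:- F.lit 4 F.:= b F.:* b F.:- F.lit 4) refl b))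
   (solve 3 (\ b w h -> ((:- b) :+ w) :* h := :- ((b :- w) :* h)) refl (ι b) (w b) ½)
  -- `σ` fixes or negates the square root `w b`, so it either fixes `Y b` or exchanges it with its
  -- inverse `Y' b`.
  Y-torus : ∀ b -> InTorus split (Y b) ⊎ InTorus inert (Y b)
  Y-torus b with sqrt-σ (disc b)
  ... | inl e = inl (*≡1⇒≢0 (YY' b) , trans (σ-* _ _) (cong2 _*_ (trans (σ-+ _ _) (cong2 _+_ (σ-ι b) e)) σ-½))
  ... | inr e = inr (trans (cong (Y b *_) (trans (σ-* _ _) (cong2 _*_ (trans (σ-+ _ _) (cong2 _+_ (σ-ι b) e)) σ-½))) (YY' b))

 Y≢0 : ∀ b -> Y b ≢ 0#
 Y≢0 b = *≡1⇒≢0 (YY' b)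

 Y⁻¹ : ∀ b -> Y b ⁻¹ ≡ Y' b
 Y⁻¹ b = *≡1⇒⁻¹ (YY' b)

 opposite : Type -> Type
 opposite split = inert
 opposite inert = split

 Y-type : ∀ t b -> InTorus t (Y b) ⊎ InTorus (opposite t) (Y b)
 Y-type split b = Y-torus b
 Y-type inert b = [ inr , inl ]′ (Y-torus b)

 -- On the tori the p-th power is read off from the orders p - 1 and p + 1.
 frobenius-split : ∀ {x} -> InTorus split x -> x ^ p ≡ x
 frobenius-split {x} ix = trans (cong (x ^_) (sym (m+[n∸m]≡n (≤-trans (s≤s z≤n) 2<p)))) (trans (cong (x *_) (InTorus-size split ix)) (*-identityʳ x))

 frobenius-nonsplit : ∀ {x} -> InTorus inert x -> x ^ p ≡ x ⁻¹
 frobenius-nonsplit {x} ix = sym (*≡1⇒⁻¹ (InTorus-size inert ix))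

 ⁻¹-involutive : ∀ {x} -> x ≢ 0# -> (x ⁻¹) ⁻¹ ≡ x
 ⁻¹-involutive x≢0 = *≡1⇒⁻¹ (trans (*-comm _ _) (*-inverseʳ x≢0))

 neg-⁻¹ : ∀ {x} -> x ≢ 0# -> (- x) ⁻¹ ≡ - x ⁻¹
 neg-⁻¹ {x} x≢0 = *≡1⇒⁻¹ (trans (solve 2 (\ x i -> (:- x) :* (:- i) := x :* i) refl x (x ⁻¹)) (*-inverseʳ x≢0))

 ⁻¹-^ : ∀ {x} -> x ≢ 0# -> ∀ n -> x ^ n * (x ⁻¹) ^ n ≡ 1#
 ⁻¹-^ x≢0 n = trans (sym (^-distrib-* _ _ n)) (trans (cong (_^ n) (*-inverseʳ x≢0)) (^-1# n))

 module Family (t1 : Type) (α β : Carrier) (α≢0 : α ≢ 0#) (β≢0 : β ≢ 0#) (αβ≢1 : α * β ≢ 1#)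
  (real : ∀ x -> InTorus t1 x -> Σ F.Carrier \ b -> α * x + β * x ⁻¹ ≡ ι b) where
  open Curve α β α≢0 β≢0 αβ≢1 public
  t2 = opposite t1
  private
   -- The preimage of `v` in `F`, with default 0, so that `height` is a total function of x; on the
   -- torus `real` supplies the preimage.
   root : ∀ v -> Dec (σ v ≡ v) -> F.Carrier
   root v (yes e) = fst (σ-fixed v e)
   root v (no _) = F.0#
   root-correct : ∀ v d b -> v ≡ ι b -> ι (root v d) ≡ v
   root-correct v (yes e) b _ = sym (snd (σ-fixed v e))
   root-correct v (no ne) b e = ⊥-elim (ne (trans (cong σ e) (trans (σ-ι b) (sym e))))
  opaque
   height : Carrier -> F.Carrier
   height x = root (α * x + β * x ⁻¹) (σ (α * x + β * x ⁻¹) ≟ (α * x + β * x ⁻¹))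
   height-eq : ∀ {x} -> InTorus t1 x -> ι (height x) ≡ α * x + β * x ⁻¹
   height-eq {x} ix = root-correct _ (σ (α * x + β * x ⁻¹) ≟ (α * x + β * x ⁻¹)) (fst (real x ix)) (snd (real x ix))
  y : Carrier -> Carrier
  y x = Y (height x)
  r : Carrier -> Carrier
  r x = x * y x
  on-curve : ∀ {x} -> InTorus t1 x -> OnCurve x (y x)
  on-curve {x} ix = onCurve (InTorus⇒≢0 t1 ix) (Y≢0 _) (trans (sym (height-eq ix)) (trans (sym (Y+Y' _)) (cong (Y (height x) +_) (sym (Y⁻¹ _)))))
  height-neg : ∀ {x} -> InTorus t1 x -> height (- x) ≡ F.- height x
  height-neg {x} ix = ι-injective (begin
   ι (height (- x)) ≡⟨ height-eq (InTorus-neg t1 ix) ⟩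
   α * - x + β * (- x) ⁻¹ ≡⟨ cong (\ t -> α * - x + β * t) (neg-⁻¹ (InTorus⇒≢0 t1 ix)) ⟩
   α * - x + β * - x ⁻¹ ≡⟨ solve 4 (\ a b x i -> a :* (:- x) :+ b :* (:- i) := :- (a :* x :+ b :* i)) refl α β x (x ⁻¹) ⟩
   - (α * x + β * x ⁻¹) ≡⟨ cong (\ t -> - t) (height-eq ix) ⟨
   - ι (height x) ≡⟨ ι-neg _ ⟨
   ι (F.- height x) ∎)
   where open ≡R
  Regular : Carrier -> Set
  Regular x = disc (height x) ≢ F.0#
  -- Y (-b) = -1 / Y b, so that x and -x give different values of r.
  r-injective : ∀ {x x'} -> InTorus t1 x -> InTorus t1 x' -> Regular x -> r x ≡ r x' -> x ≡ x'
  r-injective {x} {x'} ix ix' reg e = [ (\ z -> z) , (\ z -> ⊥-elim (antipodal z)) ]′ (sqrt-unique squares)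
   where
   s-eq : y x * x ⁻¹ ≡ y x' * x' ⁻¹
   s-eq = *-cancelʳ (v≢0 (on-curve ix)) (trans (möbius (on-curve ix)) (trans (cong (\ t -> α * t - 1#) e) (trans (sym (möbius (on-curve ix'))) (cong (\ t -> y x' * x' ⁻¹ * (t - β)) (sym e)))))
   sq : ∀ {x} -> InTorus t1 x -> x * x * (y x * x ⁻¹) ≡ r x
   sq {x} ix = trans (solve 3 (\ x y i -> x :* x :* (y :* i) := x :* y :* (x :* i)) refl x (y x) (x ⁻¹)) (trans (cong (r x *_) (*-inverseʳ (InTorus⇒≢0 t1 ix))) (*-identityʳ _))
   squares : x * x ≡ x' * x'
   squares = *-cancelʳ (s≢0 (on-curve ix)) (trans (sq ix) (trans e (trans (sym (sq ix')) (cong (x' * x' *_) (sym s-eq)))))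
   antipodal : x ≢ - x'
   antipodal z = reg (ι-injective (trans (sym (sqrt² (disc (height x)))) (trans (cong (\ t -> t * t) w≡0) (trans (zeroʳ 0#) (sym ι-0)))))
    where
    b = height x
    yx' : y x' ≡ - Y' b
    yx' = trans (cong Y (trans (cong height (trans (sym (-‿involutive x')) (cong (\ t -> - t) (sym z)))) (height-neg ix))) (Y-neg b)
    yy : Y b ≡ Y' b
    yy = *-cancelˡ (InTorus⇒≢0 t1 ix) (trans e (trans (cong2 _*_ (trans (sym (-‿involutive x')) (cong (\ t -> - t) (sym z))) yx') (solve 2 (\ x t -> (:- x) :* (:- t) := x :* t) refl x (Y' b))))
    w≡0 : w b ≡ 0#
    w≡0 = trans (sym (Y-Y' b)) (x≡y⇒x-y≡0 yy)
  r-unique : ∀ xs -> Unique xs -> All (\ x -> InTorus t1 x × Regular x) xs -> Unique (map r xs)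
  r-unique [] [] [] = []
  r-unique (x ∷ xs) (nx ∷ u) ((ix , reg) ∷ ps) =
   All.map⁺ (All.zipWith (\ { (ne , (ix' , _)) e -> ne (r-injective ix ix' reg e) }) (nx , ps)) ∷ r-unique xs u ps
  private
   swapped-u-root : eval (- β ∷ 1# ∷ []) β ≡ 0#
   swapped-u-root = trans (eval1 (- β) 1# β) (trans (cong (- β +_) (*-identityˡ β)) (-‿inverseˡ β))
   swapped-v-root : eval (- 1# ∷ α ∷ []) (α ⁻¹) ≡ 0#
   swapped-v-root = trans (eval1 (- 1#) α (α ⁻¹)) (trans (cong (- 1# +_) (*-inverseʳ α≢0)) (-‿inverseˡ 1#))
   swapped-vz : eval (- 1# ∷ α ∷ []) β ≢ 0#
   swapped-vz e = αβ≢1 (x-y≡0⇒x≡y (trans (+-comm _ _) (trans (sym (eval1 (- 1#) α β)) e)))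
   vz : eval (- β ∷ 1# ∷ []) (α ⁻¹) ≢ 0#
   vz e = αβ≢1 (trans (cong (α *_) (sym (x-y≡0⇒x≡y (trans (trans (+-comm _ _) (cong (- β +_) (sym (*-identityˡ (α ⁻¹))))) (trans (sym (eval1 (- β) 1# (α ⁻¹))) e))))) (*-inverseʳ α≢0))
  module St = Single (- 1#) α (- β) 1# (α ⁻¹) β α≢0 1≢0 swapped-v-root swapped-u-root (⁻¹-≢0 α≢0) vz
  -- Exchanging `u` and `v` replaces s by 1 / s. This is the right variable for split x and inert y,
  -- where r ^ p = x / y.
  module Sw = Single (- β) 1# (- 1#) α β (α ⁻¹) 1≢0 α≢0 swapped-u-root swapped-v-root β≢0 swapped-vz
  private
   eval-αr : ∀ t -> eval (- 1# ∷ α ∷ []) t ≡ α * t - 1#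
   eval-αr t = trans (eval1 (- 1#) α t) (+-comm _ _)
   eval-rβ : ∀ t -> eval (- β ∷ 1# ∷ []) t ≡ t - β
   eval-rβ t = trans (eval1 (- β) 1# t) (trans (cong (- β +_) (*-identityˡ t)) (+-comm _ _))
   module At {x : Carrier} (ix : InTorus t1 x) where
    c = on-curve ix
    s = y x * x ⁻¹
    s⁻¹ = x * y x ⁻¹
    rr = r x
    r≢0 : rr ≢ 0#
    r≢0 = *-≢0 (x≢0 c) (y≢0 c)
    v' : eval (- β ∷ 1# ∷ []) rr ≢ 0#
    v' e = v≢0 c (trans (sym (eval-rβ rr)) e)
    s*v : s * eval (- β ∷ 1# ∷ []) rr ≡ eval (- 1# ∷ α ∷ []) rr
    s*v = trans (cong (s *_) (eval-rβ rr)) (trans (möbius c) (sym (eval-αr rr)))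
    u' : eval (- 1# ∷ α ∷ []) rr ≢ 0#
    u' e = *-≢0 (s≢0 c) v' (trans s*v e)
    ss⁻¹ : s⁻¹ * s ≡ 1#
    ss⁻¹ = trans (solve 4 (\ x y i j -> x :* j :* (y :* i) := (x :* i) :* (y :* j)) refl x (y x) (x ⁻¹) (y x ⁻¹)) (trans (cong2 _*_ (*-inverseʳ (x≢0 c)) (*-inverseʳ (y≢0 c))) (*-identityˡ 1#))
    s⁻¹*u : s⁻¹ * eval (- 1# ∷ α ∷ []) rr ≡ eval (- β ∷ 1# ∷ []) rr
    s⁻¹*u = trans (cong (s⁻¹ *_) (sym s*v)) (trans (sym (*-assoc _ _ _)) (trans (*-congʳ ss⁻¹) (*-identityˡ _)))
  module Mixed (ℓ1 ℓ2 κ J : ℕ) (κh : suc (κ · (ℓ1 · ℓ2 · 2)) ≡ p · p) (0<κ : 0 < κ) (0<J : 0 < J)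
   (B≤ : p · suc (3 · (κ · J · (κ · J))) ≤ ℓ1 · ℓ2 · 2) (B<p : 3 · (κ · J · (κ · J)) < p) (z1 z2 : Carrier) where
   InClass : Carrier -> Set
   InClass x = InTorus t1 x × Regular x × InTorus t2 (y x) × x ^ (2 · ℓ1) ≡ z1 × y x ^ (2 · ℓ2) ≡ z2
   private
    h = ℓ1 · ℓ2 · 2
    cc = z1 ^ ℓ2 * z2 ^ ℓ1
    r^h : ∀ {x} -> InClass x -> r x ^ h ≡ cc
    r^h {x} (ix , _ , _ , e1 , e2) = trans (^-distrib-* x (y x) h) (cong2 _*_
     (trans (cong (x ^_) (calc1 ℓ1 ℓ2)) (trans (sym (^-assocʳ x (2 · ℓ1) ℓ2)) (cong (_^ ℓ2) e1)))
     (trans (cong (y x ^_) (calc2 ℓ1 ℓ2)) (trans (sym (^-assocʳ (y x) (2 · ℓ2) ℓ1)) (cong (_^ ℓ1) e2))))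
     where
     calc1 : ∀ a b -> a · b · 2 ≡ 2 · a · b
     calc1 = solve-∀
     calc2 : ∀ a b -> a · b · 2 ≡ 2 · b · a
     calc2 = solve-∀
    convert-nonsplit : ∀ {x} -> InClass x -> InTorus inert x -> InTorus split (y x) -> St.MixedTarget h cc (r x)
    convert-nonsplit {x} ic ix' iy = record
     { s = s ; r≢0 = r≢0 ; u≢0 = u' ; v≢0 = v' ; s*v = s*v
     ; r^p = trans (^-distrib-* x (y x) p) (trans (cong2 _*_ (frobenius-nonsplit ix') (frobenius-split iy)) (*-comm _ _))
     ; s^p = trans (^-distrib-* (y x) (x ⁻¹) p) (trans (cong2 _*_ (frobenius-split iy) (trans (frobenius-nonsplit (InTorus-⁻¹ inert ix')) (⁻¹-involutive (x≢0 c)))) (*-comm _ _))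
     ; r^h = r^h {x} ic }
     where open At {x} (fst ic)
    convert-split : ∀ {x} -> InClass x -> InTorus split x -> InTorus inert (y x) -> Sw.MixedTarget h cc (r x)
    convert-split {x} ic ix' iy = record
     { s = s⁻¹ ; r≢0 = r≢0 ; u≢0 = v' ; v≢0 = u' ; s*v = s⁻¹*u
     ; r^p = trans (^-distrib-* x (y x) p) (cong2 _*_ (frobenius-split ix') (frobenius-nonsplit iy))
     ; s^p = trans (^-distrib-* x (y x ⁻¹) p) (cong2 _*_ (frobenius-split ix') (trans (frobenius-nonsplit (InTorus-⁻¹ inert iy)) (⁻¹-involutive (y≢0 c))))
     ; r^h = r^h {x} ic }
     where open At {x} (fst ic)
   class-bound : ∀ xs -> Unique xs -> All InClass xs -> length xs · (κ · J ∸ 1) ≤ p · (2 N.+ J)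
   class-bound xs uq cs = subst (\ n -> n · (κ · J ∸ 1) ≤ p · (2 N.+ J)) (List.length-map r xs) (go t1 refl)
    where
    rs-unique : Unique (map r xs)
    rs-unique = r-unique xs uq (All.map (\ { (ix , reg , _) -> ix , reg }) cs)
    go : ∀ t -> t1 ≡ t -> length (map r xs) · (κ · J ∸ 1) ≤ p · (2 N.+ J)
    go split e = Sw.MixedRows.mixed-bound κ J h κh 0<κ 0<J B≤ B<p cc (map r xs) rs-unique
     (All.map⁺ (All.map (\ {x} ic -> convert-split {x} ic (subst (\ t -> InTorus t x) e (fst ic)) (subst (\ t -> InTorus (opposite t) (y x)) e (fst (snd (snd ic))))) cs))
    go inert e = St.MixedRows.mixed-bound κ J h κh 0<κ 0<J B≤ B<p cc (map r xs) rs-unique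
     (All.map⁺ (All.map (\ {x} ic -> convert-nonsplit {x} ic (subst (\ t -> InTorus t x) e (fst ic)) (subst (\ t -> InTorus (opposite t) (y x)) e (fst (snd (snd ic))))) cs))
  -- Bounds the points with both parameters in the same torus by little more than p / 2.
  module Same (J n' : ℕ) (n'-half : 2 · n' ≡ size t1) (0<J : 0 < J) (B≤n' : 3 · (2 · J · (2 · J)) ≤ n')
   (B+n'≤p : n' N.+ 3 · (2 · J · (2 · J)) ≤ p) where
   InSame : Carrier -> Set
   InSame x = InTorus t1 x × Regular x × InTorus t1 (y x)
   private
    n'≤p : n' ≤ p
    n'≤p = ≤-trans (m≤m+n n' _) B+n'≤p
    U V : Poly
    U = - 1# ∷ α ∷ []
    V = - β ∷ 1# ∷ []
    τ₊ τ₋ : Fin J -> Poly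
    τ₊ t = U ^^ toℕ t ** V ^^ (J ∸ toℕ t)
    τ₋ t = V ^^ toℕ t ** U ^^ (J ∸ toℕ t)
    τ-deg : ∀ {a b c d} (t : Fin J) -> Deg< (suc J) ((a ∷ b ∷ []) ^^ toℕ t ** (c ∷ d ∷ []) ^^ (J ∸ toℕ t))
    τ-deg t = Deg<-mono (s≤s (≤-eq (trans (cong2 N._+_ (N.*-identityʳ (toℕ t)) (N.*-identityʳ (J ∸ toℕ t))) (m+[n∸m]≡n (<⇒≤ (Fin.toℕ<n t))))))
     (Deg<-** {suc (toℕ t · 1)} {(J ∸ toℕ t) · 1} (Deg<-^^ {1} (toℕ t) Deg<-linear) (Deg<-^^ {1} (J ∸ toℕ t) Deg<-linear))
    module _ {x : Carrier} (is : InSame x) where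
     open At {x} (fst is)
     uu = eval U rr
     vv = eval V rr
     rs^n' : (rr * s) ^ n' ≡ 1#
     rs^n' = begin
      (x * y x * (y x * x ⁻¹)) ^ n' ≡⟨ cong (_^ n') (trans (solve 3 (\ x y i -> x :* y :* (y :* i) := (x :* i) :* (y :* y)) refl x (y x) (x ⁻¹)) (trans (cong (_* (y x * y x)) (*-inverseʳ (x≢0 c))) (*-identityˡ _))) ⟩
      (y x * y x) ^ n' ≡⟨ cong (\ t -> (y x * t) ^ n') (*-identityʳ (y x)) ⟨
      (y x ^ 2) ^ n' ≡⟨ ^-assocʳ (y x) 2 n' ⟩
      y x ^ (2 · n') ≡⟨ cong (y x ^_) n'-half ⟩
      y x ^ size t1 ≡⟨ InTorus-size t1 (snd (snd is)) ⟩
      1# ∎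
      where open ≡R
     power : ∀ {s u v} -> s * v ≡ u -> v ≢ 0# -> ∀ t -> t ≤ J -> s ^ t ≡ (v ⁻¹) ^ J * (u ^ t * v ^ (J ∸ t))
     power {s} {u} {v} e v≢0 t t≤J = begin
      s ^ t ≡⟨ *-identityʳ _ ⟨
      s ^ t * 1# ≡⟨ cong (s ^ t *_) (⁻¹-^ v≢0 J) ⟨
      s ^ t * (v ^ J * (v ⁻¹) ^ J) ≡⟨ cong (\ k -> s ^ t * (k * (v ⁻¹) ^ J)) (trans (cong (v ^_) (sym (m+[n∸m]≡n t≤J))) (^-homo-* v t (J ∸ t))) ⟩
      s ^ t * (v ^ t * v ^ (J ∸ t) * (v ⁻¹) ^ J) ≡⟨ solve 4 (\ a b c d -> a :* (b :* c :* d) := d :* ((a :* b) :* c)) refl (s ^ t) (v ^ t) (v ^ (J ∸ t)) ((v ⁻¹) ^ J) ⟩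
      (v ⁻¹) ^ J * (s ^ t * v ^ t * v ^ (J ∸ t)) ≡⟨ cong (\ k -> (v ⁻¹) ^ J * (k * v ^ (J ∸ t))) (trans (sym (^-distrib-* s v t)) (cong (_^ t) e)) ⟩
      (v ⁻¹) ^ J * (u ^ t * v ^ (J ∸ t)) ∎
      where open ≡R
     eval-τ : ∀ f g (t : Fin J) -> eval f rr ^ toℕ t * eval g rr ^ (J ∸ toℕ t) ≡ eval (f ^^ toℕ t ** g ^^ (J ∸ toℕ t)) rr
     eval-τ f g t = sym (trans (eval-** (f ^^ toℕ t) (g ^^ (J ∸ toℕ t)) rr) (cong2 _*_ (eval-^^ f (toℕ t) rr) (eval-^^ g (J ∸ toℕ t) rr)))
     convert₊ : InTorus split x -> InTorus split (y x) -> St.SameTarget n' τ₊ rr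
     convert₊ ix' iy = record
      { s = s ; ω = (vv ⁻¹) ^ J ; r≢0 = r≢0 ; u≢0 = u' ; v≢0 = v' ; s*v = s*v ; rs^n' = rs^n'
      ; s^pt = \ t -> trans (cong (_^ toℕ t) s^p) (trans (power s*v v' (toℕ t) (<⇒≤ (Fin.toℕ<n t))) (cong ((vv ⁻¹) ^ J *_) (eval-τ U V t))) }
      where
      s^p : s ^ p ≡ s
      s^p = frobenius-split (InTorus-* split iy (InTorus-⁻¹ split ix'))
     convert₋ : InTorus inert x -> InTorus inert (y x) -> St.SameTarget n' τ₋ rr
     convert₋ ix' iy = record
      { s = s ; ω = (uu ⁻¹) ^ J ; r≢0 = r≢0 ; u≢0 = u' ; v≢0 = v' ; s*v = s*v ; rs^n' = rs^n'
      ; s^pt = \ t -> trans (cong (_^ toℕ t) s^p) (trans (power s⁻¹*u u' (toℕ t) (<⇒≤ (Fin.toℕ<n t))) (cong ((uu ⁻¹) ^ J *_) (eval-τ V U t))) }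
      where
      s^p : s ^ p ≡ s⁻¹
      s^p = trans (frobenius-nonsplit (InTorus-* inert iy (InTorus-⁻¹ inert ix'))) (*≡1⇒⁻¹ (trans (*-comm _ _) ss⁻¹))
   same-bound : ∀ xs -> Unique xs -> All InSame xs -> length xs · (2 · J ∸ 1) ≤ p · (2 N.+ J)
   same-bound xs uq cs = subst (\ n -> n · (2 · J ∸ 1) ≤ p · (2 N.+ J)) (List.length-map r xs) (go t1 refl)
    where
    rs-unique : Unique (map r xs)
    rs-unique = r-unique xs uq (All.map (\ { (ix , reg , _) -> ix , reg }) cs)
    go : ∀ t -> t1 ≡ t -> length (map r xs) · (2 · J ∸ 1) ≤ p · (2 N.+ J)
    go split e = St.SameRows.same-bound J n' 0<J n'≤p B≤n' B+n'≤p τ₊ τ-deg (map r xs) rs-unique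
     (All.map⁺ (All.map (\ {x} is -> convert₊ {x} is (subst (\ t -> InTorus t x) e (fst is)) (subst (\ t -> InTorus t (y x)) e (snd (snd is)))) cs))
    go inert e = St.SameRows.same-bound J n' 0<J n'≤p B≤n' B+n'≤p τ₋ τ-deg (map r xs) rs-unique
     (All.map⁺ (All.map (\ {x} is -> convert₋ {x} is (subst (\ t -> InTorus t x) e (fst is)) (subst (\ t -> InTorus t (y x)) e (snd (snd is)))) cs))

-- Counting the points of a conic whose parameters have prescribed orders.

module EndCount (S : Setting) where
 open import Data.Nat.Divisibility using (_∣_; divides)
 open import Data.Nat.Primality using (Prime; prime⇒irreducible; prime⇒nonZero)
 open import Data.Nat.ListAction using (sum)
 open import Data.List using (deduplicate; cartesianProduct)
 open import Data.List.Membership.Propositional.Properties using (∈-filter⁺; ∈-map⁺; ∈-map⁻; ∈-deduplicate⁻; ∈-deduplicate⁺; ∈-cartesianProduct⁺)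

 open Count
 open Sieve
 open Tori S
 open K
 open Conic S
 open import Data.List.Relation.Unary.Unique.DecPropositional.Properties _≟_ using (deduplicate-!)

 upper-arith : ∀ A e Q w J p -> 0 < e -> 0 < Q -> 0 < J -> A · (2 · (e · Q) · J ∸ 1) ≤ p · (2 N.+ J) -> A ≤ 2 · p -> p ≤ suc (Q · w) -> J ≤ p ->
  2 · e · J · A ≤ J · w N.+ 8 · e · p
 upper-arith A e Q w J p 0<e 0<Q 0<J h A≤ p≤ J≤ = *-cancelˡ-≤ Q {{N.>-nonZero 0<Q}} (begin
  Q · (2 · e · J · A) ≡⟨ calc1 Q e J A ⟩
  A · (2 · (e · Q) · J) ≡⟨ cong (A ·_) (m+[n∸m]≡n 1≤κJ) ⟨
  A · suc D ≡⟨ *-suc A D ⟩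
  A N.+ A · D ≤⟨ +-mono-≤ A≤ h ⟩
  2 · p N.+ p · (2 N.+ J) ≡⟨ calc2 p J ⟩
  4 · p N.+ p · J ≤⟨ +-monoʳ-≤ (4 · p) (*-monoˡ-≤ J p≤) ⟩
  4 · p N.+ (J N.+ Q · w · J) ≤⟨ +-monoʳ-≤ (4 · p) (+-monoˡ-≤ (Q · w · J) J≤) ⟩
  4 · p N.+ (p N.+ Q · w · J) ≡⟨ calc3 p Q w J ⟩
  Q · (J · w) N.+ 5 · p ≤⟨ +-monoʳ-≤ (Q · (J · w)) (≤-trans (*-monoˡ-≤ p (m≤m+n 5 3)) (m≤n*m (8 · p) (Q · e) {{N.>-nonZero (*-mono-≤ 0<Q 0<e)}})) ⟩
  Q · (J · w) N.+ Q · e · (8 · p) ≡⟨ calc4 Q J w e p ⟩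
  Q · (J · w N.+ 8 · e · p) ∎)
  where
  open ≤R
  D = 2 · (e · Q) · J ∸ 1
  1≤κJ : 1 ≤ 2 · (e · Q) · J
  1≤κJ = *-mono-≤ (*-mono-≤ {1} {2} (s≤s z≤n) (*-mono-≤ 0<e 0<Q)) 0<J
  calc1 : ∀ Q e J A -> Q · (2 · e · J · A) ≡ A · (2 · (e · Q) · J)
  calc1 = solve-∀
  calc2 : ∀ p J -> 2 · p N.+ p · (2 N.+ J) ≡ 4 · p N.+ p · J
  calc2 = solve-∀
  calc3 : ∀ p Q w J -> 4 · p N.+ (p N.+ Q · w · J) ≡ Q · (J · w) N.+ 5 · p
  calc3 = solve-∀
  calc4 : ∀ Q J w e p -> Q · (J · w) N.+ Q · e · (8 · p) ≡ Q · (J · w N.+ 8 · e · p)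
  calc4 = solve-∀

 -- A bound from below by subtraction. X1 and X2 together are about p, X1 is at most about p / 2,
 -- and each of the at most e Q - 1 nontrivial classes of X2 is at most about p / (2 e Q); about p /
 -- (2 e Q) is left for the trivial class.
 lower-arith : ∀ X1 X2 A others e Q w J p -> 0 < e -> 0 < Q -> 0 < J -> p ≤ X1 N.+ X2 N.+ 5 -> X1 · (2 · J ∸ 1) ≤ p · (2 N.+ J) -> X1 ≤ 2 · p -> X2 ≤ 2 · p ->
  X2 · (2 · (e · Q) · J ∸ 1) ≤ A · (2 · (e · Q) · J ∸ 1) N.+ others · (p · (2 N.+ J)) -> suc others ≤ e · Q -> Q · w ≤ suc p -> 6 · J ≤ p ->
  J · w ≤ 2 · e · J · A N.+ 8 · e · p
 lower-arith X1 X2 A others e Q w J p 0<e 0<Q 0<J total same X1≤ X2≤ classes others< Qw≤ 6J≤ = *-cancelˡ-≤ Q {{N.>-nonZero 0<Q}} (begin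
  Q · (J · w) ≡⟨ calc1 Q J w ⟩
  J · (Q · w) ≤⟨ *-monoʳ-≤ J Qw≤ ⟩
  J · suc p ≡⟨ trans (*-suc J p) (N.+-comm J (J · p)) ⟩
  J · p N.+ J ≤⟨ +-mono-≤ main (m≤n*m J E {{E≢0}}) ⟩
  6 · E · p N.+ A · κJ N.+ 10 · E · J N.+ E · J ≡⟨ calc2 E p (A · κJ) J ⟩
  A · κJ N.+ 6 · E · p N.+ 11 · (E · J) ≤⟨ +-monoʳ-≤ (A · κJ N.+ 6 · E · p) (≤-trans (*-monoˡ-≤ (E · J) (m≤m+n 11 1)) (≤-trans (≤-eq (calc3 E J)) (*-monoʳ-≤ (2 · E) 6J≤))) ⟩
  A · κJ N.+ 6 · E · p N.+ 2 · E · p ≡⟨ calc4 A e Q J p ⟩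
  Q · (2 · e · J · A N.+ 8 · e · p) ∎)
  where
  open ≤R
  E = e · Q
  κJ = 2 · (e · Q) · J
  E≢0 : N.NonZero E
  E≢0 = N.>-nonZero (*-mono-≤ 0<e 0<Q)
  1≤κJ : 1 ≤ κJ
  1≤κJ = *-mono-≤ (*-mono-≤ {1} {2} (s≤s z≤n) (*-mono-≤ 0<e 0<Q)) 0<J
  sucD : ∀ x -> x · κJ ≡ x N.+ x · (κJ ∸ 1)
  sucD x = trans (cong (x ·_) (sym (m+[n∸m]≡n 1≤κJ))) (*-suc x (κJ ∸ 1))
  sucD2 : ∀ x -> x · (2 · J) ≡ x N.+ x · (2 · J ∸ 1)
  sucD2 x = trans (cong (x ·_) (sym (m+[n∸m]≡n (*-mono-≤ {1} {2} (s≤s z≤n) 0<J)))) (*-suc x (2 · J ∸ 1))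
  X2-bound : X2 · κJ ≤ 2 · p N.+ (A · κJ N.+ others · (p · (2 N.+ J)))
  X2-bound = begin
   X2 · κJ ≡⟨ sucD X2 ⟩
   X2 N.+ X2 · (κJ ∸ 1) ≤⟨ +-mono-≤ X2≤ classes ⟩
   2 · p N.+ (A · (κJ ∸ 1) N.+ others · (p · (2 N.+ J))) ≤⟨ +-monoʳ-≤ (2 · p) (+-monoˡ-≤ _ (*-monoʳ-≤ A (m∸n≤m κJ 1))) ⟩
   2 · p N.+ (A · κJ N.+ others · (p · (2 N.+ J))) ∎
  X1-bound : X1 · (2 · J) ≤ 2 · p N.+ p · (2 N.+ J)
  X1-bound = ≤-trans (≤-eq (sucD2 X1)) (+-mono-≤ X1≤ same)
  main : J · p ≤ 6 · E · p N.+ A · κJ N.+ 10 · E · J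
  main = +-cancelˡ-≤ (2 · E · J · p) _ _ (begin
   2 · E · J · p N.+ J · p ≤⟨ +-monoˡ-≤ (J · p) (*-monoʳ-≤ (2 · E · J) total) ⟩
   2 · E · J · (X1 N.+ X2 N.+ 5) N.+ J · p ≡⟨ calc5 E J X1 X2 p ⟩
   E · (X1 · (2 · J)) N.+ X2 · κJ N.+ 10 · E · J N.+ J · p ≤⟨ +-monoˡ-≤ (J · p) (+-monoˡ-≤ (10 · E · J) (+-mono-≤ (*-monoʳ-≤ E X1-bound) X2-bound)) ⟩
   E · (2 · p N.+ p · (2 N.+ J)) N.+ (2 · p N.+ (A · κJ N.+ others · (p · (2 N.+ J)))) N.+ 10 · E · J N.+ J · p ≡⟨ calc6 E p J (A · κJ) others ⟩
   E · (2 · p N.+ p · (2 N.+ J)) N.+ A · κJ N.+ 10 · E · J N.+ suc others · (p · (2 N.+ J)) ≤⟨ +-monoʳ-≤ (E · (2 · p N.+ p · (2 N.+ J)) N.+ A · κJ N.+ 10 · E · J) (*-monoˡ-≤ (p · (2 N.+ J)) others<) ⟩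
   E · (2 · p N.+ p · (2 N.+ J)) N.+ A · κJ N.+ 10 · E · J N.+ E · (p · (2 N.+ J)) ≡⟨ calc7 E p J (A · κJ) ⟩
   2 · E · J · p N.+ (6 · E · p N.+ A · κJ N.+ 10 · E · J) ∎)
   where
   calc5 : ∀ E J X1 X2 p -> 2 · E · J · (X1 N.+ X2 N.+ 5) N.+ J · p ≡ E · (X1 · (2 · J)) N.+ X2 · (2 · E · J) N.+ 10 · E · J N.+ J · p
   calc5 = solve-∀
   calc6 : ∀ E p J a o -> E · (2 · p N.+ p · (2 N.+ J)) N.+ (2 · p N.+ (a N.+ o · (p · (2 N.+ J)))) N.+ 10 · E · J N.+ J · p ≡ E · (2 · p N.+ p · (2 N.+ J)) N.+ a N.+ 10 · E · J N.+ suc o · (p · (2 N.+ J))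
   calc6 = solve-∀
   calc7 : ∀ E p J a -> E · (2 · p N.+ p · (2 N.+ J)) N.+ a N.+ 10 · E · J N.+ E · (p · (2 N.+ J)) ≡ 2 · E · J · p N.+ (6 · E · p N.+ a N.+ 10 · E · J)
   calc7 = solve-∀
  calc1 : ∀ Q J w -> Q · (J · w) ≡ J · (Q · w)
  calc1 = solve-∀
  calc2 : ∀ E p a J -> 6 · E · p N.+ a N.+ 10 · E · J N.+ E · J ≡ a N.+ 6 · E · p N.+ 11 · (E · J)
  calc2 = solve-∀
  calc3 : ∀ E J -> 12 · (E · J) ≡ 2 · E · (6 · J)
  calc3 = solve-∀
  calc4 : ∀ A e Q J p -> A · (2 · (e · Q) · J) N.+ 6 · (e · Q) · p N.+ 2 · (e · Q) · p ≡ Q · (2 · e · J · A N.+ 8 · e · p)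
  calc4 = solve-∀

 -- For index Q ≥ J both the main term and the count are so small that the error term covers them.
 trivial-arith : ∀ A e Q w J p -> 0 < e -> A ≤ w · 2 -> J ≤ Q -> Q · w ≤ 2 · p ->
  2 · e · J · A ≤ J · w N.+ 8 · e · p × J · w ≤ 2 · e · J · A N.+ 8 · e · p
 trivial-arith A e Q w J p 0<e A≤ J≤Q Qw≤ =
  ≤-trans (≤-trans (*-monoʳ-≤ (2 · e · J) A≤) (≤-trans (≤-eq (calc1 e J w)) (≤-trans (*-monoʳ-≤ (4 · e) Jw≤) (≤-eq (calc2 e p))))) (m≤n+m _ (J · w)) ,
  ≤-trans (≤-trans Jw≤ (≤-trans (m≤n*m (2 · p) (4 · e) {{N.>-nonZero (*-mono-≤ {1} {4} (s≤s z≤n) 0<e)}}) (≤-eq (calc2 e p)))) (m≤n+m _ (2 · e · J · A))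
  where
  Jw≤ : J · w ≤ 2 · p
  Jw≤ = ≤-trans (*-monoˡ-≤ w J≤Q) Qw≤
  calc1 : ∀ e J w -> 2 · e · J · (w · 2) ≡ 4 · e · (J · w)
  calc1 = solve-∀
  calc2 : ∀ e p -> 4 · e · (2 · p) ≡ 8 · e · p
  calc2 = solve-∀

 inTorus? : ∀ t x -> Dec (InTorus t x)
 inTorus? split x = ¬? (x ≟ 0#) ×-dec (σ x ≟ x)
 inTorus? inert x = x * σ x ≟ 1#

 1≤p : 1 ≤ p
 1≤p = ≤-trans (s≤s z≤n) 2<p

 p≤suc-size : ∀ t -> p ≤ suc (size t)
 p≤suc-size split = ≤-eq (sym (m+[n∸m]≡n 1≤p))
 p≤suc-size inert = m≤n⇒m≤1+n (n≤1+n p)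

 size≤suc-p : ∀ t -> size t ≤ suc p
 size≤suc-p split = ≤-trans (m∸n≤m p 1) (n≤1+n p)
 size≤suc-p inert = ≤-refl

 suc-p≤2p : suc p ≤ 2 · p
 suc-p≤2p = ≤-trans (+-monoˡ-≤ p 1≤p) (≤-eq (cong (p N.+_) (sym (N.+-identityʳ p))))

 size≤2p : ∀ t -> size t ≤ 2 · p
 size≤2p t = ≤-trans (size≤suc-p t) suc-p≤2p

 sizes : ∀ t -> suc (size t · size (opposite t)) ≡ p · p
 sizes split = subst (\ q -> suc ((p ∸ 1) · suc q) ≡ q · q) (m+[n∸m]≡n 1≤p) (calc (p ∸ 1))
  where
  calc : ∀ n -> suc (n · suc (suc n)) ≡ suc n · suc n
  calc = solve-∀
 sizes inert = trans (cong suc (N.*-comm (suc p) (p ∸ 1))) (sizes split)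

 module Counts (t1 : Type) (α β : Carrier) (α≢0 : α ≢ 0#) (β≢0 : β ≢ 0#) (αβ≢1 : α * β ≢ 1#)
  (real : ∀ x -> InTorus t1 x -> Σ F.Carrier \ b -> α * x + β * x ⁻¹ ≡ ι b) where
  open Family t1 α β α≢0 β≢0 αβ≢1 real public
  regular? : ∀ x -> Dec (Regular x)
  regular? x = ¬? (disc (height x) F.≟ F.0#)
  -- `X1` collects the points where y has the type of x, `X2` those where it has the opposite type.
  -- The sieve runs over `X2`; `X1` only has to be bounded from above.
  Xs X1 X2 : List Carrier
  Xs = filter regular? (torus t1)
  X2 = filter (\ x -> inTorus? t2 (y x)) Xs
  X1 = filter (\ x -> ¬? (inTorus? t2 (y x))) Xs
  Xs-sound : ∀ {x} -> x ∈ Xs -> InTorus t1 x × Regular x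
  Xs-sound x∈ with ∈-filter⁻ regular? {xs = torus t1} x∈
  ... | x∈T , reg = All.lookup (torus-sound t1) x∈T , reg
  X2-sound : ∀ {x} -> x ∈ X2 -> InTorus t1 x × Regular x × InTorus t2 (y x)
  X2-sound x∈ with ∈-filter⁻ (\ x -> inTorus? t2 (y x)) {xs = Xs} x∈
  ... | x∈Xs , i with Xs-sound x∈Xs
  ...   | ix , reg = ix , reg , i
  X1-sound : ∀ {x} -> x ∈ X1 -> InTorus t1 x × Regular x × InTorus t1 (y x)
  X1-sound {x} x∈ with ∈-filter⁻ (\ x -> ¬? (inTorus? t2 (y x))) {xs = Xs} x∈
  ... | x∈Xs , ¬i with Xs-sound x∈Xs
  ...   | ix , reg = ix , reg , [ (\ i -> i) , (\ i -> ⊥-elim (¬i i)) ]′ (Y-type t1 (height x))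
  Xs-unique : Unique Xs
  Xs-unique = Unique.filter⁺ regular? (torus-unique t1)
  X2-unique : Unique X2
  X2-unique = Unique.filter⁺ _ Xs-unique
  X1-unique : Unique X1
  X1-unique = Unique.filter⁺ _ Xs-unique
  quadratic : ∀ b xs -> Unique xs -> All (\ x -> InTorus t1 x × ι (height x) ≡ b) xs -> length xs ≤ 2
  quadratic b xs u hs = quadratic-bound α (- b) β xs α≢0 u (All.map (\ {x} -> root) hs)
   where
   root : ∀ {x} -> InTorus t1 x × ι (height x) ≡ b -> β + x * (- b + x * (α + x * 0#)) ≡ 0#
   root {x} (ix , e) = begin
    β + x * (- b + x * (α + x * 0#)) ≡⟨ solve 5 (\ a b c x i -> c :+ x :* (:- b :+ x :* (a :+ x :* lit 0)) := x :* ((a :* x :+ c :* i) :- b) :+ c :* (lit 1 :- x :* i)) refl α b β x (x ⁻¹) ⟩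
    x * ((α * x + β * x ⁻¹) - b) + β * (1# - x * x ⁻¹) ≡⟨ cong2 (\ s t -> x * s + β * t) (x≡y⇒x-y≡0 (trans (sym (height-eq ix)) e)) (x≡y⇒x-y≡0 (sym (*-inverseʳ (InTorus⇒≢0 t1 ix)))) ⟩
    x * 0# + β * 0# ≡⟨ solve 2 (\ x c -> x :* lit 0 :+ c :* lit 0 := lit 0) refl x β ⟩
    0# ∎
    where open ≡R
  private
   irregular = filter (\ x -> ¬? (regular? x)) (torus t1)
   -- Irregular heights are 2 and -2, and a height comes from at most two x.
   irregular≤4 : length irregular ≤ 4
   irregular≤4 = fiber-bound (\ b x -> ι (height x) ≟ b) irregular (num 2 ∷ - num 2 ∷ []) 2 cover fibers
    where
    cover : ∀ x -> x ∈ irregular -> Any (\ b -> ι (height x) ≡ b) (num 2 ∷ - num 2 ∷ [])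
    cover x x∈ = [ here , (\ e -> there (here e)) ]′ (sqrt-unique (begin
     ι b * ι b ≡⟨ solve 1 (\ b -> b :* b := b :* b :- lit 4 :+ lit 4) refl (ι b) ⟩
     ι b * ι b - num 4 + num 4 ≡⟨ cong (_+ num 4) (w² b) ⟨
     w b * w b + num 4 ≡⟨ cong (\ t -> t * t + num 4) w≡0 ⟩
     0# * 0# + num 4 ≡⟨ cong (_+ num 4) (zeroʳ 0#) ⟩
     0# + num 4 ≡⟨ solve 1 (\ o -> lit 0 :+ lit 4 := lit 2 :* lit 2) refl 0# ⟩
     num 2 * num 2 ∎))
     where
     open ≡R
     b = height x
     disc≡0 : disc b ≡ F.0#
     disc≡0 with disc b F.≟ F.0#
     ... | yes e = e
     ... | no ne = ⊥-elim (snd (∈-filter⁻ (\ x -> ¬? (regular? x)) {xs = torus t1} x∈) ne)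
     w≡0 : w b ≡ 0#
     w≡0 = [ (\ z -> z) , (\ z -> z) ]′ (no-zero-divisors (trans (sqrt² (disc b)) (trans (cong ι disc≡0) ι-0)))
    fibers : ∀ b -> b ∈ (num 2 ∷ - num 2 ∷ []) -> length (filter (\ x -> ι (height x) ≟ b) irregular) ≤ 2
    fibers b _ = quadratic b _ (Unique.filter⁺ _ (Unique.filter⁺ _ (torus-unique t1))) (All.tabulate \ {x} x∈ ->
     let x∈' , e = ∈-filter⁻ (\ x -> ι (height x) ≟ b) {xs = irregular} x∈
     in All.lookup (torus-sound t1) (fst (∈-filter⁻ (\ x -> ¬? (regular? x)) {xs = torus t1} x∈')) , e)
  -- In the 5, one accounts for the split torus having only p - 1 elements and four for the
  -- irregular points.
  total : p ≤ length X1 N.+ length X2 N.+ 5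
  total = begin
   p ≤⟨ p≤suc-size t1 ⟩
   suc (size t1) ≡⟨ cong suc (trans (sym (torus-length t1)) (sym (filter-split regular? (torus t1)))) ⟩
   suc (length Xs N.+ length irregular) ≤⟨ s≤s (+-mono-≤ (≤-eq (trans (sym (filter-split (\ x -> inTorus? t2 (y x)) Xs)) (N.+-comm (length X2) (length X1)))) irregular≤4) ⟩
   suc (length X1 N.+ length X2 N.+ 4) ≡⟨ +-suc (length X1 N.+ length X2) 4 ⟨
   length X1 N.+ length X2 N.+ 5 ∎
   where open ≤R
  X≤2p : ∀ {Q : Carrier -> Set} (Q? : ∀ x -> Dec (Q x)) -> length (filter Q? Xs) ≤ 2 · p
  X≤2p Q? = ≤-trans (List.length-filter Q? Xs) (≤-trans (List.length-filter regular? (torus t1)) (≤-trans (≤-eq (torus-length t1)) (size≤2p t1)))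
  -- The subgroup x ^ (2 ℓ1) = 1 has index `e1`, and about w / (2 e1) points with y ^ w = 1 are
  -- expected. The 26 comes from κ (1 + B) with κ ≤ 2 e1 J and B ≤ 12 e1² J⁴.
  module Large (e1 ℓ1 J : ℕ) (size1 : e1 · (2 · ℓ1) ≡ size t1) (0<e₁ : 0 < e1) (2≤J : 2 ≤ J)
   (large : 26 · (e1 · e1 · e1 · (J · J · (J · J) · J)) < p) where
   P : ℕ -> Carrier -> Set
   P w x = x ^ (2 · ℓ1) ≡ 1# × y x ^ w ≡ 1#
   P? : ∀ w x -> Dec (P w x)
   P? w x = (x ^ (2 · ℓ1) ≟ 1#) ×-dec (y x ^ w ≟ 1#)
   private
    n2 = size t2
    0<J : 0 < J
    0<J = ≤-trans (s≤s z≤n) 2≤J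
    J⁴ = J · J · (J · J)
    1≤J² : 1 ≤ J · J
    1≤J² = *-mono-≤ 0<J 0<J
    1≤e³ : 1 ≤ e1 · e1 · e1
    1≤e³ = *-mono-≤ (*-mono-≤ 0<e₁ 0<e₁) 0<e₁
    J⁵<p : 26 · (J⁴ · J) < p
    J⁵<p = ≤-<-trans (*-monoʳ-≤ 26 (m≤n*m (J⁴ · J) (e1 · e1 · e1) {{N.>-nonZero 1≤e³}})) large
    8J²≤J⁵ : 8 · (J · J) ≤ J⁴ · J
    8J²≤J⁵ = ≤-trans (*-monoˡ-≤ (J · J) (*-mono-≤ (*-mono-≤ 2≤J 2≤J) 2≤J)) (≤-eq (calc J))
     where
     calc : ∀ J -> J · J · J · (J · J) ≡ J · J · (J · J) · J
     calc = solve-∀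
    200J²<p : 208 · (J · J) < p
    200J²<p = ≤-<-trans (≤-trans (≤-eq (N.*-assoc 26 8 (J · J))) (*-monoʳ-≤ 26 8J²≤J⁵)) J⁵<p
    J≤J² : J ≤ J · J
    J≤J² = m≤n*m J J {{N.>-nonZero 0<J}}
    6J≤p : 6 · J ≤ p
    6J≤p = ≤-trans (*-mono-≤ (m≤m+n 6 202) J≤J²) (<⇒≤ 200J²<p)
    J≤p : J ≤ p
    J≤p = ≤-trans (m≤n*m J 6) 6J≤p
    n' = e1 · ℓ1
    n'-half : 2 · n' ≡ size t1
    n'-half = trans (calc e1 ℓ1) size1
     where
     calc : ∀ e l -> 2 · (e · l) ≡ e · (2 · l)
     calc = solve-∀
    B2 = 3 · (2 · J · (2 · J))
    B2≤n' : B2 ≤ n'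
    B2≤n' = *-cancelˡ-≤ 2 (≤-pred (begin
     suc (2 · B2) ≡⟨ calc J ⟩
     1 N.+ 24 · (J · J) ≤⟨ +-mono-≤ 1≤J² ≤-refl ⟩
     25 · (J · J) ≤⟨ *-monoˡ-≤ (J · J) (m≤m+n 25 183) ⟩
     208 · (J · J) ≤⟨ <⇒≤ 200J²<p ⟩
     p ≤⟨ p≤suc-size t1 ⟩
     suc (size t1) ≡⟨ cong suc n'-half ⟨
     suc (2 · n') ∎))
     where
     open ≤R
     calc : ∀ J -> suc (2 · (3 · (2 · J · (2 · J)))) ≡ 1 N.+ 24 · (J · J)
     calc = solve-∀
    B2+n'≤p : n' N.+ B2 ≤ p
    B2+n'≤p = *-cancelˡ-≤ 2 (begin
     2 · (n' N.+ B2) ≡⟨ N.*-distribˡ-+ 2 n' B2 ⟩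
     2 · n' N.+ 2 · B2 ≡⟨ cong (N._+ 2 · B2) n'-half ⟩
     size t1 N.+ 2 · B2 ≤⟨ +-monoˡ-≤ (2 · B2) (size≤suc-p t1) ⟩
     suc p N.+ 2 · B2 ≡⟨ calc p J ⟩
     p N.+ (1 N.+ 24 · (J · J)) ≤⟨ +-monoʳ-≤ p (≤-trans (+-mono-≤ 1≤J² ≤-refl) (≤-trans (*-monoˡ-≤ (J · J) (m≤m+n 25 183)) (<⇒≤ 200J²<p))) ⟩
     p N.+ p ≡⟨ cong (p N.+_) (N.+-identityʳ p) ⟨
     2 · p ∎)
     where
     open ≤R
     calc : ∀ p J -> suc p N.+ 2 · (3 · (2 · J · (2 · J))) ≡ p N.+ (1 N.+ 24 · (J · J))
     calc = solve-∀
   X1-bound : length X1 · (2 · J ∸ 1) ≤ p · (2 N.+ J)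
   X1-bound = Same.same-bound J n' n'-half 0<J B2≤n' B2+n'≤p X1 X1-unique (All.tabulate X1-sound)
   -- `Q` is the index of the subgroup y ^ (2 ℓ2) = 1, so `X2` falls into at most e1 Q classes, to
   -- each of which the bound for mixed types applies.
   module Small (Q ℓ2 : ℕ) (size2 : Q · (ℓ2 · 2) ≡ n2) (Q≤J : Q ≤ J) (0<Q : 0 < Q) where
    private
     κ = 2 · (e1 · Q)
     D = κ · J ∸ 1
     h = ℓ1 · ℓ2 · 2
     B = 3 · (κ · J · (κ · J))
     0<κ : 0 < κ
     0<κ = *-mono-≤ {1} {2} (s≤s z≤n) (*-mono-≤ 0<e₁ 0<Q)
     κh : suc (κ · h) ≡ p · p
     κh = trans (cong suc (trans (calc e1 Q ℓ1 ℓ2) (cong2 _·_ size1 size2))) (sizes t1)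
      where
      calc : ∀ e Q l m -> 2 · (e · Q) · (l · m · 2) ≡ e · (2 · l) · (Q · (m · 2))
      calc = solve-∀
     κ≤ : κ ≤ 2 · (e1 · J)
     κ≤ = *-monoʳ-≤ 2 (*-monoʳ-≤ e1 Q≤J)
     κB<p : κ · suc B < p
     κB<p = begin-strict
      κ · suc B ≤⟨ *-mono-≤ κ≤ (s≤s (*-monoʳ-≤ 3 (*-mono-≤ (*-monoˡ-≤ J κ≤) (*-monoˡ-≤ J κ≤)))) ⟩
      2 · (e1 · J) · suc (3 · (k · J · (k · J))) ≤⟨ *-monoʳ-≤ (2 · (e1 · J)) (+-monoˡ-≤ _ (*-mono-≤ (*-mono-≤ 0<e₁ 0<e₁) (*-mono-≤ 1≤J² 1≤J²))) ⟩
      2 · (e1 · J) · (e1 · e1 · J⁴ N.+ 3 · (k · J · (k · J))) ≡⟨ calc e1 J ⟩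
      26 · (e1 · e1 · e1 · (J⁴ · J)) <⟨ large ⟩
      p ∎
      where
      open ≤R
      k = 2 · (e1 · J)
      calc : ∀ e J -> 2 · (e · J) · (e · e · (J · J · (J · J)) N.+ 3 · (2 · (e · J) · J · (2 · (e · J) · J))) ≡ 26 · (e · e · e · (J · J · (J · J) · J))
      calc = solve-∀
     B<p : B < p
     B<p = <-trans (n<1+n B) (≤-<-trans (m≤n*m (suc B) κ {{N.>-nonZero 0<κ}}) κB<p)
     B≤ : p · suc B ≤ h
     B≤ = *-cancelˡ-≤ κ {{N.>-nonZero 0<κ}} (≤-pred (begin
      suc (κ · (p · suc B)) ≤⟨ +-monoˡ-≤ _ 1≤p ⟩
      p N.+ κ · (p · suc B) ≡⟨ calc κ p B ⟩
      p · suc (κ · suc B) ≤⟨ *-monoʳ-≤ p κB<p ⟩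
      p · p ≡⟨ κh ⟨
      suc (κ · h) ∎))
      where
      open ≤R
      calc : ∀ k p B -> p N.+ k · (p · suc B) ≡ p · suc (k · suc B)
      calc = solve-∀
     Class : Carrier × Carrier -> Carrier -> Set
     Class (z1 , z2) x = x ^ (2 · ℓ1) ≡ z1 × y x ^ (ℓ2 · 2) ≡ z2
     class? : ∀ z x -> Dec (Class z x)
     class? (z1 , z2) x = (x ^ (2 · ℓ1) ≟ z1) ×-dec (y x ^ (ℓ2 · 2) ≟ z2)
     class-size : ∀ z -> length (filter (class? z) X2) · D ≤ p · (2 N.+ J)
     class-size (z1 , z2) = Mixed.class-bound ℓ1 ℓ2 κ J κh 0<κ 0<J B≤ B<p z1 z2 _ (Unique.filter⁺ (class? (z1 , z2)) X2-unique)
      (All.tabulate \ {x} x∈ ->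
       let x∈' , e1 , e2 = ∈-filter⁻ (class? (z1 , z2)) {xs = X2} x∈
           ix , reg , iy = X2-sound x∈'
       in ix , reg , iy , e1 , trans (cong (y x ^_) (N.*-comm 2 ℓ2)) e2)
     ≢1? : ∀ z -> Dec (z ≢ 1#)
     ≢1? z = ¬? (z ≟ 1#)
     others-of : (Carrier -> Carrier) -> List Carrier
     others-of f = deduplicate _≟_ (filter ≢1? (map f X2))
     -- 1 is put in front, so that the class to be counted heads the list of all classes and
     -- `others` is the remainder.
     values : (Carrier -> Carrier) -> List Carrier
     values f = 1# ∷ others-of f
     values-complete : ∀ f x -> x ∈ X2 -> f x ∈ values f
     values-complete f x x∈ = found (f x ≟ 1#)
      where
      found : Dec (f x ≡ 1#) -> f x ∈ values f
      found (yes e) = here e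
      found (no ne) = there (∈-deduplicate⁺ _≟_ (∈-filter⁺ ≢1? (∈-map⁺ f x∈) ne))
     others-sound : ∀ f {z} -> z ∈ others-of f -> z ≢ 1# × (Σ Carrier \ x -> x ∈ X2 × z ≡ f x)
     others-sound f z∈ = let z∈' , ne = ∈-filter⁻ ≢1? {xs = map f X2} (∈-deduplicate⁻ _≟_ _ z∈) in ne , ∈-map⁻ f z∈'
     values-bound : ∀ f k -> 0 < k -> (∀ x -> x ∈ X2 -> f x ^ k ≡ 1#) -> length (values f) ≤ k
     values-bound f k 0<k hk = unity-bound k 1# (values f) 0<k 1≢0
      (All.tabulate (\ {z} z∈ e -> fst (others-sound f z∈) (sym e)) ∷ deduplicate-! (filter ≢1? (map f X2)))
      (^-1# k ∷ All.tabulate (\ {z} z∈ -> let _ , x , x∈ , e = others-sound f z∈ in trans (cong (_^ k) e) (hk x x∈)))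
     f1 f2 : Carrier -> Carrier
     f1 x = x ^ (2 · ℓ1)
     f2 x = y x ^ (ℓ2 · 2)
     classes others : List (Carrier × Carrier)
     others = map (1# ,_) (others-of f2) List.++ cartesianProduct (others-of f1) (values f2)
     classes = cartesianProduct (values f1) (values f2)
     length-cart : ∀ (as bs : List Carrier) -> length (cartesianProduct as bs) ≡ length as · length bs
     length-cart [] bs = refl
     length-cart (a ∷ as) bs = trans (List.length-++ (map (a ,_) bs)) (cong2 N._+_ (List.length-map (a ,_) bs) (length-cart as bs))
     others< : suc (length others) ≤ e1 · Q
     others< = ≤-trans (≤-eq (length-cart (values f1) (values f2))) (*-mono-≤
      (values-bound f1 e1 0<e₁ (\ x x∈ -> trans (^-assocʳ x (2 · ℓ1) e1) (trans (cong (x ^_) (trans (N.*-comm (2 · ℓ1) e1) size1)) (InTorus-size t1 (fst (X2-sound x∈))))))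
      (values-bound f2 Q 0<Q (\ x x∈ -> trans (^-assocʳ (y x) (ℓ2 · 2) Q) (trans (cong (y x ^_) (trans (N.*-comm (ℓ2 · 2) Q) size2)) (InTorus-size t2 (snd (snd (X2-sound x∈))))))))
     A = length (filter (P? (ℓ2 · 2)) X2)
     X2-classes : length X2 · D ≤ A · D N.+ length others · (p · (2 N.+ J))
     X2-classes = ≤-trans (*-monoˡ-≤ D (cover-count class? X2 ((1# , 1#) ∷ others) cover))
      (≤-trans (≤-eq (N.*-distribʳ-+ D (length (filter (class? (1# , 1#)) X2)) (sum (map (\ z -> length (filter (class? z) X2)) others))))
       (+-mono-≤ (*-monoˡ-≤ D (filter-mono (class? (1# , 1#)) (P? (ℓ2 · 2)) X2 (\ x _ c -> c)))
        (sum-bound class? X2 others D (p · (2 N.+ J)) (\ z _ -> class-size z))))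
      where
      cover : ∀ x -> x ∈ X2 -> Any (\ z -> Class z x) ((1# , 1#) ∷ others)
      cover x x∈ = Any.map (\ { refl -> refl , refl }) (∈-cartesianProduct⁺ (values-complete f1 x x∈) (values-complete f2 x x∈))
     A-bound : A · D ≤ p · (2 N.+ J)
     A-bound = ≤-trans (*-monoˡ-≤ D (filter-mono (P? (ℓ2 · 2)) (class? (1# , 1#)) X2 (\ x _ c -> c))) (class-size (1# , 1#))
     A≤2p : A ≤ 2 · p
     A≤2p = ≤-trans (List.length-filter (P? (ℓ2 · 2)) X2) (X≤2p (\ x -> inTorus? t2 (y x)))
    estimate : 2 · e1 · J · A ≤ J · (ℓ2 · 2) N.+ 8 · e1 · p × J · (ℓ2 · 2) ≤ 2 · e1 · J · A N.+ 8 · e1 · p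
    estimate = upper-arith A e1 Q (ℓ2 · 2) J p 0<e₁ 0<Q 0<J A-bound A≤2p (≤-trans (p≤suc-size t2) (s≤s (≤-eq (sym size2)))) J≤p ,
     lower-arith (length X1) (length X2) A (length others) e1 Q (ℓ2 · 2) J p 0<e₁ 0<Q 0<J total X1-bound (X≤2p (\ x -> ¬? (inTorus? t2 (y x)))) (X≤2p (\ x -> inTorus? t2 (y x)))
      X2-classes others< (≤-trans (≤-eq size2) (size≤suc-p t2)) 6J≤p
   private
    trivial-count : ∀ w -> 0 < w -> length (filter (P? w) X2) ≤ w · 2
    trivial-count w 0<w = ≤-trans (fiber-bound (\ b x -> y x ≟ b) A ys 2 cover fibers) (*-monoˡ-≤ 2 ys≤)
     where
     A = filter (P? w) X2
     ys = deduplicate _≟_ (map y A)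
     A-sound : ∀ {x} -> x ∈ A -> InTorus t1 x × y x ^ w ≡ 1#
     A-sound x∈ = let x∈' , _ , e = ∈-filter⁻ (P? w) {xs = X2} x∈ in fst (X2-sound x∈') , e
     cover : ∀ x -> x ∈ A -> Any (\ b -> y x ≡ b) ys
     cover x x∈ = ∈-deduplicate⁺ _≟_ (∈-map⁺ y x∈)
     ys≤ : length ys ≤ w
     ys≤ = unity-bound w 1# ys 0<w 1≢0 (deduplicate-! (map y A)) (All.tabulate \ {z} z∈ ->
      let x , x∈ , e = ∈-map⁻ y (∈-deduplicate⁻ _≟_ (map y A) z∈) in trans (cong (_^ w) e) (snd (A-sound x∈)))
     fibers : ∀ b -> b ∈ ys -> length (filter (\ x -> y x ≟ b) A) ≤ 2
     fibers b b∈ = quadratic (b + b ⁻¹) _ (Unique.filter⁺ _ (Unique.filter⁺ (P? w) X2-unique)) (All.tabulate \ {x} x∈ ->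
      let x∈' , e = ∈-filter⁻ (\ x -> y x ≟ b) {xs = A} x∈
      in fst (A-sound x∈') , trans (sym (Y+Y' (height x))) (trans (cong (y x +_) (sym (Y⁻¹ (height x)))) (cong (\ t -> t + t ⁻¹) e)))
    0<n₂ : 0 < n2
    0<n₂ = ≤-pred (≤-trans 2≤p (p≤suc-size t2))
     where
     2≤p : 2 ≤ p
     2≤p = <⇒≤ 2<p
   estimate : ∀ Q w -> Q · w ≡ n2 -> 2 ∣ w -> 2 · e1 · J · length (filter (P? w) X2) ≤ J · w N.+ 8 · e1 · p × J · w ≤ 2 · e1 · J · length (filter (P? w) X2) N.+ 8 · e1 · p
   estimate zero w e d = ⊥-elim (<⇒≢ 0<n₂ e)
   estimate (suc Q) zero e d = ⊥-elim (<⇒≢ 0<n₂ (trans (sym (N.*-zeroʳ (suc Q))) e))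
   estimate (suc Q) (suc w) e (divides ℓ2 w≡) = [ small , big ]′ (≤-total (suc Q) J)
    where
    small : suc Q ≤ J -> _
    small Q≤J = subst (\ w -> 2 · e1 · J · length (filter (P? w) X2) ≤ J · w N.+ 8 · e1 · p × J · w ≤ 2 · e1 · J · length (filter (P? w) X2) N.+ 8 · e1 · p)
     (sym w≡) (Small.estimate (suc Q) ℓ2 (trans (cong (suc Q ·_) (sym w≡)) e) Q≤J (s≤s z≤n))
    big : J ≤ suc Q -> _
    big J≤Q = trivial-arith (length (filter (P? (suc w)) X2)) e1 (suc Q) (suc w) J p 0<e₁ (trivial-count (suc w) (s≤s z≤n)) J≤Q (≤-trans (≤-eq e) (size≤2p t2))
   private
    intersect : ∀ q R w x -> Prime q -> R · (q · w) ≡ n2 -> ¬ (q ∣ R) -> P (q · w) x -> P (R · w) x -> P w x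
    intersect q R w x pq e q∤R (e1 , e2) (_ , e3) = e1 , trans (sym (*-identityʳ g)) (trans (cong (g ^_) (sym o≡1)) (kills (snd o)))
     where
     g = y x ^ w
     g^q : g ^ q ≡ 1#
     g^q = trans (^-assocʳ (y x) w q) (trans (cong (y x ^_) (N.*-comm w q)) e2)
     g^R : g ^ R ≡ 1#
     g^R = trans (^-assocʳ (y x) w R) (trans (cong (y x ^_) (N.*-comm w R)) e3)
     o = order g q (N.>-nonZero⁻¹ q {{prime⇒nonZero pq}}) g^q
     o≡1 : fst o ≡ 1
     o≡1 = [ (\ z -> z) , (\ z -> ⊥-elim (q∤R (subst (_∣ R) z (order-∣ R (snd o) g^R)))) ]′ (prime⇒irreducible pq (order-∣ q (snd o) g^q))
    multiple : ∀ k w x -> P w x -> P (k · w) x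
    multiple k w x (e1 , e2) = e1 , trans (cong (y x ^_) (N.*-comm k w)) (^-*-≡1 w k e2)
   open InclusionExclusion X2 P P? n2 (2 · e1 · J) J (8 · e1 · p) intersect multiple estimate public

-- The scaled surface, its rotations and the orbit relation.

module Orbit (S : Setting) where

 open Tori S
 open K
 open Conic S

 Point : Set
 Point = F.Carrier × F.Carrier × F.Carrier

 OnSurface : F.Carrier -> F.Carrier -> F.Carrier -> Set
 OnSurface a b c = a F.* a F.+ b F.* b F.+ c F.* c ≡ a F.* b F.* c

 OnSurface-swap₁₂ : ∀ {a b c} -> OnSurface a b c -> OnSurface b a c
 OnSurface-swap₁₂ {a} {b} {c} e = trans (F.solve 3 (\ a b c -> b F.:* b F.:+ a F.:* a F.:+ c F.:* c F.:= a F.:* a F.:+ b F.:* b F.:+ c F.:* c) refl a b c)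
  (trans e (F.solve 3 (\ a b c -> a F.:* b F.:* c F.:= b F.:* a F.:* c) refl a b c))

 OnSurface-rotate : ∀ {a b c} -> OnSurface a b c -> OnSurface a c (a F.* c F.- b)
 OnSurface-rotate {a} {b} {c} e = F.x-y≡0⇒x≡y (trans
  (F.solve 3 (\ a b c -> (a F.:* a F.:+ c F.:* c F.:+ (a F.:* c F.:- b) F.:* (a F.:* c F.:- b)) F.:- a F.:* c F.:* (a F.:* c F.:- b)
    F.:= (a F.:* a F.:+ b F.:* b F.:+ c F.:* c) F.:- a F.:* b F.:* c) refl a b c) (F.x≡y⇒x-y≡0 e))

 num4≢0 : num 4 ≢ 0#
 num4≢0 e = *-≢0 2≢0 2≢0 (trans (solve 1 (\ o -> lit 2 :* lit 2 := lit 4) refl 0#) e)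

 F-2≢0 : F.num 2 ≢ F.0#
 F-2≢0 e = 2≢0 (trans (sym (trans (ι-+ _ _) (cong2 _+_ ι-1 ι-1))) (trans (cong ι e) ι-0))

 F-4≢0 : F.num 4 ≢ F.0#
 F-4≢0 e = F.^-≢0 2 F-2≢0 (trans (F.solve 0 (F.lit 2 F.:^ 2 F.:= F.lit 4) refl) e)

 F-16≢0 : F.num 16 ≢ F.0#
 F-16≢0 e = F.^-≢0 4 F-2≢0 (trans (F.solve 0 (F.lit 2 F.:^ 4 F.:= F.lit 16) refl) e)

 typeOf : ∀ a -> Σ Type \ t -> InTorus t (Y a)
 typeOf a = [ (split ,_) , (inert ,_) ]′ (Y-torus a)

 sequence : F.Carrier -> F.Carrier -> F.Carrier -> ℕ -> F.Carrier × F.Carrier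
 sequence a b c zero = b , c
 sequence a b c (suc j) = let u , v = sequence a b c j in v , a F.* v F.- u

 module Rotation (a b c : F.Carrier) (on : OnSurface a b c) (a≢0 : a ≢ F.0#) (disc≢0 : disc a ≢ F.0#)
  (t1 : Type) (ξ∈ : InTorus t1 (Y a)) where
  ξ = Y a
  ξ' = Y' a
  private
   A = ι a
   B = ι b
   C = ι c
  δ = w a
  δ≢0 : δ ≢ 0#
  δ≢0 e = disc≢0 (ι-injective (trans (sym (sqrt² (disc a))) (trans (cong (\ t -> t * t) e) (trans (zeroʳ 0#) (sym ι-0)))))
  i = δ ⁻¹
  δi : δ * i ≡ 1#
  δi = *-inverseʳ δ≢0
  α β : Carrier
  α = (C - B * ξ') * i
  β = (B * ξ - C) * i
  A≢0 : A ≢ 0#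
  A≢0 e = a≢0 (ι-injective (trans e (sym ι-0)))
  private
   [ξ-ξ']i : (ξ - ξ') * i ≡ 1#
   [ξ-ξ']i = trans (cong (_* i) (Y-Y' a)) δi
   onK : A * A + B * B + C * C ≡ A * B * C
   onK = trans (sym (trans (ι-+ _ _) (cong2 _+_ (trans (ι-+ _ _) (cong2 _+_ (ι-* a a) (ι-* b b))) (ι-* c c)))) (trans (cong ι on) (trans (ι-* _ _) (cong (_* C) (ι-* a b))))
   numerator : (C - B * ξ') * (B * ξ - C) ≡ A * A
   numerator = begin
    (C - B * ξ') * (B * ξ - C) ≡⟨ solve 4 (\ b c x y -> (c :- b :* y) :* (b :* x :- c) := (x :+ y) :* b :* c :- b :* b :* (x :* y) :- c :* c) refl B C ξ ξ' ⟩
    (ξ + ξ') * B * C - B * B * (ξ * ξ') - C * C ≡⟨ cong2 (\ s t -> s * B * C - B * B * t - C * C) (Y+Y' a) (YY' a) ⟩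
    A * B * C - B * B * 1# - C * C ≡⟨ cong (\ t -> t - B * B * 1# - C * C) onK ⟨
    A * A + B * B + C * C - B * B * 1# - C * C ≡⟨ solve 3 (\ a b c -> a :* a :+ b :* b :+ c :* c :- b :* b :* lit 1 :- c :* c := a :* a) refl A B C ⟩
    A * A ∎
    where open ≡R
  α+β : α + β ≡ B
  α+β = trans (solve 5 (\ b c x y i -> (c :- b :* y) :* i :+ (b :* x :- c) :* i := b :* ((x :- y) :* i)) refl B C ξ ξ' i) (trans (cong (B *_) [ξ-ξ']i) (*-identityʳ B))
  αξ+βξ' : α * ξ + β * ξ' ≡ C
  αξ+βξ' = trans (solve 5 (\ b c x y i -> (c :- b :* y) :* i :* x :+ (b :* x :- c) :* i :* y := c :* ((x :- y) :* i)) refl B C ξ ξ' i) (trans (cong (C *_) [ξ-ξ']i) (*-identityʳ C))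
  -- The value a² / (a² - 4) depends on `a` alone. So all conics with the same `a` share it, it is
  -- nonzero for a ≠ 0, and it cannot be 1 because 4 ≠ 0.
  αβ : α * β ≡ A * A * (i * i)
  αβ = trans (solve 3 (\ x y i -> x :* i :* (y :* i) := x :* y :* (i :* i)) refl (C - B * ξ') (B * ξ - C) i) (cong (_* (i * i)) numerator)
  αβ≢0 : α * β ≢ 0#
  αβ≢0 e = *-≢0 (*-≢0 A≢0 A≢0) (*-≢0 i≢0 i≢0) (trans (sym αβ) e)
   where
   i≢0 : i ≢ 0#
   i≢0 = ⁻¹-≢0 δ≢0
  α≢0 : α ≢ 0#
  α≢0 e = αβ≢0 (trans (cong (_* β) e) (zeroˡ β))
  β≢0 : β ≢ 0#
  β≢0 e = αβ≢0 (trans (cong (α *_) e) (zeroʳ α))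
  αβ≢1 : α * β ≢ 1#
  αβ≢1 e = num4≢0 (begin
   num 4 ≡⟨ solve 1 (\ a -> lit 4 := a :* a :- (a :* a :- lit 4)) refl A ⟩
   A * A - (A * A - num 4) ≡⟨ cong (\ t -> A * A - t) (w² a) ⟨
   A * A - δ * δ ≡⟨ x≡y⇒x-y≡0 AA≡δδ ⟩
   0# ∎)
   where
   open ≡R
   AA≡δδ : A * A ≡ δ * δ
   AA≡δδ = begin
    A * A ≡⟨ *-identityʳ _ ⟨
    A * A * 1# ≡⟨ cong (A * A *_) (trans (cong2 _*_ δi δi) (*-identityˡ 1#)) ⟨
    A * A * (δ * i * (δ * i)) ≡⟨ solve 3 (\ a d i -> a :* a :* (d :* i :* (d :* i)) := a :* a :* (i :* i) :* (d :* d)) refl A δ i ⟩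
    A * A * (i * i) * (δ * δ) ≡⟨ cong (_* (δ * δ)) (trans (sym αβ) e) ⟩
    1# * (δ * δ) ≡⟨ *-identityˡ _ ⟩
    δ * δ ∎
  private
   σ-sub : ∀ x y -> σ (x - y) ≡ σ x - σ y
   σ-sub x y = trans (σ-+ x (- y)) (cong (σ x +_) (σ-neg y))
   σα-with : ∀ {η η' j} -> σ ξ ≡ η -> σ ξ' ≡ η' -> σ i ≡ j -> σ α ≡ (C - B * η') * j × σ β ≡ (B * η - C) * j
   σα-with e e' ej =
    trans (σ-* _ _) (cong2 _*_ (trans (σ-sub C (B * ξ')) (cong2 _-_ (σ-ι c) (trans (σ-* B ξ') (cong2 _*_ (σ-ι b) e')))) ej) ,
    trans (σ-* _ _) (cong2 _*_ (trans (σ-sub (B * ξ) C) (cong2 _-_ (trans (σ-* B ξ) (cong2 _*_ (σ-ι b) e)) (σ-ι c))) ej)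
   σξ'-from : ∀ {η η'} -> σ ξ ≡ η -> η * η' ≡ 1# -> σ ξ' ≡ η'
   σξ'-from {η} {η'} e ηη' = *-cancelˡ (*≡1⇒≢0 ηη') (trans (cong (_* σ ξ') (sym e)) (trans (sym (σ-* ξ ξ')) (trans (cong σ (YY' a)) (trans σ-1 (sym ηη')))))
   σδ-from : ∀ {η η'} -> σ ξ ≡ η -> σ ξ' ≡ η' -> σ δ ≡ η - η'
   σδ-from e e' = trans (cong σ (sym (Y-Y' a))) (trans (σ-sub ξ ξ') (cong2 _-_ e e'))
  -- In the split case `σ` fixes ξ and δ; in the inert case it exchanges ξ with ξ' and negates δ,
  -- which exchanges α with β. Either way α x + β / x is fixed for x in the torus.
  conjugate : ∀ t -> InTorus t ξ -> (t ≡ split × σ α ≡ α × σ β ≡ β) ⊎ (t ≡ inert × σ α ≡ β × σ β ≡ α)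
  conjugate split (_ , e) = inl (refl , fst both , snd both)
   where
   e' : σ ξ' ≡ ξ'
   e' = σξ'-from e (YY' a)
   eδ : σ δ ≡ δ
   eδ = trans (σδ-from e e') (Y-Y' a)
   ei : σ i ≡ i
   ei = *-cancelˡ δ≢0 (trans (cong (_* σ i) (sym eδ)) (trans (σ-⁻¹ δ≢0) (sym δi)))
   both = σα-with e e' ei
  conjugate inert n = inr (refl , trans (fst both) (solve 4 (\ b c x i -> (c :- b :* x) :* (:- i) := (b :* x :- c) :* i) refl B C ξ i) ,
                    trans (snd both) (solve 4 (\ b c x i -> (b :* x :- c) :* (:- i) := (c :- b :* x) :* i) refl B C ξ' i))
   where
   e : σ ξ ≡ ξ'
   e = *-cancelˡ (Y≢0 a) (trans n (sym (YY' a)))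
   e' : σ ξ' ≡ ξ
   e' = σξ'-from e (trans (*-comm _ _) (YY' a))
   eδ : σ δ ≡ - δ
   eδ = trans (σδ-from e e') (trans (solve 2 (\ x y -> y :- x := :- (x :- y)) refl ξ ξ') (cong (\ t -> - t) (Y-Y' a)))
   ei : σ i ≡ - i
   ei = *-cancelˡ (neg-≢0 δ≢0) (trans (cong (_* σ i) (sym eδ)) (trans (σ-⁻¹ δ≢0) (trans (sym δi) (solve 2 (\ d i -> d :* i := (:- d) :* (:- i)) refl δ i))))
   both = σα-with e e' ei
  real : ∀ x -> InTorus t1 x -> Σ F.Carrier \ b -> α * x + β * x ⁻¹ ≡ ι b
  real x ix = σ-fixed _ (fixed (conjugate t1 ξ∈))
   where
   σ-form : σ (α * x + β * x ⁻¹) ≡ σ α * σ x + σ β * σ (x ⁻¹)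
   σ-form = trans (σ-+ _ _) (cong2 _+_ (σ-* _ _) (σ-* _ _))
   fixed : _ -> σ (α * x + β * x ⁻¹) ≡ α * x + β * x ⁻¹
   fixed (inl (t≡ , eα , eβ)) = trans σ-form (cong2 _+_ (cong2 _*_ eα (snd ix')) (cong2 _*_ eβ (snd (InTorus-⁻¹ split ix'))))
    where
    ix' : InTorus split x
    ix' = subst (\ t -> InTorus t x) t≡ ix
   fixed (inr (t≡ , eα , eβ)) = trans σ-form (trans (cong2 _+_ (cong2 _*_ eα σx) (cong2 _*_ eβ σx⁻¹)) (+-comm _ _))
    where
    ix' : InTorus inert x
    ix' = subst (\ t -> InTorus t x) t≡ ix
    x≢0 = InTorus⇒≢0 inert ix'
    σx : σ x ≡ x ⁻¹
    σx = sym (*≡1⇒⁻¹ ix')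
    σx⁻¹ : σ (x ⁻¹) ≡ x
    σx⁻¹ = *-cancelˡ (⁻¹-≢0 x≢0) (trans (InTorus-⁻¹ inert ix') (trans (sym (*-inverseʳ x≢0)) (*-comm _ _)))
  sequence-eq : ∀ j -> ι (fst (sequence a b c j)) ≡ α * ξ ^ j + β * ξ' ^ j × ι (snd (sequence a b c j)) ≡ α * ξ ^ suc j + β * ξ' ^ suc j
  sequence-eq zero = trans (sym α+β) (sym (cong2 _+_ (*-identityʳ α) (*-identityʳ β))) , trans (sym αξ+βξ') (sym (cong2 (\ s t -> α * s + β * t) (*-identityʳ ξ) (*-identityʳ ξ')))
  sequence-eq (suc j) = let e1 , e2 = sequence-eq j in e2 , (begin
   ι (a F.* v F.- u) ≡⟨ trans (ι-+ _ _) (cong2 _+_ (ι-* a v) (ι-neg u)) ⟩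
   A * ι v - ι u ≡⟨ cong2 (\ s t -> A * s - t) e2 e1 ⟩
   A * (α * (ξ * X) + β * (ξ' * X')) - (α * X + β * X') ≡⟨ cong (\ t -> t * (α * (ξ * X) + β * (ξ' * X')) - (α * X + β * X')) (Y+Y' a) ⟨
   (ξ + ξ') * (α * (ξ * X) + β * (ξ' * X')) - (α * X + β * X')
    ≡⟨ solve 6 (\ x y α β X X' -> (x :+ y) :* (α :* (x :* X) :+ β :* (y :* X')) :- (α :* X :+ β :* X')
       := α :* (x :* (x :* X)) :+ β :* (y :* (y :* X')) :+ (x :* y :- lit 1) :* (α :* X :+ β :* X')) refl ξ ξ' α β X X' ⟩
   α * (ξ * (ξ * X)) + β * (ξ' * (ξ' * X')) + (ξ * ξ' - 1#) * (α * X + β * X') ≡⟨ cong (\ t -> α * (ξ * (ξ * X)) + β * (ξ' * (ξ' * X')) + t * (α * X + β * X')) (x≡y⇒x-y≡0 (YY' a)) ⟩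
   α * (ξ * (ξ * X)) + β * (ξ' * (ξ' * X')) + 0# * (α * X + β * X') ≡⟨ trans (cong (α * (ξ * (ξ * X)) + β * (ξ' * (ξ' * X')) +_) (zeroˡ _)) (+-identityʳ _) ⟩
   α * ξ ^ suc (suc j) + β * ξ' ^ suc (suc j) ∎)
   where
   open ≡R
   u = fst (sequence a b c j)
   v = snd (sequence a b c j)
   X = ξ ^ j
   X' = ξ' ^ j
  ξ^⁻¹ : ∀ j -> (ξ ^ j) ⁻¹ ≡ ξ' ^ j
  ξ^⁻¹ j = *≡1⇒⁻¹ (trans (sym (^-distrib-* ξ ξ' j)) (trans (cong (_^ j) (YY' a)) (^-1# j)))
  ξ^∈ : ∀ j -> InTorus t1 (ξ ^ j)
  ξ^∈ zero = 1∈ t1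
   where
   1∈ : ∀ t -> InTorus t 1#
   1∈ split = 1≢0 , σ-1
   1∈ inert = trans (*-identityˡ _) σ-1
  ξ^∈ (suc j) = InTorus-* t1 ξ∈ (ξ^∈ j)

 -- The orbit relation enters only through these closure properties, so that the relation of the
 -- unscaled surface can be transported later.
 record Moves (_~_ : Point -> Point -> Set) : Set where
  field
   ~-refl : ∀ {P} -> P ~ P
   ~-sym : ∀ {P Q} -> P ~ Q -> Q ~ P
   ~-trans : ∀ {P Q R} -> P ~ Q -> Q ~ R -> P ~ R
   swap₁₂ : ∀ a b c -> (a , b , c) ~ (b , a , c)
   swap₂₃ : ∀ a b c -> (a , b , c) ~ (a , c , b)
   vieta3 : ∀ a b c -> (a , b , c) ~ (a , b , a F.* b F.- c)

 module Connected {_~_ : Point -> Point -> Set} (moves : Moves _~_) where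
  open Moves moves
  Hits : Point -> F.Carrier -> Set
  Hits P a = Σ F.Carrier \ b -> Σ F.Carrier \ c -> OnSurface a b c × P ~ (a , b , c)
  rotate : ∀ a b c -> (a , b , c) ~ (a , c , a F.* c F.- b)
  rotate a b c = ~-trans (swap₂₃ a b c) (vieta3 a c b)
  sequence-reach : ∀ {P a b c} -> OnSurface a b c -> P ~ (a , b , c) -> ∀ j -> let u , v = sequence a b c j in OnSurface a u v × P ~ (a , u , v)
  sequence-reach on r zero = on , r
  sequence-reach {a = a} on r (suc j) = let on' , r' = sequence-reach on r j in OnSurface-rotate on' , ~-trans r' (rotate a _ _)
  hits-sequence : ∀ {P a b c} -> OnSurface a b c -> P ~ (a , b , c) -> ∀ j -> Hits P (fst (sequence a b c j))
  hits-sequence {a = a} {b} {c} on r j = let on' , r' = sequence-reach on r j in a , snd (sequence a b c j) , OnSurface-swap₁₂ on' , ~-trans r' (swap₁₂ a _ _)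
  -- Both points have the same α β, so the quotient of their α's lies in the torus. A generator ξ
  -- has it as a power ξ ^ j, and j rotations carry one point to the other.
  transitive : ∀ {a b c b' c'} -> OnSurface a b c -> OnSurface a b' c' -> a ≢ F.0# -> disc a ≢ F.0# -> ∀ t -> InTorus t (Y a) -> Order (Y a) (size t) -> (a , b , c) ~ (a , b' , c')
  transitive {a} {b} {c} {b'} {c'} on on' a≢0 disc≢0 t Y∈ ord = subst₂ (\ u v -> (a , b , c) ~ (a , u , v)) ub uc (snd (sequence-reach on ~-refl j))
   where
   module R1 = Rotation a b c on a≢0 disc≢0 t Y∈
   module R2 = Rotation a b' c' on' a≢0 disc≢0 t Y∈
   αi = R1.α ⁻¹
   βi = R1.β ⁻¹
   ρ = R2.α * αi
   ρ∈ : InTorus t ρ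
   ρ∈ = go t Y∈
    where
    go : ∀ t -> InTorus t (Y a) -> InTorus t ρ
    go t i = both (R1.conjugate t i) (R2.conjugate t i)
     where
     both : _ -> _ -> InTorus t ρ
     both (inl (refl , e1 , _)) (inl (_ , e2 , _)) = *-≢0 R2.α≢0 (⁻¹-≢0 R1.α≢0) , trans (σ-* _ _) (cong2 _*_ e2 (*-cancelˡ R1.α≢0 (trans (cong (_* σ αi) (sym e1)) (trans (σ-⁻¹ R1.α≢0) (sym (*-inverseʳ R1.α≢0))))))
     both (inr (refl , e1 , _)) (inr (_ , e2 , _)) = begin
      ρ * σ ρ ≡⟨ cong (ρ *_) (trans (σ-* _ _) (cong2 _*_ e2 σαi)) ⟩
      R2.α * αi * (R2.β * βi) ≡⟨ solve 4 (\ a i b j -> a :* i :* (b :* j) := (a :* b) :* (i :* j)) refl R2.α αi R2.β βi ⟩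
      R2.α * R2.β * (αi * βi) ≡⟨ cong (_* (αi * βi)) (trans R2.αβ (sym R1.αβ)) ⟩
      R1.α * R1.β * (αi * βi) ≡⟨ solve 4 (\ a b i j -> a :* b :* (i :* j) := (a :* i) :* (b :* j)) refl R1.α R1.β αi βi ⟩
      R1.α * αi * (R1.β * βi) ≡⟨ cong2 _*_ (*-inverseʳ R1.α≢0) (*-inverseʳ R1.β≢0) ⟩
      1# * 1# ≡⟨ *-identityˡ 1# ⟩
      1# ∎
      where
      open ≡R
      σαi : σ αi ≡ βi
      σαi = *-cancelˡ R1.β≢0 (trans (cong (_* σ αi) (sym e1)) (trans (σ-⁻¹ R1.α≢0) (sym (*-inverseʳ R1.β≢0))))
     both (inl (refl , _)) (inr (() , _))
     both (inr (refl , _)) (inl (() , _))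
   power = powers-complete ord ρ (InTorus-size t ρ∈)
   j = fst power
   α2 : R2.α ≡ R1.α * R1.ξ ^ j
   α2 = trans (trans (sym (*-identityʳ _)) (trans (cong (R2.α *_) (sym (*-inverseʳ R1.α≢0))) (solve 3 (\ x a i -> x :* (a :* i) := a :* (x :* i)) refl R2.α R1.α αi))) (cong (R1.α *_) (snd (snd power)))
   XX' : R1.ξ ^ j * R1.ξ' ^ j ≡ 1#
   XX' = trans (sym (^-distrib-* R1.ξ R1.ξ' j)) (trans (cong (_^ j) (YY' a)) (^-1# j))
   β2 : R2.β ≡ R1.β * R1.ξ' ^ j
   β2 = *-cancelˡ R2.α≢0 (begin
    R2.α * R2.β ≡⟨ trans R2.αβ (sym R1.αβ) ⟩
    R1.α * R1.β ≡⟨ *-identityʳ _ ⟨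
    R1.α * R1.β * 1# ≡⟨ cong (R1.α * R1.β *_) XX' ⟨
    R1.α * R1.β * (R1.ξ ^ j * R1.ξ' ^ j) ≡⟨ solve 4 (\ a b x y -> a :* b :* (x :* y) := a :* x :* (b :* y)) refl R1.α R1.β _ _ ⟩
    R1.α * R1.ξ ^ j * (R1.β * R1.ξ' ^ j) ≡⟨ cong (_* (R1.β * R1.ξ' ^ j)) α2 ⟨
    R2.α * (R1.β * R1.ξ' ^ j) ∎)
    where open ≡R
   ub : fst (sequence a b c j) ≡ b'
   ub = ι-injective (trans (fst (R1.sequence-eq j)) (trans (sym (cong2 _+_ α2 β2)) R2.α+β))
   uc : snd (sequence a b c j) ≡ c'
   uc = ι-injective (trans (snd (R1.sequence-eq j)) (trans (cong2 _+_ (shuffle R1.α R1.ξ (R1.ξ ^ j)) (shuffle R1.β R1.ξ' (R1.ξ' ^ j))) (trans (sym (cong2 (\ s t -> s * R1.ξ + t * R1.ξ') α2 β2)) R2.αξ+βξ')))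
    where
    shuffle : ∀ a x X -> a * (x * X) ≡ a * X * x
    shuffle = solve 3 (\ a x X -> a :* (x :* X) := a :* X :* x) refl

-- Numbers of divisors and of prime divisors.

module NT where
 open import Data.Nat hiding (parity)
 open import Data.Nat.Properties
 open import Data.Nat.Divisibility
 open import Data.Nat.DivMod using (m≡m%n+[m/n]*n; m%n<n)
 open import Data.Nat.Primality
 open import Data.Nat.Primality.Factorisation using (factorise; module PrimeFactorisation)
 open import Data.Nat.Coprimality using (Coprime; coprime-divisor)
 open import Data.Nat.ListAction using (product)
 open import Data.List using (upTo; cartesianProductWith)
 open import Data.List.Membership.Propositional.Properties using (∈-filter⁺; ∈-upTo⁺; ∈-cartesianProductWith⁺)

 open Count

 unique-bound : ∀ N xs -> Unique xs -> All (_< N) xs -> length xs ≤ N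
 unique-bound N xs u b = ≤-trans (unique-⊆ _≟_ xs (upTo N) u (\ x x∈ -> ∈-upTo⁺ (All.lookup b x∈))) (≤-eq (List.length-upTo N))

 prime-divisor : ∀ n -> 1 < n -> Σ ℕ \ q -> Prime q × q ∣ n
 prime-divisor n 1<n = go (PrimeFactorisation.factors f) (PrimeFactorisation.isFactorisation f) (PrimeFactorisation.factorsPrime f)
  where
  f = factorise n {{>-nonZero (<-trans (s≤s z≤n) 1<n)}}
  go : ∀ fs -> n ≡ product fs -> All Prime fs -> Σ ℕ \ q -> Prime q × q ∣ n
  go [] e _ = ⊥-elim (<⇒≢ 1<n (sym e))
  go (q ∷ qs) e (pq ∷ _) = q , pq , subst (q ∣_) (sym e) (m∣m*n (product qs))

 distinct-primes : ∀ {q r} -> Prime q -> Prime r -> r ∣ q -> q ≡ r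
 distinct-primes pq pr r∣q = [ (\ e -> ⊥-elim (¬prime[1] (subst Prime e pr))) , sym ]′ (prime⇒irreducible pq r∣q)

 product-∣ : ∀ n qs -> Unique qs -> All (\ q -> Prime q × q ∣ n) qs -> product qs ∣ n
 product-∣ n [] _ _ = 1∣ n
 product-∣ n (q ∷ qs) (nq ∷ u) ((pq , divides m e) ∷ ds) = subst (q * product qs ∣_) (trans (*-comm q m) (sym e)) (*-monoʳ-∣ q (product-∣ m qs u (All.zipWith (\ { (ne , pr , r∣n) -> pr , [ (\ r∣m -> r∣m) , (\ r∣q -> ⊥-elim (ne (distinct-primes pq pr r∣q))) ]′ (euclidsLemma m q pr (subst (_ ∣_) e r∣n)) }) (nq , ds))))

 opaque
  prime-divisors : ℕ -> List ℕ
  prime-divisors n = filter (\ q -> prime? q ×-dec (q ∣? n)) (upTo (suc n))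
  prime-divisors-unique : ∀ n -> Unique (prime-divisors n)
  prime-divisors-unique n = Unique.filter⁺ (\ q -> prime? q ×-dec (q ∣? n)) (Unique.upTo⁺ (suc n))
  prime-divisors-sound : ∀ n -> All (\ q -> Prime q × q ∣ n) (prime-divisors n)
  prime-divisors-sound n = All.tabulate \ q∈ -> snd (∈-filter⁻ (\ q -> prime? q ×-dec (q ∣? n)) {xs = upTo (suc n)} q∈)
  prime-divisors-complete : ∀ n -> 0 < n -> ∀ {q} -> Prime q -> q ∣ n -> q ∈ prime-divisors n
  prime-divisors-complete (suc n) _ pq q∣n = ∈-filter⁺ (\ q -> prime? q ×-dec (q ∣? suc n)) (∈-upTo⁺ (s≤s (∣⇒≤ q∣n))) (pq , q∣n)

 -- Every prime above 2 ^ C contributes more than 2 ^ C to the product; there are at most 2 ^ C + 1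
 -- others.
 few-primes : ∀ C n qs -> 0 < n -> Unique qs -> All (\ q -> Prime q × q ∣ n) qs -> 2 ^ (C * length qs) ≤ 2 ^ (C * suc (2 ^ C)) * n
 few-primes C n qs 0<n u ds = begin
  2 ^ (C * length qs) ≤⟨ go qs (All.map fst ds) ⟩
  2 ^ (C * length (filter (_≤? 2 ^ C) qs)) * product qs ≤⟨ *-mono-≤ (^-monoʳ-≤ 2 (*-monoʳ-≤ C small)) (∣⇒≤ {{>-nonZero 0<n}} (product-∣ n qs u ds)) ⟩
  2 ^ (C * suc (2 ^ C)) * n ∎
  where
  open ≤R
  small : length (filter (_≤? 2 ^ C) qs) ≤ suc (2 ^ C)
  small = unique-bound (suc (2 ^ C)) _ (Unique.filter⁺ (_≤? 2 ^ C) u) (All.tabulate \ q∈ -> s≤s (snd (∈-filter⁻ (_≤? 2 ^ C) {xs = qs} q∈)))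
  go : ∀ qs -> All Prime qs -> 2 ^ (C * length qs) ≤ 2 ^ (C * length (filter (_≤? 2 ^ C) qs)) * product qs
  go [] _ = ≤-eq (sym (*-identityʳ _))
  go (q ∷ qs) (pq ∷ ps) = by (q ≤? 2 ^ C)
   where
   s = length (filter (_≤? 2 ^ C) qs)
   calc : ∀ a b c -> a * (b * c) ≡ b * (a * c)
   calc = solve-∀
   step : ∀ k -> 2 ^ (C * suc k) ≡ 2 ^ C * 2 ^ (C * k)
   step k = trans (cong (2 ^_) (*-suc C k)) (^-distribˡ-+-* 2 C (C * k))
   by : Dec (q ≤ 2 ^ C) -> 2 ^ (C * length (q ∷ qs)) ≤ 2 ^ (C * length (filter (_≤? 2 ^ C) (q ∷ qs))) * product (q ∷ qs)
   by (yes le) rewrite List.filter-accept (_≤? 2 ^ C) {q} {qs} le = begin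
    2 ^ (C * suc (length qs)) ≡⟨ step (length qs) ⟩
    2 ^ C * 2 ^ (C * length qs) ≤⟨ *-monoʳ-≤ (2 ^ C) (go qs ps) ⟩
    2 ^ C * (2 ^ (C * s) * product qs) ≡⟨ *-assoc (2 ^ C) _ _ ⟨
    2 ^ C * 2 ^ (C * s) * product qs ≡⟨ cong (_* product qs) (step s) ⟨
    2 ^ (C * suc s) * product qs ≤⟨ *-monoʳ-≤ (2 ^ (C * suc s)) (m≤n*m (product qs) q {{prime⇒nonZero pq}}) ⟩
    2 ^ (C * suc s) * (q * product qs) ∎
   by (no gt) rewrite List.filter-reject (_≤? 2 ^ C) {q} {qs} gt = begin
    2 ^ (C * suc (length qs)) ≡⟨ step (length qs) ⟩
    2 ^ C * 2 ^ (C * length qs) ≤⟨ *-mono-≤ (<⇒≤ (≰⇒> gt)) (go qs ps) ⟩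
    q * (2 ^ (C * s) * product qs) ≡⟨ calc q (2 ^ (C * s)) (product qs) ⟩
    2 ^ (C * s) * (q * product qs) ∎

 ^-distribʳ-* : ∀ n x y -> (x * y) ^ n ≡ x ^ n * y ^ n
 ^-distribʳ-* zero x y = refl
 ^-distribʳ-* (suc n) x y = trans (cong (x * y *_) (^-distribʳ-* n x y)) (calc x y (x ^ n) (y ^ n))
  where
  calc : ∀ a b c d -> a * b * (c * d) ≡ a * c * (b * d)
  calc = solve-∀

 suc≤2^ : ∀ b -> suc b ≤ 2 ^ b
 suc≤2^ zero = s≤s z≤n
 suc≤2^ (suc b) = ≤-trans (+-mono-≤ (m^n>0 2 b) (suc≤2^ b)) (≤-eq (cong (2 ^ b +_) (sym (+-identityʳ (2 ^ b)))))

 -- Write a = bC + r with r < C, so that a + 1 ≤ C (b + 1) ≤ C 2^b.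
 power-vs-exponential : ∀ C .{{_ : NonZero C}} a -> suc a ^ C ≤ C ^ C * 2 ^ a
 power-vs-exponential C a = begin
  suc a ^ C ≤⟨ ^-monoˡ-≤ C (≤-trans suc-a≤ (*-monoʳ-≤ C (suc≤2^ b))) ⟩
  (C * 2 ^ b) ^ C ≡⟨ ^-distribʳ-* C C (2 ^ b) ⟩
  C ^ C * (2 ^ b) ^ C ≡⟨ cong (C ^ C *_) (^-*-assoc 2 b C) ⟩
  C ^ C * 2 ^ (b * C) ≤⟨ *-monoʳ-≤ (C ^ C) (^-monoʳ-≤ 2 (≤-trans (m≤n+m (b * C) (a % C)) (≤-eq (sym (m≡m%n+[m/n]*n a C))))) ⟩
  C ^ C * 2 ^ a ∎
  where
  open ≤R
  b = a / C
  suc-a≤ : suc a ≤ C * suc b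
  suc-a≤ = ≤-trans (≤-eq (cong suc (m≡m%n+[m/n]*n a C))) (≤-trans (+-monoˡ-≤ (b * C) (m%n<n a C)) (≤-eq (trans (cong (C +_) (*-comm b C)) (sym (*-suc C b)))))

 valuation : ∀ q n -> 1 < q -> 0 < n -> Σ ℕ \ a -> Σ ℕ \ m -> n ≡ q ^ a * m × ¬ (q ∣ m)
 valuation q n0 1<q 0<n₀ = go n0 n0 ≤-refl 0<n₀
  where
  go : ∀ fuel n -> n ≤ fuel -> 0 < n -> Σ ℕ \ a -> Σ ℕ \ m -> n ≡ q ^ a * m × ¬ (q ∣ m)
  go zero (suc _) () _
  go (suc fuel) n n≤ 0<n = by (q ∣? n)
   where
   by : Dec (q ∣ n) -> Σ ℕ \ a -> Σ ℕ \ m -> n ≡ q ^ a * m × ¬ (q ∣ m)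
   by (no ¬d) = 0 , n , sym (+-identityʳ n) , ¬d
   by (yes (divides k e)) = let a , m , e' , nd = go fuel k (s≤s⁻¹ (≤-trans k<n n≤)) 0<k in suc a , m , trans e (trans (*-comm k q) (trans (cong (q *_) e') (sym (*-assoc q (q ^ a) m)))) , nd
    where
    0<k : 0 < k
    0<k = n≢0⇒n>0 \ z -> <⇒≢ 0<n (sym (trans e (cong (_* q) z)))
    k<n : k < n
    k<n = subst (k <_) (sym e) (m<m*n k q {{>-nonZero 0<k}} 1<q)

 record DivisorList (n : ℕ) : Set where
  field
   list : List ℕ
   complete : ∀ d -> d ∣ n -> d ∈ list
 open DivisorList

 extend : ∀ q a m -> Prime q -> DivisorList m -> DivisorList (q ^ a * m)
 extend q a m pq D = record
  { list = cartesianProductWith (\ i e -> q ^ i * e) (upTo (suc a)) (list D)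
  ; complete = \ d d∣ -> let i , e , i≤ , e∣ , eq = decompose a d d∣ in subst (_∈ _) (sym eq) (∈-cartesianProductWith⁺ (\ i e -> q ^ i * e) (∈-upTo⁺ (s≤s i≤)) (complete D e e∣)) }
  where
  decompose : ∀ a d -> d ∣ q ^ a * m -> Σ ℕ \ i -> Σ ℕ \ e -> i ≤ a × e ∣ m × d ≡ q ^ i * e
  decompose zero d d∣ = 0 , d , z≤n , subst (d ∣_) (+-identityʳ m) d∣ , sym (+-identityʳ d)
  decompose (suc a) d d∣ = by (q ∣? d)
   where
   d∣' : d ∣ q * (q ^ a * m)
   d∣' = subst (d ∣_) (*-assoc q (q ^ a) m) d∣
   by : Dec (q ∣ d) -> Σ ℕ \ i -> Σ ℕ \ e -> i ≤ suc a × e ∣ m × d ≡ q ^ i * e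
   by (yes (divides d' eq)) = let i , e , i≤ , e∣ , eq' = decompose a d' (*-cancelˡ-∣ q {{prime⇒nonZero pq}} (subst (_∣ q * (q ^ a * m)) (trans eq (*-comm d' q)) d∣'))
    in suc i , e , s≤s i≤ , e∣ , trans eq (trans (*-comm d' q) (trans (cong (q *_) eq') (sym (*-assoc q (q ^ i) e))))
   by (no nd) = let i , e , i≤ , r = decompose a d (coprime-divisor coprime d∣') in i , e , m≤n⇒m≤1+n i≤ , r
    where
    coprime : Coprime d q
    coprime (e∣d , e∣q) = [ (\ z -> z) , (\ z -> ⊥-elim (nd (subst (_∣ d) z e∣d))) ]′ (prime⇒irreducible pq e∣q)

 extend-length : ∀ q a m pq D -> length (list (extend q a m pq D)) ≡ suc a * length (list D)
 extend-length q a m pq D = trans (go (upTo (suc a))) (cong (_* length (list D)) (List.length-upTo (suc a)))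
  where
  go : ∀ is -> length (cartesianProductWith (\ i e -> q ^ i * e) is (list D)) ≡ length is * length (list D)
  go [] = refl
  go (i ∷ is) = trans (List.length-++ (List.map (\ e -> q ^ i * e) (list D))) (cong2 _+_ (List.length-map _ (list D)) (go is))

 -- The divisor bound d(n) ^ C ≤ k n, one prime power at a time. A prime q ≥ 2 ^ C satisfies (a + 1)
 -- ^ C ≤ q ^ a and costs nothing; a smaller one costs a factor C ^ C.
 module DivisorBound (C : ℕ) .{{_ : NonZero C}} where
  Bounded : ℕ -> ℕ -> Set
  Bounded k n = Σ (DivisorList n) \ D -> length (list D) ^ C ≤ k * n
  private
   K = C ^ C
   calc : ∀ w x k m -> w * x * (k * m) ≡ w * k * (x * m)
   calc = solve-∀
   extract : ∀ q a m w k -> Prime q -> suc a ^ C ≤ w * q ^ a -> Bounded k m -> Bounded (w * k) (q ^ a * m)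
   extract q a m w k pq le (D , b) = extend q a m pq D , (begin
    length (list (extend q a m pq D)) ^ C ≡⟨ cong (_^ C) (extend-length q a m pq D) ⟩
    (suc a * length (list D)) ^ C ≡⟨ ^-distribʳ-* C (suc a) _ ⟩
    suc a ^ C * length (list D) ^ C ≤⟨ *-mono-≤ le b ⟩
    w * q ^ a * (k * m) ≡⟨ calc w (q ^ a) k m ⟩
    w * k * (q ^ a * m) ∎)
    where open ≤R
   Rough' : ℕ -> ℕ -> Set
   Rough' B n = ∀ q -> Prime q -> q ∣ n -> B ≤ q
   factor-pos : ∀ {n x m} -> 0 < n -> n ≡ x * m -> 0 < m
   factor-pos {x = x} 0<n e = n≢0⇒n>0 \ z -> <⇒≢ 0<n (sym (trans e (trans (cong (x *_) z) (*-zeroʳ x))))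
   rough : ∀ fuel n -> n ≤ fuel -> 0 < n -> Rough' (2 ^ C) n -> Bounded 1 n
   rough zero (suc _) ()
   rough (suc fuel) n n≤ 0<n R = by (n ≟ 1)
    where
    by : Dec (n ≡ 1) -> Bounded 1 n
    by (yes refl) = record { list = 1 ∷ [] ; complete = \ d d∣1 -> here (∣1⇒≡1 d∣1) } , ≤-eq (^-zeroˡ C)
    by (no n≢1) = let q , pq , q∣n = prime-divisor n (≤∧≢⇒< 0<n (\ e -> n≢1 (sym e))) in at q pq q∣n
     where
     at : ∀ q -> Prime q -> q ∣ n -> Bounded 1 n
     at q pq q∣n = let a , m , e , nd = valuation q n 1<q 0<n in sub a m e nd
      where
      1<q = nonTrivial⇒n>1 q {{prime⇒nonTrivial pq}}
      sub : ∀ a m -> n ≡ q ^ a * m -> ¬ (q ∣ m) -> Bounded 1 n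
      sub zero m e nd = ⊥-elim (nd (subst (q ∣_) (trans e (+-identityʳ m)) q∣n))
      sub (suc a) m e nd = subst (Bounded 1) (sym e) (extract q (suc a) m 1 1 pq weight
        (rough fuel m (s≤s⁻¹ (≤-trans m<n n≤)) 0<m \ r pr r∣m -> R r pr (subst (r ∣_) (sym e) (∣-trans r∣m (n∣m*n (q ^ suc a))))))
       where
       0<m = factor-pos {x = q ^ suc a} 0<n e
       m<n : m < n
       m<n = subst (m <_) (trans (*-comm m _) (sym e)) (m<m*n m (q ^ suc a) {{>-nonZero 0<m}} (<-≤-trans 1<q (m≤m*n q (q ^ a) {{m^n≢0 q a {{prime⇒nonZero pq}}}})))
       weight : suc (suc a) ^ C ≤ 1 * q ^ suc a
       weight = begin
        suc (suc a) ^ C ≤⟨ ^-monoˡ-≤ C (suc≤2^ (suc a)) ⟩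
        (2 ^ suc a) ^ C ≡⟨ trans (^-*-assoc 2 (suc a) C) (trans (cong (2 ^_) (*-comm (suc a) C)) (sym (^-*-assoc 2 C (suc a)))) ⟩
        (2 ^ C) ^ suc a ≤⟨ ^-monoˡ-≤ (suc a) (R q pq q∣n) ⟩
        q ^ suc a ≡⟨ *-identityˡ _ ⟨
        1 * q ^ suc a ∎
        where open ≤R
   -- `q` runs upwards to 2 ^ C with `j` candidates left, and every candidate, prime or not, is
   -- charged the factor `K`.
   smooth : ∀ j q n -> j + q ≡ 2 ^ C -> 0 < n -> Rough' q n -> Bounded (K ^ j) n
   smooth zero q n refl 0<n R = rough n n ≤-refl 0<n R
   smooth (suc j) q n e 0<n R = by (prime? q)
    where
    e' : j + suc q ≡ 2 ^ C
    e' = trans (+-suc j q) e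
    K≥1 : 1 ≤ K
    K≥1 = m^n>0 C C
    by : Dec (Prime q) -> Bounded (K ^ suc j) n
    by (no np) = let D , b = smooth j (suc q) n e' 0<n (\ r pr r∣n -> ≤∧≢⇒< (R r pr r∣n) (\ z -> np (subst Prime (sym z) pr)))
     in D , ≤-trans b (*-monoˡ-≤ n (m≤n*m (K ^ j) K {{>-nonZero K≥1}}))
    by (yes pq) = let a , m , eq , nd = valuation q n (nonTrivial⇒n>1 q {{prime⇒nonTrivial pq}}) 0<n in
     subst (Bounded (K ^ suc j)) (sym eq) (extract q a m K (K ^ j) pq
      (≤-trans (power-vs-exponential C a) (*-monoʳ-≤ K (^-monoˡ-≤ a (nonTrivial⇒n>1 q {{prime⇒nonTrivial pq}}))))
      (smooth j (suc q) m e' (factor-pos {x = q ^ a} 0<n eq) \ r pr r∣m -> ≤∧≢⇒< (R r pr (subst (r ∣_) (sym eq) (∣-trans r∣m (n∣m*n (q ^ a))))) (\ z -> nd (subst (_∣ m) (sym z) r∣m))))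
  divisors : ∀ n -> 0 < n -> Bounded (K ^ (2 ^ C)) n
  divisors n 0<n = smooth (2 ^ C) 0 n (+-identityʳ _) 0<n (\ _ _ _ -> z≤n)

 parity : ∀ n -> Σ ℕ \ m -> n ≡ 2 * m ⊎ n ≡ suc (2 * m)
 parity zero = 0 , inl refl
 parity (suc n) with parity n
 ... | m , inl e = m , inr (cong suc e)
 ... | m , inr e = suc m , inl (trans (cong suc e) (calc m))
  where
  calc : ∀ m -> suc (suc (2 * m)) ≡ 2 * suc m
  calc = solve-∀

 odd≢even : ∀ m n -> suc (2 * m) ≢ 2 * n
 odd≢even m (suc n) e = odd≢even' m n (suc-injective (trans e (calc n)))
  where
  calc : ∀ n -> 2 * suc n ≡ suc (suc (2 * n))
  calc = solve-∀
  odd≢even' : ∀ m n -> 2 * m ≢ suc (2 * n)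
  odd≢even' zero n ()
  odd≢even' (suc m) n e = odd≢even m n (suc-injective (trans (sym (calc m)) e))

 -- The exponent 2 C instead of C leaves room for the constants: 2 k p ≤ L p, and L p is still below
 -- (L + 1) ^ (2 C).
 below-root : ∀ C L p k n x -> k * 2 ≤ L -> 1 ≤ C -> p < suc L ^ C -> n ≤ 2 * p -> x ^ (C + C) ≤ k * n -> x ≤ L
 below-root C L p k n x k≤ 1≤C p< n≤ x≤ = ≮⇒≥ \ L<x -> <⇒≱ (begin-strict
  x ^ (C + C) ≤⟨ x≤ ⟩
  k * n ≤⟨ *-monoʳ-≤ k n≤ ⟩
  k * (2 * p) ≡⟨ *-assoc k 2 p ⟨
  k * 2 * p ≤⟨ *-monoˡ-≤ p (≤-trans k≤ (≤-trans (n≤1+n L) (≤-trans (≤-eq (sym (^-identityʳ (suc L)))) (^-monoʳ-≤ (suc L) 1≤C)))) ⟩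
  suc L ^ C * p <⟨ *-monoʳ-< (suc L ^ C) {{m^n≢0 (suc L) C}} p< ⟩
  suc L ^ C * suc L ^ C ≡⟨ ^-distribˡ-+-* (suc L) C C ⟨
  suc L ^ (C + C) ∎) (^-monoˡ-≤ (C + C) L<x)
  where open ≤R

 module Powers (L : ℕ) (1≤L : 1 ≤ L) where
  opaque
   pw : ℕ -> ℕ
   pw n = L ^ n
   pw≡ : ∀ n -> pw n ≡ L ^ n
   pw≡ n = refl
   pw-+ : ∀ m n -> pw m * pw n ≡ pw (m + n)
   pw-+ m n = sym (^-distribˡ-+-* L m n)
   pw-1 : pw 1 ≡ L
   pw-1 = *-identityʳ L
   pw-mono : ∀ {m n} -> m ≤ n -> pw m ≤ pw n
   pw-mono = ^-monoʳ-≤ L {{>-nonZero 1≤L}}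
   absorb : ∀ {k} -> k ≤ L -> ∀ n -> k * pw n ≤ pw (suc n)
   absorb k≤ n = *-monoˡ-≤ (L ^ n) k≤
  pw>0 : ∀ n -> 1 ≤ pw n
  pw>0 n = subst (1 ≤_) (sym (pw≡ n)) (m^n>0 L {{>-nonZero 1≤L}} n)

 -- The constants of the bounds for the number of divisors and of prime divisors with exponent 1 / (2C).
 divisor-constant prime-constant : ℕ -> ℕ
 divisor-constant C = ((C + C) ^ (C + C)) ^ (2 ^ (C + C))
 prime-constant C = 2 ^ ((C + C) * suc (2 ^ (C + C)))

-- Raising the order of a coordinate by rotations.

module Climb (S : Setting) where
 open import Data.Nat.Divisibility using (_∣_; ∣⇒≤)
 open import Data.Nat.ListAction using (sum)
 open import Data.Fin using (Fin; toℕ; fromℕ<)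
 open import Data.List.Membership.Propositional.Properties using (∈-applyUpTo⁻)
 open import Relation.Nullary.Decidable using (_⊎-dec_)

 open Count
 open Tori S
 open K
 open Conic S
 open EndCount S using (sizes; 1≤p; module Counts)
 open Orbit S

 N : ℕ
 N = size split · size inert

 0<N : 0 < N
 0<N = *-mono-≤ {1} {p ∸ 1} {1} {suc p} (m<n⇒0<n∸m (<-trans (s≤s (s≤s z≤n)) 2<p)) (s≤s z≤n)

 opaque
  order-exists : ∀ b -> Σ ℕ (Order (Y b))
  order-exists b = order (Y b) N 0<N ([ (\ i -> ^-*-≡1 (size split) (size inert) (InTorus-size split i)) ,
   (\ i -> trans (cong (Y b ^_) (N.*-comm (size split) (size inert))) (^-*-≡1 (size inert) (size split) (InTorus-size inert i))) ]′ (Y-torus b))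
  ord : F.Carrier -> ℕ
  ord b = fst (order-exists b)
  ord-order : ∀ b -> Order (Y b) (ord b)
  ord-order b = snd (order-exists b)

 ord-∣ : ∀ b t -> InTorus t (Y b) -> ord b ∣ size t
 ord-∣ b t i = order-∣ (size t) (ord-order b) (InTorus-size t i)

 ord-divides : ∀ b -> ord b ∣ size split ⊎ ord b ∣ size inert
 ord-divides b = [ (\ i -> inl (ord-∣ b split i)) , (\ i -> inr (ord-∣ b inert i)) ]′ (Y-torus b)

 ord≤ : ∀ b k -> 0 < k -> Y b ^ k ≡ 1# -> ord b ≤ k
 ord≤ b (suc k) _ e = ∣⇒≤ (order-∣ (suc k) (ord-order b) e)

 large-order⇒≢0 : ∀ {b} -> 4 < ord b -> b ≢ F.0#
 large-order⇒≢0 {b} lt b≡0 = <⇒≱ lt (ord≤ b 4 (s≤s z≤n) (trans (solve 1 (\ y -> y :^ 4 := (y :* y) :* (y :* y)) refl (Y b)) (trans (cong2 _*_ Y² Y²) (solve 1 (\ o -> (:- lit 1) :* (:- lit 1) := lit 1) refl 0#))))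
  where
  Y² : Y b * Y b ≡ - 1#
  Y² = begin
   Y b * Y b ≡⟨ solve 2 (\ y z -> y :* y := y :* (y :+ z) :- y :* z) refl (Y b) (Y' b) ⟩
   Y b * (Y b + Y' b) - Y b * Y' b ≡⟨ cong2 (\ s t -> Y b * s - t) (trans (Y+Y' b) (trans (cong ι b≡0) ι-0)) (YY' b) ⟩
   Y b * 0# - 1# ≡⟨ solve 1 (\ y -> y :* lit 0 :- lit 1 := :- lit 1) refl (Y b) ⟩
   - 1# ∎
   where open ≡R

 large-order⇒disc≢0 : ∀ {b} -> 2 < ord b -> disc b ≢ F.0#
 large-order⇒disc≢0 {b} lt e = <⇒≱ lt (ord≤ b 2 (s≤s z≤n) (begin
  Y b * (Y b * 1#) ≡⟨ cong (Y b *_) (*-identityʳ (Y b)) ⟩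
  Y b * Y b ≡⟨ cong (Y b *_) (x-y≡0⇒x≡y (trans (Y-Y' b) w≡0)) ⟩
  Y b * Y' b ≡⟨ YY' b ⟩
  1# ∎))
  where
  open ≡R
  w≡0 : w b ≡ 0#
  w≡0 = [ (\ z -> z) , (\ z -> z) ]′ (no-zero-divisors (trans (sqrt² (disc b)) (trans (cong ι e) ι-0)))

 Y-injective : ∀ {a b} -> Y a ≡ Y b -> a ≡ b
 Y-injective {a} {b} e = ι-injective (trans (sym (Y+Y' a)) (trans (cong2 _+_ e (trans (sym (Y⁻¹ a)) (trans (cong _⁻¹ e) (Y⁻¹ b)))) (Y+Y' b)))

 module Divisors (Ds : List ℕ) (Ds-complete : ∀ d -> d ∣ size split ⊎ d ∣ size inert -> d ∈ Ds) where
  ord∈Ds : ∀ b -> ord b ∈ Ds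
  ord∈Ds b = Ds-complete (ord b) (ord-divides b)
  few-small-orders : ∀ bs -> Unique bs -> ∀ M -> (∀ b -> b ∈ bs -> ord b ≤ M) -> length bs ≤ length Ds · M
  few-small-orders bs u M small = fiber-bound (\ d b -> ord b N.≟ d) bs Ds M (\ b b∈ -> ord∈Ds b) fiber
   where
   fiber : ∀ d -> d ∈ Ds -> length (filter (\ b -> ord b N.≟ d) bs) ≤ M
   fiber d _ = go (filter (\ b -> ord b N.≟ d) bs) (Unique.filter⁺ _ u) (\ b b∈ -> ∈-filter⁻ (\ b -> ord b N.≟ d) {xs = bs} b∈)
    where
    go : ∀ cs -> Unique cs -> (∀ b -> b ∈ cs -> b ∈ bs × ord b ≡ d) -> length cs ≤ M
    go [] _ _ = z≤n
    go (c ∷ cs) uc sound = let c∈ , e = sound c (here refl) in ≤-trans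
     (subst (_≤ d) (List.length-map Y (c ∷ cs)) (unity-bound d 1# (map Y (c ∷ cs)) (subst (0 <_) e (positive (ord-order c))) 1≢0 (Unique.map⁺ Y-injective uc)
      (All.map⁺ (All.tabulate \ {b} b∈ -> subst (\ k -> Y b ^ k ≡ 1#) (snd (sound b b∈)) (kills (ord-order b))))))
     (subst (_≤ M) e (small c c∈))
  module Ascent (t1 : Type) (α β : Carrier) (α≢0 : α ≢ 0#) (β≢0 : β ≢ 0#) (αβ≢1 : α * β ≢ 1#)
   (real : ∀ x -> InTorus t1 x -> Σ F.Carrier \ b -> α * x + β * x ⁻¹ ≡ ι b)
   (ξ : Carrier) (ξ^∈ : ∀ j -> InTorus t1 (ξ ^ j)) (ℓ Λ : ℕ) (oℓ : Order ξ ℓ) (Λ> : 18 · length Ds < Λ)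
   (6Λ⁴≤ℓ : 6 · (Λ · Λ · (Λ · Λ)) ≤ ℓ) (13Λ²ℓ<p : 13 · (Λ · Λ · ℓ) < p) where
   open Family t1 α β α≢0 β≢0 αβ≢1 real using (height; height-eq; y; r-unique; Regular; on-curve; module Subgroups)
   -- The parabolic case disc b = 0 counts as success although the order of `Y b` is at most 2
   -- there: the rotation that fixes such a `b` reaches every coordinate.
   Up : F.Carrier -> Set
   Up b = disc b ≡ F.0# ⊎ ℓ < ord b
   up? : ∀ b -> Dec (Up b)
   up? b = (disc b F.≟ F.0#) ⊎-dec (ℓ N.<? ord b)
   private
    0<Λ : 0 < Λ
    0<Λ = ≤-<-trans z≤n Λ>
    -- If no power of ξ succeeds, all ℓ heights are regular of order at most ℓ. Each of the possible
    -- orders in `Ds` accounts for at most 18 ℓ / Λ of them, so Λ ≤ 18 |Ds|.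
    module Contra (none : ∀ j -> j < ℓ -> ¬ Up (height (ξ ^ j))) where
     xs : List Carrier
     xs = powers ξ ℓ
     record Good (x : Carrier) : Set where
      constructor good
      field
       inside : InTorus t1 x
       regular : Regular x
       small : ord (height x) ≤ ℓ
       killed : x ^ ℓ ≡ 1#
     open Good
     power-good : ∀ j -> j < ℓ -> Good (ξ ^ j)
     power-good j j< = good (ξ^∈ j) (\ z -> none j j< (inl z)) (≮⇒≥ (\ z -> none j j< (inr z))) (powers-kill ℓ j (kills oℓ))
     sound : ∀ {x} -> x ∈ xs -> Good x
     sound {x} x∈ = let j , j< , e = ∈-applyUpTo⁻ (ξ ^_) x∈ in subst Good (sym e) (power-good j j<)
     fiber : ∀ d -> length (filter (\ x -> ord (height x) N.≟ d) xs) · Λ ≤ 18 · ℓ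
     fiber d = go (filter (\ x -> ord (height x) N.≟ d) xs) (Unique.filter⁺ _ (powers-unique oℓ)) (\ x x∈ -> ∈-filter⁻ (\ x -> ord (height x) N.≟ d) {xs = xs} x∈)
      where
      go : ∀ zs -> Unique zs -> (∀ x -> x ∈ zs -> x ∈ xs × ord (height x) ≡ d) -> length zs · Λ ≤ 18 · ℓ
      go [] _ _ = z≤n
      go zs@(z ∷ _) uz zs-sound = subst (\ n -> n · Λ ≤ 18 · ℓ) (List.length-map (\ x -> x , y x) zs)
        (bounded (Λ · Λ N.≤? d))
       where
       d≤ℓ : d ≤ ℓ
       d≤ℓ = let z∈ , e = zs-sound z (here refl) in subst (_≤ ℓ) e (small (sound z∈))
       0<d : 0 < d
       0<d = subst (0 <_) (snd (zs-sound z (here refl))) (positive (ord-order (height z)))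
       ps = map (\ x -> x , y x) zs
       uniq : Unique (map (\ { (x , y) -> x * y }) ps)
       uniq = subst Unique (List.map-∘ zs) (r-unique zs uz (All.tabulate \ {x} x∈ -> let g = sound (fst (zs-sound x x∈)) in inside g , regular g))
       y^d : ∀ {x} -> x ∈ zs -> y x ^ d ≡ 1#
       y^d {x} x∈ = subst (\ k -> y x ^ k ≡ 1#) (snd (zs-sound x x∈)) (kills (ord-order (height x)))
       bounded : Dec (Λ · Λ ≤ d) -> length ps · Λ ≤ 18 · ℓ
       bounded (yes le) = Subgroups.subgroup-bound ℓ d Λ 0<Λ d≤ℓ le 6Λ⁴≤ℓ 13Λ²ℓ<p ps uniq
        (All.map⁺ (All.tabulate \ {x} x∈ -> let g = sound (fst (zs-sound x x∈)) in on-curve (inside g) , killed g , y^d x∈))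
       -- A group of order d < Λ² is too small for the bound, but y ^ d = 1 implies y ^ (d Λ²) = 1,
       -- and d Λ² lies between Λ² and Λ⁴ ≤ ℓ.
       bounded (no nle) = Subgroups.subgroup-bound ℓ (d · (Λ · Λ)) Λ 0<Λ
        (≤-trans (*-monoˡ-≤ (Λ · Λ) (<⇒≤ (≰⇒> nle))) (≤-trans (m≤n*m _ 6) 6Λ⁴≤ℓ))
        (m≤n*m (Λ · Λ) d {{N.>-nonZero 0<d}}) 6Λ⁴≤ℓ 13Λ²ℓ<p ps uniq
        (All.map⁺ (All.tabulate \ {x} x∈ -> let g = sound (fst (zs-sound x x∈)) in on-curve (inside g) , killed g , ^-*-≡1 d (Λ · Λ) (y^d x∈)))
     contradiction : ⊥
     contradiction = <⇒≱ Λ> (*-cancelˡ-≤ ℓ {{N.>-nonZero (positive oℓ)}} (begin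
      ℓ · Λ ≡⟨ cong (_· Λ) (List.length-applyUpTo (ξ ^_) ℓ) ⟨
      length xs · Λ ≤⟨ *-monoˡ-≤ Λ (cover-count (\ d x -> ord (height x) N.≟ d) xs Ds (\ x _ -> ord∈Ds (height x))) ⟩
      sum (map (\ d -> length (filter (\ x -> ord (height x) N.≟ d) xs)) Ds) · Λ ≤⟨ sum-bound (\ d x -> ord (height x) N.≟ d) xs Ds Λ (18 · ℓ) (\ d _ -> fiber d) ⟩
      length Ds · (18 · ℓ) ≡⟨ calc (length Ds) ℓ ⟩
      ℓ · (18 · length Ds) ∎))
      where
      open ≤R
      calc : ∀ D l -> D · (18 · l) ≡ l · (18 · D)
      calc = solve-∀
   ascent : Σ ℕ \ j -> ∀ b -> ι b ≡ α * ξ ^ j + β * (ξ ^ j) ⁻¹ -> Up b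
   ascent = found (Fin.any? {n = ℓ} (\ j -> up? (height (ξ ^ toℕ j))))
    where
    found : Dec (Σ (Fin ℓ) \ j -> Up (height (ξ ^ toℕ j))) -> Σ ℕ \ j -> ∀ b -> ι b ≡ α * ξ ^ j + β * (ξ ^ j) ⁻¹ -> Up b
    found (yes (j , u)) = toℕ j , \ b e -> subst Up (ι-injective (trans (height-eq (ξ^∈ (toℕ j))) (sym e))) u
    found (no none) = ⊥-elim (Contra.contradiction \ j j< u -> none (fromℕ< j< , subst (\ j -> Up (height (ξ ^ j))) (sym (Fin.toℕ-fromℕ< j<)) u))
  module _ {_~_ : Point -> Point -> Set} (moves : Moves _~_) where
   open Connected moves
   ascend : ∀ {P a} Λ -> 18 · length Ds < Λ -> Hits P a -> a ≢ F.0# -> disc a ≢ F.0# -> 6 · (Λ · Λ · (Λ · Λ)) ≤ ord a -> 13 · (Λ · Λ · ord a) < p ->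
    Σ F.Carrier \ b -> Hits P b × (disc b ≡ F.0# ⊎ ord a < ord b)
   ascend {P} {a} Λ Λ> (b , c , on , hit) a≢0 d≢0 le lt = fst (sequence a b c j) , hits-sequence on hit j ,
     snd found (fst (sequence a b c j)) (trans (fst (R.sequence-eq j)) (cong (\ t -> R.α * R.ξ ^ j + R.β * t) (sym (R.ξ^⁻¹ j))))
    where
    t = fst (typeOf a)
    module R = Rotation a b c on a≢0 d≢0 t (snd (typeOf a))
    found = Ascent.ascent t R.α R.β R.α≢0 R.β≢0 R.αβ≢1 R.real R.ξ R.ξ^∈ (ord a) Λ (ord-order a) Λ> le lt
    j = fst found
   -- For disc b = 0 the rotation is unipotent up to sign: the even terms of the sequence form an arithmetic progression.
   parabolic : ∀ {P b} -> Hits P b -> disc b ≡ F.0# -> ∀ b' -> Hits P b'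
   parabolic {P} {b} (c , d , on , hit) db b' = subst (Hits P) reached (hits-sequence on hit (2 · k))
    where
    g = b F.* d F.- F.num 2 F.* c
    b² : b F.* b F.- F.num 4 ≡ F.0#
    b² = db
    -- The surface equation with b² = 4 fixes the square of the common difference, which is
    -- therefore nonzero in odd characteristic.
    g²≡-16 : g F.* g ≡ F.- F.num 16
    g²≡-16 = F.x-y≡0⇒x≡y (begin
     g F.* g F.- (F.- F.num 16)
      ≡⟨ F.solve 3 (\ b c d -> (b F.:* d F.:- F.lit 2 F.:* c) F.:* (b F.:* d F.:- F.lit 2 F.:* c) F.:- (F.:- F.lit 16)
         F.:= (b F.:* b F.:- F.lit 4) F.:* (d F.:* d F.:- F.lit 4) F.:+ F.lit 4 F.:* ((b F.:* b F.:+ c F.:* c F.:+ d F.:* d) F.:- b F.:* c F.:* d)) refl b c d ⟩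
     (b F.* b F.- F.num 4) F.* (d F.* d F.- F.num 4) F.+ F.num 4 F.* ((b F.* b F.+ c F.* c F.+ d F.* d) F.- b F.* c F.* d)
      ≡⟨ cong2 (\ s t -> s F.* (d F.* d F.- F.num 4) F.+ F.num 4 F.* t) b² (F.x≡y⇒x-y≡0 on) ⟩
     F.0# F.* (d F.* d F.- F.num 4) F.+ F.num 4 F.* F.0# ≡⟨ trans (cong2 F._+_ (F.zeroˡ _) (F.zeroʳ _)) (F.+-identityʳ F.0#) ⟩
     F.0# ∎)
     where open ≡R
    g≢0 : g ≢ F.0#
    g≢0 e = F.neg-≢0 F-16≢0 (trans (sym g²≡-16) (trans (cong (F._* g) e) (F.zeroˡ g)))
    onto = cast-onto ((b' F.- c) F.* g F.⁻¹)
    k = fst onto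
    progression : ∀ j -> let u , v = sequence b c d (2 · j) in u ≡ c F.+ F.cast j F.* g × b F.* v F.- F.num 2 F.* u ≡ g
    progression zero = sym (trans (cong (c F.+_) (F.zeroˡ g)) (F.+-identityʳ c)) , refl
    progression (suc j) = subst (\ n -> let u , v = sequence b c d n in u ≡ c F.+ F.cast (suc j) F.* g × b F.* v F.- F.num 2 F.* u ≡ g) (calc j) (step1 , step2)
     where
     calc : ∀ j -> suc (suc (2 · j)) ≡ 2 · suc j
     calc = solve-∀
     u = fst (sequence b c d (2 · j))
     v = snd (sequence b c d (2 · j))
     IH = progression j
     step1 : b F.* v F.- u ≡ c F.+ F.cast (suc j) F.* g
     step1 = begin
      b F.* v F.- u ≡⟨ F.solve 3 (\ b v u -> b F.:* v F.:- u F.:= u F.:+ (b F.:* v F.:- F.lit 2 F.:* u)) refl b v u ⟩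
      u F.+ (b F.* v F.- F.num 2 F.* u) ≡⟨ cong2 F._+_ (fst IH) (snd IH) ⟩
      c F.+ F.cast j F.* g F.+ g ≡⟨ F.solve 3 (\ c k g -> c F.:+ k F.:* g F.:+ g F.:= c F.:+ (F.lit 1 F.:+ k) F.:* g) refl c (F.cast j) g ⟩
      c F.+ F.cast (suc j) F.* g ∎
      where open ≡R
     step2 : b F.* (b F.* (b F.* v F.- u) F.- v) F.- F.num 2 F.* (b F.* v F.- u) ≡ g
     step2 = begin
      b F.* (b F.* (b F.* v F.- u) F.- v) F.- F.num 2 F.* (b F.* v F.- u)
       ≡⟨ F.solve 3 (\ b v u -> b F.:* (b F.:* (b F.:* v F.:- u) F.:- v) F.:- F.lit 2 F.:* (b F.:* v F.:- u)
          F.:= (b F.:* v F.:- F.lit 2 F.:* u) F.:+ (b F.:* b F.:- F.lit 4) F.:* (b F.:* v F.:- u)) refl b v u ⟩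
      (b F.* v F.- F.num 2 F.* u) F.+ (b F.* b F.- F.num 4) F.* (b F.* v F.- u) ≡⟨ cong2 F._+_ (snd IH) (trans (cong (F._* (b F.* v F.- u)) b²) (F.zeroˡ _)) ⟩
      g F.+ F.0# ≡⟨ F.+-identityʳ g ⟩
      g ∎
      where open ≡R
    reached : fst (sequence b c d (2 · k)) ≡ b'
    reached = begin
     fst (sequence b c d (2 · k)) ≡⟨ fst (progression k) ⟩
     c F.+ F.cast k F.* g ≡⟨ cong (\ t -> c F.+ t F.* g) (snd onto) ⟩
     c F.+ (b' F.- c) F.* g F.⁻¹ F.* g ≡⟨ F.solve 4 (\ c b g i -> c F.:+ (b F.:- c) F.:* i F.:* g F.:= c F.:+ (b F.:- c) F.:* (g F.:* i)) refl c b' g (g F.⁻¹) ⟩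
     c F.+ (b' F.- c) F.* (g F.* g F.⁻¹) ≡⟨ cong (\ t -> c F.+ (b' F.- c) F.* t) (F.*-inverseʳ g≢0) ⟩
     c F.+ (b' F.- c) F.* F.1# ≡⟨ F.solve 2 (\ c b -> c F.:+ (b F.:- c) F.:* F.lit 1 F.:= b) refl c b' ⟩
     b' ∎
     where open ≡R
   module Climbing (Λ : ℕ) (Λ> : 18 · length Ds < Λ) where
    private
     0<Λ : 0 < Λ
     0<Λ = ≤-<-trans z≤n Λ>
     C = 13 · (Λ · Λ)
    Large : F.Carrier -> Set
    Large b = p ≤ C · ord b
    -- Orders up to p / C are taken by at most |Ds| p / C < p elements. This supplies the goal when
    -- the climb ends in the parabolic case, where any coordinate can be chosen.
    exists-large : Σ F.Carrier Large
    exists-large = find elements (\ none -> <⇒≱ (too-few none) (≤-trans (≤-eq (sym elements-length)) ≤-refl))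
     where
     M = p N./ C
      where instance _ = N.>-nonZero (*-mono-≤ {1} {13} (s≤s z≤n) (*-mono-≤ 0<Λ 0<Λ))
     too-few : (∀ b -> b ∈ elements -> ¬ Large b) -> length elements < p
     too-few none = *-cancelˡ-< C (length elements) p (begin-strict
      C · length elements ≤⟨ *-monoʳ-≤ C (few-small-orders elements elements-unique M (\ b b∈ -> small b b∈)) ⟩
      C · (length Ds · M) ≡⟨ calc C (length Ds) M ⟩
      length Ds · (M · C) ≤⟨ *-monoʳ-≤ (length Ds) (m/n*n≤m p C) ⟩
      length Ds · p <⟨ *-monoˡ-< p {{N.>-nonZero 1≤p}} Ds<C ⟩
      C · p ∎)
      where
      open ≤R
      open import Data.Nat.DivMod using (m/n*n≤m; /-monoˡ-≤; m*n/n≡m)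
      instance _ = N.>-nonZero (*-mono-≤ {1} {13} (s≤s z≤n) (*-mono-≤ 0<Λ 0<Λ))
      calc : ∀ C D M -> C · (D · M) ≡ D · (M · C)
      calc = solve-∀
      Ds<C : length Ds < C
      Ds<C = ≤-<-trans (m≤n*m (length Ds) 18) (<-≤-trans Λ> (≤-trans (m≤n*m Λ Λ {{N.>-nonZero 0<Λ}}) (m≤n*m (Λ · Λ) 13)))
      small : ∀ b -> b ∈ elements -> ord b ≤ M
      small b b∈ = subst (_≤ M) (m*n/n≡m (ord b) C) (/-monoˡ-≤ C (≤-trans (≤-eq (N.*-comm (ord b) C)) (<⇒≤ (≰⇒> (none b b∈)))))
     find : ∀ bs -> ¬ (∀ b -> b ∈ bs -> ¬ Large b) -> Σ F.Carrier Large
     find [] h = ⊥-elim (h (\ b ()))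
     find (b ∷ bs) h = test (p N.≤? C · ord b)
      where
      test : Dec (Large b) -> Σ F.Carrier Large
      test (yes l) = b , l
      test (no nl) = find bs (\ none -> h (\ { b' (here refl) -> nl ; b' (there b∈) -> none b' b∈ }))
    climb : ∀ {P a} -> Hits P a -> 4 < ord a -> 6 · (Λ · Λ · (Λ · Λ)) ≤ ord a -> Σ F.Carrier \ b -> Hits P b × Large b
    climb {P} {a0} h0 = go p a0 h0 (m≤n+m p (ord a0))
     where
     go : ∀ fuel a -> Hits P a -> p ≤ ord a N.+ fuel -> 4 < ord a -> 6 · (Λ · Λ · (Λ · Λ)) ≤ ord a -> Σ F.Carrier \ b -> Hits P b × Large b
     go fuel a h@(b , c , on , hit) le 4< 6Λ⁴≤ = test (p N.≤? C · ord a)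
      where
      next : ∀ fuel -> p ≤ ord a N.+ fuel -> 13 · (Λ · Λ · ord a) < p -> (Σ F.Carrier \ b -> Hits P b × (disc b ≡ F.0# ⊎ ord a < ord b)) -> Σ F.Carrier \ b -> Hits P b × Large b
      next fuel le lt (b' , h' , inl d≡0) = fst exists-large , parabolic h' d≡0 (fst exists-large) , snd exists-large
      next zero le lt (b' , h' , inr up) = ⊥-elim (<⇒≱ lt (≤-trans (≤-trans le (≤-eq (N.+-identityʳ (ord a)))) (≤-trans (m≤n*m (ord a) (Λ · Λ) {{N.>-nonZero (*-mono-≤ 0<Λ 0<Λ)}}) (m≤n*m _ 13))))
      next (suc fuel) le lt (b' , h' , inr up) = go fuel b' h' (≤-trans le (≤-trans (≤-eq (+-suc (ord a) fuel)) (+-monoˡ-≤ fuel up))) (<-trans 4< up) (≤-trans 6Λ⁴≤ (<⇒≤ up))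
      test : Dec (Large a) -> Σ F.Carrier \ b -> Hits P b × Large b
      test (yes l) = a , h , l
      test (no nl) = next fuel le lt (ascend Λ Λ> h (large-order⇒≢0 4<) (large-order⇒disc≢0 (<-trans (s≤s (s≤s (s≤s z≤n))) 4<)) 6Λ⁴≤ lt)
       where
       lt : 13 · (Λ · Λ · ord a) < p
       lt = subst (_< p) (N.*-assoc 13 (Λ · Λ) (ord a)) (≰⇒> nl)

-- From a coordinate of almost maximal order to many coordinates avoiding given prime indices.

module EndStep (S : Setting) where
 open import Data.Nat.Divisibility using (_∣_; divides; m∣m*n)
 open import Data.Nat.Primality using (Prime; prime⇒irreducible)
 open import Data.Nat.ListAction using (product)
 open import Data.List using (deduplicate)
 open import Data.List.Membership.Propositional using (lose)
 open import Data.List.Membership.Propositional.Properties using (∈-deduplicate⁺; ∈-deduplicate⁻)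
 open import Relation.Nullary.Decidable using (_⊎-dec_)

 open Count
 open NT using (parity; odd≢even)
 open Tori S
 open K
 open Conic S
 open EndCount S using (1≤p; p≤suc-size; size≤suc-p; module Counts)
 open Orbit S
 open Climb S using (ord; ord-order; ord-∣; ord≤)

 -- Only even w are excluded in `avoids`: b may have to be replaced by -b, which turns `Y b` into -1
 -- / Y b, and even powers do not see the sign.
 record Target (Good : F.Carrier -> Set) (t : Type) (qs : List ℕ) (b : F.Carrier) : Set where
  field
   good : Good b
   regular : disc b ≢ F.0#
   inside : InTorus t (Y b)
   avoids : ∀ {q} -> q ∈ qs -> ∀ w -> q · w ≡ size t -> 2 ∣ w -> Y b ^ w ≢ 1#
 open Target

 neg-even-^ : ∀ x {w} -> 2 ∣ w -> (- x) ^ w ≡ x ^ w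
 neg-even-^ x (divides v refl) = begin
  (- x) ^ (v · 2) ≡⟨ cong ((- x) ^_) (N.*-comm v 2) ⟩
  (- x) ^ (2 · v) ≡⟨ ^-assocʳ (- x) 2 v ⟨
  ((- x) ^ 2) ^ v ≡⟨ cong (_^ v) (solve 1 (\ x -> (:- x) :^ 2 := x :^ 2) refl x) ⟩
  (x ^ 2) ^ v ≡⟨ ^-assocʳ x 2 v ⟩
  x ^ (2 · v) ≡⟨ cong (x ^_) (N.*-comm 2 v) ⟩
  x ^ (v · 2) ∎
  where open ≡R

 Y-neg-^ : ∀ b {w} -> 2 ∣ w -> Y (F.- b) ^ w ≡ 1# -> Y b ^ w ≡ 1#
 Y-neg-^ b {w} 2∣w e = begin
  Y b ^ w ≡⟨ *-identityʳ _ ⟨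
  Y b ^ w * 1# ≡⟨ cong (Y b ^ w *_) (trans (sym e) (trans (cong (_^ w) (Y-neg b)) (neg-even-^ (Y' b) 2∣w))) ⟩
  Y b ^ w * Y' b ^ w ≡⟨ ^-distrib-* (Y b) (Y' b) w ⟨
  (Y b * Y' b) ^ w ≡⟨ cong (_^ w) (YY' b) ⟩
  1# ^ w ≡⟨ ^-1# w ⟩
  1# ∎
  where open ≡R

 disc-neg : ∀ b -> disc (F.- b) ≡ disc b
 disc-neg b = F.solve 1 (\ b -> (F.:- b) F.:* (F.:- b) F.:- F.lit 4 F.:= b F.:* b F.:- F.lit 4) refl b

 Y-neg-∈ : ∀ t b -> InTorus t (Y b) -> InTorus t (Y (F.- b))
 Y-neg-∈ t b i = subst (InTorus t) (trans (cong (\ s -> - s) (Y⁻¹ b)) (sym (Y-neg b))) (InTorus-neg t (InTorus-⁻¹ t i))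

 -- The points counted have heights that are `Good` only up to sign. The other fields of `Target`
 -- are stable under b ↦ -b, so the sign is chosen after sieving.
 module Produce (t1 : Type) (α β : Carrier) (α≢0 : α ≢ 0#) (β≢0 : β ≢ 0#) (αβ≢1 : α * β ≢ 1#)
  (real : ∀ x -> InTorus t1 x -> Σ F.Carrier \ b -> α * x + β * x ⁻¹ ≡ ι b)
  (e1 ℓ1 J : ℕ) (size1 : e1 · (2 · ℓ1) ≡ size t1) (0<e₁ : 0 < e1) (2≤J : 2 ≤ J)
  (large : 26 · (e1 · e1 · e1 · (J · J · (J · J) · J)) < p)
  (Good : F.Carrier -> Set)
  (choose : ∀ x -> InTorus t1 x -> x ^ (2 · ℓ1) ≡ 1# -> ∀ b -> ι b ≡ α * x + β * x ⁻¹ -> Good b ⊎ Good (F.- b))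
  (qs : List ℕ) (ps : All Prime qs) (uq : Unique qs) (∣n₂ : 2 · product qs ∣ size (opposite t1)) where
  open Counts t1 α β α≢0 β≢0 αβ≢1 real using (height; height-eq; y; X2; X2-sound; X2-unique; quadratic; module Large)
  open Large e1 ℓ1 J size1 0<e₁ 2≤J large using (survivors; survivor-sound; sieve-lower)
  private
   t2 = opposite t1
   k = length qs
   zs : List Carrier
   zs = survivors qs ps (size t2)
   record Chosen (x : Carrier) : Set where
    constructor chosen
    field
     b : F.Carrier
     target : Target Good t2 qs b
     close : height x ≡ b ⊎ height x ≡ F.- b
   open Chosen
   sound : ∀ {x} -> x ∈ zs -> InTorus t1 x
   sound x∈ = fst (X2-sound (fst (survivor-sound qs ps (size t2) _ x∈)))
   chosen-at : ∀ {x} -> x ∈ zs -> Chosen x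
   chosen-at {x} x∈ = pick (choose x ix (fst Px) (height x) (height-eq ix))
    where
    s = survivor-sound qs ps (size t2) x x∈
    ix = fst (X2-sound (fst s))
    reg = fst (snd (X2-sound (fst s)))
    iy = snd (snd (X2-sound (fst s)))
    Px = fst (snd s)
    av : ∀ {q} -> q ∈ qs -> ∀ w -> q · w ≡ size t2 -> 2 ∣ w -> Y (height x) ^ w ≢ 1#
    av q∈ w e _ z = All.lookup (snd (snd s)) q∈ w e (fst Px , z)
    pick : Good (height x) ⊎ Good (F.- height x) -> Chosen x
    pick (inl g) = chosen (height x) (record { good = g ; regular = reg ; inside = iy ; avoids = av }) (inl refl)
    pick (inr g) = chosen (F.- height x) (record { good = g ; regular = \ e -> reg (trans (sym (disc-neg (height x))) e)
     ; inside = Y-neg-∈ t2 (height x) iy ; avoids = \ q∈ w e 2∣w z -> av q∈ w e 2∣w (Y-neg-^ (height x) 2∣w z) }) (inr (sym (F.-‿involutive (height x))))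
   all-chosen : All Chosen zs
   all-chosen = All.tabulate chosen-at
   bs : ∀ {zs} -> All Chosen zs -> List F.Carrier
   bs [] = []
   bs (c ∷ cs) = b c ∷ bs cs
   bs-targets : ∀ {zs} (cs : All Chosen zs) -> All (Target Good t2 qs) (bs cs)
   bs-targets [] = []
   bs-targets (c ∷ cs) = target c ∷ bs-targets cs
   bs-cover : ∀ {zs} (cs : All Chosen zs) {x} -> x ∈ zs -> Σ F.Carrier \ b -> b ∈ bs cs × (height x ≡ b ⊎ height x ≡ F.- b)
   bs-cover (c ∷ cs) (here refl) = b c , here refl , close c
   bs-cover (c ∷ cs) (there x∈) = let b , b∈ , r = bs-cover cs x∈ in b , there b∈ , r
   R? : ∀ b x -> Dec (height x ≡ b ⊎ height x ≡ F.- b)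
   R? b x = (height x F.≟ b) ⊎-dec (height x F.≟ (F.- b))
   zs-unique : Unique zs
   zs-unique = Unique.filter⁺ _ X2-unique
  targets : List F.Carrier
  targets = deduplicate F._≟_ (bs all-chosen)
  targets-unique : Unique targets
  targets-unique = DecUnique.deduplicate-! F._≟_ (bs all-chosen)
  targets-sound : All (Target Good t2 qs) targets
  targets-sound = All.tabulate \ b∈ -> All.lookup (bs-targets all-chosen) (∈-deduplicate⁻ F._≟_ (bs all-chosen) b∈)
  private
   -- 4 = 2 · 2: a target comes from the heights b and -b, each with at most two x.
   zs≤ : length zs ≤ length targets · 4
   zs≤ = fiber-bound R? zs targets 4 (\ x x∈ -> let b , b∈ , r = bs-cover all-chosen x∈ in lose (∈-deduplicate⁺ F._≟_ b∈) r) fiber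
    where
    fiber : ∀ b -> b ∈ targets -> length (filter (R? b) zs) ≤ 4
    fiber b _ = fiber-bound (\ c x -> height x F.≟ c) (filter (R? b) zs) (b ∷ F.- b ∷ []) 2
     (\ x x∈ -> [ here , (\ e -> there (here e)) ]′ (snd (∈-filter⁻ (R? b) {xs = zs} x∈)))
     \ c _ -> quadratic (ι c) _ (Unique.filter⁺ _ (Unique.filter⁺ _ zs-unique)) (All.tabulate \ {x} x∈ ->
      let x∈' , e = ∈-filter⁻ (\ x -> height x F.≟ c) {xs = filter (R? b) zs} x∈ in sound (fst (∈-filter⁻ (R? b) {xs = zs} x∈')) , cong ι e)
  targets-many : J · size t2 ≤ 2 N.^ k · (2 · e1 · J · (length targets · 4) N.+ 2 N.^ k · (8 · e1 · p))
  targets-many = ≤-trans (sieve-lower qs ps uq ∣n₂) (*-monoʳ-≤ (2 N.^ k) (+-monoˡ-≤ _ (*-monoʳ-≤ (2 · e1 · J) zs≤)))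

 -- The count needs a subgroup of even order 2 ℓ1. If ℓ is odd, the index c is even and the subgroup
 -- can be doubled; the new elements are the negatives of the old ones, which costs only the sign of
 -- b.
 halve : ∀ c ℓ m -> c · ℓ ≡ 2 · m -> Σ ℕ \ e -> Σ ℕ \ ℓ1 -> e · (2 · ℓ1) ≡ c · ℓ × e ≤ c × (2 · ℓ1 ≡ ℓ ⊎ (ℓ1 ≡ ℓ × Σ ℕ \ h -> ℓ ≡ suc (2 · h)))
 halve c ℓ m eq with parity ℓ
 ... | h , inl e = c , h , cong (c ·_) (sym e) , ≤-refl , inl (sym e)
 ... | h , inr e with parity c
 ...   | d , inl e' = d , ℓ , trans (calc d ℓ) (cong (_· ℓ) (sym e')) , ≤-trans (m≤n*m d 2) (≤-eq (sym e')) , inr (refl , h , e)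
  where
  calc : ∀ d l -> d · (2 · l) ≡ 2 · d · l
  calc = solve-∀
 ...   | d , inr e' = ⊥-elim (odd≢even (h N.+ d · suc (2 · h)) m (trans (calc d h) (trans (cong2 _·_ (sym e') (sym e)) eq)))
  where
  calc : ∀ d h -> suc (2 · (h N.+ d · suc (2 · h))) ≡ suc (2 · d) · suc (2 · h)
  calc = solve-∀

 p-odd : Σ ℕ \ h -> p ≡ suc (2 · h)
 p-odd with parity p
 ... | h , inr e = h , e
 ... | h , inl e = ⊥-elim (<⇒≢ 2<p ([ (\ ()) , (\ z -> z) ]′ (prime⇒irreducible p-prime (divides h (trans e (N.*-comm 2 h))))))

 size-half : ∀ t -> Σ ℕ \ m -> size t ≡ 2 · m
 size-half split = let h , e = p-odd in h , cong (_∸ 1) e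
 size-half inert = let h , e = p-odd in suc h , trans (cong suc e) (calc h)
  where
  calc : ∀ h -> suc (suc (2 · h)) ≡ 2 · suc h
  calc = solve-∀

 0<size : ∀ t -> 0 < size t
 0<size split = m<n⇒0<n∸m (<-trans (s≤s (s≤s z≤n)) 2<p)
 0<size inert = s≤s z≤n

 p≤2size : ∀ t -> p ≤ 2 · size t
 p≤2size t = ≤-trans (p≤suc-size t) (+-mono-≤ (0<size t) (≤-eq (sym (N.+-identityʳ (size t)))))

 module _ {_~_ : Point -> Point -> Set} (moves : Moves _~_) where
  open Connected moves
  end-step : ∀ {P a} t -> InTorus t (Y a) -> Hits P a -> a ≢ F.0# -> disc a ≢ F.0# -> ∀ E J -> size t ≤ E · ord a -> ∀ qs -> All Prime qs -> Unique qs -> 2 · product qs ∣ size (opposite t) ->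
   32 · E · (2 N.^ length qs · 2 N.^ length qs) ≤ J -> 26 · (E · E · E · (J · J · (J · J) · J)) < p ->
   Σ (List F.Carrier) \ U -> Unique U × p ≤ J · length U × All (Target (Hits P) (opposite t) qs) U
  end-step {P} {a} t Y∈ (b , c , on , hit) a≢0 d≢0 E J size≤ qs ps uq ∣n₂ J≥ large =
    Pr.targets , Pr.targets-unique , many , Pr.targets-sound
   where
   module R = Rotation a b c on a≢0 d≢0 t Y∈
   ℓ = ord a
   oℓ = ord-order a
   q = ord-∣ a t Y∈
   d = _∣_.quotient q
   m = fst (size-half t)
   d≤E : d ≤ E
   d≤E = *-cancelʳ-≤ d E ℓ {{N.>-nonZero (positive oℓ)}} (≤-trans (≤-eq (sym (_∣_.equality q))) size≤)
   halves = halve d ℓ m (trans (sym (_∣_.equality q)) (snd (size-half t)))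
   e1 = fst halves
   ℓ1 = fst (snd halves)
   size1 : e1 · (2 · ℓ1) ≡ size t
   size1 = trans (fst (snd (snd halves))) (sym (_∣_.equality q))
   e1≤E : e1 ≤ E
   e1≤E = ≤-trans (fst (snd (snd (snd halves)))) d≤E
   0<e₁ : 0 < e1
   0<e₁ = n≢0⇒n>0 \ z -> <⇒≢ (0<size t) (trans (sym (cong (_· (2 · ℓ1)) z)) size1)
   D = 2 N.^ length qs
   1≤D : 1 ≤ D
   1≤D = m^n>0 2 (length qs)
   2≤J : 2 ≤ J
   2≤J = ≤-trans (*-mono-≤ (*-mono-≤ (s≤s (s≤s (z≤n {30}))) (≤-trans 0<e₁ e1≤E)) (*-mono-≤ 1≤D 1≤D)) J≥
   large1 : 26 · (e1 · e1 · e1 · (J · J · (J · J) · J)) < p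
   large1 = ≤-<-trans (*-monoʳ-≤ 26 (*-monoˡ-≤ _ (*-mono-≤ (*-mono-≤ e1≤E e1≤E) e1≤E))) large
   hits-at : ∀ x -> x ^ ℓ ≡ 1# -> ∀ b -> ι b ≡ R.α * x + R.β * x ⁻¹ -> Hits P b
   hits-at x e b' eb = let j , _ , ex = powers-complete oℓ x e in
    subst (Hits P) (ι-injective (trans (fst (R.sequence-eq j)) (trans (cong (\ t -> R.α * R.ξ ^ j + R.β * t) (sym (R.ξ^⁻¹ j))) (trans (cong (\ x -> R.α * x + R.β * x ⁻¹) (sym ex)) (sym eb)))))
     (hits-sequence on hit j)
   choose : ∀ x -> InTorus t x -> x ^ (2 · ℓ1) ≡ 1# -> ∀ b -> ι b ≡ R.α * x + R.β * x ⁻¹ -> Hits P b ⊎ Hits P (F.- b)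
   choose x ix e b' eb = [ (\ e2 -> inl (hits-at x (trans (cong (x ^_) (sym e2)) e) b' eb)) ,
     (\ (e2 , h , odd) -> [ (\ z -> inl (hits-at x z b' eb)) , (\ z -> inr (hits-at (- x) (minus h odd z) (F.- b') neg)) ]′ (sqrt-unique (square e2))) ]′
     (snd (snd (snd (snd halves))))
    where
    square : ℓ1 ≡ ℓ -> x ^ ℓ * x ^ ℓ ≡ 1# * 1#
    square e2 = trans (sym (^-homo-* x ℓ ℓ)) (trans (cong (x ^_) (trans (cong (ℓ N.+_) (sym (N.+-identityʳ ℓ))) (cong (2 ·_) (sym e2)))) (trans e (sym (*-identityˡ 1#))))
    minus : ∀ h -> ℓ ≡ suc (2 · h) -> x ^ ℓ ≡ - 1# -> (- x) ^ ℓ ≡ 1#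
    minus h odd z = begin
     (- x) ^ ℓ ≡⟨ cong ((- x) ^_) odd ⟩
     - x * (- x) ^ (2 · h) ≡⟨ cong (- x *_) (neg-even-^ x (m∣m*n h)) ⟩
     - x * x ^ (2 · h) ≡⟨ solve 2 (\ x y -> (:- x) :* y := :- (x :* y)) refl x _ ⟩
     - (x * x ^ (2 · h)) ≡⟨ cong (\ n -> - (x ^ n)) odd ⟨
     - (x ^ ℓ) ≡⟨ cong (\ t -> - t) z ⟩
     - - 1# ≡⟨ -‿involutive 1# ⟩
     1# ∎
     where open ≡R
    neg : ι (F.- b') ≡ R.α * - x + R.β * (- x) ⁻¹
    neg = trans (ι-neg b') (trans (cong (\ t -> - t) eb) (trans (solve 4 (\ a b x i -> :- (a :* x :+ b :* i) := a :* (:- x) :+ b :* (:- i)) refl R.α R.β x (x ⁻¹)) (cong (\ t -> R.α * - x + R.β * t) (sym (neg-⁻¹ (InTorus⇒≢0 t ix))))))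
   module Pr = Produce t R.α R.β R.α≢0 R.β≢0 R.αβ≢1 R.real e1 ℓ1 J size1 0<e₁ 2≤J large1 (Hits P) choose qs ps uq ∣n₂
   n2 = size (opposite t)
   u = length Pr.targets
   -- J ≥ 32 E D² makes the main term J n2 at least twice the error 8 e1 D² p, since p ≤ 2 n2.
   many : p ≤ J · u
   many = *-cancelˡ-≤ (8 · e1 · D · D) {{N.>-nonZero (*-mono-≤ (*-mono-≤ (*-mono-≤ (s≤s (z≤n {7})) 0<e₁) 1≤D) 1≤D)}} (+-cancelˡ-≤ T _ _ (begin
    T N.+ T ≡⟨ calc1 e1 D p ⟩
    16 · e1 · (D · D) · p ≤⟨ *-monoʳ-≤ (16 · e1 · (D · D)) (p≤2size (opposite t)) ⟩
    16 · e1 · (D · D) · (2 · n2) ≡⟨ calc2 e1 D n2 ⟩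
    32 · e1 · (D · D) · n2 ≤⟨ *-monoˡ-≤ n2 (≤-trans (*-monoˡ-≤ (D · D) (*-monoʳ-≤ 32 e1≤E)) J≥) ⟩
    J · n2 ≤⟨ Pr.targets-many ⟩
    D · (2 · e1 · J · (u · 4) N.+ D · (8 · e1 · p)) ≡⟨ calc3 D e1 J u p ⟩
    T N.+ 8 · e1 · D · 1 · (J · u) ≤⟨ +-monoʳ-≤ T (*-monoˡ-≤ (J · u) (*-monoʳ-≤ (8 · e1 · D) 1≤D)) ⟩
    T N.+ 8 · e1 · D · D · (J · u) ∎))
    where
    open ≤R
    T = 8 · e1 · D · D · p
    calc1 : ∀ e D p -> 8 · e · D · D · p N.+ 8 · e · D · D · p ≡ 16 · e · (D · D) · p
    calc1 = solve-∀
    calc2 : ∀ e D n -> 16 · e · (D · D) · (2 · n) ≡ 32 · e · (D · D) · n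
    calc2 = solve-∀
    calc3 : ∀ D e J u p -> D · (2 · e · J · (u · 4) N.+ D · (8 · e · p)) ≡ 8 · e · D · D · p N.+ 8 · e · D · 1 · (J · u)
    calc3 = solve-∀

-- Coordinates whose parameters generate a torus.

module Primitive (S : Setting) where
 open import Data.Nat.Divisibility using (_∣_; divides; _∣?_; ∣-trans; m∣m*n; n∣m*n; *-monoʳ-∣)
 open import Data.Nat.Primality using (Prime; euclidsLemma; prime[2])
 open import Data.Nat.ListAction using (product)

 open NT
 open Tori S
 open K
 open Conic S
 open EndCount S using (1≤p; size≤suc-p)
 open Orbit S
 open Climb S using (ord; ord-order; ord-∣; large-order⇒≢0)
 open EndStep S

 half : Type -> ℕ
 half t = fst (size-half t)

 0<half : ∀ t -> 0 < half t
 0<half t = n≢0⇒n>0 \ z -> <⇒≢ (0<size t) (sym (trans (snd (size-half t)) (cong (2 ·_) z)))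

 -- (p - 1) / 2 and (p + 1) / 2 are consecutive.
 half-even : ∀ t -> 2 ∣ half (opposite t) ⊎ 2 ∣ half t
 half-even t with parity (fst p-odd)
 half-even split | k , inl e = inr (divides k (trans e (N.*-comm 2 k)))
 half-even split | k , inr e = inl (divides (suc k) (cong suc (trans e (cong suc (N.*-comm 2 k)))))
 half-even inert | k , inl e = inl (divides k (trans e (N.*-comm 2 k)))
 half-even inert | k , inr e = inr (divides (suc k) (cong suc (trans e (cong suc (N.*-comm 2 k)))))

 -- For the index `c` of the group generated by `Y b`, a prime q dividing `c` makes the power
 -- `size t` / q of `Y b` trivial. `Target` forbids this when q divides `half t` and `size t` / q is
 -- even. For even `half t` this leaves c = 1; for odd `half t` only c ≤ 2.
 module Index {Good : F.Carrier -> Set} (t : Type) {b : F.Carrier} (T : Target Good t (prime-divisors (half t)) b) where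
  open Target T
  private
   m = half t
   o = ord b
   c∣ = ord-∣ b t inside
   c = _∣_.quotient c∣
   size≡ : size t ≡ c · o
   size≡ = _∣_.equality c∣
   0<c : 0 < c
   0<c = n≢0⇒n>0 \ z -> <⇒≢ (0<size t) (sym (trans size≡ (cong (_· o) z)))
   excluded : ∀ q k -> Prime q -> c ≡ k · q -> q ∣ m -> ¬ (2 ∣ k · o)
   excluded q k pq e q∣m 2∣w = avoids (prime-divisors-complete m (0<half t) pq q∣m) (k · o)
    (trans (calc q k o) (trans (cong (_· o) (sym e)) (sym size≡))) 2∣w
    (trans (cong (Y b ^_) (N.*-comm k o)) (^-*-≡1 o k (kills (ord-order b))))
    where
    calc : ∀ q k o -> q · (k · o) ≡ k · q · o
    calc = solve-∀
   only-two : ∀ q -> Prime q -> q ∣ c -> q ≡ 2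
   only-two q pq (divides k e) = by (q N.≟ 2)
    where
    calc : ∀ q k o -> k · q · o ≡ q · (k · o)
    calc = solve-∀
    2m≡ : 2 · m ≡ q · (k · o)
    2m≡ = trans (sym (snd (size-half t))) (trans size≡ (trans (cong (_· o) e) (calc q k o)))
    by : Dec (q ≡ 2) -> q ≡ 2
    by (yes z) = z
    by (no q≢2) = ⊥-elim (excluded q k pq e
     ([ (\ q∣2 -> ⊥-elim (q≢2 (sym (distinct-primes prime[2] pq q∣2)))) , (\ z -> z) ]′ (euclidsLemma 2 m pq (divides (k · o) (trans 2m≡ (N.*-comm q _)))))
     ([ (\ 2∣q -> ⊥-elim (q≢2 (distinct-primes pq prime[2] 2∣q))) , (\ z -> z) ]′ (euclidsLemma q (k · o) prime[2] (divides m (trans (sym 2m≡) (N.*-comm 2 m))))))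
   half≡ : ∀ k -> c ≡ k · 2 -> m ≡ k · o
   half≡ k e = *-cancelˡ-≡ m (k · o) 2 (trans (sym (snd (size-half t))) (trans size≡ (trans (cong (_· o) e) (calc k o))))
    where
    calc : ∀ k o -> k · 2 · o ≡ 2 · (k · o)
    calc = solve-∀
   c≡1 : 2 ∣ m -> c ≡ 1
   c≡1 2∣m = by (c N.≟ 1)
    where
    by : Dec (c ≡ 1) -> c ≡ 1
    by (yes e) = e
    by (no ne) = ⊥-elim (contra (prime-divisor c (≤∧≢⇒< 0<c (\ z -> ne (sym z)))))
     where
     contra : (Σ ℕ \ q -> Prime q × q ∣ c) -> ⊥
     contra (q , pq , q∣c) = at (only-two q pq q∣c) q∣c
      where
      at : q ≡ 2 -> q ∣ c -> ⊥
      at refl (divides k e) = excluded 2 k pq e 2∣m (subst (2 ∣_) (half≡ k e) 2∣m)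
   c≤2 : ¬ (2 ∣ m) -> c ≤ 2
   c≤2 2∤m = by (c N.≤? 2)
    where
    by : Dec (c ≤ 2) -> c ≤ 2
    by (yes le) = le
    by (no gt) = ⊥-elim (cases (parity c))
     where
     2<c = ≰⇒> gt
     cases : (Σ ℕ \ h -> c ≡ 2 · h ⊎ c ≡ suc (2 · h)) -> ⊥
     cases (h , inr e) = at (prime-divisor c (<-trans (s≤s (s≤s z≤n)) 2<c))
      where
      at : (Σ ℕ \ q -> Prime q × q ∣ c) -> ⊥
      at (q , pq , q∣c) = two (only-two q pq q∣c) q∣c
       where
       two : ∀ {q} -> q ≡ 2 -> q ∣ c -> ⊥
       two refl (divides k e') = odd≢even h k (trans (sym e) (trans e' (N.*-comm k 2)))
     cases (h , inl e) = at (prime-divisor h (*-cancelˡ-< 2 1 h (subst (2 <_) e 2<c)))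
      where
      at : (Σ ℕ \ q -> Prime q × q ∣ h) -> ⊥
      at (q , pq , q∣h) = 2∤m (subst (2 ∣_) (sym (half≡ h (trans e (N.*-comm 2 h)))) (∣-trans (subst (_∣ h) (only-two q pq (subst (q ∣_) (sym e) (∣-trans q∣h (n∣m*n 2)))) q∣h) (m∣m*n o)))
  full : 2 ∣ half t -> Order (Y b) (size t)
  full 2∣m = subst (Order (Y b)) (sym (trans size≡ (trans (cong (_· o) (c≡1 2∣m)) (N.+-identityʳ o)))) (ord-order b)
  index≤2 : size t ≤ 2 · o
  index≤2 = by (2 ∣? m)
   where
   by : Dec (2 ∣ m) -> size t ≤ 2 · o
   by (yes d) = ≤-trans (≤-eq size≡) (*-monoˡ-≤ o (≤-trans (≤-eq (c≡1 d)) (m≤m+n 1 1)))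
   by (no nd) = ≤-trans (≤-eq size≡) (*-monoˡ-≤ o (c≤2 nd))

 module _ {_~_ : Point -> Point -> Set} (moves : Moves _~_) where
  open Connected moves
  record IsPrimitive (P : Point) (b : F.Carrier) : Set where
   field
    type : Type
    hits : Hits P b
    nonzero : b ≢ F.0#
    regular : disc b ≢ F.0#
    inside : InTorus type (Y b)
    generates : Order (Y b) (size type)
  module Primitives (P : Point) (E J : ℕ) (2≤E : 2 ≤ E)
   (J≥ : ∀ t -> 32 · E · (2 N.^ length (prime-divisors (half t)) · 2 N.^ length (prime-divisors (half t))) ≤ J)
   (large : 26 · (E · E · E · (J · J · (J · J) · J)) < p) where
   private
    1≤J : 1 ≤ J
    1≤J = ≤-trans (*-mono-≤ (*-mono-≤ {1} {32} (s≤s z≤n) (≤-trans (s≤s z≤n) 2≤E)) (*-mono-≤ (m^n>0 2 k) (m^n>0 2 k))) (J≥ split)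
     where k = length (prime-divisors (half split))
    8E<p : 8 · E < p
    8E<p = ≤-<-trans (*-mono-≤ (m≤m+n 8 18) (≤-trans (≤-trans (≤-eq (sym (N.*-identityʳ E))) (*-mono-≤ (m≤n*m E (E · E) {{N.>-nonZero (*-mono-≤ 1≤E 1≤E)}}) 1≤J⁵)) ≤-refl)) large
     where
     1≤E = ≤-trans (s≤s z≤n) 2≤E
     1≤J⁵ : 1 ≤ J · J · (J · J) · J
     1≤J⁵ = *-mono-≤ (*-mono-≤ (*-mono-≤ 1≤J 1≤J) (*-mono-≤ 1≤J 1≤J)) 1≤J
    4<ord : ∀ t b -> size t ≤ E · ord b -> 4 < ord b
    4<ord t b le = ≰⇒> \ small -> <⇒≱ 8E<p (begin
     p ≤⟨ p≤2size t ⟩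
     2 · size t ≤⟨ *-monoʳ-≤ 2 (≤-trans le (*-monoʳ-≤ E small)) ⟩
     2 · (E · 4) ≡⟨ calc E ⟩
     8 · E ∎)
     where
     open ≤R
     calc : ∀ E -> 2 · (E · 4) ≡ 8 · E
     calc = solve-∀
    Targets : Type -> List F.Carrier -> Set
    Targets t U = Unique U × p ≤ J · length U × All (Target (Hits P) t (prime-divisors (half t))) U
    step : ∀ {a} t -> InTorus t (Y a) -> Hits P a -> disc a ≢ F.0# -> size t ≤ E · ord a -> Σ (List F.Carrier) (Targets (opposite t))
    step {a} t i h d le = end-step moves t i h (large-order⇒≢0 (4<ord t a le)) d E J le qs (All.map fst (prime-divisors-sound m)) (prime-divisors-unique m)
     (subst (2 · product qs ∣_) (sym (snd (size-half t'))) (*-monoʳ-∣ 2 (product-∣ m qs (prime-divisors-unique m) (prime-divisors-sound m)))) (J≥ t') large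
     where
     t' = opposite t
     m = half t'
     qs = prime-divisors m
    finish : ∀ t -> 2 ∣ half t -> Σ (List F.Carrier) (Targets t) -> Σ (List F.Carrier) \ U -> Unique U × p ≤ J · length U × All (IsPrimitive P) U
    finish t 2∣ (U , u , many , targets) = U , u , many , All.map (\ {b} T -> record
     { type = t ; hits = Target.good T ; nonzero = large-order⇒≢0 (4<ord t b (≤-trans (Index.index≤2 t T) (*-monoˡ-≤ (ord b) 2≤E)))
     ; regular = Target.regular T ; inside = Target.inside T ; generates = Index.full t T 2∣ }) targets
    opposite² : ∀ t -> opposite (opposite t) ≡ t
    opposite² split = refl
    opposite² inert = refl
   -- Each step changes the type. If the type reached first has odd `half`, its targets have index
   -- at most 2 ≤ E, so a second step starts from one of them and returns to the original type,
   -- whose `half` is even.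
   primitives : ∀ {a} -> Hits P a -> disc a ≢ F.0# -> 2 · p ≤ E · ord a -> Σ (List F.Carrier) \ U -> Unique U × p ≤ J · length U × All (IsPrimitive P) U
   primitives {a} h d le = by (half-even t)
    where
    t = fst (typeOf a)
    first = step t (snd (typeOf a)) h d (≤-trans (size≤suc-p t) (≤-trans (+-mono-≤ 1≤p (≤-eq (sym (N.+-identityʳ p)))) le))
    again : Σ (List F.Carrier) (Targets (opposite t)) -> Σ (List F.Carrier) (Targets t)
    again ([] , _ , many , _) = ⊥-elim (<⇒≱ 1≤p (≤-trans many (≤-eq (N.*-zeroʳ J))))
    again (b ∷ _ , _ , _ , T ∷ _) = subst (\ t -> Σ (List F.Carrier) (Targets t)) (opposite² t)
     (step (opposite t) (Target.inside T) (Target.good T) (Target.regular T) (≤-trans (Index.index≤2 (opposite t) T) (*-monoˡ-≤ (ord b) 2≤E)))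
    by : 2 ∣ half (opposite t) ⊎ 2 ∣ half t -> _
    by (inl 2∣) = finish (opposite t) 2∣ first
    by (inr 2∣) = finish t 2∣ (again first)

-- Two large sets of coordinates are joined by a point of the surface.

module Expander (S : Setting) where
 open import Data.Nat.ListAction using (sum)
 open import Data.List using (cartesianProduct; deduplicate)
 open import Data.List.Membership.Propositional using (lose; find)
 open import Data.List.Membership.Propositional.Properties using (∈-filter⁺; ∈-map⁺; ∈-map⁻; ∈-deduplicate⁺; ∈-deduplicate⁻; ∈-cartesianProduct⁺; ∈-cartesianProduct⁻)
 open import Data.Product.Properties using (≡-dec)

 open Count
 open Tori S
 open K
 open Conic S using (disc)
 open Orbit S
 open EndStep S using (0<size)

 private
  16' = F.num 16

 square-roots : ∀ c xs -> Unique xs -> All (\ x -> x F.* x ≡ c) xs -> length xs ≤ 2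
 square-roots c [] _ _ = z≤n
 square-roots c (x ∷ []) _ _ = s≤s z≤n
 square-roots c (x ∷ y ∷ []) _ _ = s≤s (s≤s z≤n)
 square-roots c (x ∷ y ∷ z ∷ _) ((x≢y ∷ x≢z ∷ _) ∷ (y≢z ∷ _) ∷ _) (ex ∷ ey ∷ ez ∷ _) = ⊥-elim (y≢z (trans (minus ey x≢y) (sym (minus ez x≢z))))
  where
  minus : ∀ {y} -> y F.* y ≡ c -> x ≢ y -> y ≡ F.- x
  minus ey x≢y = [ (\ e -> ⊥-elim (x≢y (sym e))) , (\ e -> e) ]′ (F.sqrt-unique (trans ey (sym ex)))

 -- A conic s'y² − s y'² = c with c ≠ 0 has at most p + 1 points: over K the form splits as a product of two conjugates, and the ratio of
 -- the values of one factor at two points lies in a torus.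
 conic-bound : ∀ s s' -> s ≢ F.0# -> s' ≢ F.0# -> s ≢ s' -> ∀ (ps : List (F.Carrier × F.Carrier)) -> Unique ps ->
  All (\ (y , y') -> (y F.* y F.+ 16') F.* s' ≡ (y' F.* y' F.+ 16') F.* s) ps -> length ps ≤ suc p
 conic-bound s s' s≢0 s'≢0 s≢s' [] _ _ = z≤n
 conic-bound s s' s≢0 s'≢0 s≢s' ps0@((y0 , y0') ∷ _) u on0 = bounded (sqrt-σ (s F.* s'))
  where
  ρ = sqrt (s F.* s')
  κF = 16' F.* (s' F.* (s F.- s'))
  κ = ι κF
  κ≢0 : κ ≢ 0#
  κ≢0 e = F.*-≢0 F-16≢0 (F.*-≢0 s'≢0 (\ z -> s≢s' (F.x-y≡0⇒x≡y z))) (ι-injective (trans e (sym ι-0)))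
  ρ≢0 : ρ ≢ 0#
  ρ≢0 e = F.*-≢0 s≢0 s'≢0 (ι-injective (trans (sym (sqrt² (s F.* s'))) (trans (cong (_* ρ) e) (trans (zeroˡ ρ) (sym ι-0)))))
  z z̄ : F.Carrier × F.Carrier -> Carrier
  z (y , y') = ι (s' F.* y) + ρ * ι y'
  z̄ (y , y') = ι (s' F.* y) - ρ * ι y'
  On : F.Carrier × F.Carrier -> Set
  On (y , y') = (y F.* y F.+ 16') F.* s' ≡ (y' F.* y' F.+ 16') F.* s
  norm : ∀ {q} -> On q -> z q * z̄ q ≡ κ
  norm {y , y'} on = begin
   (ι (s' F.* y) + ρ * ι y') * (ι (s' F.* y) - ρ * ι y') ≡⟨ solve 3 (\ a r b -> (a :+ r :* b) :* (a :- r :* b) := a :* a :- r :* r :* (b :* b)) refl (ι (s' F.* y)) ρ (ι y') ⟩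
   ι (s' F.* y) * ι (s' F.* y) - ρ * ρ * (ι y' * ι y') ≡⟨ cong2 (\ a b -> a - b) (sym (ι-* _ _)) (trans (cong2 _*_ (sqrt² (s F.* s')) (sym (ι-* y' y'))) (sym (ι-* _ _))) ⟩
   ι (s' F.* y F.* (s' F.* y)) - ι (s F.* s' F.* (y' F.* y')) ≡⟨ trans (cong (ι _ +_) (sym (ι-neg _))) (sym (ι-+ _ _)) ⟩
   ι (s' F.* y F.* (s' F.* y) F.- s F.* s' F.* (y' F.* y')) ≡⟨ cong ι (F.x-y≡0⇒x≡y (trans
    (F.solve 4 (\ s t y w -> t F.:* y F.:* (t F.:* y) F.:- s F.:* t F.:* (w F.:* w) F.:- F.lit 16 F.:* (t F.:* (s F.:- t))
     F.:= t F.:* ((y F.:* y F.:+ F.lit 16) F.:* t F.:- (w F.:* w F.:+ F.lit 16) F.:* s)) refl s s' y y')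
    (trans (cong (s' F.*_) (F.x≡y⇒x-y≡0 on)) (F.zeroʳ s')))) ⟩
   κ ∎
   where open ≡R
  z≢0 : ∀ {q} -> On q -> z q ≢ 0#
  z≢0 {q} on e = κ≢0 (trans (sym (norm {q} on)) (trans (cong (_* z̄ q) e) (zeroˡ _)))
  z-injective : ∀ {q q'} -> On q -> On q' -> z q ≡ z q' -> q ≡ q'
  z-injective {q@(y , y')} {r@(x , x')} on on' e = cong2 _,_
    (F.*-cancelˡ s'≢0 (ι-injective (*-cancelˡ 2≢0 (trans (sum-eq q) (trans (cong2 _+_ e ē) (sym (sum-eq r)))))))
    (ι-injective (*-cancelˡ ρ≢0 (*-cancelˡ 2≢0 (trans (diff-eq q) (trans (cong2 _-_ e ē) (sym (diff-eq r)))))))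
   where
   ē : z̄ q ≡ z̄ r
   ē = *-cancelˡ (z≢0 {q} on) (trans (norm {q} on) (trans (sym (norm {r} on')) (cong (_* z̄ r) (sym e))))
   sum-eq : ∀ q -> num 2 * ι (s' F.* fst q) ≡ z q + z̄ q
   sum-eq (y , y') = solve 3 (\ a r b -> lit 2 :* a := (a :+ r :* b) :+ (a :- r :* b)) refl (ι (s' F.* y)) ρ (ι y')
   diff-eq : ∀ q -> num 2 * (ρ * ι (snd q)) ≡ z q - z̄ q
   diff-eq (y , y') = solve 3 (\ a r b -> lit 2 :* (r :* b) := (a :+ r :* b) :- (a :- r :* b)) refl (ι (s' F.* y)) ρ (ι y')
  σ-of : ∀ {η} q -> σ ρ ≡ η -> σ (z q) ≡ ι (s' F.* fst q) + η * ι (snd q)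
  σ-of (y , y') e = trans (σ-+ _ _) (cong2 _+_ (σ-ι _) (trans (σ-* _ _) (cong2 _*_ e (σ-ι y'))))
  z0 = z (y0 , y0')
  i0 = z0 ⁻¹
  i0≢0 : i0 ≢ 0#
  i0≢0 = ⁻¹-≢0 (z≢0 {y0 , y0'} (All.head on0))
  count : ∀ t -> (∀ {q} -> On q -> InTorus t (z q * i0)) -> length ps0 ≤ size t
  count t inside = subst (_≤ size t) (List.length-map (\ q -> z q * i0) ps0) (unity-bound (size t) 1# (map (\ q -> z q * i0) ps0) (0<size t) 1≢0
   (unique ps0 u on0)
   (All.map⁺ (All.map (\ {q} on -> InTorus-size t (inside {q} on)) on0)))
   where
   unique : ∀ qs -> Unique qs -> All On qs -> Unique (map (\ q -> z q * i0) qs)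
   unique [] _ _ = []
   unique (q ∷ qs) (nq ∷ u) (on ∷ ons) = All.map⁺ (All.zipWith (\ {r} (ne , on') e -> ne (z-injective {q} {r} on on' (*-cancelʳ i0≢0 e))) (nq , ons)) ∷ unique qs u ons
  bounded : σ ρ ≡ ρ ⊎ σ ρ ≡ - ρ -> length ps0 ≤ suc p
  bounded (inl e) = ≤-trans (count split (\ {q} on -> InTorus-* split (real {q} on) (InTorus-⁻¹ split (real {y0 , y0'} (All.head on0))))) (≤-trans (m∸n≤m p 1) (n≤1+n p))
   where
   real : ∀ {q} -> On q -> InTorus split (z q)
   real {q} on = z≢0 {q} on , σ-of q e
  bounded (inr e) = count inert \ {q} on -> begin
   z q * i0 * σ (z q * i0) ≡⟨ cong (z q * i0 *_) (σ-* _ _) ⟩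
   z q * i0 * (σ (z q) * σ i0) ≡⟨ solve 4 (\ a b c d -> a :* b :* (c :* d) := (a :* c) :* (b :* d)) refl _ _ _ _ ⟩
   z q * σ (z q) * (i0 * σ i0) ≡⟨ cong (_* (i0 * σ i0)) (trans (conj {q} on) (sym (conj {y0 , y0'} (All.head on0)))) ⟩
   z0 * σ z0 * (i0 * σ i0) ≡⟨ solve 4 (\ a b c d -> (a :* b) :* (c :* d) := (a :* c) :* (b :* d)) refl _ _ _ _ ⟩
   z0 * i0 * (σ z0 * σ i0) ≡⟨ cong2 _*_ (*-inverseʳ z0≢0) (σ-⁻¹ z0≢0) ⟩
   1# * 1# ≡⟨ *-identityˡ 1# ⟩
   1# ∎
   where
   open ≡R
   z0≢0 = z≢0 {y0 , y0'} (All.head on0)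
   conj : ∀ {q} -> On q -> z q * σ (z q) ≡ κ
   conj {q@(y , y')} on = trans (cong (z q *_) (trans (σ-of q e) (cong (ι (s' F.* y) +_) (solve 2 (\ r b -> (:- r) :* b := :- (r :* b)) refl ρ (ι y'))))) (norm {q} on)

 am-gm : ∀ n f -> 2 · n · f ≤ f · f N.+ n · n
 am-gm n f = [ (\ le -> subst (\ f -> 2 · n · f ≤ f · f N.+ n · n) (m+[n∸m]≡n le) (up n (f N.∸ n))) ,
        (\ le -> subst (\ n -> 2 · n · f ≤ f · f N.+ n · n) (m+[n∸m]≡n le) (down f (n N.∸ f))) ]′ (≤-total n f)
  where
  e1 : ∀ n k -> (n N.+ k) · (n N.+ k) N.+ n · n ≡ 2 · n · (n N.+ k) N.+ k · k
  e1 = solve-∀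
  e2 : ∀ f k -> f · f N.+ (f N.+ k) · (f N.+ k) ≡ 2 · (f N.+ k) · f N.+ k · k
  e2 = solve-∀
  up : ∀ n k -> 2 · n · (n N.+ k) ≤ (n N.+ k) · (n N.+ k) N.+ n · n
  up n k = ≤-trans (m≤m+n _ _) (≤-eq (sym (e1 n k)))
  down : ∀ f k -> 2 · (f N.+ k) · f ≤ f · f N.+ (f N.+ k) · (f N.+ k)
  down f k = ≤-trans (m≤m+n _ _) (≤-eq (sym (e2 f k)))

 -- Expand Σ (f t - n)² and keep only the terms with f t = 0, which are n² each.
 variance : ∀ {T : Set} (f : T -> ℕ) n ts -> 2 · n · sum (map f ts) N.+ length (filter (\ t -> f t N.≟ 0) ts) · (n · n) ≤ sum (map (\ t -> f t · f t) ts) N.+ length ts · (n · n)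
 variance f n [] = ≤-eq (trans (N.+-identityʳ _) (N.*-zeroʳ (2 · n)))
 variance f n (t ∷ ts) = by (f t N.≟ 0)
  where
  open ≤R
  A = 2 · n
  B = n · n
  Σf = sum (map f ts)
  Σf² = sum (map (\ t -> f t · f t) ts)
  zs = filter (\ t -> f t N.≟ 0)
  z = length (zs ts)
  calc1 : ∀ a b c -> a N.+ (b N.+ c) ≡ b N.+ (a N.+ c)
  calc1 = solve-∀
  calc2 : ∀ a x y c -> a · (x N.+ y) N.+ c ≡ a · x N.+ (a · y N.+ c)
  calc2 = solve-∀
  calc3 : ∀ x b y c -> (x N.+ b) N.+ (y N.+ c) ≡ x N.+ y N.+ (b N.+ c)
  calc3 = solve-∀
  by : Dec (f t ≡ 0) -> A · (f t N.+ Σf) N.+ length (zs (t ∷ ts)) · B ≤ f t · f t N.+ Σf² N.+ (B N.+ length ts · B)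
  by (yes e) = begin
   A · (f t N.+ Σf) N.+ length (zs (t ∷ ts)) · B ≡⟨ cong2 (\ x l -> A · (x N.+ Σf) N.+ length l · B) e (List.filter-accept (\ t -> f t N.≟ 0) {t} {ts} e) ⟩
   A · Σf N.+ (B N.+ z · B) ≡⟨ calc1 (A · Σf) B (z · B) ⟩
   B N.+ (A · Σf N.+ z · B) ≤⟨ +-monoʳ-≤ B (variance f n ts) ⟩
   B N.+ (Σf² N.+ length ts · B) ≡⟨ calc1 B Σf² (length ts · B) ⟩
   Σf² N.+ (B N.+ length ts · B) ≡⟨ cong (\ x -> x · x N.+ Σf² N.+ (B N.+ length ts · B)) e ⟨
   f t · f t N.+ Σf² N.+ (B N.+ length ts · B) ∎
  by (no ne) = begin
   A · (f t N.+ Σf) N.+ length (zs (t ∷ ts)) · B ≡⟨ cong (\ l -> A · (f t N.+ Σf) N.+ length l · B) (List.filter-reject (\ t -> f t N.≟ 0) {t} {ts} ne) ⟩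
   A · (f t N.+ Σf) N.+ z · B ≡⟨ calc2 A (f t) Σf (z · B) ⟩
   A · f t N.+ (A · Σf N.+ z · B) ≤⟨ +-mono-≤ (am-gm n (f t)) (variance f n ts) ⟩
   (f t · f t N.+ B) N.+ (Σf² N.+ length ts · B) ≡⟨ calc3 (f t · f t) B Σf² (length ts · B) ⟩
   f t · f t N.+ Σf² N.+ (B N.+ length ts · B) ∎

 module Collisions {A T : Set} (_≟T_ : ∀ (s t : T) -> Dec (s ≡ t)) (τ : A -> T) (ts : List T) (ts-unique : Unique ts) where
  fiber : List A -> T -> List A
  fiber as t = filter (\ a -> τ a ≟T t) as
  private
   weights : ∀ (g : T -> ℕ) as -> sum (map (\ t -> length (fiber as t) · g t) ts) ≤ sum (map (\ a -> g (τ a)) as)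
   weights g [] = ≤-eq (zeros ts)
    where
    zeros : ∀ ts -> sum (map (\ t -> length (fiber [] t) · g t) ts) ≡ 0
    zeros [] = refl
    zeros (t ∷ ts) = zeros ts
   weights g (a ∷ as) = ≤-trans (add ts ts-unique) (+-monoʳ-≤ (g (τ a)) (weights g as))
    where
    w w' : T -> ℕ
    w t = length (fiber (a ∷ as) t) · g t
    w' t = length (fiber as t) · g t
    same : ∀ {t} -> τ a ≢ t -> w t ≡ w' t
    same {t} ne = cong (\ l -> length l · g t) (List.filter-reject (\ a -> τ a ≟T t) {a} {as} ne)
    same-sum : ∀ ts -> All (τ a ≢_) ts -> sum (map w ts) ≡ sum (map w' ts)
    same-sum [] _ = refl
    same-sum (t ∷ ts) (ne ∷ nes) = cong2 N._+_ (same ne) (same-sum ts nes)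
    add : ∀ ts -> Unique ts -> sum (map w ts) ≤ g (τ a) N.+ sum (map w' ts)
    add [] _ = z≤n
    add (t ∷ ts) (nt ∷ u) = by (τ a ≟T t)
     where
     by : Dec (τ a ≡ t) -> sum (map w (t ∷ ts)) ≤ g (τ a) N.+ sum (map w' (t ∷ ts))
     by (yes refl) = ≤-eq (trans (cong2 N._+_ (cong (\ l -> length l · g t) (List.filter-accept (\ a -> τ a ≟T t) {a} {as} refl)) (same-sum ts nt)) (N.+-assoc (g t) _ _))
     by (no ne) = ≤-trans (+-mono-≤ (≤-eq (same ne)) (add ts u)) (≤-eq (calc (w' t) (g (τ a)) _))
      where
      calc : ∀ x y z -> x N.+ (y N.+ z) ≡ y N.+ (x N.+ z)
      calc = solve-∀
  collide? : ∀ (q : A × A) -> Dec (τ (snd q) ≡ τ (fst q))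
  collide? (a , b) = τ b ≟T τ a
  collisions : List A -> List (A × A)
  collisions as = filter collide? (cartesianProduct as as)
  -- A sum of squared fibre sizes counts the pairs on which `τ` agrees.
  second-moment : ∀ as -> sum (map (\ t -> length (fiber as t) · length (fiber as t)) ts) ≤ length (collisions as)
  second-moment as = ≤-trans (weights (\ t -> length (fiber as t)) as) (≤-eq (sym (rows as)))
   where
   row : ∀ a bs -> length (filter collide? (map (a ,_) bs)) ≡ length (fiber bs (τ a))
   row a [] = refl
   row a (b ∷ bs) with τ b ≟T τ a
   ... | yes _ = cong suc (row a bs)
   ... | no _ = row a bs
   rows : ∀ bs -> length (filter collide? (cartesianProduct bs as)) ≡ sum (map (\ a -> length (fiber as (τ a))) bs)
   rows [] = refl
   rows (a ∷ bs) = trans (cong length (List.filter-++ collide? (map (a ,_) as) (cartesianProduct bs as)))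
    (trans (List.length-++ (filter collide? (map (a ,_) as))) (cong2 N._+_ (row a as) (rows bs)))

 -- Here s and t are joined when s t - 16 is a square. With s = u² - 4 and t = v² - 4 this says that
 -- the surface equation has a solution w, since 4 (u² + v² + w² - u v w) = (2 w - u v)² + 16 - s t.
 -- The vertex t is written as `τ (s , y)`.
 module Graph (ss : List F.Carrier) (ss-unique : Unique ss) (nonzero : ∀ {s} -> s ∈ ss -> s ≢ F.0#) where
  private
   Pair = F.Carrier × F.Carrier
   A : List Pair
   A = cartesianProduct ss elements
   n = length ss
   _≟²_ : ∀ (a b : Pair) -> Dec (a ≡ b)
   _≟²_ = ≡-dec F._≟_ F._≟_
   A-unique : Unique A
   A-unique = Unique.cartesianProduct⁺ ss-unique elements-unique
   τ : Pair -> F.Carrier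
   τ (s , y) = (y F.* y F.+ 16') F.* s F.⁻¹
   A-length : length A ≡ n · p
   A-length = trans (length-product ss elements) (cong (n ·_) elements-length)
  open Collisions F._≟_ τ elements elements-unique
  f : F.Carrier -> ℕ
  f t = length (fiber A t)
  private
   first-moment : n · p ≤ sum (map f elements)
   first-moment = ≤-trans (≤-eq (sym A-length)) (cover-count (\ t a -> τ a F.≟ t) A elements (\ a _ -> elements-complete (τ a)))
   W = collisions A
   W-unique : Unique W
   W-unique = Unique.filter⁺ collide? (Unique.cartesianProduct⁺ A-unique A-unique)
   W-sound : ∀ {q} -> q ∈ W -> fst (fst q) ∈ ss × fst (snd q) ∈ ss × τ (snd q) ≡ τ (fst q)
   W-sound {q} q∈ = let q∈' , e = ∈-filter⁻ collide? {xs = cartesianProduct A A} q∈ ; a∈ , b∈ = ∈-cartesianProduct⁻ A A q∈' in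
    fst (∈-cartesianProduct⁻ ss elements a∈) , fst (∈-cartesianProduct⁻ ss elements b∈) , e
   cross : ∀ {s y s' y'} -> s ≢ F.0# -> s' ≢ F.0# -> τ (s' , y') ≡ τ (s , y) -> (y F.* y F.+ 16') F.* s' ≡ (y' F.* y' F.+ 16') F.* s
   cross {s} {y} {s'} {y'} s≢0 s'≢0 e = begin
    u F.* s' ≡⟨ trans (sym (F.*-identityʳ _)) (cong (u F.* s' F.*_) (sym (F.*-inverseʳ s≢0))) ⟩
    u F.* s' F.* (s F.* s F.⁻¹) ≡⟨ F.solve 4 (\ u t s i -> u F.:* t F.:* (s F.:* i) F.:= (u F.:* i) F.:* (t F.:* s)) refl u s' s (s F.⁻¹) ⟩
    u F.* s F.⁻¹ F.* (s' F.* s) ≡⟨ cong (F._* (s' F.* s)) (sym e) ⟩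
    u' F.* s' F.⁻¹ F.* (s' F.* s) ≡⟨ F.solve 4 (\ u i t s -> u F.:* i F.:* (t F.:* s) F.:= u F.:* s F.:* (t F.:* i)) refl u' (s' F.⁻¹) s' s ⟩
    u' F.* s F.* (s' F.* s' F.⁻¹) ≡⟨ trans (cong (u' F.* s F.*_) (F.*-inverseʳ s'≢0)) (F.*-identityʳ _) ⟩
    u' F.* s ∎
    where
    open ≡R
    u = y F.* y F.+ 16'
    u' = y' F.* y' F.+ 16'
   equal? : ∀ (q : Pair × Pair) -> Dec (fst (fst q) ≡ fst (snd q))
   equal? q = fst (fst q) F.≟ fst (snd q)
   map-unique : ∀ {A B : Set} (h : A -> B) (xs : List A) -> (∀ {x y} -> x ∈ xs -> y ∈ xs -> h x ≡ h y -> x ≡ y) -> Unique xs -> Unique (map h xs)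
   map-unique h [] inj u = []
   map-unique h (x ∷ xs) inj (nx ∷ u) = All.map⁺ (All.tabulate \ y∈ e -> All.lookup nx y∈ (inj (here refl) (there y∈) e)) ∷ map-unique h xs (\ a b -> inj (there a) (there b)) u
   -- For equal s the squares of y and y' agree.
   W₌ : length (filter equal? W) ≤ n · p · 2
   W₌ = ≤-trans (fiber-bound (\ a q -> fst q ≟² a) zs A 2 (\ q q∈ -> fst (∈-cartesianProduct⁻ A A (fst (∈-filter⁻ collide? {xs = cartesianProduct A A} (fst (∈-filter⁻ equal? {xs = W} q∈)))))) fibers)
     (≤-eq (cong (_· 2) A-length))
    where
    zs = filter equal? W
    fibers : ∀ a -> a ∈ A -> length (filter (\ q -> fst q ≟² a) zs) ≤ 2
    fibers (s , y) _ = subst (_≤ 2) (List.length-map (\ q -> snd (snd q)) qs) (square-roots (y F.* y) _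
      (map-unique (\ q -> snd (snd q)) qs inj (Unique.filter⁺ (\ q -> fst q ≟² (s , y)) (Unique.filter⁺ equal? W-unique)))
      (All.map⁺ (All.tabulate \ {q} q∈ -> let e , e' , s∈ , c = sound q∈ in root e e' s∈ c)))
     where
     qs = filter (\ q -> fst q ≟² (s , y)) zs
     sound : ∀ {q} -> q ∈ qs -> fst q ≡ (s , y) × s ≡ fst (snd q) × s ∈ ss × τ (snd q) ≡ τ (s , y)
     sound {q} q∈ with ∈-filter⁻ (\ q -> fst q ≟² (s , y)) {xs = zs} q∈
     ... | q∈' , refl with ∈-filter⁻ equal? {xs = W} q∈'
     ...   | q∈″ , e = refl , e , fst (W-sound q∈″) , snd (snd (W-sound q∈″))
     inj : ∀ {q r} -> q ∈ qs -> r ∈ qs -> snd (snd q) ≡ snd (snd r) -> q ≡ r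
     inj q∈ r∈ e = let eq , eq' , _ = sound q∈ ; er , er' , _ = sound r∈ in cong2 _,_ (trans eq (sym er)) (cong2 _,_ (trans (sym eq') er') e)
     root : ∀ {q} -> fst q ≡ (s , y) -> s ≡ fst (snd q) -> s ∈ ss -> τ (snd q) ≡ τ (s , y) -> snd (snd q) F.* snd (snd q) ≡ y F.* y
     root {_ , (_ , y')} refl refl s∈ c = F.x-y≡0⇒x≡y (trans
      (F.solve 2 (\ y z -> z F.:* z F.:- y F.:* y F.:= (z F.:* z F.:+ F.lit 16) F.:- (y F.:* y F.:+ F.lit 16)) refl y y')
      (F.x≡y⇒x-y≡0 (sym (F.*-cancelʳ (nonzero s∈) (cross (nonzero s∈) (nonzero s∈) c)))))
   -- For given s ≠ s' the pairs (y, y') lie on a conic, so `conic-bound` applies.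
   W≠ : length (filter (\ q -> ¬? (equal? q)) W) ≤ n · n · suc p
   W≠ = ≤-trans (fiber-bound (\ r q -> (fst (fst q) , fst (snd q)) ≟² r) zs (cartesianProduct ss ss) (suc p)
      (\ q q∈ -> let s∈ , s∈' , _ = W-sound (fst (∈-filter⁻ (\ q -> ¬? (equal? q)) {xs = W} q∈)) in ∈-cartesianProduct⁺ s∈ s∈') fibers)
     (≤-eq (cong (_· suc p) (length-product ss ss)))
    where
    zs = filter (\ q -> ¬? (equal? q)) W
    fibers : ∀ r -> r ∈ cartesianProduct ss ss -> length (filter (\ q -> (fst (fst q) , fst (snd q)) ≟² r) zs) ≤ suc p
    fibers (s , s') r∈ = bound qs (\ q∈ -> sound q∈) (Unique.filter⁺ _ (Unique.filter⁺ _ W-unique))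
     where
     qs = filter (\ q -> (fst (fst q) , fst (snd q)) ≟² (s , s')) zs
     sound : ∀ {q} -> q ∈ qs -> (fst (fst q) , fst (snd q)) ≡ (s , s') × s ≢ s' × τ (snd q) ≡ τ (fst q)
     sound {q} q∈ with ∈-filter⁻ (\ q -> (fst (fst q) , fst (snd q)) ≟² (s , s')) {xs = zs} q∈
     ... | q∈' , refl with ∈-filter⁻ (\ q -> ¬? (equal? q)) {xs = W} q∈'
     ...   | q∈″ , ne = refl , ne , snd (snd (W-sound q∈″))
     s≢0 = nonzero (fst (∈-cartesianProduct⁻ ss ss r∈))
     s'≢0 = nonzero (snd (∈-cartesianProduct⁻ ss ss r∈))
     h : Pair × Pair -> Pair
     h q = snd (fst q) , snd (snd q)
     bound : ∀ qs -> (∀ {q} -> q ∈ qs -> (fst (fst q) , fst (snd q)) ≡ (s , s') × s ≢ s' × τ (snd q) ≡ τ (fst q)) -> Unique qs -> length qs ≤ suc p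
     bound [] _ _ = z≤n
     bound qs@(q0 ∷ _) sound u = subst (_≤ suc p) (List.length-map h qs) (conic-bound s s' s≢0 s'≢0 (fst (snd (sound {q0} (here refl)))) (map h qs)
      (map-unique h qs inj u) (All.map⁺ (All.tabulate \ {q} q∈ -> on q (sound q∈))))
      where
      inj : ∀ {q r} -> q ∈ qs -> r ∈ qs -> h q ≡ h r -> q ≡ r
      inj {(_ , _) , (_ , _)} {(_ , _) , (_ , _)} q∈ r∈ e with fst (sound q∈) | fst (sound r∈) | e
      ... | refl | refl | refl = refl
      on : ∀ q -> (fst (fst q) , fst (snd q)) ≡ (s , s') × s ≢ s' × τ (snd q) ≡ τ (fst q) ->
       (fst (h q) F.* fst (h q) F.+ 16') F.* s' ≡ (snd (h q) F.* snd (h q) F.+ 16') F.* s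
      on ((_ , y) , (_ , y')) (refl , _ , c) = cross s≢0 s'≢0 c
  -- `f` has mean at least n, and the collisions number at most 2 n p + n² (p + 1). So the sum of
  -- the (f t - n)² is at most (2 p + n) n, while every missed t contributes n².
  missed : ∀ ts -> Unique ts -> (∀ t -> t ∈ ts -> f t ≡ 0) -> 0 < n -> length ts · n ≤ 2 · p N.+ n
  missed ts u none 0<n = *-cancelʳ-≤ _ _ n {{N.>-nonZero 0<n}} (+-cancelˡ-≤ X _ _ (begin
   X N.+ length ts · n · n ≡⟨ calc1 n p (length ts) ⟩
   2 · n · (n · p) N.+ length ts · (n · n) ≤⟨ +-mono-≤ (*-monoʳ-≤ (2 · n) first-moment)
     (*-monoˡ-≤ (n · n) (unique-⊆ F._≟_ ts (filter (\ t -> f t N.≟ 0) elements) u \ t t∈ -> ∈-filter⁺ (\ t -> f t N.≟ 0) (elements-complete t) (none t t∈))) ⟩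
   2 · n · sum (map f elements) N.+ length (filter (\ t -> f t N.≟ 0) elements) · (n · n) ≤⟨ variance f n elements ⟩
   sum (map (\ t -> f t · f t) elements) N.+ length elements · (n · n) ≤⟨ +-mono-≤ (≤-trans (second-moment A) W≤) (≤-eq (cong (_· (n · n)) elements-length)) ⟩
   (n · p · 2 N.+ n · n · suc p) N.+ p · (n · n) ≡⟨ calc2 n p ⟩
   X N.+ (2 · p N.+ n) · n ∎))
   where
   open ≤R
   X = 2 · (n · n · p)
   W≤ : length W ≤ n · p · 2 N.+ n · n · suc p
   W≤ = ≤-trans (≤-eq (sym (filter-split equal? W))) (+-mono-≤ W₌ W≠)
   calc1 : ∀ n p t -> 2 · (n · n · p) N.+ t · n · n ≡ 2 · n · (n · p) N.+ t · (n · n)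
   calc1 = solve-∀
   calc2 : ∀ n p -> (n · p · 2 N.+ n · n · suc p) N.+ p · (n · n) ≡ 2 · (n · n · p) N.+ (2 · p N.+ n) · n
   calc2 = solve-∀
  hit : ∀ s y t -> s ∈ ss -> y F.* y F.+ 16' ≡ s F.* t -> f t ≢ 0
  hit s y t s∈ e z = nonempty (fiber A t) (∈-filter⁺ (\ a -> τ a F.≟ t) (∈-cartesianProduct⁺ s∈ (elements-complete y))
    (trans (cong (F._* s F.⁻¹) e) (trans (F.solve 3 (\ s t i -> s F.:* t F.:* i F.:= t F.:* (s F.:* i)) refl s t (s F.⁻¹)) (trans (cong (t F.*_) (F.*-inverseʳ (nonzero s∈))) (F.*-identityʳ t))))) z
   where
   nonempty : ∀ (l : List Pair) {a} -> a ∈ l -> length l ≢ 0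
   nonempty (_ ∷ _) _ ()
  member : ∀ t -> f t ≢ 0 -> Σ F.Carrier \ s -> Σ F.Carrier \ y -> s ∈ ss × y F.* y F.+ 16' ≡ s F.* t
  member t ne = first (fiber A t) (\ a∈ -> ∈-filter⁻ (\ a -> τ a F.≟ t) {xs = A} a∈) ne
   where
   first : ∀ l -> (∀ {a} -> a ∈ l -> a ∈ A × τ a ≡ t) -> length l ≢ 0 -> Σ F.Carrier \ s -> Σ F.Carrier \ y -> s ∈ ss × y F.* y F.+ 16' ≡ s F.* t
   first [] _ ne = ⊥-elim (ne refl)
   first ((s , y) ∷ _) sound _ = let a∈ , e = sound (here refl) ; s∈ , _ = ∈-cartesianProduct⁻ ss elements a∈ in s , y , s∈ ,
    trans (trans (sym (F.*-identityʳ _)) (cong ((y F.* y F.+ 16') F.*_) (sym (F.*-inverseʳ (nonzero s∈)))))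
     (trans (F.solve 3 (\ u s i -> u F.:* (s F.:* i) F.:= s F.:* (u F.:* i)) refl (y F.* y F.+ 16') s (s F.⁻¹)) (cong (s F.*_) e))

 -- 12 = 2 · 2 · 3: passing to discriminants may halve each set, and 2 p + n ≤ 3 p.
 edge : ∀ U V -> Unique U -> Unique V -> (∀ {u} -> u ∈ U -> disc u ≢ F.0#) -> 12 · p < length U · length V ->
  Σ F.Carrier \ u -> Σ F.Carrier \ v -> Σ F.Carrier \ w -> u ∈ U × v ∈ V × OnSurface u v w
 edge U V uU uV regular many = search (Any.any? (\ t -> ¬? (G.f t N.≟ 0)) ts)
  where
  ss ts : List F.Carrier
  ss = deduplicate F._≟_ (map disc U)
  ts = deduplicate F._≟_ (map disc V)
  back : ∀ W {s} -> s ∈ deduplicate F._≟_ (map disc W) -> Σ F.Carrier \ u -> u ∈ W × s ≡ disc u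
  back W s∈ = ∈-map⁻ disc (∈-deduplicate⁻ F._≟_ (map disc W) s∈)
  ss-nonzero : ∀ {s} -> s ∈ ss -> s ≢ F.0#
  ss-nonzero s∈ z = let u , u∈ , e = back U s∈ in regular u∈ (trans (sym e) z)
  module G = Graph ss (DecUnique.deduplicate-! F._≟_ (map disc U)) ss-nonzero
  halved : ∀ W -> Unique W -> length W ≤ length (deduplicate F._≟_ (map disc W)) · 2
  halved W u = fiber-bound (\ s w -> disc w F.≟ s) W _ 2 (\ w w∈ -> ∈-deduplicate⁺ F._≟_ (∈-map⁺ disc w∈)) \ s _ ->
   square-roots (s F.+ F.num 4) _ (Unique.filter⁺ _ u) (All.tabulate \ {w} w∈ -> trans (F.solve 1 (\ w -> w F.:* w F.:= w F.:* w F.:- F.lit 4 F.:+ F.lit 4) refl w)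
    (cong (F._+ F.num 4) (snd (∈-filter⁻ (\ w -> disc w F.≟ s) {xs = W} w∈))))
  search : Dec (Any (\ t -> ¬ (G.f t ≡ 0)) ts) -> Σ F.Carrier \ u -> Σ F.Carrier \ v -> Σ F.Carrier \ w -> u ∈ U × v ∈ V × OnSurface u v w
  search (yes found) with find found
  ... | t , t∈ , ne with G.member t ne | back V t∈
  ...   | s , y , s∈ , e | v , v∈ , refl with back U s∈
  ...     | u , u∈ , refl = u , v , w , u∈ , v∈ , F.*-cancelˡ F-4≢0 (F.x-y≡0⇒x≡y (begin
   F.num 4 F.* (u F.* u F.+ v F.* v F.+ w F.* w) F.- F.num 4 F.* (u F.* v F.* w)
    ≡⟨ F.solve 3 (\ u v w -> F.lit 4 F.:* (u F.:* u F.:+ v F.:* v F.:+ w F.:* w) F.:- F.lit 4 F.:* (u F.:* v F.:* w)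
       F.:= (F.lit 2 F.:* w F.:- u F.:* v) F.:* (F.lit 2 F.:* w F.:- u F.:* v) F.:+ F.lit 16 F.:- (u F.:* u F.:- F.lit 4) F.:* (v F.:* v F.:- F.lit 4)) refl u v w ⟩
   (F.num 2 F.* w F.- u F.* v) F.* (F.num 2 F.* w F.- u F.* v) F.+ 16' F.- (u F.* u F.- F.num 4) F.* (v F.* v F.- F.num 4)
    ≡⟨ cong (\ z -> z F.* z F.+ 16' F.- (u F.* u F.- F.num 4) F.* (v F.* v F.- F.num 4)) 2w ⟩
   y F.* y F.+ 16' F.- (u F.* u F.- F.num 4) F.* (v F.* v F.- F.num 4) ≡⟨ F.x≡y⇒x-y≡0 e ⟩
   F.0# ∎))
   where
   open ≡R
   w = (u F.* v F.+ y) F.* F.num 2 F.⁻¹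
   2w : F.num 2 F.* w F.- u F.* v ≡ y
   2w = trans (cong (F._- u F.* v) (trans (F.solve 3 (\ x a i -> a F.:* (x F.:* i) F.:= x F.:* (a F.:* i)) refl _ (F.num 2) (F.num 2 F.⁻¹)) (trans (cong ((u F.* v F.+ y) F.*_) (F.*-inverseʳ F-2≢0)) (F.*-identityʳ _))))
    (F.solve 2 (\ a y -> a F.:+ y F.:- a F.:= y) refl (u F.* v) y)
  search (no none) = ⊥-elim (<⇒≱ many (begin
   length U · length V ≤⟨ *-mono-≤ (halved U uU) (halved V uV) ⟩
   n · 2 · (m · 2) ≡⟨ calc n m ⟩
   4 · (m · n) ≤⟨ *-monoʳ-≤ 4 (≤-trans (G.missed ts (DecUnique.deduplicate-! F._≟_ (map disc V)) zero-on 0<n) (+-monoʳ-≤ (2 · p) n≤p)) ⟩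
   4 · (2 · p N.+ p) ≡⟨ calc' p ⟩
   12 · p ∎))
   where
   open ≤R
   n = length ss
   m = length ts
   calc : ∀ n m -> n · 2 · (m · 2) ≡ 4 · (m · n)
   calc = solve-∀
   calc' : ∀ p -> 4 · (2 · p N.+ p) ≡ 12 · p
   calc' = solve-∀
   zero-on : ∀ t -> t ∈ ts -> G.f t ≡ 0
   zero-on t t∈ = stable (G.f t N.≟ 0)
    where
    stable : Dec (G.f t ≡ 0) -> G.f t ≡ 0
    stable (yes e) = e
    stable (no ne) = ⊥-elim (none (lose t∈ ne))
   n≤p : n ≤ p
   n≤p = ≤-trans (unique-⊆ F._≟_ ss elements (DecUnique.deduplicate-! F._≟_ (map disc U)) (\ s _ -> elements-complete s)) (≤-eq elements-length)
   0<n : 0 < n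
   0<n = n≢0⇒n>0 \ z -> <⇒≱ many (≤-trans (*-monoˡ-≤ (length V) (≤-trans (halved U uU) (≤-eq (cong (_· 2) z)))) z≤n)

-- Triples of small orders: Siegel's lemma in an integral group ring.

module Opening where
 open import Algebra.Structures using (IsCommutativeMonoid; IsCommutativeRing)
 open import Data.Nat.DivMod using (_%_; m<n⇒m%n≡m; [m+n]%n≡m%n)
 open import Data.Integer using (ℤ; +_; -[1+_]; ∣_∣; _+_; _*_; _-_; -_)
 open import Data.Fin using (Fin; zero; suc; toℕ; fromℕ<; funToFin; finToFun)

 open NT using (odd≢even)

 X : Set
 X = ℕ × ℕ × ℕ

 infixr 6 _⊕_
 _⊕_ : X -> X -> X
 u ⊕ x = fst u N.+ fst x , fst (snd u) N.+ fst (snd x) , snd (snd u) N.+ snd (snd x)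

 ⊕-exchange : ∀ u v x -> u ⊕ v ⊕ x ≡ v ⊕ u ⊕ x
 ⊕-exchange (a , b , c) (a' , b' , c') (i , j , k) = cong2 _,_ (exchange a a' i) (cong2 _,_ (exchange b b' j) (exchange c c' k))
  where
  exchange : ∀ a b i -> a N.+ (b N.+ i) ≡ b N.+ (a N.+ i)
  exchange = solve-∀

 data Axis : Set where
  x1 x2 x3 : Axis

 -- Elements of the group ring are represented by periodic functions on ℕ³ with periods e1 + 1, e2 +
 -- 1, e3 + 1; translation by `unit' a` is the inverse of translation by `unit a`.
 module Box (e1 e2 e3 : ℕ) where
  unit unit' period : Axis -> X
  unit x1 = 1 , 0 , 0
  unit x2 = 0 , 1 , 0
  unit x3 = 0 , 0 , 1
  unit' x1 = e1 , 0 , 0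
  unit' x2 = 0 , e2 , 0
  unit' x3 = 0 , 0 , e3
  period x1 = suc e1 , 0 , 0
  period x2 = 0 , suc e2 , 0
  period x3 = 0 , 0 , suc e3
  unit'-unit : ∀ a x -> unit' a ⊕ unit a ⊕ x ≡ period a ⊕ x
  unit'-unit x1 (i , j , k) = cong (_, j , k) (+-suc e1 i)
  unit'-unit x2 (i , j , k) = cong (\ t -> i , t , k) (+-suc e2 j)
  unit'-unit x3 (i , j , k) = cong (\ t -> i , j , t) (+-suc e3 k)
  record Periodic {A : Set} (f : X -> A) : Set where
   constructor periodic
   field
    repeats : ∀ a x -> f (period a ⊕ x) ≡ f x
  open Periodic
  Periodic-shift : ∀ {A : Set} {f : X -> A} u -> Periodic f -> Periodic (\ x -> f (u ⊕ x))
  Periodic-shift {f = f} u P = periodic \ a x -> trans (cong f (⊕-exchange u (period a) x)) (repeats P a (u ⊕ x))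
  Periodic-map2 : ∀ {A B C : Set} (_∙_ : A -> B -> C) {f : X -> A} {g : X -> B} -> Periodic f -> Periodic g -> Periodic (\ x -> f x ∙ g x)
  Periodic-map2 _∙_ P Q = periodic \ a x -> cong2 _∙_ (repeats P a x) (repeats Q a x)
  inv : ∀ {A : Set} {f : X -> A} -> Periodic f -> ∀ a x -> f (unit' a ⊕ unit a ⊕ x) ≡ f x
  inv {f = f} P a x = trans (cong f (unit'-unit a x)) (repeats P a x)
  module Sums {A : Set} {_∙_ : A -> A -> A} {ε : A} (M : IsCommutativeMonoid _≡_ _∙_ ε) where
   open IsCommutativeMonoid M using (assoc; comm; identityˡ; identityʳ)
   sum : ℕ -> (ℕ -> A) -> A
   sum zero f = ε
   sum (suc n) f = f 0 ∙ sum n (f ∘ suc)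
   sum-cong : ∀ n {f g : ℕ -> A} -> (∀ i -> f i ≡ g i) -> sum n f ≡ sum n g
   sum-cong zero e = refl
   sum-cong (suc n) e = cong2 _∙_ (e 0) (sum-cong n (e ∘ suc))
   sum-∙ : ∀ n (f g : ℕ -> A) -> sum n (\ i -> f i ∙ g i) ≡ sum n f ∙ sum n g
   sum-∙ zero f g = sym (identityˡ ε)
   sum-∙ (suc n) f g = trans (cong ((f 0 ∙ g 0) ∙_) (sum-∙ n (f ∘ suc) (g ∘ suc))) (interchange (f 0) (g 0) _ _)
    where
    interchange : ∀ a b c d -> (a ∙ b) ∙ (c ∙ d) ≡ (a ∙ c) ∙ (b ∙ d)
    interchange a b c d = trans (assoc a b (c ∙ d)) (trans (cong (a ∙_) (trans (sym (assoc b c d)) (trans (cong (_∙ d) (comm b c)) (assoc c b d)))) (sym (assoc a c (b ∙ d))))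
   sum-last : ∀ n (f : ℕ -> A) -> sum (suc n) f ≡ sum n f ∙ f n
   sum-last zero f = comm (f 0) ε
   sum-last (suc n) f = trans (cong (f 0 ∙_) (sum-last n (f ∘ suc))) (sym (assoc _ _ _))
   sum-cycle : ∀ n (f : ℕ -> A) -> f (suc n) ≡ f 0 -> sum (suc n) (f ∘ suc) ≡ sum (suc n) f
   sum-cycle n f e = trans (sum-last n (f ∘ suc)) (trans (cong (sum n (f ∘ suc) ∙_) e) (comm (sum n (f ∘ suc)) (f 0)))
   sum-ε : ∀ n {f : ℕ -> A} -> (∀ i -> i < n -> f i ≡ ε) -> sum n f ≡ ε
   sum-ε zero e = refl
   sum-ε (suc n) e = trans (cong2 _∙_ (e 0 (s≤s z≤n)) (sum-ε n (\ i i< -> e (suc i) (s≤s i<)))) (identityˡ ε)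
   sum-first : ∀ n {f : ℕ -> A} -> (∀ i -> i < n -> f (suc i) ≡ ε) -> sum (suc n) f ≡ f 0
   sum-first n {f} e = trans (cong (f 0 ∙_) (sum-ε n e)) (identityʳ (f 0))
   opaque
    box : (X -> A) -> A
    box f = sum (suc e1) \ i -> sum (suc e2) \ j -> sum (suc e3) \ k -> f (i , j , k)
    box-cong : ∀ {f g : X -> A} -> (∀ x -> f x ≡ g x) -> box f ≡ box g
    box-cong e = sum-cong (suc e1) \ i -> sum-cong (suc e2) \ j -> sum-cong (suc e3) \ k -> e (i , j , k)
    box-∙ : ∀ (f g : X -> A) -> box (\ x -> f x ∙ g x) ≡ box f ∙ box g
    box-∙ f g = trans (sum-cong (suc e1) \ i -> trans (sum-cong (suc e2) \ j -> sum-∙ (suc e3) (\ k -> f (i , j , k)) (\ k -> g (i , j , k)))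
     (sum-∙ (suc e2) (\ j -> sum (suc e3) \ k -> f (i , j , k)) (\ j -> sum (suc e3) \ k -> g (i , j , k))))
     (sum-∙ (suc e1) (\ i -> sum (suc e2) \ j -> sum (suc e3) \ k -> f (i , j , k)) (\ i -> sum (suc e2) \ j -> sum (suc e3) \ k -> g (i , j , k)))
    box-ε : ∀ {f : X -> A} -> (∀ x -> f x ≡ ε) -> box f ≡ ε
    box-ε e = sum-ε (suc e1) \ i _ -> sum-ε (suc e2) \ j _ -> sum-ε (suc e3) \ k _ -> e (i , j , k)
    box-origin : ∀ (f : X -> A) -> (∀ i j k -> i < e1 -> f (suc i , j , k) ≡ ε) -> (∀ j k -> j < e2 -> f (0 , suc j , k) ≡ ε) -> (∀ k -> k < e3 -> f (0 , 0 , suc k) ≡ ε) -> box f ≡ f (0 , 0 , 0)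
    box-origin f h1 h2 h3 = trans (sum-first e1 {\ i -> sum (suc e2) \ j -> sum (suc e3) \ k -> f (i , j , k)} \ i i< -> sum-ε (suc e2) \ j _ -> sum-ε (suc e3) \ k _ -> h1 i j k i<)
     (trans (sum-first e2 {\ j -> sum (suc e3) \ k -> f (0 , j , k)} \ j j< -> sum-ε (suc e3) \ k _ -> h2 j k j<) (sum-first e3 {\ k -> f (0 , 0 , k)} h3))
    box-hom : ∀ (h : A -> A) -> (∀ a b -> h (a ∙ b) ≡ h a ∙ h b) -> h ε ≡ ε -> ∀ f -> box (\ x -> h (f x)) ≡ h (box f)
    box-hom h h∙ hε f = trans (sum-cong (suc e1) \ i -> trans (sum-cong (suc e2) \ j -> sum-hom (suc e3) (\ k -> f (i , j , k)))
     (sum-hom (suc e2) (\ j -> sum (suc e3) \ k -> f (i , j , k)))) (sum-hom (suc e1) (\ i -> sum (suc e2) \ j -> sum (suc e3) \ k -> f (i , j , k)))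
     where
     sum-hom : ∀ n f -> sum n (\ i -> h (f i)) ≡ h (sum n f)
     sum-hom zero f = sym hε
     sum-hom (suc n) f = trans (cong (h (f 0) ∙_) (sum-hom n (f ∘ suc))) (sym (h∙ (f 0) _))
    box-shift : ∀ a {f : X -> A} -> Periodic f -> box (\ x -> f (unit a ⊕ x)) ≡ box f
    box-shift x1 {f} P = sum-cycle e1 (\ i -> sum (suc e2) \ j -> sum (suc e3) \ k -> f (i , j , k))
     (sum-cong (suc e2) \ j -> sum-cong (suc e3) \ k -> trans (cong (\ i -> f (i , j , k)) (sym (N.+-identityʳ (suc e1)))) (repeats P x1 (0 , j , k)))
    box-shift x2 {f} P = sum-cong (suc e1) \ i -> sum-cycle e2 (\ j -> sum (suc e3) \ k -> f (i , j , k))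
     (sum-cong (suc e3) \ k -> trans (cong (\ j -> f (i , j , k)) (sym (N.+-identityʳ (suc e2)))) (repeats P x2 (i , 0 , k)))
    box-shift x3 {f} P = sum-cong (suc e1) \ i -> sum-cong (suc e2) \ j -> sum-cycle e3 (\ k -> f (i , j , k))
     (trans (cong (\ k -> f (i , j , k)) (sym (N.+-identityʳ (suc e3)))) (repeats P x3 (i , j , 0)))
   box-shift' : ∀ a {f : X -> A} -> Periodic f -> box (\ x -> f (unit' a ⊕ x)) ≡ box f
   box-shift' a P = trans (sym (box-shift a (Periodic-shift (unit' a) P))) (box-cong (inv P a))
  open Sums ℤ.+-0-isCommutativeMonoid
  everywhere : ∀ d {P : ℕ -> Set} -> (∀ i -> i < suc d -> P i) -> (∀ i -> P i -> P (suc d N.+ i)) -> ∀ n -> P n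
  everywhere d {P} base step n = go n n ≤-refl
   where
   go : ∀ fuel n -> n ≤ fuel -> P n
   go fuel n le = by (n N.<? suc d) fuel le
    where
    by : Dec (n < suc d) -> ∀ fuel -> n ≤ fuel -> P n
    by (yes lt) _ _ = base n lt
    by (no ge) zero le = base n (≤-<-trans le (s≤s z≤n))
    by (no ge) (suc fuel) le = subst P (m+[n∸m]≡n (≮⇒≥ ge)) (step _ (go fuel (n N.∸ suc d) (≤-trans (∸-monoˡ-≤ (suc d) le) (m∸n≤m fuel d))))
  periodic-everywhere : ∀ {A : Set} {f : X -> A} {c} -> Periodic f -> (∀ i j k -> i < suc e1 -> j < suc e2 -> k < suc e3 -> f (i , j , k) ≡ c) -> ∀ x -> f x ≡ c
  periodic-everywhere {f = f} {c} P base (i , j , k) =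
   everywhere e1 {\ i -> ∀ j k -> f (i , j , k) ≡ c}
    (\ i i< -> \ j k -> everywhere e2 {\ j -> ∀ k -> f (i , j , k) ≡ c}
     (\ j j< -> everywhere e3 {\ k -> f (i , j , k) ≡ c} (\ k k< -> base i j k i< j< k<) (\ k e -> trans (repeats P x3 (i , j , k)) e))
     (\ j e k -> trans (repeats P x2 (i , j , k)) (e k)) j k)
    (\ i e j k -> trans (repeats P x1 (i , j , k)) (e j k)) i j k
  sum-mono : ∀ n {f g : ℕ -> ℤ} -> (∀ i -> f i ℤ.≤ g i) -> sum n f ℤ.≤ sum n g
  sum-mono zero e = ℤ.≤-refl
  sum-mono (suc n) e = ℤ.+-mono-≤ (e 0) (sum-mono n (e ∘ suc))
  opaque
   unfolding box
   box-mono : ∀ {f g : X -> ℤ} -> (∀ x -> f x ℤ.≤ g x) -> box f ℤ.≤ box g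
   box-mono e = sum-mono (suc e1) \ i -> sum-mono (suc e2) \ j -> sum-mono (suc e3) \ k -> e (i , j , k)
  sum-nonneg : ∀ n {f : ℕ -> ℤ} -> (∀ i -> + 0 ℤ.≤ f i) -> + 0 ℤ.≤ sum n f
  sum-nonneg zero e = ℤ.≤-refl
  sum-nonneg (suc n) e = ℤ.+-mono-≤ (e 0) (sum-nonneg n (e ∘ suc))
  sum-member : ∀ n {f : ℕ -> ℤ} -> (∀ i -> + 0 ℤ.≤ f i) -> ∀ i -> i < n -> f i ℤ.≤ sum n f
  sum-member (suc n) {f} e zero _ = subst (ℤ._≤ f 0 + sum n (f ∘ suc)) (ℤ.+-identityʳ (f 0)) (ℤ.+-monoʳ-≤ (f 0) (sum-nonneg n (e ∘ suc)))
  sum-member (suc n) {f} e (suc i) (s≤s i<) = ℤ.≤-trans (sum-member n (e ∘ suc) i i<) (subst (ℤ._≤ f 0 + sum n (f ∘ suc)) (ℤ.+-identityˡ _) (ℤ.+-monoˡ-≤ (sum n (f ∘ suc)) (e 0)))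
  opaque
   unfolding box
   box-member : ∀ {q : X -> ℤ} -> (∀ x -> + 0 ℤ.≤ q x) -> ∀ i j k -> i < suc e1 -> j < suc e2 -> k < suc e3 -> q (i , j , k) ℤ.≤ box q
   box-member {q} nonneg i j k i< j< k< = ℤ.≤-trans (sum-member (suc e3) {\ k -> q (i , j , k)} (\ k -> nonneg (i , j , k)) k k<)
    (ℤ.≤-trans (sum-member (suc e2) {\ j -> sum (suc e3) \ k -> q (i , j , k)} (\ j -> sum-nonneg (suc e3) \ k -> nonneg (i , j , k)) j j<)
     (sum-member (suc e1) {\ i -> sum (suc e2) \ j -> sum (suc e3) \ k -> q (i , j , k)} (\ i -> sum-nonneg (suc e2) \ j -> sum-nonneg (suc e3) \ k -> nonneg (i , j , k)) i i<))
  square-nonneg : ∀ i -> + 0 ℤ.≤ i * i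
  square-nonneg (+ zero) = ℤ.≤-refl
  square-nonneg (+ suc n) = ℤ.+≤+ z≤n
  square-nonneg -[1+ n ] = ℤ.+≤+ z≤n
  square≤0 : ∀ i -> i * i ℤ.≤ + 0 -> i ≡ + 0
  square≤0 (+ zero) _ = refl
  square≤0 (+ suc n) (ℤ.+≤+ ())
  square≤0 -[1+ n ] (ℤ.+≤+ ())
  ⟪_∥_⟫ : (X -> ℤ) -> (X -> ℤ) -> ℤ
  ⟪ z ∥ w ⟫ = box (\ x -> z x * w x)
  definite : ∀ {z} -> Periodic z -> ⟪ z ∥ z ⟫ ℤ.≤ + 0 -> ∀ x -> z x ≡ + 0
  definite {z} P le = periodic-everywhere P \ i j k i< j< k< -> square≤0 (z (i , j , k)) (ℤ.≤-trans (box-member (\ x -> square-nonneg (z x)) i j k i< j< k<) le)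
  U : Axis -> (X -> ℤ) -> X -> ℤ
  U a z x = z (unit a ⊕ x) + z (unit' a ⊕ x)
  U-periodic : ∀ a {z} -> Periodic z -> Periodic (U a z)
  U-periodic a P = Periodic-map2 _+_ (Periodic-shift (unit a) P) (Periodic-shift (unit' a) P)
  U-cong : ∀ a z w -> (∀ x -> z x ≡ w x) -> ∀ x -> U a z x ≡ U a w x
  U-cong a z w e x = cong2 _+_ (e _) (e _)
  U-comm : ∀ a b z x -> U a (U b z) x ≡ U b (U a z) x
  U-comm a b z x = trans (cong2 _+_ (cong2 (\ s t -> z s + z t) (⊕-exchange (unit b) (unit a) x) (⊕-exchange (unit' b) (unit a) x))
    (cong2 (\ s t -> z s + z t) (⊕-exchange (unit b) (unit' a) x) (⊕-exchange (unit' b) (unit' a) x)))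
   (interchange (z (unit a ⊕ unit b ⊕ x)) (z (unit a ⊕ unit' b ⊕ x)) (z (unit' a ⊕ unit b ⊕ x)) (z (unit' a ⊕ unit' b ⊕ x)))
   where
   interchange : ∀ a b c d -> (a + b) + (c + d) ≡ (a + c) + (b + d)
   interchange = ℤ-Solver.solve-∀
  -- The elements of ℤ[ℤ/d1 × ℤ/d2 × ℤ/d3] with values a1, a2, a3 (U) and a1² + a2² + a3² − a1a2a3 (Φ) at a character.
  Φ : (X -> ℤ) -> X -> ℤ
  Φ z x = U x1 (U x1 z) x + U x2 (U x2 z) x + U x3 (U x3 z) x - U x2 (U x1 (U x3 z)) x
  Φ-periodic : ∀ {z} -> Periodic z -> Periodic (Φ z)
  Φ-periodic {z} P = periodic \ a x -> cong2 _-_ (cong2 _+_ (cong2 _+_ (repeats (UU x1) a x) (repeats (UU x2) a x)) (repeats (UU x3) a x)) (repeats (U-periodic x2 (U-periodic x1 (U-periodic x3 P))) a x)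
   where
   UU : ∀ a -> Periodic (U a (U a z))
   UU a = U-periodic a (U-periodic a P)
  ΦU : ∀ z x -> Φ (U x1 z) x ≡ U x1 (Φ z) x
  ΦU z x = trans (cong2 _-_ (cong2 _+_ (cong (\ t -> U x1 (U x1 (U x1 z)) x + t) (move x2)) (move x3)) cubic) (sym (distribute x1))
   where
   move : ∀ a -> U a (U a (U x1 z)) x ≡ U x1 (U a (U a z)) x
   move a = trans (U-cong a (U a (U x1 z)) (U x1 (U a z)) (U-comm a x1 z) x) (U-comm a x1 (U a z) x)
   cubic : U x2 (U x1 (U x3 (U x1 z))) x ≡ U x1 (U x2 (U x1 (U x3 z))) x
   cubic = trans (U-cong x2 _ _ (U-cong x1 (U x3 (U x1 z)) (U x1 (U x3 z)) (U-comm x3 x1 z)) x) (U-comm x2 x1 (U x1 (U x3 z)) x)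
   distribute : ∀ a -> U a (Φ z) x ≡ U a (U x1 (U x1 z)) x + U a (U x2 (U x2 z)) x + U a (U x3 (U x3 z)) x - U a (U x2 (U x1 (U x3 z))) x
   distribute a = calc (U x1 (U x1 z) (unit a ⊕ x)) (U x2 (U x2 z) (unit a ⊕ x)) (U x3 (U x3 z) (unit a ⊕ x)) (U x2 (U x1 (U x3 z)) (unit a ⊕ x))
    (U x1 (U x1 z) (unit' a ⊕ x)) (U x2 (U x2 z) (unit' a ⊕ x)) (U x3 (U x3 z) (unit' a ⊕ x)) (U x2 (U x1 (U x3 z)) (unit' a ⊕ x))
    where
    calc : ∀ a b c d a' b' c' d' -> (a + b + c - d) + (a' + b' + c' - d') ≡ (a + a') + (b + b') + (c + c') - (d + d')
    calc = ℤ-Solver.solve-∀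
  adjoint : ∀ a {z w} -> Periodic z -> Periodic w -> ⟪ U a z ∥ w ⟫ ≡ ⟪ z ∥ U a w ⟫
  adjoint a {z} {w} P Q = begin
   box (\ x -> (z (u ⊕ x) + z (u' ⊕ x)) * w x) ≡⟨ box-cong (\ x -> ℤ.*-distribʳ-+ (w x) (z (u ⊕ x)) (z (u' ⊕ x))) ⟩
   box (\ x -> z (u ⊕ x) * w x + z (u' ⊕ x) * w x) ≡⟨ box-∙ _ _ ⟩
   box (\ x -> z (u ⊕ x) * w x) + box (\ x -> z (u' ⊕ x) * w x) ≡⟨ cong2 _+_ left right ⟩
   box (\ x -> z x * w (u' ⊕ x)) + box (\ x -> z x * w (u ⊕ x)) ≡⟨ ℤ.+-comm (box (\ x -> z x * w (u' ⊕ x))) _ ⟩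
   box (\ x -> z x * w (u ⊕ x)) + box (\ x -> z x * w (u' ⊕ x)) ≡⟨ box-∙ _ _ ⟨
   box (\ x -> z x * w (u ⊕ x) + z x * w (u' ⊕ x)) ≡⟨ box-cong (\ x -> sym (ℤ.*-distribˡ-+ (z x) (w (u ⊕ x)) (w (u' ⊕ x)))) ⟩
   box (\ x -> z x * (w (u ⊕ x) + w (u' ⊕ x))) ∎
   where
   open ≡R
   u = unit a
   u' = unit' a
   left : box (\ x -> z (u ⊕ x) * w x) ≡ box (\ x -> z x * w (u' ⊕ x))
   left = trans (box-cong (\ x -> cong (z (u ⊕ x) *_) (sym (inv Q a x)))) (box-shift a (Periodic-map2 _*_ P (Periodic-shift u' Q)))
   right : box (\ x -> z (u' ⊕ x) * w x) ≡ box (\ x -> z x * w (u ⊕ x))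
   right = trans (sym (box-shift a (Periodic-map2 _*_ (Periodic-shift u' P) Q))) (box-cong (\ x -> cong (_* w (u ⊕ x)) (inv P a x)))
  -- Twice the difference of the two sides is the sum of the squares of the two translates of z,
  -- each minus w.
  U-bound : ∀ a {z w} -> Periodic z -> Periodic w -> ⟪ U a z ∥ w ⟫ ℤ.≤ ⟪ z ∥ z ⟫ + ⟪ w ∥ w ⟫
  U-bound a {z} {w} P Q = ℤ.*-cancelˡ-≤-pos _ _ (+ 2) (begin
   + 2 * ⟪ U a z ∥ w ⟫ ≡⟨ double _ ⟩
   ⟪ U a z ∥ w ⟫ + ⟪ U a z ∥ w ⟫ ≡⟨ box-∙ _ _ ⟨
   box (\ x -> U a z x * w x + U a z x * w x) ≤⟨ box-mono (\ x -> pointwise (z (u ⊕ x)) (z (u' ⊕ x)) (w x)) ⟩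
   box (\ x -> (z (u ⊕ x) * z (u ⊕ x) + z (u' ⊕ x) * z (u' ⊕ x)) + (w x * w x + w x * w x)) ≡⟨ trans (box-∙ _ _) (cong2 _+_ (box-∙ _ _) (box-∙ _ _)) ⟩
   (box (\ x -> z (u ⊕ x) * z (u ⊕ x)) + box (\ x -> z (u' ⊕ x) * z (u' ⊕ x))) + (⟪ w ∥ w ⟫ + ⟪ w ∥ w ⟫)
    ≡⟨ cong (_+ (⟪ w ∥ w ⟫ + ⟪ w ∥ w ⟫)) (cong2 _+_ (box-shift a (Periodic-map2 _*_ P P)) (box-shift' a (Periodic-map2 _*_ P P))) ⟩
   (⟪ z ∥ z ⟫ + ⟪ z ∥ z ⟫) + (⟪ w ∥ w ⟫ + ⟪ w ∥ w ⟫) ≡⟨ collect ⟪ z ∥ z ⟫ ⟪ w ∥ w ⟫ ⟩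
   + 2 * (⟪ z ∥ z ⟫ + ⟪ w ∥ w ⟫) ∎)
   where
   open ℤ.≤-Reasoning
   u = unit a
   u' = unit' a
   double : ∀ t -> + 2 * t ≡ t + t
   double = ℤ-Solver.solve-∀
   collect : ∀ s t -> (s + s) + (t + t) ≡ + 2 * (s + t)
   collect = ℤ-Solver.solve-∀
   split : ∀ a b c -> (a * a + b * b) + (c * c + c * c) ≡ ((a + b) * c + (a + b) * c) + ((a - c) * (a - c) + (b - c) * (b - c))
   split = ℤ-Solver.solve-∀
   pointwise : ∀ a b c -> (a + b) * c + (a + b) * c ℤ.≤ (a * a + b * b) + (c * c + c * c)
   pointwise a b c = ℤ.≤-trans (subst (ℤ._≤ t + q) (ℤ.+-identityʳ t) (ℤ.+-monoʳ-≤ t (ℤ.+-mono-≤ (square-nonneg (a - c)) (square-nonneg (b - c))))) (ℤ.≤-reflexive (sym (split a b c)))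
    where
    t = (a + b) * c + (a + b) * c
    q = (a - c) * (a - c) + (b - c) * (b - c)
  -- At a complex character the values a1, a2, a3 lie in [-2, 2], where a1² + a2² + a3² = a1a2a3 forces a1 = 0.
  kernel : ∀ {w} -> Periodic w -> (∀ x -> Φ w x ≡ + 0) -> ∀ x -> U x1 w x ≡ + 0
  kernel {w} P Φw≡0 = definite (U-periodic x1 P) (ℤ.≤-trans (ℤ.≤-reflexive isolate) (ℤ.i≤j⇒i-j≤0 bound))
   where
   open ≡R
   n : Axis -> ℤ
   n a = ⟪ U a w ∥ U a w ⟫
   c = ⟪ U x1 (U x3 w) ∥ U x2 w ⟫
   bound : c ℤ.≤ n x3 + n x2
   bound = U-bound x1 (U-periodic x3 P) (U-periodic x2 P)
   square : ∀ a -> box (\ x -> U a (U a w) x * w x) ≡ n a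
   square a = adjoint a (U-periodic a P) P
   neg : ∀ f -> box (\ x -> - f x) ≡ - box f
   neg = box-hom (\ t -> - t) ℤ.neg-distrib-+ refl
   -- This is Φ w = 0 paired with w. Together with c ≤ n x3 + n x2 it leaves n x1 ≤ 0.
   total : n x1 + n x2 + n x3 - c ≡ + 0
   total = begin
    n x1 + n x2 + n x3 - c ≡⟨ cong2 _-_ (cong2 _+_ (cong2 _+_ (square x1) (square x2)) (square x3)) (adjoint x2 (U-periodic x1 (U-periodic x3 P)) P) ⟨
    box (\ x -> q x1 x) + box (\ x -> q x2 x) + box (\ x -> q x3 x) - box (\ x -> r x) ≡⟨ cong (\ t -> box (\ x -> q x1 x) + box (\ x -> q x2 x) + box (\ x -> q x3 x) + t) (neg r) ⟨
    box (\ x -> q x1 x) + box (\ x -> q x2 x) + box (\ x -> q x3 x) + box (\ x -> - r x) ≡⟨ trans (box-∙ _ _) (cong (_+ box (\ x -> - r x)) (trans (box-∙ _ _) (cong (_+ box (\ x -> q x3 x)) (box-∙ _ _)))) ⟨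
    box (\ x -> q x1 x + q x2 x + q x3 x + - r x) ≡⟨ box-cong (\ x -> trans (collect (U x1 (U x1 w) x) _ _ _ (w x)) (trans (cong (_* w x) (Φw≡0 x)) (ℤ.*-zeroˡ (w x)))) ⟩
    box (\ _ -> + 0) ≡⟨ box-ε (\ _ -> refl) ⟩
    + 0 ∎
    where
    q : Axis -> X -> ℤ
    q a x = U a (U a w) x * w x
    r : X -> ℤ
    r x = U x2 (U x1 (U x3 w)) x * w x
    collect : ∀ a b c d w -> a * w + b * w + c * w + - (d * w) ≡ (a + b + c - d) * w
    collect = ℤ-Solver.solve-∀
   isolate : n x1 ≡ c - (n x3 + n x2)
   isolate = trans (rearrange (n x1) (n x2) (n x3) c) (trans (cong (_+ (c - (n x3 + n x2))) total) (ℤ.+-identityˡ _))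
    where
    rearrange : ∀ a b d c -> a ≡ (a + b + d - c) + (c - (d + b))
    rearrange = ℤ-Solver.solve-∀
  -- The polynomial Σ c_k Φᵏ applied to z, in Horner form.
  app : ∀ {m} -> (Fin m -> ℤ) -> (X -> ℤ) -> X -> ℤ
  app {zero} c z x = + 0
  app {suc m} c z x = c zero * z x + Φ (app (c ∘ suc) z) x
  Φ-cong : ∀ z w -> (∀ x -> z x ≡ w x) -> ∀ x -> Φ z x ≡ Φ w x
  Φ-cong z w e x = cong2 _-_ (cong2 _+_ (cong2 _+_ (UU x1) (UU x2)) (UU x3)) (U-cong x2 (U x1 (U x3 z)) (U x1 (U x3 w)) (U-cong x1 (U x3 z) (U x3 w) (U-cong x3 z w e)) x)
   where
   UU : ∀ a -> U a (U a z) x ≡ U a (U a w) x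
   UU a = U-cong a (U a z) (U a w) (U-cong a z w e) x
  app-periodic : ∀ {m} c {z} -> Periodic z -> Periodic (app {m} c z)
  app-periodic {zero} c P = periodic \ a x -> refl
  app-periodic {suc m} c P = Periodic-map2 _+_ (periodic \ a x -> cong (c zero *_) (repeats P a x)) (Φ-periodic (app-periodic (c ∘ suc) P))
  app-U : ∀ {m} c z x -> app {m} c (U x1 z) x ≡ U x1 (app c z) x
  app-U {zero} c z x = refl
  app-U {suc m} c z x = trans (cong (\ t -> c zero * U x1 z x + t) (trans (Φ-cong (app (c ∘ suc) (U x1 z)) (U x1 (app (c ∘ suc) z)) (app-U (c ∘ suc) z) x) (ΦU (app (c ∘ suc) z) x))) (calc (c zero) _ _ _ _)
   where
   calc : ∀ c a b p q -> c * (a + b) + (p + q) ≡ (c * a + p) + (c * b + q)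
   calc = ℤ-Solver.solve-∀
  app-sub : ∀ {m} c c' z x -> app {m} c z x - app c' z x ≡ app (\ k -> c k - c' k) z x
  app-sub {zero} c c' z x = refl
  app-sub {suc m} c c' z x = trans (calc (c zero) (c' zero) (z x) _ _) (cong (\ t -> (c zero - c' zero) * z x + t) (trans (Φ-sub (app (c ∘ suc) z) (app (c' ∘ suc) z) x) (Φ-cong (\ x -> app (c ∘ suc) z x - app (c' ∘ suc) z x) (app (\ k -> c (suc k) - c' (suc k)) z) (app-sub (c ∘ suc) (c' ∘ suc) z) x)))
   where
   calc : ∀ c c' z p q -> (c * z + p) - (c' * z + q) ≡ (c - c') * z + (p - q)
   calc = ℤ-Solver.solve-∀
   U-sub : ∀ a z w x -> U a z x - U a w x ≡ U a (\ x -> z x - w x) x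
   U-sub a z w x = calc' (z (unit a ⊕ x)) _ (w (unit a ⊕ x)) _
    where
    calc' : ∀ a b c d -> (a + b) - (c + d) ≡ (a - c) + (b - d)
    calc' = ℤ-Solver.solve-∀
   Φ-sub : ∀ z w x -> Φ z x - Φ w x ≡ Φ (\ x -> z x - w x) x
   Φ-sub z w x = trans (arith″ (UU x1 z) (UU x2 z) (UU x3 z) (U x2 (U x1 (U x3 z)) x) (UU x1 w) (UU x2 w) (UU x3 w) (U x2 (U x1 (U x3 w)) x))
    (cong2 _-_ (cong2 _+_ (cong2 _+_ (two x1) (two x2)) (two x3)) (trans (U-sub x2 (U x1 (U x3 z)) (U x1 (U x3 w)) x) (U-cong x2 _ (U x1 (U x3 v)) (\ x -> trans (U-sub x1 (U x3 z) (U x3 w) x) (U-cong x1 _ (U x3 v) (U-sub x3 z w) x)) x)))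
    where
    v : X -> ℤ
    v x = z x - w x
    UU : Axis -> (X -> ℤ) -> ℤ
    UU a z = U a (U a z) x
    two : ∀ a -> UU a z - UU a w ≡ UU a (\ x -> z x - w x)
    two a = trans (U-sub a (U a z) (U a w) x) (U-cong a (\ x -> U a z x - U a w x) (U a v) (U-sub a z w) x)
    arith″ : ∀ a b c d a' b' c' d' -> (a + b + c - d) - (a' + b' + c' - d') ≡ (a - a') + (b - b') + (c - c') - (d - d')
    arith″ = ℤ-Solver.solve-∀
  -- A character of the group, with values in any field, at which the Markoff polynomial vanishes
  -- and the first coordinate does not. A point whose three parameters have the given orders
  -- provides one.
  record Character : Set1 where
   field
    K : Field
   open FieldProps K public renaming (_+_ to _+ᴷ_; _*_ to _*ᴷ_; -_ to -ᴷ_; _-_ to _-ᴷ_)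
   field
    y y' : Axis -> Carrier
    yy' : ∀ a -> y a *ᴷ y' a ≡ 1#
    y1^ : y x1 ^ suc e1 ≡ 1#
    y2^ : y x2 ^ suc e2 ≡ 1#
    y3^ : y x3 ^ suc e3 ≡ 1#
   A : Axis -> Carrier
   A a = y a +ᴷ y' a
   field
    A1≢0 : A x1 ≢ 0#
    relation : A x1 *ᴷ A x1 +ᴷ A x2 *ᴷ A x2 +ᴷ A x3 *ᴷ A x3 ≡ A x2 *ᴷ (A x1 *ᴷ A x3)
   χ : X -> Carrier
   χ (i , j , k) = y x1 ^ i *ᴷ (y x2 ^ j *ᴷ y x3 ^ k)
   χ-unit : ∀ a x -> χ (unit a ⊕ x) ≡ y a *ᴷ χ x
   χ-unit x1 (i , j , k) = *-assoc _ _ _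
   χ-unit x2 (i , j , k) = solve 4 (\ p q r s -> p :* (q :* r :* s) := q :* (p :* (r :* s))) refl _ (y x2) _ _
   χ-unit x3 (i , j , k) = solve 4 (\ p q r s -> p :* (q :* (r :* s)) := r :* (p :* (q :* s))) refl _ _ (y x3) _
   χ-repeats : ∀ a x -> χ (period a ⊕ x) ≡ χ x
   χ-repeats x1 (i , j , k) = cong (_*ᴷ (y x2 ^ j *ᴷ y x3 ^ k)) (trans (^-homo-* (y x1) (suc e1) i) (trans (cong (_*ᴷ y x1 ^ i) y1^) (*-identityˡ _)))
   χ-repeats x2 (i , j , k) = cong (\ t -> y x1 ^ i *ᴷ (t *ᴷ y x3 ^ k)) (trans (^-homo-* (y x2) (suc e2) j) (trans (cong (_*ᴷ y x2 ^ j) y2^) (*-identityˡ _)))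
   χ-repeats x3 (i , j , k) = cong (\ t -> y x1 ^ i *ᴷ (y x2 ^ j *ᴷ t)) (trans (^-homo-* (y x3) (suc e3) k) (trans (cong (_*ᴷ y x3 ^ k) y3^) (*-identityˡ _)))
   module SK = Sums (IsCommutativeRing.+-isCommutativeMonoid (Field.isCommutativeRing K))
   pair : (X -> ℤ) -> Carrier
   pair z = SK.box (\ x -> castℤ (z x) *ᴷ χ x)
   box-scale : ∀ c f -> SK.box (\ x -> c *ᴷ f x) ≡ c *ᴷ SK.box f
   box-scale c = SK.box-hom (c *ᴷ_) (distribˡ c) (zeroʳ c)
   pair-scale : ∀ c z -> pair (\ x -> c * z x) ≡ castℤ c *ᴷ pair z
   pair-scale c z = trans (SK.box-cong \ x -> trans (cong (_*ᴷ χ x) (castℤ-* c (z x))) (*-assoc _ _ _)) (box-scale (castℤ c) _)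
   pair-+ : ∀ z w -> pair (\ x -> z x + w x) ≡ pair z +ᴷ pair w
   pair-+ z w = trans (SK.box-cong \ x -> trans (cong (_*ᴷ χ x) (castℤ-+ (z x) (w x))) (distribʳ (χ x) _ _)) (SK.box-∙ _ _)
   pair-neg : ∀ z -> pair (\ x -> - z x) ≡ -ᴷ pair z
   pair-neg z = trans (SK.box-cong \ x -> trans (cong (_*ᴷ χ x) (castℤ-neg (z x))) (solve 2 (\ z c -> (:- z) :* c := (:- lit 1) :* (z :* c)) refl _ _))
    (trans (box-scale (-ᴷ 1#) _) (solve 1 (\ p -> (:- lit 1) :* p := :- p) refl _))
   pair-U : ∀ a {z} -> Periodic z -> pair (U a z) ≡ A a *ᴷ pair z
   pair-U a {z} P = trans (pair-+ (\ x -> z (unit a ⊕ x)) (\ x -> z (unit' a ⊕ x))) (trans (cong2 _+ᴷ_ up down) (trans (+-comm _ _) (sym (distribʳ (pair z) (y a) (y' a)))))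
    where
    f : X -> Carrier
    f x = castℤ (z x) *ᴷ (y' a *ᴷ χ x)
    back : ∀ x -> χ x ≡ y' a *ᴷ χ (unit a ⊕ x)
    back x = sym (trans (cong (y' a *ᴷ_) (χ-unit a x)) (trans (solve 3 (\ y i c -> i :* (y :* c) := y :* i :* c) refl (y a) (y' a) (χ x)) (trans (cong (_*ᴷ χ x) (yy' a)) (*-identityˡ _))))
    up : pair (\ x -> z (unit a ⊕ x)) ≡ y' a *ᴷ pair z
    up = trans (SK.box-cong \ x -> cong (castℤ (z (unit a ⊕ x)) *ᴷ_) (back x))
     (trans (SK.box-shift a {f} (periodic \ b x -> cong2 (\ s t -> castℤ s *ᴷ (y' a *ᴷ t)) (repeats P b x) (χ-repeats b x)))
      (trans (SK.box-cong \ x -> solve 3 (\ z y c -> z :* (y :* c) := y :* (z :* c)) refl (castℤ (z x)) (y' a) (χ x)) (box-scale (y' a) _)))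
    down : pair (\ x -> z (unit' a ⊕ x)) ≡ y a *ᴷ pair z
    down = trans (sym (SK.box-shift a {\ x -> castℤ (z (unit' a ⊕ x)) *ᴷ χ x} (periodic \ b x -> cong2 (\ s t -> castℤ s *ᴷ t) (repeats (Periodic-shift (unit' a) P) b x) (χ-repeats b x))))
     (trans (SK.box-cong \ x -> trans (cong2 (\ s t -> castℤ s *ᴷ t) (inv P a x) (χ-unit a x)) (solve 3 (\ z y c -> z :* (y :* c) := y :* (z :* c)) refl (castℤ (z x)) (y a) (χ x))) (box-scale (y a) _))
   pair-Φ : ∀ {z} -> Periodic z -> pair (Φ z) ≡ 0#
   pair-Φ {z} P = begin
    pair (Φ z) ≡⟨ trans (pair-+ (\ x -> q x1 x + q x2 x + q x3 x) (\ x -> - r x)) (cong2 _+ᴷ_ (trans (pair-+ (\ x -> q x1 x + q x2 x) (q x3)) (cong2 _+ᴷ_ (trans (pair-+ (q x1) (q x2)) (cong2 _+ᴷ_ (two x1) (two x2))) (two x3))) (trans (pair-neg r) (cong -ᴷ_ three))) ⟩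
    A1 *ᴷ (A1 *ᴷ pair z) +ᴷ A2 *ᴷ (A2 *ᴷ pair z) +ᴷ A3 *ᴷ (A3 *ᴷ pair z) +ᴷ -ᴷ (A2 *ᴷ (A1 *ᴷ (A3 *ᴷ pair z)))
     ≡⟨ solve 4 (\ a b c z -> a :* (a :* z) :+ b :* (b :* z) :+ c :* (c :* z) :+ :- (b :* (a :* (c :* z))) := ((a :* a :+ b :* b :+ c :* c) :- b :* (a :* c)) :* z) refl A1 A2 A3 (pair z) ⟩
    ((A1 *ᴷ A1 +ᴷ A2 *ᴷ A2 +ᴷ A3 *ᴷ A3) -ᴷ A2 *ᴷ (A1 *ᴷ A3)) *ᴷ pair z ≡⟨ cong (_*ᴷ pair z) (x≡y⇒x-y≡0 relation) ⟩
    0# *ᴷ pair z ≡⟨ zeroˡ _ ⟩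
    0# ∎
    where
    open ≡R
    q : Axis -> X -> ℤ
    q a = U a (U a z)
    r : X -> ℤ
    r = U x2 (U x1 (U x3 z))
    A1 = A x1
    A2 = A x2
    A3 = A x3
    two : ∀ a -> pair (U a (U a z)) ≡ A a *ᴷ (A a *ᴷ pair z)
    two a = trans (pair-U a (U-periodic a P)) (cong (A a *ᴷ_) (pair-U a P))
    three : pair (U x2 (U x1 (U x3 z))) ≡ A2 *ᴷ (A1 *ᴷ (A3 *ᴷ pair z))
    three = trans (pair-U x2 (U-periodic x1 (U-periodic x3 P))) (cong (A2 *ᴷ_) (trans (pair-U x1 (U-periodic x3 P)) (cong (A1 *ᴷ_) (pair-U x3 P))))
  -- A character of this kind sends Φ to 0, so of a relation Σ c_k Φᵏ z = 0 it sees only c_0. If c_0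
  -- = 0, one factor Φ must be removed; by `kernel` this is allowed after applying `U x1`, which
  -- multiplies the value of z at the character by the nonzero first coordinate.
  lowest : ∀ {m} (c : Fin m -> ℤ) z -> Periodic z -> (∀ x -> app c z x ≡ + 0) ->
   (∀ k -> c k ≡ + 0) ⊎ Σ (Fin m) \ k -> c k ≢ + 0 × ∀ (ψ : Character) -> let open Character ψ in castℤ (c k) *ᴷ pair z ≡ 0#
  lowest {zero} c z P e = inl \ ()
  lowest {suc m} c z P e = by (c zero ℤ.≟ + 0)
   where
   by : Dec (c zero ≡ + 0) -> _
   by (no c≢0) = inr (zero , c≢0 , \ ψ -> let open Character ψ in begin
    castℤ (c zero) *ᴷ pair z ≡⟨ trans (+-identityʳ _) (pair-scale (c zero) z) ⟨
    pair (\ x -> c zero * z x) +ᴷ 0# ≡⟨ cong (pair (\ x -> c zero * z x) +ᴷ_) (pair-Φ (app-periodic (c ∘ suc) P)) ⟨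
    pair (\ x -> c zero * z x) +ᴷ pair (Φ (app (c ∘ suc) z)) ≡⟨ pair-+ (\ x -> c zero * z x) (Φ (app (c ∘ suc) z)) ⟨
    pair (app c z) ≡⟨ SK.box-cong (\ x -> trans (cong (\ t -> castℤ t *ᴷ χ x) (e x)) (zeroˡ _)) ⟩
    SK.box (\ _ -> 0#) ≡⟨ SK.box-ε (\ _ -> refl) ⟩
    0# ∎)
    where open ≡R
   by (yes c≡0) = next (lowest (c ∘ suc) (U x1 z) (U-periodic x1 P) (\ x -> trans (app-U (c ∘ suc) z x) (kernel (app-periodic (c ∘ suc) P) Φ≡0 x)))
    where
    Φ≡0 : ∀ x -> Φ (app (c ∘ suc) z) x ≡ + 0
    Φ≡0 x = trans (sym (trans (cong (\ t -> t * z x + Φ (app (c ∘ suc) z) x) c≡0) (trans (cong (_+ Φ (app (c ∘ suc) z) x) (ℤ.*-zeroˡ (z x))) (ℤ.+-identityˡ _)))) (e x)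
    next : _ -> _
    next (inl zeros) = inl \ { zero -> c≡0 ; (suc k) -> zeros k }
    next (inr (k , ne , f)) = inr (suc k , ne , \ ψ -> let open Character ψ in
     *-cancelˡ A1≢0 (trans (solve 3 (\ a c p -> a :* (c :* p) := c :* (a :* p)) refl (A x1) (castℤ (c (suc k))) (pair z)) (trans (cong (castℤ (c (suc k)) *ᴷ_) (sym (pair-U x1 P))) (trans (f ψ) (sym (zeroʳ _))))))
  private
   ind : ℕ -> ℤ
   ind zero = + 1
   ind (suc _) = + 0
  δ : X -> ℤ
  δ (i , j , k) = ind (i % suc e1 N.+ (j % suc e2 N.+ k % suc e3))
  δ-repeats : ∀ a x -> δ (period a ⊕ x) ≡ δ x
  δ-repeats x1 (i , j , k) = cong (\ t -> ind (t N.+ (j % suc e2 N.+ k % suc e3))) (trans (cong (_% suc e1) (N.+-comm (suc e1) i)) ([m+n]%n≡m%n i (suc e1)))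
  δ-repeats x2 (i , j , k) = cong (\ t -> ind (i % suc e1 N.+ (t N.+ k % suc e3))) (trans (cong (_% suc e2) (N.+-comm (suc e2) j)) ([m+n]%n≡m%n j (suc e2)))
  δ-repeats x3 (i , j , k) = cong (\ t -> ind (i % suc e1 N.+ (j % suc e2 N.+ t))) (trans (cong (_% suc e3) (N.+-comm (suc e3) k)) ([m+n]%n≡m%n k (suc e3)))
  δ-periodic : Periodic δ
  δ-periodic = periodic δ-repeats
  pair-δ : ∀ (ψ : Character) -> let open Character ψ in pair δ ≡ 1#
  pair-δ ψ = trans (SK.box-origin (\ x -> castℤ (δ x) *ᴷ χ x)
    (\ i j k i< -> vanish (cong (N._+ (j % suc e2 N.+ k % suc e3)) (m<n⇒m%n≡m (s≤s i<))))
    (\ j k j< -> vanish (cong (N._+ k % suc e3) (m<n⇒m%n≡m (s≤s j<))))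
    (\ k k< -> vanish (m<n⇒m%n≡m (s≤s k<))))
   (solve 0 (lit 1 :* (lit 1 :* (lit 1 :* lit 1)) := lit 1) refl)
   where
   open Character ψ
   vanish : ∀ {n m c} -> n ≡ suc m -> castℤ (ind n) *ᴷ c ≡ 0#
   vanish {c = c} refl = zeroˡ c
  U-abs : ∀ a z {b} -> (∀ x -> ∣ z x ∣ ≤ b) -> ∀ x -> ∣ U a z x ∣ ≤ b N.+ b
  U-abs a z h x = ≤-trans (ℤ.∣i+j∣≤∣i∣+∣j∣ (z (unit a ⊕ x)) _) (+-mono-≤ (h _) (h _))
  -- 20 = 4 + 4 + 4 + 8: each `U` at most doubles the absolute values.
  Φ-abs : ∀ z {b} -> (∀ x -> ∣ z x ∣ ≤ b) -> ∀ x -> ∣ Φ z x ∣ ≤ 20 · b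
  Φ-abs z {b} h x = ≤-trans (ℤ.∣i-j∣≤∣i∣+∣j∣ (UU x1 + UU x2 + UU x3) _) (≤-trans (+-mono-≤ (≤-trans (ℤ.∣i+j∣≤∣i∣+∣j∣ (UU x1 + UU x2) (UU x3))
    (+-mono-≤ (≤-trans (ℤ.∣i+j∣≤∣i∣+∣j∣ (UU x1) (UU x2)) (+-mono-≤ (two x1) (two x2))) (two x3))) (U-abs x2 (U x1 (U x3 z)) (U-abs x1 (U x3 z) (U-abs x3 z h)) x)) (≤-eq (calc b)))
   where
   UU : Axis -> ℤ
   UU a = U a (U a z) x
   two : ∀ a -> ∣ UU a ∣ ≤ (b N.+ b) N.+ (b N.+ b)
   two a = U-abs a (U a z) (U-abs a z h) x
   calc : ∀ b -> (((b N.+ b) N.+ (b N.+ b)) N.+ ((b N.+ b) N.+ (b N.+ b))) N.+ ((b N.+ b) N.+ (b N.+ b)) N.+ (((b N.+ b) N.+ (b N.+ b)) N.+ ((b N.+ b) N.+ (b N.+ b))) ≡ 20 · b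
   calc = solve-∀
  -- The geometric sum is bounded together with an extra `H`, which makes the induction close.
  app-abs : ∀ {m} (c : Fin m -> ℤ) H -> (∀ k -> ∣ c k ∣ ≤ H) -> Σ ℕ \ b -> (∀ x -> ∣ app c δ x ∣ ≤ b) × b N.+ H ≤ H · 20 N.^ m
  app-abs {zero} c H h = 0 , (\ x -> z≤n) , ≤-eq (sym (N.*-identityʳ H))
  app-abs {suc m} c H h = let b , hb , le = app-abs (c ∘ suc) H (h ∘ suc) in H N.+ 20 · b ,
   (\ x -> ≤-trans (ℤ.∣i+j∣≤∣i∣+∣j∣ (c zero * δ x) _) (+-mono-≤ (≤-trans (≤-eq (ℤ.abs-* (c zero) (δ x))) (≤-trans (*-mono-≤ (h zero) (δ≤1 x)) (≤-eq (N.*-identityʳ H)))) (Φ-abs (app (c ∘ suc) δ) hb x))) ,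
   ≤-trans (m≤n+m _ (18 · H)) (≤-trans (≤-eq (calc b H)) (≤-trans (*-monoʳ-≤ 20 le) (≤-eq (calc' H (20 N.^ m)))))
   where
   ind≤1 : ∀ n -> ∣ ind n ∣ ≤ 1
   ind≤1 zero = s≤s z≤n
   ind≤1 (suc _) = z≤n
   δ≤1 : ∀ x -> ∣ δ x ∣ ≤ 1
   δ≤1 (i , j , k) = ind≤1 (i % suc e1 N.+ (j % suc e2 N.+ k % suc e3))
   calc : ∀ b H -> 18 · H N.+ (H N.+ 20 · b N.+ H) ≡ 20 · (b N.+ H)
   calc = solve-∀
   calc' : ∀ H t -> 20 · (H · t) ≡ H · (20 · t)
   calc' = solve-∀
  private
   -- An injection of ℤ into ℕ, so that tables of values can be counted by the pigeonhole principle.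
   code : ℤ -> ℕ
   code (+ n) = 2 · n
   code -[1+ n ] = suc (2 · n)
   code-injective : ∀ i j -> code i ≡ code j -> i ≡ j
   code-injective (+ m) (+ n) e = cong +_ (*-cancelˡ-≡ m n 2 e)
   code-injective (+ m) -[1+ n ] e = ⊥-elim (odd≢even n m (sym e))
   code-injective -[1+ m ] (+ n) e = ⊥-elim (odd≢even m n e)
   code-injective -[1+ m ] -[1+ n ] e = cong -[1+_] (*-cancelˡ-≡ m n 2 (suc-injective e))
   code-bound : ∀ i -> code i ≤ 2 · ∣ i ∣
   code-bound (+ n) = ≤-refl
   code-bound -[1+ n ] = ≤-trans (n≤1+n _) (≤-eq (calc n))
    where
    calc : ∀ n -> suc (suc (2 · n)) ≡ 2 · suc n
    calc = solve-∀
  -- Coefficients range over 0, ..., H - 1. The codes of all values of the combinations stay below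
  -- `Q`, and `fewer` provides more coefficient vectors than tables of values.
  module Siegel (m H Q : ℕ) (Q> : 2 · (H · 20 N.^ m) < Q) (fewer : ((Q N.^ suc e3) N.^ suc e2) N.^ suc e1 < H N.^ m) where
   private
    coefficients : Fin (H N.^ m) -> Fin m -> ℤ
    coefficients s k = + toℕ (finToFun {H} {m} s k)
    entry : ∀ s x -> code (app (coefficients s) δ x) < Q
    entry s x = let b , hb , le = app-abs (coefficients s) H (\ k -> <⇒≤ (Fin.toℕ<n (finToFun {H} {m} s k))) in
     ≤-<-trans (≤-trans (code-bound (app (coefficients s) δ x)) (*-monoʳ-≤ 2 (≤-trans (hb x) (≤-trans (m≤m+n b H) le)))) Q>
    row : ∀ s (i : Fin (suc e1)) (j : Fin (suc e2)) (k : Fin (suc e3)) -> Fin Q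
    row s i j k = fromℕ< (entry s (toℕ i , toℕ j , toℕ k))
    column : ∀ s (i : Fin (suc e1)) (j : Fin (suc e2)) -> Fin (Q N.^ suc e3)
    column s i j = funToFin (row s i j)
    plane : ∀ s (i : Fin (suc e1)) -> Fin ((Q N.^ suc e3) N.^ suc e2)
    plane s i = funToFin (column s i)
    values : Fin (H N.^ m) -> Fin (((Q N.^ suc e3) N.^ suc e2) N.^ suc e1)
    values s = funToFin (plane s)
    funToFin-injective : ∀ {m n} (f g : Fin m -> Fin n) -> funToFin f ≡ funToFin g -> ∀ i -> f i ≡ g i
    funToFin-injective f g e i = trans (sym (Fin.finToFun-funToFin f i)) (trans (cong (\ t -> finToFun t i) e) (Fin.finToFun-funToFin g i))
    funToFin-cong : ∀ {m n} {f g : Fin m -> Fin n} -> (∀ i -> f i ≡ g i) -> funToFin f ≡ funToFin g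
    funToFin-cong {zero} e = refl
    funToFin-cong {suc m} e = cong2 Fin.combine (e zero) (funToFin-cong (e ∘ suc))
   -- Siegel's lemma for the vectors Φᵏ δ.
   siegel : Σ ℕ \ g -> 0 < g × g < H × ∀ (ψ : Character) -> Character.cast ψ g ≡ Character.0# ψ
   siegel = conclude (Fin.pigeonhole fewer values)
    where
    conclude : (Σ _ \ s -> Σ _ \ t -> s Fin.< t × values s ≡ values t) -> _
    conclude (s , t , s<t , e) = finish (lowest c δ δ-periodic vanish)
     where
     c : Fin m -> ℤ
     c k = coefficients s k - coefficients t k
     vanish : ∀ x -> app c δ x ≡ + 0
     vanish = periodic-everywhere (app-periodic c δ-periodic) \ i j k i< j< k< -> trans (sym (app-sub (coefficients s) (coefficients t) δ (i , j , k))) (ℤ.i≡j⇒i-j≡0 (same i j k i< j< k<))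
      where
      same : ∀ i j k -> i < suc e1 -> j < suc e2 -> k < suc e3 -> app (coefficients s) δ (i , j , k) ≡ app (coefficients t) δ (i , j , k)
      same i j k i< j< k< = subst (\ x -> app (coefficients s) δ x ≡ app (coefficients t) δ x) (cong2 _,_ (Fin.toℕ-fromℕ< i<) (cong2 _,_ (Fin.toℕ-fromℕ< j<) (Fin.toℕ-fromℕ< k<)))
       (code-injective _ _ (Fin.fromℕ<-injective _ _ (entry s x) (entry t x) (funToFin-injective (row s I J) (row t I J) (funToFin-injective (column s I) (column t I) (funToFin-injective (plane s) (plane t) e I) J) (fromℕ< k<))))
       where
       I = fromℕ< i<
       J = fromℕ< j<
       x = toℕ (fromℕ< i<) , toℕ (fromℕ< j<) , toℕ (fromℕ< k<)
     finish : _ -> _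
     finish (inl zeros) = ⊥-elim (Fin.<⇒≢ s<t (trans (sym (Fin.funToFin-finToFin {m} s)) (trans (funToFin-cong (\ k -> Fin.toℕ-injective (ℤ.+-injective (ℤ.i-j≡0⇒i≡j _ _ (zeros k))))) (Fin.funToFin-finToFin {m} t))))
     finish (inr (k , ne , f)) = ∣ c k ∣ , n≢0⇒n>0 (\ z -> ne (ℤ.∣i∣≡0⇒i≡0 z)) , bounded (finToFun {H} {m} s k) (finToFun {H} {m} t k) ,
      \ ψ -> let open Character ψ in abs (c k) ψ (trans (sym (*-identityʳ _)) (trans (cong (castℤ (c k) *ᴷ_) (sym (pair-δ ψ))) (f ψ)))
      where
      bounded : ∀ (a b : Fin H) -> ∣ + toℕ a - + toℕ b ∣ < H
      bounded a b = subst (\ t -> ∣ t ∣ < H) (sym (ℤ.m-n≡m⊖n (toℕ a) (toℕ b))) (≤-<-trans (ℤ.∣m⊝n∣≤m⊔n (toℕ a) (toℕ b)) (⊔-lub (Fin.toℕ<n a) (Fin.toℕ<n b)))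
      abs : ∀ i (ψ : Character) -> let open Character ψ in castℤ i ≡ 0# -> cast ∣ i ∣ ≡ 0#
      abs (+ n) ψ e = trans (Character.cast≈num ψ n) e
      abs -[1+ n ] ψ e = let open Character ψ in trans (cast≈num (suc n)) (trans (sym (-‿involutive _)) (trans (cong -ᴷ_ e) (solve 0 (:- lit 0 := lit 0) refl)))
  volume : ℕ
  volume = suc e3 · suc e2 · suc e1
  -- With m twice the volume v the pigeonhole condition is Q ^ v < H ^ (2 v), that is Q < H². For H
  -- = 4 · 20 ^ m and Q = 2 H · 20 ^ m + 1 this reads 8 · 400 ^ m + 1 < 16 · 400 ^ m.
  opening : Σ ℕ \ g -> 0 < g × g < 4 · 20 N.^ (2 · volume) × ∀ (ψ : Character) -> Character.cast ψ g ≡ Character.0# ψ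
  opening = at volume refl
   where
   fewer : ∀ v -> 0 < v -> let H = 4 · 20 N.^ (2 · v) in suc (2 · (H · 20 N.^ (2 · v))) N.^ v < H N.^ (2 · v)
   fewer v 0<v = subst (suc (2 · (H · P)) N.^ v <_) (^-*-assoc H 2 v) (^-monoˡ-< v {{N.>-nonZero 0<v}} Q<H²)
    where
    P = 20 N.^ (2 · v)
    H = 4 · P
    calc : ∀ P -> suc (2 · (4 · P · P)) N.+ (8 · (P · P)) ≡ suc (4 · P · (4 · P · 1))
    calc = solve-∀
    less : ∀ P -> 0 < P -> suc (2 · (4 · P · P)) < (4 · P) N.^ 2
    less P 0<P = ≤-pred (≤-trans (≤-eq (N.+-comm 2 _)) (≤-trans (+-monoʳ-≤ (suc (2 · (4 · P · P))) (≤-trans (m≤m+n 2 6) (*-monoʳ-≤ 8 (*-mono-≤ 0<P 0<P)))) (≤-eq (calc P))))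
    Q<H² : suc (2 · (H · P)) < H N.^ 2
    Q<H² = less P (m^n>0 20 (2 · v))
   at : ∀ v -> volume ≡ v -> Σ ℕ \ g -> 0 < g × g < 4 · 20 N.^ (2 · v) × ∀ (ψ : Character) -> Character.cast ψ g ≡ Character.0# ψ
   at v e = Siegel.siegel (2 · v) (4 · 20 N.^ (2 · v)) (suc (2 · (4 · 20 N.^ (2 · v) · 20 N.^ (2 · v)))) ≤-refl
     (subst (_< (4 · 20 N.^ (2 · v)) N.^ (2 · v)) (sym (power (suc (2 · (4 · 20 N.^ (2 · v) · 20 N.^ (2 · v)))))) (fewer v (subst (0 <_) e (s≤s z≤n))))
    where
    power : ∀ Q -> ((Q N.^ suc e3) N.^ suc e2) N.^ suc e1 ≡ Q N.^ v
    power Q = trans (cong (N._^ suc e1) (^-*-assoc Q (suc e3) (suc e2))) (trans (^-*-assoc Q (suc e3 · suc e2) (suc e1)) (cong (Q N.^_) e))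

-- The parameters, and the argument for a single prime.

module Final (S : Setting) where
 open import Data.Nat.Divisibility using (_∣_)
 open import Data.List using (_++_)
 open import Data.List.Membership.Propositional.Properties using (∈-++⁺ˡ; ∈-++⁺ʳ)

 open NT
 open Opening using (x1; x2; x3; module Box)
 open Tori S
 open K
 open Conic S
 open EndCount S using (1≤p; size≤2p)
 open Orbit S
 open Climb S using (ord; ord-order; large-order⇒disc≢0; module Divisors)
 open EndStep S using (0<size; size-half)
 open Primitive S
 open Expander S

 -- `L` is the integral C-th root of p. The last two hypotheses make it exceed the constants of the
 -- bounds for divisors and prime divisors, so that these numbers are at most `L` and 2 to the
 -- number of primes is at most `L`.
 module PerPrime (C L : ℕ) (57≤C : 57 ≤ C) (L^C≤p : L N.^ C ≤ p) (p<L'^C : p < suc L N.^ C)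
  (40≤L : 40 ≤ L) (kD≤L : divisor-constant C · 2 ≤ L) (kP≤L : prime-constant C · 2 ≤ L) where
  private
   C2 = C N.+ C
   1≤C : 1 ≤ C
   1≤C = ≤-trans (s≤s z≤n) 57≤C
   instance
    C2≢0 : N.NonZero C2
    C2≢0 = N.>-nonZero (≤-trans 1≤C (m≤m+n C C))
   open Powers L (≤-trans (s≤s z≤n) 40≤L)
   upto : ∀ k {d} -> k N.+ d ≡ 40 -> k ≤ L
   upto k {d} e = ≤-trans (≤-trans (m≤m+n k d) (≤-eq e)) 40≤L
   bounded : ∀ t -> DivisorBound.Bounded C2 (divisor-constant C) (size t)
   bounded t = DivisorBound.divisors C2 (size t) (0<size t)
   ds : Type -> List ℕ
   ds t = DivisorList.list (fst (bounded t))
   ds≤L : ∀ t -> length (ds t) ≤ L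
   ds≤L t = below-root C L p (divisor-constant C) (size t) (length (ds t)) kD≤L 1≤C p<L'^C (size≤2p t) (snd (bounded t))
   Ds : List ℕ
   Ds = ds split ++ ds inert
   Ds-complete : ∀ d -> d ∣ size split ⊎ d ∣ size inert -> d ∈ Ds
   Ds-complete d = [ (\ h -> ∈-++⁺ˡ (DivisorList.complete (fst (bounded split)) d h)) , (\ h -> ∈-++⁺ʳ (ds split) (DivisorList.complete (fst (bounded inert)) d h)) ]′
   -- Λ = L² exceeds 18 |Ds| ≤ 36 L; E = L⁵ exceeds 26 Λ², the loss after climbing; J = L⁸ exceeds
   -- 32 E L², where L² bounds the error factor of the sieve.
   Λ E J : ℕ
   Λ = pw 2
   E = pw 5
   J = pw 8
   Λ> : 18 · length Ds < Λ
   Λ> = begin-strict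
    18 · length Ds ≤⟨ *-monoʳ-≤ 18 (≤-trans (≤-eq (List.length-++ (ds split))) (+-mono-≤ (ds≤L split) (ds≤L inert))) ⟩
    18 · (L N.+ L) ≡⟨ calc L ⟩
    36 · L <⟨ *-monoˡ-< L {{N.>-nonZero (upto 1 refl)}} (<-≤-trans (m≤m+n 37 3) 40≤L) ⟩
    L · L ≡⟨ trans (cong2 _·_ (sym pw-1) (sym pw-1)) (pw-+ 1 1) ⟩
    Λ ∎
    where
    open ≤R
    calc : ∀ L -> 18 · (L N.+ L) ≡ 36 · L
    calc = solve-∀
   6Λ⁴≤ : 6 · (Λ · Λ · (Λ · Λ)) ≤ pw 9
   6Λ⁴≤ = ≤-trans (≤-eq (cong (6 ·_) (trans (cong2 _·_ (pw-+ 2 2) (pw-+ 2 2)) (pw-+ 4 4)))) (absorb (upto 6 refl) 8)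
   4<pw9 : 4 < pw 9
   4<pw9 = ≤-trans (upto 5 refl) (≤-trans (≤-eq (sym pw-1)) (pw-mono (s≤s z≤n)))
   pw57≤p : pw 57 ≤ p
   pw57≤p = ≤-trans (pw-mono 57≤C) (≤-trans (≤-eq (pw≡ C)) L^C≤p)
   2≤E : 2 ≤ E
   2≤E = ≤-trans (upto 2 refl) (≤-trans (≤-eq (sym pw-1)) (pw-mono (s≤s z≤n)))
   J≥ : ∀ t -> 32 · E · (2 N.^ length (prime-divisors (half t)) · 2 N.^ length (prime-divisors (half t))) ≤ J
   J≥ t = begin
    32 · E · (2 N.^ k · 2 N.^ k) ≤⟨ *-monoʳ-≤ (32 · E) (*-mono-≤ 2^k≤L 2^k≤L) ⟩
    32 · E · (L · L) ≡⟨ cong2 _·_ (refl {x = 32 · E}) (trans (cong2 _·_ (sym pw-1) (sym pw-1)) (pw-+ 1 1)) ⟩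
    32 · E · pw 2 ≡⟨ trans (N.*-assoc 32 E (pw 2)) (cong (32 ·_) (pw-+ 5 2)) ⟩
    32 · pw 7 ≤⟨ absorb (upto 32 refl) 7 ⟩
    J ∎
    where
    open ≤R
    m = half t
    qs = prime-divisors m
    k = length qs
    2^k≤L : 2 N.^ k ≤ L
    2^k≤L = below-root C L p (prime-constant C) m (2 N.^ k) kP≤L 1≤C p<L'^C
     (≤-trans (m≤n*m m 2) (≤-trans (≤-eq (sym (snd (size-half t)))) (size≤2p t)))
     (subst (_≤ prime-constant C · m) (sym (trans (^-*-assoc 2 k C2) (cong (2 N.^_) (N.*-comm k C2)))) (few-primes C2 m qs (0<half t) (prime-divisors-unique m) (prime-divisors-sound m)))
   large : 26 · (E · E · E · (J · J · (J · J) · J)) < p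
   large = begin-strict
    26 · (E · E · E · (J · J · (J · J) · J)) ≡⟨ cong (26 ·_) (trans (cong2 _·_ (trans (cong (_· E) (pw-+ 5 5)) (pw-+ 10 5))
      (trans (cong (_· J) (trans (cong2 _·_ (pw-+ 8 8) (pw-+ 8 8)) (pw-+ 16 16))) (pw-+ 32 8))) (pw-+ 15 40)) ⟩
    26 · pw 55 <⟨ *-monoˡ-< (pw 55) {{N.>-nonZero (pw>0 55)}} (m≤m+n 27 13) ⟩
    40 · pw 55 ≤⟨ absorb 40≤L 55 ⟩
    pw 56 ≤⟨ pw-mono (m≤m+n 56 1) ⟩
    pw 57 ≤⟨ pw57≤p ⟩
    p ∎
    where open ≤R
  M : ℕ
  M = L N.^ 9
  module _ {_~_ : Point -> Point -> Set} (moves : Moves _~_) where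
   open Moves moves
   open Connected moves
   Reaches : Point -> Set
   Reaches P = Σ F.Carrier \ a -> Hits P a × pw 9 ≤ ord a
   private
    many-primitives : ∀ P -> Reaches P -> Σ (List F.Carrier) \ U -> Unique U × p ≤ J · length U × All (IsPrimitive moves P) U
    many-primitives P (a , h , le) = Primitives.primitives moves P E J 2≤E J≥ large hb (large-order⇒disc≢0 2<ord) 2p≤
     where
     climbed = Divisors.Climbing.climb Ds Ds-complete moves Λ Λ> h (<-≤-trans 4<pw9 le) (≤-trans 6Λ⁴≤ le)
     b = fst climbed
     hb = fst (snd climbed)
     p≤ : p ≤ 13 · (Λ · Λ) · ord b
     p≤ = snd (snd climbed)
     2p≤ : 2 · p ≤ E · ord b
     2p≤ = begin
      2 · p ≤⟨ *-monoʳ-≤ 2 p≤ ⟩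
      2 · (13 · (Λ · Λ) · ord b) ≡⟨ calc (Λ · Λ) (ord b) ⟩
      26 · (Λ · Λ) · ord b ≡⟨ cong (\ t -> 26 · t · ord b) (pw-+ 2 2) ⟩
      26 · pw 4 · ord b ≤⟨ *-monoˡ-≤ (ord b) (absorb (upto 26 refl) 4) ⟩
      E · ord b ∎
      where
      open ≤R
      calc : ∀ x o -> 2 · (13 · x · o) ≡ 26 · x · o
      calc = solve-∀
     2<ord : 2 < ord b
     2<ord = ≰⇒> \ small -> <⇒≱ {E} {p} (<-≤-trans E<pw57 pw57≤p) (*-cancelˡ-≤ 2 (≤-trans 2p≤ (≤-trans (*-monoʳ-≤ E small) (≤-eq (N.*-comm E 2)))))
      where
      E<pw57 : E < pw 57
      E<pw57 = <-≤-trans (<-≤-trans (≤-<-trans (≤-eq (sym (N.*-identityˡ E))) (*-monoˡ-< E {{N.>-nonZero (pw>0 5)}} {1} {2} (s≤s (s≤s z≤n)))) (absorb (upto 2 refl) 5)) (pw-mono (m≤m+n 6 51))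
   -- The orbit of P contains the whole conic of any u in U, the orbit of Q that of any v in V. A
   -- point (u, v, w) of the surface lies on both; it exists because 12 J² < p.
   connected : ∀ P Q -> Reaches P -> Reaches Q -> P ~ Q
   connected P Q hP hQ = join (edge U V (fst (snd mU)) (fst (snd mV)) (\ u∈ -> IsPrimitive.regular (All.lookup allU u∈)) dense)
    where
    mU = many-primitives P hP
    mV = many-primitives Q hQ
    U = fst mU
    V = fst mV
    allU = snd (snd (snd mU))
    allV = snd (snd (snd mV))
    u = length U
    v = length V
    dense : 12 · p < u · v
    dense = ≰⇒> \ le -> <⇒≱ 12J²<p (*-cancelʳ-≤ p (12 · (J · J)) p {{N.>-nonZero 1≤p}} (begin
     p · p ≤⟨ *-mono-≤ (fst (snd (snd mU))) (fst (snd (snd mV))) ⟩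
     J · u · (J · v) ≡⟨ calc J u v ⟩
     J · J · (u · v) ≤⟨ *-monoʳ-≤ (J · J) le ⟩
     J · J · (12 · p) ≡⟨ calc' (J · J) p ⟩
     12 · (J · J) · p ∎))
     where
     open ≤R
     calc : ∀ J u v -> J · u · (J · v) ≡ J · J · (u · v)
     calc = solve-∀
     calc' : ∀ x p -> x · (12 · p) ≡ 12 · x · p
     calc' = solve-∀
     12J²<p : 12 · (J · J) < p
     12J²<p = begin-strict
      12 · (J · J) ≡⟨ cong (12 ·_) (pw-+ 8 8) ⟩
      12 · pw 16 <⟨ *-monoˡ-< (pw 16) {{N.>-nonZero (pw>0 16)}} (m≤m+n 13 27) ⟩
      40 · pw 16 ≤⟨ absorb 40≤L 16 ⟩
      pw 17 ≤⟨ pw-mono (m≤m+n 17 40) ⟩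
      pw 57 ≤⟨ pw57≤p ⟩
      p ∎
    join : (Σ F.Carrier \ u -> Σ F.Carrier \ v -> Σ F.Carrier \ w -> u ∈ U × v ∈ V × OnSurface u v w) -> P ~ Q
    join (u , v , w , u∈ , v∈ , on) =
      ~-trans (snd (snd (snd (hits pu)))) (~-trans (transitive (fst (snd (snd (hits pu)))) on (nonzero pu) (regular pu) (type pu) (inside pu) (generates pu))
       (~-trans (swap₁₂ u v w) (~-trans (transitive (OnSurface-swap₁₂ on) (fst (snd (snd (hits pv)))) (nonzero pv) (regular pv) (type pv) (inside pv) (generates pv)) (~-sym (snd (snd (snd (hits pv))))))))
     where
     open IsPrimitive
     pu = All.lookup allU u∈
     pv = All.lookup allV v∈
   OnSurface-swap₂₃ : ∀ {a b c} -> OnSurface a b c -> OnSurface a c b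
   OnSurface-swap₂₃ {a} {b} {c} e = trans (F.solve 3 (\ a b c -> a F.:* a F.:+ c F.:* c F.:+ b F.:* b F.:= a F.:* a F.:+ b F.:* b F.:+ c F.:* c) refl a b c)
    (trans e (F.solve 3 (\ a b c -> a F.:* b F.:* c F.:= a F.:* c F.:* b) refl a b c))
   -- If all three coordinates have small order, they give a character of a small group at which the Markoff polynomial vanishes.
   module _ (excluded : ∀ e1 e2 e3 -> e1 < M -> e2 < M -> e3 < M -> ¬ (p ∣ fst (Box.opening e1 e2 e3))) where
    private
     reaches1 : ∀ a b c -> OnSurface a b c -> a ≢ F.0# -> Reaches (a , b , c)
     reaches1 a b c on a≢0 = by (pw 9 N.≤? ord a) (pw 9 N.≤? ord b) (pw 9 N.≤? ord c)
      where
      pred : ∀ b -> Σ ℕ \ e -> ord b ≡ suc e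
      pred b = go (ord b) (positive (ord-order b))
       where
       go : ∀ n -> 0 < n -> Σ ℕ \ e -> n ≡ suc e
       go (suc e) _ = e , refl
      power : ∀ b -> Y b ^ suc (fst (pred b)) ≡ 1#
      power b = subst (\ n -> Y b ^ n ≡ 1#) (snd (pred b)) (kills (ord-order b))
      small : ∀ b -> ¬ (pw 9 ≤ ord b) -> fst (pred b) < M
      small b nb = <-trans (≤-eq (sym (snd (pred b)))) (subst (ord b <_) (pw≡ 9) (≰⇒> nb))
      open Box (fst (pred a)) (fst (pred b)) (fst (pred c)) using (Character; opening)
      coordinate : Opening.Axis -> F.Carrier
      coordinate x1 = a
      coordinate x2 = b
      coordinate x3 = c
      relation : ∀ {x y z} -> x ≡ ι a -> y ≡ ι b -> z ≡ ι c -> x * x + y * y + z * z ≡ y * (x * z)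
      relation refl refl refl = begin
       ι a * ι a + ι b * ι b + ι c * ι c ≡⟨ cong2 _+_ (trans (cong2 _+_ (sym (ι-* a a)) (sym (ι-* b b))) (sym (ι-+ _ _))) (sym (ι-* c c)) ⟩
       ι (a F.* a F.+ b F.* b) + ι (c F.* c) ≡⟨ ι-+ _ _ ⟨
       ι (a F.* a F.+ b F.* b F.+ c F.* c) ≡⟨ cong ι on ⟩
       ι (a F.* b F.* c) ≡⟨ trans (ι-* _ _) (cong (_* ι c) (ι-* a b)) ⟩
       ι a * ι b * ι c ≡⟨ solve 3 (\ a b c -> a :* b :* c := b :* (a :* c)) refl (ι a) (ι b) (ι c) ⟩
       ι b * (ι a * ι c) ∎
       where open ≡R
      character : Character
      character = record
       { K = Setting.K S ; y = \ i -> Y (coordinate i) ; y' = \ i -> Y' (coordinate i) ; yy' = \ i -> YY' (coordinate i)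
       ; y1^ = power a ; y2^ = power b ; y3^ = power c
       ; A1≢0 = \ z -> a≢0 (ι-injective (trans (sym (Y+Y' a)) (trans z (sym ι-0)))) ; relation = relation (Y+Y' a) (Y+Y' b) (Y+Y' c) }
      by : Dec (pw 9 ≤ ord a) -> Dec (pw 9 ≤ ord b) -> Dec (pw 9 ≤ ord c) -> Reaches (a , b , c)
      by (yes la) _ _ = a , (b , c , on , ~-refl) , la
      by (no _) (yes lb) _ = b , (a , c , OnSurface-swap₁₂ on , swap₁₂ a b c) , lb
      by (no _) (no _) (yes lc) = c , (a , b , OnSurface-swap₁₂ (OnSurface-swap₂₃ on) , ~-trans (swap₂₃ a b c) (swap₁₂ a c b)) , lc
      by (no na) (no nb) (no nc) = ⊥-elim (excluded _ _ _ (small a na) (small b nb) (small c nc)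
       (char-F (fst opening) (ι-injective (trans (sym (cast-ι (fst opening))) (trans (snd (snd (snd opening)) character) (sym ι-0))))))
     move : ∀ {P Q} -> P ~ Q -> Reaches Q -> Reaches P
     move r (a , (b , c , on , h) , le) = a , (b , c , on , ~-trans r h) , le
    -- A nonzero coordinate is moved to the front, because a `Character` needs its first value to be
    -- nonzero.
    reaches : ∀ a b c -> OnSurface a b c -> ¬ (a ≡ F.0# × b ≡ F.0# × c ≡ F.0#) -> Reaches (a , b , c)
    reaches a b c on nz = by (a F.≟ F.0#) (b F.≟ F.0#) (c F.≟ F.0#)
     where
     by : Dec (a ≡ F.0#) -> Dec (b ≡ F.0#) -> Dec (c ≡ F.0#) -> Reaches (a , b , c)
     by (no a≢0) _ _ = reaches1 a b c on a≢0
     by (yes _) (no b≢0) _ = move (swap₁₂ a b c) (reaches1 b a c (OnSurface-swap₁₂ on) b≢0)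
     by (yes _) (yes _) (no c≢0) = move (~-trans (swap₂₃ a b c) (swap₁₂ a c b)) (reaches1 c a b (OnSurface-swap₁₂ (OnSurface-swap₂₃ on)) c≢0)
     by (yes za) (yes zb) (yes zc) = ⊥-elim (nz (za , zb , zc))
    single-orbit : ∀ a b c a' b' c' -> OnSurface a b c -> OnSurface a' b' c' -> ¬ (a ≡ F.0# × b ≡ F.0# × c ≡ F.0#) -> ¬ (a' ≡ F.0# × b' ≡ F.0# × c' ≡ F.0#) -> (a , b , c) ~ (a' , b' , c')
    single-orbit a b c a' b' c' on on' nz nz' = connected _ _ (reaches a b c on nz) (reaches a' b' c' on' nz')

-- Transfer to the unscaled surface over the residues modulo p.

module Concrete where
 open import Data.Nat.Divisibility using (∣⇒≤)
 open import Data.Nat.Primality using (Prime)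
 open import Data.Fin using (toℕ)
 open import Data.List using (allFin)
 open import Data.List.Membership.Propositional.Properties using (∈-allFin)
 open import Relation.Binary.Construct.Closure.ReflexiveTransitive using (ε; _◅_; _◅◅_; reverse)
 open import Relation.Binary.Construct.Closure.Symmetric using (fwd; symmetric)
 open import Defs using (Step; SameOrbit; SingleOrbit; OnMarkoff; InXstar; vieta; R₃; swap₁₂; swap₂₃)

 open Fp

 module Markoff (p : ℕ) (p-prime : Prime p) (3<p : 3 < p) where
  private
   2<p : 2 < p
   2<p = <-trans (s≤s (s≤s (s≤s z≤n))) 3<p
  open PrimeField p p-prime
  open Odd 2<p using (nonsquare; x≡-x⇒x≡0; square-class)
  private
   module F = FieldProps 𝔽
   d = fst nonsquare
   module Q = Quad 𝔽 d (snd nonsquare)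
   module K = FieldProps Q.𝕂
   sqrt' : ∀ t -> (Σ F.Carrier \ w -> t ≡ w F.* w ⊎ t ≡ d F.* (w F.* w)) -> Σ K.Carrier \ r -> r K.* r ≡ Q.ι t × (Q.σ r ≡ r ⊎ Q.σ r ≡ K.- r)
   sqrt' t (w , inl e) = Q.ι w , trans (sym (Q.ι-* w w)) (cong Q.ι (sym e)) , inl (Q.σ-ι w)
   sqrt' t (w , inr e) = Q.√d K.* Q.ι w , square , inr (trans (Q.σ-* Q.√d (Q.ι w)) (trans (cong2 K._*_ Q.σ-√d (Q.σ-ι w)) (K.solve 2 (\ a b -> (K.:- a) K.:* b K.:= K.:- (a K.:* b)) refl Q.√d (Q.ι w))))
    where
    open ≡R
    square : (Q.√d K.* Q.ι w) K.* (Q.√d K.* Q.ι w) ≡ Q.ι t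
    square = begin
     (Q.√d K.* Q.ι w) K.* (Q.√d K.* Q.ι w) ≡⟨ K.solve 2 (\ a b -> (a K.:* b) K.:* (a K.:* b) K.:= (a K.:* a) K.:* (b K.:* b)) refl Q.√d (Q.ι w) ⟩
     (Q.√d K.* Q.√d) K.* (Q.ι w K.* Q.ι w) ≡⟨ cong2 K._*_ Q.√d² (sym (Q.ι-* w w)) ⟩
     Q.ι d K.* Q.ι (w F.* w) ≡⟨ Q.ι-* d (w F.* w) ⟨
     Q.ι (d F.* (w F.* w)) ≡⟨ cong Q.ι (sym e) ⟩
     Q.ι t ∎
  setting : Setting
  setting = record
   { p = p ; p-prime = p-prime ; 2<p = 2<p ; F = 𝔽 ; K = Q.𝕂
   ; elements = allFin p ; elements-unique = Unique.allFin⁺ p ; elements-complete = ∈-allFin ; elements-length = List.length-tabulate (\ x -> x)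
   ; char-F = cast≡0⇒∣ ; cast-onto = \ a -> toℕ a , cast-toℕ a ; cast-p = cast-p
   ; ι = Q.ι ; ι-injective = Q.ι-injective ; ι-+ = Q.ι-+ ; ι-* = Q.ι-* ; ι-neg = Q.ι-neg ; ι-0 = refl ; ι-1 = refl
   ; σ = Q.σ ; σ-+ = Q.σ-+ ; σ-* = Q.σ-* ; σ-neg = Q.σ-neg ; σ-ι = Q.σ-ι ; σ-fixed = \ x e -> fst x , Q.σ-fixed x≡-x⇒x≡0 x e
   ; √d = Q.√d ; √d≢0 = \ e -> F.1≢0 (cong snd e) ; σ-√d = Q.σ-√d
   ; sqrt = \ t -> fst (sqrt' t (square-class d (snd nonsquare) t))
   ; sqrt² = \ t -> fst (snd (sqrt' t (square-class d (snd nonsquare) t)))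
   ; sqrt-σ = \ t -> snd (snd (sqrt' t (square-class d (snd nonsquare) t))) }
  open F using (_⁻¹)
  private
   T i : F.Carrier
   T = F.num 3
   i = T ⁻¹
   Ti : T F.* i ≡ F.1#
   Ti = F.*-inverseʳ \ e -> <⇒≱ 3<p (∣⇒≤ (cast≡0⇒∣ 3 (trans (F.cast≈num 3) e)))
   π3 : π 3 ≡ T
   π3 = trans (sym (cast≡π 3)) (F.cast≈num 3)
   π-toℕ³ : ∀ a b -> π (3 · toℕ a · toℕ b) ≡ T F.* a F.* b
   π-toℕ³ a b = trans (π-* (3 · toℕ a) (toℕ b)) (cong2 F._*_ (trans (π-* 3 (toℕ a)) (cong2 F._*_ π3 (π-toℕ a))) (π-toℕ b))
   vieta-eq : ∀ a b c -> vieta p a b c ≡ T F.* a F.* b F.- c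
   vieta-eq a b c = trans (π-+ (3 · toℕ a · toℕ b) (p ∸ toℕ c)) (cong (F._+ (F.- c)) (π-toℕ³ a b))
   Point = Orbit.Point setting
   scale third : Point -> Point
   scale (a , b , c) = T F.* a , T F.* b , T F.* c
   third (a , b , c) = a F.* i , b F.* i , c F.* i
   third-scale : ∀ x -> third (scale x) ≡ x
   third-scale (a , b , c) = cong2 _,_ (cancel a) (cong2 _,_ (cancel b) (cancel c))
    where
    cancel : ∀ a -> T F.* a F.* i ≡ a
    cancel a = trans (F.solve 3 (\ t a i -> t F.:* a F.:* i F.:= t F.:* i F.:* a) refl T a i) (trans (cong (F._* a) Ti) (F.*-identityˡ a))
   -- The orbit relation of the original surface, transported along division by 3, which is possible
   -- for p > 3.
   _~_ : Point -> Point -> Set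
   P ~ Q = SameOrbit p (third P) (third Q)
   moves : Orbit.Moves setting _~_
   moves = record
    { ~-refl = ε ; ~-sym = reverse (symmetric (Step p)) ; ~-trans = _◅◅_
    ; swap₁₂ = \ a b c -> fwd (swap₁₂ _ _ _) ◅ ε ; swap₂₃ = \ a b c -> fwd (swap₂₃ _ _ _) ◅ ε
    ; vieta3 = \ a b c -> subst (\ t -> SameOrbit p (third (a , b , c)) (a F.* i , b F.* i , t)) (equation a b c) (fwd (R₃ _ _ _) ◅ ε) }
    where
    equation : ∀ a b c -> vieta p (a F.* i) (b F.* i) (c F.* i) ≡ (a F.* b F.- c) F.* i
    equation a b c = begin
     vieta p (a F.* i) (b F.* i) (c F.* i) ≡⟨ vieta-eq (a F.* i) (b F.* i) (c F.* i) ⟩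
     T F.* (a F.* i) F.* (b F.* i) F.- c F.* i ≡⟨ F.solve 5 (\ t a b c i -> t F.:* (a F.:* i) F.:* (b F.:* i) F.:- c F.:* i F.:= t F.:* i F.:* (a F.:* b F.:* i) F.:- c F.:* i) refl T a b c i ⟩
     T F.* i F.* (a F.* b F.* i) F.- c F.* i ≡⟨ cong (\ t -> t F.* (a F.* b F.* i) F.- c F.* i) Ti ⟩
     F.1# F.* (a F.* b F.* i) F.- c F.* i ≡⟨ F.solve 4 (\ a b c i -> F.lit 1 F.:* (a F.:* b F.:* i) F.:- c F.:* i F.:= (a F.:* b F.:- c) F.:* i) refl a b c i ⟩
     (a F.* b F.- c) F.* i ∎
     where open ≡R
   on-surface : ∀ {a b c} -> OnMarkoff p (a , b , c) -> Orbit.OnSurface setting (T F.* a) (T F.* b) (T F.* c)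
   on-surface {a} {b} {c} on = F.x-y≡0⇒x≡y (trans
    (F.solve 4 (\ t a b c -> t F.:* a F.:* (t F.:* a) F.:+ t F.:* b F.:* (t F.:* b) F.:+ t F.:* c F.:* (t F.:* c) F.:- t F.:* a F.:* (t F.:* b) F.:* (t F.:* c)
     F.:= t F.:* t F.:* ((a F.:* a F.:+ b F.:* b F.:+ c F.:* c) F.:- t F.:* a F.:* b F.:* c)) refl T a b c)
    (trans (cong (T F.* T F.*_) (F.x≡y⇒x-y≡0 equation)) (F.zeroʳ (T F.* T))))
    where
    equation : a F.* a F.+ b F.* b F.+ c F.* c ≡ T F.* a F.* b F.* c
    equation = trans (sym (trans (π-+ _ (toℕ c · toℕ c)) (cong (F._+ c F.* c) (π-+ _ _)))) (trans on (trans (π-* (3 · toℕ a · toℕ b) (toℕ c)) (cong2 F._*_ (π-toℕ³ a b) (π-toℕ c))))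
   nonzero : ∀ {a b c} -> InXstar p (a , b , c) -> ¬ (T F.* a ≡ F.0# × T F.* b ≡ F.0# × T F.* c ≡ F.0#)
   nonzero {a} {b} {c} (_ , nz) (za , zb , zc) = nz (cong2 _,_ (zero-of {a} za) (cong2 _,_ (zero-of {b} zb) (zero-of {c} zc)))
    where
    zero-of : ∀ {a} -> T F.* a ≡ F.0# -> a ≡ F.0#
    zero-of {a} e = [ (\ z -> ⊥-elim (F.1≢0 (trans (sym Ti) (trans (cong (F._* i) z) (F.zeroˡ i))))) , (\ z -> z) ]′ (F.no-zero-divisors {T} {a} e)
  single-orbit : (∀ {_~_} -> Orbit.Moves setting _~_ -> ∀ a b c a' b' c' -> Orbit.OnSurface setting a b c -> Orbit.OnSurface setting a' b' c' ->
    ¬ (a ≡ F.0# × b ≡ F.0# × c ≡ F.0#) -> ¬ (a' ≡ F.0# × b' ≡ F.0# × c' ≡ F.0#) -> (a , b , c) ~ (a' , b' , c')) -> SingleOrbit p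
  single-orbit h x@(a , b , c) y@(a' , b' , c') X Y = subst₂ (SameOrbit p) (third-scale x) (third-scale y)
   (h moves _ _ _ _ _ _ (on-surface {a} {b} {c} (fst X)) (on-surface {a'} {b'} {c'} (fst Y)) (nonzero X) (nonzero Y))

-- Counting the exceptional primes.

open import Defs
open import Data.Nat using (_^_; _+_; _*_)
open import Data.Nat.Properties
open import Data.Nat.Divisibility using (_∣_; _∣?_; ∣⇒≤; ∣-trans)
open import Data.Nat.Primality using (Prime; prime⇒nonTrivial)
open import Data.Nat.ListAction using (product)
open import Data.Nat.ListAction.Properties using (∈⇒∣product)
open import Data.List using (upTo; cartesianProduct)
open import Data.List.Membership.Propositional.Properties using (∈-map⁺; ∈-upTo⁺; ∈-upTo⁻; ∈-cartesianProduct⁺; ∈-cartesianProduct⁻)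

open Count
open NT
open Opening using (module Box)
open Concrete

root : ∀ C n -> 0 < C -> Σ ℕ \ L -> L ^ C ≤ n × n < suc L ^ C
root (suc C) zero _ = 0 , z≤n , m^n>0 1 (suc C)
root C (suc n) 0<C = by (root C n 0<C)
 where
 by : (Σ ℕ \ L -> L ^ C ≤ n × n < suc L ^ C) -> Σ ℕ \ L -> L ^ C ≤ suc n × suc n < suc L ^ C
 by (L , le , lt) = test (suc n N.<? suc L ^ C)
  where
  test : Dec (suc n < suc L ^ C) -> Σ ℕ \ L -> L ^ C ≤ suc n × suc n < suc L ^ C
  test (yes lt') = L , m≤n⇒m≤1+n le , lt'
  test (no ge) = suc L , ≮⇒≥ ge , ≤-<-trans lt (^-monoˡ-< C {{N.>-nonZero 0<C}} (n<1+n (suc L)))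

^-cancel-≤ : ∀ C {x y n} -> x ^ C ≤ n -> n < suc y ^ C -> x ≤ y
^-cancel-≤ C {x} {y} le lt = ≮⇒≥ \ y<x -> <⇒≱ lt (≤-trans (^-monoˡ-≤ C y<x) le)

2^-cancel-≤ : ∀ {m n} -> 2 ^ m ≤ 2 ^ n -> m ≤ n
2^-cancel-≤ le = ≮⇒≥ \ n<m -> <⇒≱ (^-monoʳ-< 2 (s≤s (s≤s z≤n)) n<m) le

primes-bound : ∀ n ps B -> 0 < n -> Unique ps -> All (\ p -> Prime p × p ∣ n) ps -> n ≤ 2 ^ B -> length ps ≤ B
primes-bound n ps B 0<n u ds n≤ = 2^-cancel-≤ (≤-trans (go ps (All.map fst ds)) (≤-trans (∣⇒≤ {{N.>-nonZero 0<n}} (product-∣ n ps u ds)) n≤))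
 where
 go : ∀ ps -> All Prime ps -> 2 ^ length ps ≤ product ps
 go [] _ = ≤-refl
 go (p ∷ ps) (pp ∷ pps) = *-mono-≤ (N.nonTrivial⇒n>1 p {{prime⇒nonTrivial pp}}) (go ps pps)

product-bound : ∀ B ns -> All (\ n -> 0 < n × n ≤ B) ns -> 0 < product ns × product ns ≤ B ^ length ns
product-bound B [] [] = s≤s z≤n , ≤-refl
product-bound B (n ∷ ns) ((0<n , n≤B) ∷ bs) = let 0<Π , Π≤ = product-bound B ns bs in *-mono-≤ 0<n 0<Π , *-mono-≤ n≤B Π≤

opaque
 obstruction : ℕ × ℕ × ℕ -> ℕ
 obstruction (e1 , e2 , e3) = fst (Box.opening e1 e2 e3)

 obstruction≡ : ∀ e1 e2 e3 -> obstruction (e1 , e2 , e3) ≡ fst (Box.opening e1 e2 e3)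
 obstruction≡ e1 e2 e3 = refl

 obstruction-bound : ∀ M e1 e2 e3 -> e1 < M -> e2 < M -> e3 < M -> 0 < obstruction (e1 , e2 , e3) × obstruction (e1 , e2 , e3) ≤ 2 ^ (12 * (M * M * M))
 obstruction-bound M e1 e2 e3 l1 l2 l3 = fst (snd (Box.opening e1 e2 e3)) , ≤-trans (<⇒≤ (fst (snd (snd (Box.opening e1 e2 e3)))))
   (bound (Box.volume e1 e2 e3) (s≤s z≤n) (*-mono-≤ (*-mono-≤ l3 l2) l1))
  where
  open ≤R
  calc : ∀ v -> 2 * v + 5 * (2 * v) ≡ 12 * v
  calc = solve-∀
  bound : ∀ v -> 0 < v -> v ≤ M * M * M -> 4 * 20 ^ (2 * v) ≤ 2 ^ (12 * (M * M * M))
  bound v 0<v v≤ = begin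
   -- 4 ≤ 2 ^ (2 v) because v ≥ 1, and 20 ≤ 2 ^ 5; together 2 ^ (12 v).
   4 * 20 ^ (2 * v) ≤⟨ *-mono-≤ (^-monoʳ-≤ 2 (*-monoʳ-≤ 2 0<v)) (^-monoˡ-≤ (2 * v) (m≤m+n 20 12)) ⟩
   2 ^ (2 * v) * (2 ^ 5) ^ (2 * v) ≡⟨ cong (2 ^ (2 * v) *_) (^-*-assoc 2 5 (2 * v)) ⟩
   2 ^ (2 * v) * 2 ^ (5 * (2 * v)) ≡⟨ ^-distribˡ-+-* 2 (2 * v) (5 * (2 * v)) ⟨
   2 ^ (2 * v + 5 * (2 * v)) ≡⟨ cong (2 ^_) (calc v) ⟩
   2 ^ (12 * v) ≤⟨ ^-monoʳ-≤ 2 (*-monoʳ-≤ 12 v≤) ⟩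
   2 ^ (12 * (M * M * M)) ∎

-- A prime dividing one of the obstructions divides their product, so a single integer controls all
-- large exceptional primes. There are M³ factors of at most 12 M³ binary digits, up to rounding.
module Exceptional (M : ℕ) where
 private
  triples : List (ℕ × ℕ × ℕ)
  triples = cartesianProduct (upTo M) (cartesianProduct (upTo M) (upTo M))
  count : length (map obstruction triples) ≡ M * (M * M)
  count = trans (List.length-map obstruction triples) (trans (length-product (upTo M) _) (cong2 _*_ (List.length-upTo M) (trans (length-product (upTo M) (upTo M)) (cong2 _*_ (List.length-upTo M) (List.length-upTo M)))))
  bounds : 0 < product (map obstruction triples) × product (map obstruction triples) ≤ (2 ^ (12 * (M * M * M))) ^ length (map obstruction triples)
  bounds = product-bound (2 ^ (12 * (M * M * M))) (map obstruction triples) (All.map⁺ (All.tabulate \ {(e1 , e2 , e3)} e∈ ->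
   let e1∈ , e23∈ = ∈-cartesianProduct⁻ (upTo M) (cartesianProduct (upTo M) (upTo M)) e∈ ; e2∈ , e3∈ = ∈-cartesianProduct⁻ (upTo M) (upTo M) e23∈ in
   obstruction-bound M e1 e2 e3 (∈-upTo⁻ e1∈) (∈-upTo⁻ e2∈) (∈-upTo⁻ e3∈)))

 discriminant : ℕ
 discriminant = product (map obstruction triples)

 0<discriminant : 0 < discriminant
 0<discriminant = fst bounds

 discriminant-bound : discriminant ≤ 2 ^ (12 * (M * M * M) * (M * (M * M)))
 discriminant-bound = ≤-trans (snd bounds) (≤-eq (trans (^-*-assoc 2 (12 * (M * M * M)) _) (cong (\ n -> 2 ^ (12 * (M * M * M) * n)) count)))

 obstruction-∣ : ∀ e1 e2 e3 -> e1 < M -> e2 < M -> e3 < M -> obstruction (e1 , e2 , e3) ∣ discriminant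
 obstruction-∣ e1 e2 e3 l1 l2 l3 = ∈⇒∣product (∈-map⁺ obstruction (∈-cartesianProduct⁺ (∈-upTo⁺ l1) (∈-cartesianProduct⁺ (∈-upTo⁺ l2) (∈-upTo⁺ l3))))

module Counting (C : ℕ) (57≤C : 57 ≤ C) where
 private
  0<C : 0 < C
  0<C = ≤-trans (s≤s z≤n) 57≤C

 -- If the C-th root of p is at least this large, all hypotheses of `PerPrime` on the size of the
 -- root hold.
 threshold : ℕ
 threshold = 40 + (divisor-constant C * 2 + prime-constant C * 2)

 -- The prime has its own root ℓ ≤ L, and the triples of orders below ℓ ^ 9 are among those below L
 -- ^ 9; this makes the integer the same for all primes up to T.
 exceptional-∣ : ∀ L p -> p < suc L ^ C -> threshold ^ C ≤ p -> E p -> p ∣ Exceptional.discriminant (L ^ 9)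
 exceptional-∣ L p@(suc n) p< p0≤p (pp , ¬single) = by (p ∣? discriminant)
  where
  open Exceptional (L ^ 9)
  ℓ = fst (root C p 0<C)
  ℓ^C≤p = fst (snd (root C p 0<C))
  p<ℓ'^C = snd (snd (root C p 0<C))
  ℓ≤L : ℓ ≤ L
  ℓ≤L = ^-cancel-≤ C ℓ^C≤p p<
  t≤ℓ : threshold ≤ ℓ
  t≤ℓ = ^-cancel-≤ C p0≤p p<ℓ'^C
  3<p : 3 < p
  3<p = ≤-trans (≤-trans (≤-trans (m≤m+n 4 36) (m≤m+n 40 _)) (≤-trans (≤-eq (sym (^-identityʳ threshold))) (^-monoʳ-≤ threshold 0<C))) p0≤p
  open Markoff p pp 3<p using (setting; single-orbit)
  -- `E p` is a negation and can only refute, so divisibility is decided first.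
  by : Dec (p ∣ discriminant) -> p ∣ discriminant
  by (yes d) = d
  by (no nd) = ⊥-elim (¬single (single-orbit \ moves -> Final.PerPrime.single-orbit setting C ℓ 57≤C ℓ^C≤p p<ℓ'^C
   (m+n≤o⇒m≤o 40 t≤ℓ) (m+n≤o⇒m≤o _ (m+n≤o⇒n≤o 40 t≤ℓ)) (m+n≤o⇒n≤o _ (m+n≤o⇒n≤o 40 t≤ℓ)) moves
   \ e1 e2 e3 l1 l2 l3 p∣g -> nd (∣-trans (subst (p ∣_) (sym (obstruction≡ e1 e2 e3)) p∣g) (obstruction-∣ e1 e2 e3 (up l1) (up l2) (up l3)))))
   where
   up : ∀ {e} -> e < ℓ ^ 9 -> e < L ^ 9
   up l = <-≤-trans l (^-monoˡ-≤ 9 ℓ≤L)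

 module _ (T L : ℕ) (L^C≤T : L ^ C ≤ T) (T< : T < suc L ^ C) (40≤L : 40 ≤ L) (p0≤L : threshold ^ C ≤ L) where
  private
   p0 = threshold ^ C
   open Powers L (≤-trans (s≤s z≤n) 40≤L)
  -- The primes from threshold ^ C on divide the discriminant, whose size allows 12 L ^ 54 of them;
  -- the smaller ones number at most threshold ^ C ≤ L.
  few-exceptions : ∀ ps -> Unique ps -> All (\ p -> p ≤ T × E p) ps -> length ps ≤ L ^ 56
  few-exceptions ps u all = begin
   length ps ≡⟨ filter-split (p0 ≤?_) ps ⟨
   length large + length small ≤⟨ +-mono-≤ large≤ small≤ ⟩
   12 * pw 54 + p0 ≤⟨ +-mono-≤ (≤-trans (absorb {12} (≤-trans (m≤m+n 12 28) 40≤L) 54) (≤-eq (sym (+-identityʳ (pw 55))))) (≤-trans p0≤L (≤-trans (≤-eq (sym pw-1)) (pw-mono (m≤m+n 1 54)))) ⟩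
   pw 55 + 0 + pw 55 ≡⟨ +-comm (pw 55 + 0) (pw 55) ⟩
   2 * pw 55 ≤⟨ absorb {2} (≤-trans (m≤m+n 2 38) 40≤L) 55 ⟩
   pw 56 ≡⟨ pw≡ 56 ⟩
   L ^ 56 ∎
   where
   open ≤R
   large = filter (p0 ≤?_) ps
   small = filter (\ p -> ¬? (p0 ≤? p)) ps
   small≤ : length small ≤ p0
   small≤ = unique-bound p0 small (Unique.filter⁺ _ u) (All.tabulate \ p∈ -> ≰⇒> (snd (∈-filter⁻ (\ p -> ¬? (p0 ≤? p)) {xs = ps} p∈)))
   prime : ∀ {p} -> E p -> Prime p
   prime {suc _} = fst
   M = L ^ 9
   large≤ : length large ≤ 12 * pw 54
   large≤ = ≤-trans (primes-bound (Exceptional.discriminant M) large _ (Exceptional.0<discriminant M) (Unique.filter⁺ _ u)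
     (All.tabulate \ {p} p∈ -> let p∈' , le = ∈-filter⁻ (p0 ≤?_) {xs = ps} p∈ ; p≤T , Ep = All.lookup all p∈' in prime Ep , exceptional-∣ L p (≤-<-trans p≤T T<) le Ep)
     (Exceptional.discriminant-bound M)) (≤-eq (trans (*-assoc 12 (M * M * M) (M * (M * M))) (cong (12 *_) volume)))
    where
    volume : M * M * M * (M * (M * M)) ≡ pw 54
    volume = trans (cong (\ m -> m * m * m * (m * (m * m))) (sym (pw≡ 9))) (trans (cong2 _*_ (trans (cong (_* pw 9) (pw-+ 9 9)) (pw-+ 18 9)) (trans (cong (pw 9 *_) (pw-+ 9 9)) (pw-+ 9 18))) (pw-+ 27 27))

-- ε is the rational number a / b, and N ≤ T ^ ε is written without roots as N ^ b ≤ T ^ a. Rational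
-- ε suffice, since a smaller ε gives a stronger bound.
theorem2 : (a b : ℕ) → 0 < a → 0 < b →
 Σ ℕ (λ T₀ → (T : ℕ) → T₀ ≤ T → (ps : List ℕ) → Unique ps →
  All (λ p → p ≤ T × E p) ps → length ps ^ b ≤ T ^ a)
-- 57 serves the estimates for a single prime; 56 b turns N ≤ L ^ 56 into N ^ b ≤ L ^ C ≤ T.
theorem2 a b 0<a 0<b = sparse (57 + 56 * b) (m≤m+n 57 (56 * b)) (m≤n+m (56 * b) 57)
 where
 open ≤R
 sparse : ∀ C → 57 ≤ C → 56 * b ≤ C → Σ ℕ (λ T₀ → (T : ℕ) → T₀ ≤ T → (ps : List ℕ) → Unique ps → All (λ p → p ≤ T × E p) ps → length ps ^ b ≤ T ^ a)
 sparse C 57≤C 56b≤C = L0 ^ C , λ T T0≤T ps u all → bound T ps u all T0≤T (root C T (≤-trans (s≤s z≤n) 57≤C))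
  where
  open Counting C 57≤C
  L0 = 40 + threshold ^ C
  bound : ∀ T ps → Unique ps → All (λ p → p ≤ T × E p) ps → L0 ^ C ≤ T → (Σ ℕ λ L → L ^ C ≤ T × T < suc L ^ C) → length ps ^ b ≤ T ^ a
  bound T ps u all T0≤T (L , L^C≤T , T<) = begin
   length ps ^ b ≤⟨ ^-monoˡ-≤ b (few-exceptions T L L^C≤T T< 40≤L (m+n≤o⇒n≤o 40 L0≤L) ps u all) ⟩
   (L ^ 56) ^ b ≡⟨ ^-*-assoc L 56 b ⟩
   L ^ (56 * b) ≤⟨ ^-monoʳ-≤ L 56b≤C ⟩
   L ^ C ≤⟨ L^C≤T ⟩
   T ≡⟨ ^-identityʳ T ⟨
   T ^ 1 ≤⟨ ^-monoʳ-≤ T 0<a ⟩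
   T ^ a ∎
   where
   L0≤L = ^-cancel-≤ C T0≤T T<
   40≤L = m+n≤o⇒m≤o 40 L0≤L
   instance
    L≢0 = N.>-nonZero (≤-trans (s≤s z≤n) 40≤L)
    T≢0 = N.>-nonZero (≤-trans (m^n>0 L C) L^C≤T)
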